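{- There exists an $(\mathbb{F}_{17}\times\mathbb{F}_q,\mathbb{F}_{17}\times\{0\},17,2)$-DF for every prime $q\equiv 1 \pmod{8}$.
   Context: For an additive group $G$ with a subgroup $N$, a $(G,N,k,\lambda)$ relative difference family (DF) is a multiset $[B_1,\dots,B_r]$ of $k$-subsets of $G$ such that the multiset $\bigcup_{i}[x-y: x,y\in B_i, x\neq y]$ contains every element of $G\setminus N$ exactly $\lambda$ times and no element of $N$. -}

module Defs where

open import Data.Nat using (ℕ; _∸_; NonZero)
open import Data.Nat.DivMod using (_mod_)
open import Data.Nat.Primality using (Prime; prime⇒nonZero)
open import Data.Fin using (Fin; toℕ; zero)
import Data.Fin as F
open import Data.Product using (_×_; _,_)
open import Data.Product.Properties using (≡-dec)
open import Data.List using (List; length; filter; map; concatMap)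
open import Data.List.Relation.Unary.All using (All)
open import Data.List.Relation.Unary.Unique.Propositional using (Unique)
open import Relation.Binary.PropositionalEquality using (_≡_)
open import Relation.Binary.Definitions using (DecidableEquality)
open import Relation.Nullary using (¬_; ¬?)
import Data.Nat as N

-- Generic relative difference family.
-- A : carrier of an additive group, _≟_ decidable equality, _−_ subtraction,
-- InN : membership predicate of the subgroup N.
-- A block is a k-subset, represented as a duplicate-free list of length k;
-- the family is a multiset of blocks, represented as a list.
module _ {A : Set} (_≟_ : DecidableEquality A) (_−_ : A → A → A) where

  diffs : List A → List A
  diffs B = concatMap (λ x → map (λ y → x − y) (filter (λ y → ¬? (y ≟ x)) B)) B

  allDiffs : List (List A) → List A
  allDiffs Bs = concatMap diffs Bs

  mult : A → List A → ℕ
  mult g xs = length (filter (λ x → x ≟ g) xs)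

  IsRelativeDF : (InN : A → Set) (k λ' : ℕ) → List (List A) → Set
  IsRelativeDF InN k λ' Bs =
    All (λ B → length B ≡ k × Unique B) Bs
    × (∀ g → InN g → mult g (allDiffs Bs) ≡ 0)
    × (∀ g → ¬ InN g → mult g (allDiffs Bs) ≡ λ')

-- Z_n (= additive group of F_n for n prime) subtraction
subₙ : ∀ {n} .{{_ : NonZero n}} → Fin n → Fin n → Fin n
subₙ {n} a b = (toℕ a N.+ (n ∸ toℕ b)) mod n

G : ℕ → Set
G q = Fin 17 × Fin q

_≟G_ : ∀ {q} → DecidableEquality (G q)
_≟G_ = ≡-dec F._≟_ F._≟_

subG : ∀ q → Prime q → G q → G q → G q
subG q pq (a , b) (c , d) = subₙ a c , subₙ {{prime⇒nonZero pq}} b d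

InN : ∀ {q} → Prime q → G q → Set
InN pq (a , b) = toℕ b ≡ 0

-- Write q = 8 k + 1 and i² = −1 in 𝔽_q. The base block consists of (0 , 0) and the sixteen points
-- ((−1)^r 2^j , i^r y_j), so it is invariant under (x , z) ↦ (− x , i z). The differences whose first
-- coordinate is a given d are then the multiples by powers of i of four forms in y, which depend only on ± d.
-- Multiplying the second coordinates by representatives s of the nonzero squares modulo ⟨ i ⟩ yields a
-- family as soon as each of the resulting nine quadruples contains two squares and two nonsquares.
--
-- For large q take y = (1 , c , ε , ε c) with ε⁴ = −1. The condition then only concerns the quadratic
-- characters of c − ρ for nine roots ρ. Stepanov's method bounds the number of points of z² = f(x),
-- hence the sums of the characters of the products of the x − ρ, and expanding the indicator of an
-- admissible sign pattern into such characters gives a suitable c once q > 1.2 · 10⁶.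
-- For smaller q a value of c, or of y when q < 864, is found by computation.

{-# OPTIONS --safe #-}
module Submission where

open import Defs
open import Data.Nat using (ℕ; _%_)
open import Data.Nat.Primality using (Prime)
open import Data.Product using (Σ)
open import Data.List using (List)
open import Relation.Binary.PropositionalEquality using (_≡_)

-- λ = 2 is two squares out of four: for given z and a form δ there is exactly one pair of a
-- representative s and a power i^e with s i^e δ = z when z and δ have equal character, and none
-- otherwise. Sixteen differences lie over each d, hence four forms, because the first coordinates
-- are 0 once and every nonzero square modulo 17 twice. The threshold comes from adding up error
-- terms. At most seven products of characters prescribe a pattern, an eighth being avoided by
-- letting ε³ compete with ε; this gives up to 127 nontrivial character sums. Stepanov's auxiliary
-- polynomial vanishes to order M at the points counted and exists for roughly M² < q; here it is a
-- difference of two polynomials found by the pigeonhole principle. With q = 2 h + 1 and e = 1 + ⌊m'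
-- / 2⌋, M times the sum for m' + 1 factors is at most (2 m' + 4 e) h plus a constant, against a
-- main term of about M q. The coefficients 2 m' + 4 e add up to at most 2178, so the main term,
-- about 2 M h, wins for M = 1092, which asks for q > 1.2 · 10⁶.

-- A ring solver with integer coefficients

module IntegerSolver where
  open import Algebra using (CommutativeRing)

  -- Integer coefficients let the solver collect and cancel signed multiples, in the field and in
  -- its polynomial ring alike.
  module IntegerCoefficients {c ℓ} (R : CommutativeRing c ℓ) where
    open import Data.Nat as ℕ using (ℕ; zero; suc)
    open import Data.Integer as ℤ using (ℤ; +_; -[1+_]; _⊖_)
    import Data.Integer.Properties as ℤ
    open import Data.Maybe using (Maybe; just; nothing)
    open import Relation.Nullary using (yes; no)
    import Relation.Binary.PropositionalEquality as ≡
    open import Algebra.Solver.Ring.AlmostCommutativeRing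
      using (fromCommutativeRing; _-Raw-AlmostCommutative⟶_)
    open CommutativeRing R
    open import Algebra.Properties.Semiring.Mult semiring using (_×_; ×-homo-+; ×1-homo-*)
    open import Algebra.Properties.Ring ring
      using (-‿distribˡ-*; -‿distribʳ-*; -0#≈0#; -‿involutive)
    open import Algebra.Properties.AbelianGroup +-abelianGroup using (⁻¹-∙-comm)
    open import Relation.Binary.Reasoning.Setoid setoid

    fromℤ : ℤ → Carrier
    fromℤ (+ n)    = n × 1#
    fromℤ -[1+ n ] = - (suc n × 1#)

    fromℤ-neg : ∀ i → fromℤ (ℤ.- i) ≈ - fromℤ i
    fromℤ-neg (+ zero)  = sym -0#≈0#
    fromℤ-neg (+ suc n) = refl
    fromℤ-neg -[1+ n ]  = sym (-‿involutive _)

    shift : ∀ x a b → (x + a) - (x + b) ≈ a - b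
    shift x a b = begin
      (x + a) + - (x + b)     ≈⟨ +-congˡ (⁻¹-∙-comm x b) ⟨
      (x + a) + (- x + - b)   ≈⟨ +-congʳ (+-comm x a) ⟩
      (a + x) + (- x + - b)   ≈⟨ +-assoc a x _ ⟩
      a + (x + (- x + - b))   ≈⟨ +-congˡ (+-assoc x (- x) (- b)) ⟨
      a + ((x + - x) + - b)   ≈⟨ +-congˡ (+-congʳ (-‿inverseʳ x)) ⟩
      a + (0# + - b)          ≈⟨ +-congˡ (+-identityˡ _) ⟩
      a - b                   ∎

    fromℤ-⊖ : ∀ m n → fromℤ (m ⊖ n) ≈ m × 1# - n × 1#
    fromℤ-⊖ zero zero = sym (-‿inverseʳ 0#)
    fromℤ-⊖ zero (suc n) = sym (+-identityˡ _)
    fromℤ-⊖ (suc m) zero = sym (trans (+-congˡ -0#≈0#) (+-identityʳ _))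
    fromℤ-⊖ (suc m) (suc n) = begin
      fromℤ (suc m ⊖ suc n)                    ≡⟨ ≡.cong fromℤ (ℤ.[1+m]⊖[1+n]≡m⊖n m n) ⟩
      fromℤ (m ⊖ n)                            ≈⟨ fromℤ-⊖ m n ⟩
      m × 1# - n × 1#                          ≈⟨ shift 1# _ _ ⟨
      suc m × 1# - suc n × 1#                  ∎

    fromℤ-+ : ∀ i j → fromℤ (i ℤ.+ j) ≈ fromℤ i + fromℤ j
    fromℤ-+ (+ m) (+ n) = ×-homo-+ 1# m n
    fromℤ-+ (+ m) -[1+ n ] = fromℤ-⊖ m (suc n)
    fromℤ-+ -[1+ m ] (+ n) = trans (fromℤ-⊖ n (suc m)) (+-comm _ _)
    fromℤ-+ -[1+ m ] -[1+ n ] = begin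
      - (suc (suc (m ℕ.+ n)) × 1#)             ≡⟨ ≡.cong (λ k → - (k × 1#)) (lemma m n) ⟩
      - ((suc m ℕ.+ suc n) × 1#)               ≈⟨ -‿cong (×-homo-+ 1# (suc m) (suc n)) ⟩
      - (suc m × 1# + suc n × 1#)              ≈⟨ ⁻¹-∙-comm _ _ ⟨
      - (suc m × 1#) + - (suc n × 1#)          ∎
      where
      open import Data.Nat.Properties using (+-suc)
      lemma : ∀ m n → suc (suc (m ℕ.+ n)) ≡.≡ suc m ℕ.+ suc n
      lemma m n = ≡.cong suc (≡.sym (+-suc m n))

    fromℤ-+* : ∀ m n → fromℤ (+ m ℤ.* + n) ≈ fromℤ (+ m) * fromℤ (+ n)
    fromℤ-+* m n = trans (reflexive (≡.cong fromℤ (≡.sym (ℤ.pos-* m n)))) (×1-homo-* m n)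

    fromℤ-* : ∀ i j → fromℤ (i ℤ.* j) ≈ fromℤ i * fromℤ j
    fromℤ-* (+ m) (+ n) = fromℤ-+* m n
    fromℤ-* (+ m) -[1+ n ] = begin
      fromℤ (+ m ℤ.* -[1+ n ])                 ≡⟨ ≡.cong fromℤ (ℤ.neg-distribʳ-* (+ m) (+ suc n)) ⟨
      fromℤ (ℤ.- (+ m ℤ.* + suc n))            ≈⟨ fromℤ-neg (+ m ℤ.* + suc n) ⟩
      - fromℤ (+ m ℤ.* + suc n)                ≈⟨ -‿cong (fromℤ-+* m (suc n)) ⟩
      - (m × 1# * (suc n × 1#))                ≈⟨ -‿distribʳ-* _ _ ⟩
      m × 1# * - (suc n × 1#)                  ∎
    fromℤ-* -[1+ m ] j = begin
      fromℤ (-[1+ m ] ℤ.* j)                   ≡⟨ ≡.cong fromℤ (ℤ.neg-distribˡ-* (+ suc m) j) ⟨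
      fromℤ (ℤ.- (+ suc m ℤ.* j))              ≈⟨ fromℤ-neg (+ suc m ℤ.* j) ⟩
      - fromℤ (+ suc m ℤ.* j)                  ≈⟨ -‿cong (pos* j) ⟩
      - (suc m × 1# * fromℤ j)                 ≈⟨ -‿distribˡ-* _ _ ⟩
      - (suc m × 1#) * fromℤ j                 ∎
      where
      pos* : ∀ j → fromℤ (+ suc m ℤ.* j) ≈ suc m × 1# * fromℤ j
      pos* (+ n) = fromℤ-+* (suc m) n
      pos* -[1+ n ] = begin
        fromℤ (ℤ.- (+ suc m ℤ.* + suc n))      ≈⟨ fromℤ-neg (+ suc m ℤ.* + suc n) ⟩
        - fromℤ (+ suc m ℤ.* + suc n)          ≈⟨ -‿cong (fromℤ-+* (suc m) (suc n)) ⟩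
        - (suc m × 1# * (suc n × 1#))          ≈⟨ -‿distribʳ-* _ _ ⟩
        suc m × 1# * - (suc n × 1#)            ∎

    morphism : CommutativeRing.rawRing ℤ.+-*-commutativeRing
               -Raw-AlmostCommutative⟶ fromCommutativeRing R
    morphism = record
      { ⟦_⟧    = fromℤ
      ; +-homo = fromℤ-+
      ; *-homo = fromℤ-*
      ; -‿homo = fromℤ-neg
      ; 0-homo = refl
      ; 1-homo = +-identityʳ 1#
      }

    -- Weak decidability is what the solver asks for: distinct integers with the same image, which
    -- exist in characteristic q, are merely left undecided, so `solve` proves only identities valid
    -- in every commutative ring.
    dec : ∀ i j → Maybe (fromℤ i ≈ fromℤ j)
    dec i j with i ℤ.≟ j
    ... | yes ≡.refl = just refl
    ... | no _ = nothing

    open import Algebra.Solver.Ring _ (fromCommutativeRing R) morphism dec public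
      using (solve; _:=_; _:+_; _:*_; _:-_; :-_; con; _:^_; Polynomial)

-- Prime fields, axiomatically

module PrimeFields where
  open IntegerSolver
  open import Level using (0ℓ)
  open import Algebra using (CommutativeRing; IsCommutativeRing)
  open import Data.Nat as ℕ using (ℕ; zero; suc)
  import Data.Nat.Properties as ℕ
  open import Data.Nat.Divisibility using (_∣_; ∣⇒≤)
  open import Data.Fin as F using (Fin; toℕ)
  open import Data.Sum using (_⊎_; inj₁; inj₂)
  open import Data.Empty using (⊥-elim)
  open import Relation.Nullary using (¬_; Dec)
  open import Relation.Binary.PropositionalEquality

  -- The interface hides the arithmetic of residues, so that type checking never computes in
  -- `Fin q`, while the carrier `Fin q` keeps enumeration and decidable equality. The map `ι`
  -- carries the information on the characteristic, and `a*b≡0` takes the place of division.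
  record PrimeField (q : ℕ) : Set where
    infixl 6 _+_
    infixl 7 _*_
    infix 8 -_
    field
      _+_ _*_ : Fin q → Fin q → Fin q
      -_ : Fin q → Fin q
      0# 1# : Fin q
      isCommutativeRing : IsCommutativeRing _≡_ _+_ _*_ -_ 0# 1#
      1<q : 1 ℕ.< q
      ι : ℕ → Fin q
      ι-0 : ι 0 ≡ 0#
      ι-1 : ι 1 ≡ 1#
      ι-+ : ∀ m n → ι m + ι n ≡ ι (m ℕ.+ n)
      ι-* : ∀ m n → ι m * ι n ≡ ι (m ℕ.* n)
      ι-toℕ : ∀ a → ι (toℕ a) ≡ a
      ι≡0⇒∣ : ∀ n → ι n ≡ 0# → q ∣ n
      ι-q : ι q ≡ 0#
      a*b≡0 : ∀ {a b} → a * b ≡ 0# → a ≡ 0# ⊎ b ≡ 0#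

  -- The fourth power is bracketed as a square of a square so that a proof is literally one of
  -- `i * i ≡ - 1#` for i = ε².
  IsPrimitiveEighthRoot : ∀ {q} → PrimeField q → Fin q → Set
  IsPrimitiveEighthRoot 𝔽 ε = (ε * ε) * (ε * ε) ≡ - 1#
    where open PrimeField 𝔽

  module FieldProperties {q : ℕ} (𝔽 : PrimeField q) where
    open PrimeField 𝔽 public

    K : Set
    K = Fin q

    commutativeRing : CommutativeRing 0ℓ 0ℓ
    commutativeRing = record { isCommutativeRing = isCommutativeRing }

    open CommutativeRing commutativeRing public
      using (_-_; +-identityˡ; +-identityʳ; *-identityˡ; *-identityʳ; zeroˡ; zeroʳ; distribˡ; distribʳ
            ; -‿inverseˡ; -‿inverseʳ; +-comm; +-assoc; *-comm; *-assoc; semiring; ring)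
    open import Algebra.Properties.Ring ring public
      using (-‿distribˡ-*; -‿distribʳ-*; -0#≈0#; -‿involutive)
    open IntegerCoefficients commutativeRing public

    infix 4 _≟K_
    _≟K_ : (a b : K) → Dec (a ≡ b)
    _≟K_ = F._≟_

    ι-suc : ∀ n → ι (suc n) ≡ 1# + ι n
    ι-suc n = trans (sym (ι-+ 1 n)) (cong (_+ ι n) ι-1)

    ι-suc≢0 : ∀ n → suc n ℕ.< q → ¬ ι (suc n) ≡ 0#
    ι-suc≢0 n n<q e = ℕ.<⇒≱ n<q (∣⇒≤ (ι≡0⇒∣ (suc n) e))

    1≢0 : ¬ 1# ≡ 0#
    1≢0 e = ι-suc≢0 0 1<q (trans ι-1 e)

    *-nonzero : ∀ {a b} → ¬ a ≡ 0# → ¬ b ≡ 0# → ¬ a * b ≡ 0#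
    *-nonzero a≢0 b≢0 e with a*b≡0 e
    ... | inj₁ p = a≢0 p
    ... | inj₂ p = b≢0 p

    a≡[a+b]-b : ∀ a b → a ≡ (a + b) - b
    a≡[a+b]-b = solve 2 (λ a b → a := (a :+ b) :- b) refl

    a-b≡0 : ∀ {a b} → a - b ≡ 0# → a ≡ b
    a-b≡0 {a} {b} e = trans (solve 2 (λ a b → a := (a :- b) :+ b) refl a b)
                            (trans (cong (_+ b) e) (+-identityˡ b))

    *-cancelˡ : ∀ a {b c} → ¬ a ≡ 0# → a * b ≡ a * c → b ≡ c
    *-cancelˡ a {b} {c} a≢0 e with a*b≡0 {a} {b - c}
      (trans (solve 3 (λ a b c → a :* (b :- c) := a :* b :- a :* c) refl a b c)
             (trans (cong (_- (a * c)) e) (-‿inverseʳ _)))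
    ... | inj₁ p = ⊥-elim (a≢0 p)
    ... | inj₂ p = a-b≡0 p

    infixr 9 _^_
    _^_ : K → ℕ → K
    a ^ zero = 1#
    a ^ suc n = a * a ^ n

-- The integers modulo a prime

module IntegersModulo (q : ℕ) (pq : Prime q) where
  open import Data.Nat using (ℕ)
  open import Defs using (subₙ)
  open import Algebra using (IsCommutativeRing)
  open import Data.Nat as ℕ using (NonZero; z≤n; s≤s)
  import Data.Nat.Properties as ℕ
  open PrimeFields
  open import Data.Nat.DivMod using (_mod_; _%_; m%n<n; m%n%n≡m%n; m<n⇒m%n≡m; n%n≡0; %-distribˡ-+; %-distribˡ-*)
  open import Data.Nat.Divisibility using (_∣_; m%n≡0⇒n∣m; n∣m⇒m%n≡0)
  open import Data.Nat.Primality using (prime⇒nonZero; prime⇒nonTrivial; euclidsLemma)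
  open import Data.Fin using (Fin; toℕ)
  open import Data.Fin.Properties using (toℕ-fromℕ<; toℕ-injective; toℕ<n)
  open import Data.Product using (_,_)
  open import Data.Sum using (_⊎_)
  import Data.Sum as Sum
  open import Relation.Binary.PropositionalEquality

  instance
    q≢0 : NonZero q
    q≢0 = prime⇒nonZero pq

  1<q : 1 ℕ.< q
  1<q = ℕ.nonTrivial⇒n>1 q {{prime⇒nonTrivial pq}}

  K : Set
  K = Fin q

  infixl 6 _+_
  infixl 7 _*_
  infix 8 -_

  abstract
    ι : ℕ → K
    ι n = n mod q

    _+_ _*_ : K → K → K
    a + b = ι (toℕ a ℕ.+ toℕ b)
    a * b = ι (toℕ a ℕ.* toℕ b)

    -_ : K → K
    - a = ι (q ℕ.∸ toℕ a)

    toℕ-ι : ∀ n → toℕ (ι n) ≡ n % q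
    toℕ-ι n = toℕ-fromℕ< (m%n<n n q)

    ι-cong : ∀ {m n} → m % q ≡ n % q → ι m ≡ ι n
    ι-cong {m} {n} e = toℕ-injective (trans (toℕ-ι m) (trans e (sym (toℕ-ι n))))

    ι-toℕ : ∀ a → (ι (toℕ a)) ≡ a
    ι-toℕ a = toℕ-injective (trans (toℕ-ι (toℕ a)) (m<n⇒m%n≡m (toℕ<n a)))

    ι-+ : ∀ m n → ι m + ι n ≡ (ι (m ℕ.+ n))
    ι-+ m n = ι-cong (trans (cong₂ (λ x y → (x ℕ.+ y) % q) (toℕ-ι m) (toℕ-ι n))
                              (sym (%-distribˡ-+ m n q)))

    ι-* : ∀ m n → ι m * ι n ≡ (ι (m ℕ.* n))
    ι-* m n = ι-cong (trans (cong₂ (λ x y → (x ℕ.* y) % q) (toℕ-ι m) (toℕ-ι n))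
                              (sym (%-distribˡ-* m n q)))

    ι-neg : ∀ a → - a ≡ (ι (q ℕ.∸ toℕ a))
    ι-neg a = refl

  ι-q : ι q ≡ ι 0
  ι-q = ι-cong (trans (n%n≡0 q) (sym (m<n⇒m%n≡m (ℕ.≤-trans (s≤s z≤n) 1<q))))

  -- Links the subtraction in which the theorem is stated, which computes, to the opaque operations
  -- of the field.
  subₙ≡ : ∀ a b → subₙ {{prime⇒nonZero pq}} a b ≡ a + - b
  subₙ≡ a b = lemma
    where
    abstract
      lemma : subₙ {{prime⇒nonZero pq}} a b ≡ a + - b
      lemma = sym (trans (cong₂ _+_ (sym (ι-toℕ a)) refl) (ι-+ (toℕ a) (q ℕ.∸ toℕ b)))

  -- Every element is some `ι n`, so a law need only be checked on images of natural numbers, where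
  -- `ι-+` and `ι-*` reduce it to the semiring laws of ℕ.
  via₁ : (P : K → Set) → (∀ n → P (ι n)) → ∀ a → P a
  via₁ P f a = subst P (ι-toℕ a) (f (toℕ a))

  +-comm : ∀ a b → a + b ≡ b + a
  +-comm = via₁ _ λ m → via₁ _ λ n →
    trans (ι-+ m n) (trans (cong ι (ℕ.+-comm m n)) (sym (ι-+ n m)))

  *-comm : ∀ a b → a * b ≡ b * a
  *-comm = via₁ _ λ m → via₁ _ λ n →
    trans (ι-* m n) (trans (cong ι (ℕ.*-comm m n)) (sym (ι-* n m)))

  +-assoc : ∀ a b c → (a + b) + c ≡ a + (b + c)
  +-assoc = via₁ _ λ l → via₁ _ λ m → via₁ _ λ n →
    trans (trans (cong (_+ ι n) (ι-+ l m)) (ι-+ (l ℕ.+ m) n))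
    (trans (cong ι (ℕ.+-assoc l m n))
    (sym (trans (cong (ι l +_) (ι-+ m n)) (ι-+ l (m ℕ.+ n)))))

  *-assoc : ∀ a b c → (a * b) * c ≡ a * (b * c)
  *-assoc = via₁ _ λ l → via₁ _ λ m → via₁ _ λ n →
    trans (trans (cong (_* ι n) (ι-* l m)) (ι-* (l ℕ.* m) n))
    (trans (cong ι (ℕ.*-assoc l m n))
    (sym (trans (cong (ι l *_) (ι-* m n)) (ι-* l (m ℕ.* n)))))

  *-distribʳ-+ : ∀ a b c → (b + c) * a ≡ b * a + c * a
  *-distribʳ-+ = via₁ _ λ l → via₁ _ λ m → via₁ _ λ n →
    trans (trans (cong (_* ι l) (ι-+ m n)) (ι-* (m ℕ.+ n) l))
    (trans (cong ι (ℕ.*-distribʳ-+ l m n))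
    (sym (trans (cong₂ _+_ (ι-* m l) (ι-* n l)) (ι-+ (m ℕ.* l) (n ℕ.* l)))))

  +-identityˡ : ∀ a → ι 0 + a ≡ a
  +-identityˡ = via₁ _ λ n → ι-+ 0 n

  *-identityˡ : ∀ a → ι 1 * a ≡ a
  *-identityˡ = via₁ _ λ n → trans (ι-* 1 n) (cong ι (ℕ.*-identityˡ n))

  -‿inverseʳ : ∀ a → a + - a ≡ ι 0
  -‿inverseʳ a = trans (cong₂ _+_ (sym (ι-toℕ a)) (ι-neg a))
    (trans (ι-+ (toℕ a) (q ℕ.∸ toℕ a))
    (trans (cong ι (ℕ.m+[n∸m]≡n (ℕ.<⇒≤ (toℕ<n a)))) ι-q))

  isCommutativeRing : IsCommutativeRing _≡_ _+_ _*_ -_ (ι 0) (ι 1)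
  isCommutativeRing = record
    { isRing = record
      { +-isAbelianGroup = record
        { isGroup = record
          { isMonoid = record
            { isSemigroup = record
              { isMagma = record { isEquivalence = isEquivalence ; ∙-cong = cong₂ _+_ }
              ; assoc = +-assoc }
            ; identity = +-identityˡ , λ a → trans (+-comm a (ι 0)) (+-identityˡ a) }
          ; inverse = (λ a → trans (+-comm (- a) a) (-‿inverseʳ a)) , -‿inverseʳ
          ; ⁻¹-cong = cong -_ }
        ; comm = +-comm }
      ; *-cong = cong₂ _*_
      ; *-assoc = *-assoc
      ; *-identity = *-identityˡ , λ a → trans (*-comm a (ι 1)) (*-identityˡ a)
      ; distrib = (λ a b c → trans (*-comm a (b + c))
                    (trans (*-distribʳ-+ a b c) (cong₂ _+_ (*-comm b a) (*-comm c a))))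
                , *-distribʳ-+ }
    ; *-comm = *-comm }

  ι≡0⇒∣ : ∀ n → ι n ≡ ι 0 → q ∣ n
  ι≡0⇒∣ n e = m%n≡0⇒n∣m n q
    (trans (sym (toℕ-ι n)) (trans (cong toℕ e) (trans (toℕ-ι 0) (m<n⇒m%n≡m (ℕ.≤-trans (s≤s z≤n) 1<q)))))

  a*b≡0 : ∀ {a b} → a * b ≡ ι 0 → a ≡ ι 0 ⊎ b ≡ ι 0
  a*b≡0 {a} {b} e =
    Sum.map (lift a) (lift b) (euclidsLemma (toℕ a) (toℕ b) pq
      (ι≡0⇒∣ _ (trans (sym (ι-* (toℕ a) (toℕ b))) (trans (cong₂ _*_ (ι-toℕ a) (ι-toℕ b)) e))))
    where
    lift : ∀ a → q ∣ toℕ a → a ≡ ι 0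
    lift a d = trans (sym (ι-toℕ a)) (ι-cong (trans (n∣m⇒m%n≡0 _ q d)
      (sym (m<n⇒m%n≡m (ℕ.≤-trans (s≤s z≤n) 1<q)))))

  primeField : PrimeField q
  primeField = record
    { isCommutativeRing = isCommutativeRing
    ; 1<q = 1<q ; ι = ι ; ι-0 = refl ; ι-1 = refl ; ι-+ = ι-+ ; ι-* = ι-* ; ι-toℕ = ι-toℕ
    ; ι≡0⇒∣ = ι≡0⇒∣ ; ι-q = ι-q ; a*b≡0 = a*b≡0 }

  toℕ-0 : toℕ (ι 0) ≡ 0
  toℕ-0 = trans (toℕ-ι 0) (m<n⇒m%n≡m (ℕ.≤-trans (s≤s z≤n) 1<q))

  ι-% : ∀ m → ι (m % q) ≡ ι m
  ι-% m = ι-cong (m%n%n≡m%n m q)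

-- Polynomials over a prime field as coefficient lists

module PolynomialRings where
  open IntegerSolver
  open PrimeFields
  open import Level using (0ℓ)
  open import Algebra using (CommutativeRing; IsCommutativeRing)
  open import Data.Nat as ℕ using (ℕ; zero; suc; z≤n; s≤s; _≤_; _⊔_)
  import Data.Nat.Properties as ℕ
  open import Data.List using (List; []; _∷_; length; map)
  import Data.List.Properties as L
  open import Data.Product using (_,_)
  open import Data.Sum using (_⊎_; inj₁; inj₂)
  open import Data.Empty using (⊥-elim)
  open import Function using (_∘_)
  open import Relation.Nullary using (¬_; yes; no)
  open import Relation.Binary using (IsEquivalence)
  open import Relation.Binary.PropositionalEquality
  import Relation.Binary.Reasoning.Setoid as SetoidReasoning

  module Polynomials {q : ℕ} (𝔽 : PrimeField q) where
    open FieldProperties 𝔽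

    Poly : Set
    Poly = List K

    coef : Poly → ℕ → K
    coef []      n       = 0#
    coef (c ∷ p) zero    = c
    coef (c ∷ p) (suc n) = coef p n

    infix 4 _≈_
    -- Trailing zeros let different lists represent one polynomial, so equality is coefficientwise.
    -- Being a record, it allows unification to recover `p` and `r`, which a bare function type
    -- would not.
    record _≈_ (p r : Poly) : Set where
      constructor mk≈
      field at : ∀ n → coef p n ≡ coef r n
    open _≈_ public

    infixl 6 _⊕_
    infixl 7 _⊗_
    infix 8 ⊖_

    scale : K → Poly → Poly
    scale c = map (c *_)

    abstract
      _⊕_ : Poly → Poly → Poly
      []      ⊕ r       = r
      p@(_ ∷ _) ⊕ []    = p
      (c ∷ p) ⊕ (d ∷ r) = (c + d) ∷ (p ⊕ r)

      ⊖_ : Poly → Poly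
      ⊖_ = map (λ c → - c)

      _⊗_ : Poly → Poly → Poly
      []      ⊗ r = []
      (c ∷ p) ⊗ r = scale c r ⊕ (0# ∷ p ⊗ r)

      coef-⊕ : ∀ p r n → coef (p ⊕ r) n ≡ coef p n + coef r n
      coef-⊕ []      r       n       = sym (+-identityˡ _)
      coef-⊕ (c ∷ p) []      n       = sym (+-identityʳ _)
      coef-⊕ (c ∷ p) (d ∷ r) zero    = refl
      coef-⊕ (c ∷ p) (d ∷ r) (suc n) = coef-⊕ p r n

      coef-⊖ : ∀ p n → coef (⊖ p) n ≡ - coef p n
      coef-⊖ []      n       = sym -0#≈0#
      coef-⊖ (c ∷ p) zero    = refl
      coef-⊖ (c ∷ p) (suc n) = coef-⊖ p n

      ∷⊗ : ∀ c p r → (c ∷ p) ⊗ r ≡ scale c r ⊕ (0# ∷ p ⊗ r)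
      ∷⊗ c p r = refl

      []⊗ : ∀ r → [] ⊗ r ≡ []
      []⊗ r = refl

      ∷⊕∷ : ∀ c d p r → (c ∷ p) ⊕ (d ∷ r) ≡ (c + d) ∷ (p ⊕ r)
      ∷⊕∷ c d p r = refl

      ⊖∷ : ∀ c p → ⊖ (c ∷ p) ≡ - c ∷ ⊖ p
      ⊖∷ c p = refl

      ⊖[] : ⊖ [] ≡ []
      ⊖[] = refl

      []⊕ : ∀ r → [] ⊕ r ≡ r
      []⊕ r = refl

    coef-scale : ∀ c p n → coef (scale c p) n ≡ c * coef p n
    coef-scale c []      n       = sym (zeroʳ c)
    coef-scale c (d ∷ p) zero    = refl
    coef-scale c (d ∷ p) (suc n) = coef-scale c p n

    -- The Cauchy product of coefficient sequences. The ring laws are proved for infinite sequences,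
    -- where padding by zeros is no issue, and transferred through `coef-⊗`.
    conv : (ℕ → K) → (ℕ → K) → ℕ → K
    conv f g zero    = f 0 * g 0
    conv f g (suc n) = f 0 * g (suc n) + conv (f ∘ suc) g n

    conv-zeroˡ : ∀ f g n → (∀ m → m ≤ n → f m ≡ 0#) → conv f g n ≡ 0#
    conv-zeroˡ f g zero    z = trans (cong (_* g 0) (z 0 z≤n)) (zeroˡ _)
    conv-zeroˡ f g (suc n) z =
      trans (cong₂ _+_ (trans (cong (_* g (suc n)) (z 0 z≤n)) (zeroˡ _))
                       (conv-zeroˡ (f ∘ suc) g n λ m m≤n → z (suc m) (s≤s m≤n)))
            (+-identityˡ _)

    abstract
      coef-⊗ : ∀ p r n → coef (p ⊗ r) n ≡ conv (coef p) (coef r) n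
      coef-⊗ []      r n       = sym (conv-zeroˡ (λ _ → 0#) (coef r) n λ _ _ → refl)
      coef-⊗ (c ∷ p) r zero    =
        trans (coef-⊕ (scale c r) _ 0) (trans (+-identityʳ _) (coef-scale c r 0))
      coef-⊗ (c ∷ p) r (suc n) =
        trans (coef-⊕ (scale c r) _ (suc n)) (cong₂ _+_ (coef-scale c r (suc n)) (coef-⊗ p r n))

    conv-cong : ∀ {f f' g g'} → (∀ n → f n ≡ f' n) → (∀ n → g n ≡ g' n) → ∀ n → conv f g n ≡ conv f' g' n
    conv-cong ff gg zero    = cong₂ _*_ (ff 0) (gg 0)
    conv-cong ff gg (suc n) = cong₂ _+_ (cong₂ _*_ (ff 0) (gg (suc n))) (conv-cong (ff ∘ suc) gg n)

    conv-sucʳ : ∀ f g n → conv f g (suc n) ≡ conv f (g ∘ suc) n + f (suc n) * g 0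
    conv-sucʳ f g zero    = refl
    conv-sucʳ f g (suc n) = trans (cong (f 0 * g (suc (suc n)) +_) (conv-sucʳ (f ∘ suc) g n)) (sym (+-assoc _ _ _))

    conv-comm : ∀ f g n → conv f g n ≡ conv g f n
    conv-comm f g zero    = *-comm _ _
    conv-comm f g (suc n) = trans (cong₂ _+_ (*-comm _ _) (conv-comm (f ∘ suc) g n))
      (trans (+-comm _ _) (sym (conv-sucʳ g f n)))

    -- The shifted sequence of `conv f g` has the shape c f + g, so associativity reduces to this
    -- linearity after one unfolding.
    conv-linearˡ : ∀ c f g h n → conv (λ m → c * f m + g m) h n ≡ c * conv f h n + conv g h n
    conv-linearˡ c f g h zero    = solve 4 (λ c f g h → (c :* f :+ g) :* h := c :* (f :* h) :+ g :* h) refl _ _ _ _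
    conv-linearˡ c f g h (suc n) = trans
      (cong ((c * f 0 + g 0) * h (suc n) +_) (conv-linearˡ c (f ∘ suc) (g ∘ suc) h n))
      (solve 6 (λ c f g h a b → (c :* f :+ g) :* h :+ (c :* a :+ b) := c :* (f :* h :+ a) :+ (g :* h :+ b))
         refl _ _ _ _ _ _)

    conv-distribʳ : ∀ f g h n → conv (λ m → f m + g m) h n ≡ conv f h n + conv g h n
    conv-distribʳ f g h n =
      trans (conv-cong (λ m → cong (_+ g m) (sym (*-identityˡ (f m)))) (λ _ → refl) n)
      (trans (conv-linearˡ 1# f g h n) (cong (_+ conv g h n) (*-identityˡ _)))

    conv-assoc : ∀ f g h n → conv (conv f g) h n ≡ conv f (conv g h) n
    conv-assoc f g h zero    = *-assoc _ _ _
    conv-assoc f g h (suc n) = trans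
      (cong (f 0 * g 0 * h (suc n) +_)
        (trans (conv-linearˡ (f 0) (g ∘ suc) (conv (f ∘ suc) g) h n)
               (cong (f 0 * conv (g ∘ suc) h n +_) (conv-assoc (f ∘ suc) g h n))))
      (solve 5 (λ f g h a b → f :* g :* h :+ (f :* a :+ b) := f :* (g :* h :+ a) :+ b) refl _ _ _ _ _)

    ≈-refl : ∀ {p} → p ≈ p
    ≈-refl = mk≈ λ _ → refl
    ≈-sym : ∀ {p r} → p ≈ r → r ≈ p
    ≈-sym e = mk≈ (sym ∘ at e)
    ≈-trans : ∀ {p r s} → p ≈ r → r ≈ s → p ≈ s
    ≈-trans e f = mk≈ λ n → trans (at e n) (at f n)

    ⊕-at : ∀ {p p' r r'} n → coef p n ≡ coef p' n → coef r n ≡ coef r' n → coef (p ⊕ r) n ≡ coef (p' ⊕ r') n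
    ⊕-at {p} {p'} {r} {r'} n e f = trans (coef-⊕ p r n) (trans (cong₂ _+_ e f) (sym (coef-⊕ p' r' n)))

    ⊕-cong : ∀ {p p' r r'} → p ≈ p' → r ≈ r' → p ⊕ r ≈ p' ⊕ r'
    ⊕-cong {p} {p'} {r} {r'} e f = mk≈ λ n → ⊕-at {p} {p'} {r} {r'} n (at e n) (at f n)

    ⊗-cong : ∀ {p p' r r'} → p ≈ p' → r ≈ r' → p ⊗ r ≈ p' ⊗ r'
    ⊗-cong {p} {p'} {r} {r'} e f = mk≈ λ n →
      trans (coef-⊗ p r n) (trans (conv-cong (at e) (at f) n) (sym (coef-⊗ p' r' n)))

    ⊗-comm : ∀ p r → p ⊗ r ≈ r ⊗ p
    ⊗-comm p r = mk≈ λ n → trans (coef-⊗ p r n) (trans (conv-comm (coef p) (coef r) n) (sym (coef-⊗ r p n)))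

    ⊗-assoc : ∀ p r s → (p ⊗ r) ⊗ s ≈ p ⊗ (r ⊗ s)
    ⊗-assoc p r s = mk≈ λ n →
      trans (coef-⊗ (p ⊗ r) s n) (trans (conv-cong (coef-⊗ p r) (λ _ → refl) n)
      (trans (conv-assoc (coef p) (coef r) (coef s) n)
      (trans (conv-cong {f = coef p} (λ _ → refl) (sym ∘ coef-⊗ r s) n) (sym (coef-⊗ p (r ⊗ s) n)))))

    ⊗-distribʳ : ∀ s p r → (p ⊕ r) ⊗ s ≈ p ⊗ s ⊕ r ⊗ s
    ⊗-distribʳ s p r = mk≈ λ n →
      trans (coef-⊗ (p ⊕ r) s n) (trans (conv-cong (coef-⊕ p r) (λ _ → refl) n)
      (trans (conv-distribʳ (coef p) (coef r) (coef s) n)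
      (trans (cong₂ _+_ (sym (coef-⊗ p s n)) (sym (coef-⊗ r s n))) (sym (coef-⊕ (p ⊗ s) (r ⊗ s) n)))))

    const : K → Poly
    const c = c ∷ []

    const⊗ : ∀ c p → const c ⊗ p ≈ scale c p
    const⊗ c p = mk≈ λ n → trans (cong (λ x → coef x n) (trans (∷⊗ c [] p) (cong (λ z → scale c p ⊕ (0# ∷ z)) ([]⊗ p)))) (trans (coef-⊕ (scale c p) _ n) (trans (cong (coef (scale c p) n +_) (z n)) (+-identityʳ _)))
      where
      z : ∀ n → coef (0# ∷ []) n ≡ 0#
      z zero = refl
      z (suc n) = refl

    ⊗-identityˡ : ∀ p → const 1# ⊗ p ≈ p
    ⊗-identityˡ p = ≈-trans (const⊗ 1# p) (mk≈ λ n → trans (coef-scale 1# p n) (*-identityˡ _))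

    ≡⇒≈ : ∀ {p r} → p ≡ r → p ≈ r
    ≡⇒≈ refl = ≈-refl

    ⊕-identityˡ : ∀ p → [] ⊕ p ≈ p
    ⊕-identityˡ p = ≡⇒≈ ([]⊕ p)

    ⊕-assoc : ∀ p r s → (p ⊕ r) ⊕ s ≈ p ⊕ (r ⊕ s)
    ⊕-assoc p r s = mk≈ λ n →
      trans (coef-⊕ (p ⊕ r) s n) (trans (cong (_+ coef s n) (coef-⊕ p r n))
      (trans (+-assoc _ _ _)
      (sym (trans (coef-⊕ p (r ⊕ s) n) (cong (coef p n +_) (coef-⊕ r s n))))))

    ⊕-comm : ∀ p r → p ⊕ r ≈ r ⊕ p
    ⊕-comm p r = mk≈ λ n → trans (coef-⊕ p r n) (trans (+-comm _ _) (sym (coef-⊕ r p n)))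

    ⊖-inverseʳ : ∀ p → p ⊕ ⊖ p ≈ []
    ⊖-inverseʳ p = mk≈ λ n → trans (coef-⊕ p (⊖ p) n) (trans (cong (coef p n +_) (coef-⊖ p n)) (-‿inverseʳ _))

    ⊖-cong : ∀ {p r} → p ≈ r → ⊖ p ≈ ⊖ r
    ⊖-cong {p} {r} e = mk≈ λ n → trans (coef-⊖ p n) (trans (cong (λ c → - c) (at e n)) (sym (coef-⊖ r n)))

    ≈-isEquivalence : IsEquivalence _≈_
    ≈-isEquivalence = record { refl = ≈-refl ; sym = ≈-sym ; trans = ≈-trans }

    isCommutativeRingᴾ : IsCommutativeRing _≈_ _⊕_ _⊗_ ⊖_ [] (const 1#)
    isCommutativeRingᴾ = record
      { isRing = record
        { +-isAbelianGroup = record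
          { isGroup = record
            { isMonoid = record
              { isSemigroup = record
                { isMagma = record { isEquivalence = ≈-isEquivalence ; ∙-cong = ⊕-cong }
                ; assoc = ⊕-assoc }
              ; identity = ⊕-identityˡ , λ p → ≈-trans (⊕-comm p []) (⊕-identityˡ p) }
            ; inverse = (λ p → ≈-trans (⊕-comm (⊖ p) p) (⊖-inverseʳ p)) , ⊖-inverseʳ
            ; ⁻¹-cong = ⊖-cong }
          ; comm = ⊕-comm }
        ; *-cong = ⊗-cong
        ; *-assoc = ⊗-assoc
        ; *-identity = ⊗-identityˡ , λ p → ≈-trans (⊗-comm p _) (⊗-identityˡ p)
        ; distrib = (λ s p r → ≈-trans (⊗-comm s (p ⊕ r))
                      (≈-trans (⊗-distribʳ s p r) (⊕-cong (⊗-comm p s) (⊗-comm r s))))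
                  , ⊗-distribʳ }
      ; *-comm = ⊗-comm }

    polyRing : CommutativeRing 0ℓ 0ℓ
    polyRing = record { isCommutativeRing = isCommutativeRingᴾ }

    module PS = IntegerCoefficients polyRing


    module ≈R = SetoidReasoning (CommutativeRing.setoid polyRing)

    ev : Poly → K → K
    ev []      a = 0#
    ev (c ∷ p) a = c + a * ev p a

    ev-scale : ∀ c p a → ev (scale c p) a ≡ c * ev p a
    ev-scale c []      a = sym (zeroʳ c)
    ev-scale c (d ∷ p) a = trans (cong (λ x → c * d + a * x) (ev-scale c p a))
      (solve 4 (λ c d a x → c :* d :+ a :* (c :* x) := c :* (d :+ a :* x)) refl c d a _)

    abstract
      ev-⊕ : ∀ p r a → ev (p ⊕ r) a ≡ ev p a + ev r a
      ev-⊕ []      r       a = sym (+-identityˡ _)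
      ev-⊕ (c ∷ p) []      a = sym (+-identityʳ _)
      ev-⊕ (c ∷ p) (d ∷ r) a = trans (cong (λ x → c + d + a * x) (ev-⊕ p r a))
        (solve 5 (λ c d a x y → c :+ d :+ a :* (x :+ y) := c :+ a :* x :+ (d :+ a :* y)) refl c d a _ _)

      ev-⊖ : ∀ p a → ev (⊖ p) a ≡ - ev p a
      ev-⊖ []      a = sym -0#≈0#
      ev-⊖ (c ∷ p) a = trans (cong (λ x → - c + a * x) (ev-⊖ p a))
        (solve 3 (λ c a x → :- c :+ a :* (:- x) := :- (c :+ a :* x)) refl c a _)

      ev-⊗ : ∀ p r a → ev (p ⊗ r) a ≡ ev p a * ev r a
      ev-⊗ []      r a = sym (zeroˡ _)
      ev-⊗ (c ∷ p) r a = trans (ev-⊕ (scale c r) _ a)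
        (trans (cong₂ (λ x y → x + (0# + a * y)) (ev-scale c r a) (ev-⊗ p r a))
        (trans (cong (c * ev r a +_) (+-identityˡ _))
        (solve 4 (λ c r a x → c :* r :+ a :* (x :* r) := (c :+ a :* x) :* r) refl c _ a _)))

    tail-≈0 : ∀ {c p} → c ∷ p ≈ [] → p ≈ []
    tail-≈0 e = mk≈ λ n → at e (suc n)

    ev-≈0 : ∀ p a → p ≈ [] → ev p a ≡ 0#
    ev-≈0 []      a e = refl
    ev-≈0 (c ∷ p) a e = trans (cong₂ (λ x y → x + a * y) (at e 0) (ev-≈0 p a (tail-≈0 e)))
      (trans (+-identityˡ _) (zeroʳ a))

    ≈⇒⊖≈0 : ∀ {p r} → p ≈ r → p ⊕ ⊖ r ≈ []
    ≈⇒⊖≈0 {p} {r} e = ≈-trans (⊕-cong e ≈-refl) (⊖-inverseʳ r)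

    ⊖≈0⇒≈ : ∀ {p r} → p ⊕ ⊖ r ≈ [] → p ≈ r
    ⊖≈0⇒≈ {p} {r} e = ≈-trans (PS.solve 2 (λ p r → p PS.:= (p PS.:+ PS.:- r) PS.:+ r) ≈-refl p r)
                              (≈-trans (⊕-cong e ≈-refl) (⊕-identityˡ r))

    -- Equal polynomials may be lists of different lengths; evaluating the difference, which is
    -- equal to [], avoids a simultaneous induction.
    ev-cong : ∀ {p r} a → p ≈ r → ev p a ≡ ev r a
    ev-cong {p} {r} a e = a-b≡0 (trans (cong (ev p a +_) (sym (ev-⊖ r a)))
      (trans (sym (ev-⊕ p (⊖ r) a)) (ev-≈0 (p ⊕ ⊖ r) a (≈⇒⊖≈0 e))))

    X : Poly
    X = 0# ∷ 1# ∷ []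

    0∷[]≈[] : 0# ∷ [] ≈ []
    0∷[]≈[] = mk≈ λ { zero → refl ; (suc n) → refl }

    ∷-cong : ∀ {c d p r} → c ≡ d → p ≈ r → c ∷ p ≈ d ∷ r
    ∷-cong e f = mk≈ λ { zero → e ; (suc n) → at f n }

    X⊗ : ∀ p → X ⊗ p ≈ 0# ∷ p
    X⊗ p = ≈-trans (≡⇒≈ (∷⊗ 0# (1# ∷ []) p)) (≈-trans (⊕-cong (mk≈ {r = []} λ n → trans (coef-scale 0# p n) (zeroˡ _)) ≈-refl)
                   (≈-trans (⊕-identityˡ _) (∷-cong refl (⊗-identityˡ p))))

    ∷-≈ : ∀ c p → c ∷ p ≈ const c ⊕ X ⊗ p
    ∷-≈ c p = ≈-sym (≈-trans (⊕-cong ≈-refl (X⊗ p)) (≈-trans (≡⇒≈ (∷⊕∷ c 0# [] p)) (∷-cong (+-identityʳ c) (⊕-identityˡ p))))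

    const-+ : ∀ c d → const (c + d) ≈ const c ⊕ const d
    const-+ c d = ≈-sym (≈-trans (≡⇒≈ (∷⊕∷ c d [] [])) (∷-cong refl (⊕-identityˡ [])))

    const-* : ∀ c d → const (c * d) ≈ const c ⊗ const d
    const-* c d = ≈-sym (const⊗ c (const d))

    ev-const : ∀ c a → ev (const c) a ≡ c
    ev-const c a = trans (cong (c +_) (zeroʳ a)) (+-identityʳ c)

    lin : K → Poly
    lin a = - a ∷ 1# ∷ []

    lin-≈ : ∀ a → lin a ≈ X ⊕ ⊖ const a
    lin-≈ a = ≈-sym (≈-trans (≡⇒≈ (trans (cong (X ⊕_) (trans (⊖∷ a []) (cong (- a ∷_) ⊖[]))) (∷⊕∷ 0# (- a) _ [])))
      (∷-cong (+-identityˡ _) (≈-trans (⊕-comm _ []) (⊕-identityˡ _))))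

    ev-lin : ∀ a b → ev (lin a) b ≡ b - a
    ev-lin a b = trans (cong (λ x → - a + b * x) (ev-const 1# b))
      (trans (cong (- a +_) (*-identityʳ b)) (+-comm _ _))

    -- Horner's scheme: the coefficients of the quotient by X − a are the values of the tails.
    horner : Poly → K → Poly
    horner []      a = []
    horner (c ∷ p) a = ev (c ∷ p) a ∷ horner p a

    quo : Poly → K → Poly
    quo []      a = []
    quo (c ∷ p) a = horner p a

    length-quo : ∀ p a → length (quo p a) ≡ ℕ.pred (length p)
    length-quo []      a = refl
    length-quo (c ∷ p) a = go p
      where
      go : ∀ p → length (horner p a) ≡ length p
      go [] = refl
      go (c ∷ p) = cong suc (go p)

    ⊗-zeroʳ : ∀ p → p ⊗ [] ≈ []
    ⊗-zeroʳ p = ≈-trans (⊗-comm p []) (≡⇒≈ ([]⊗ p))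

    quo-≈ : ∀ p a → p ≈ lin a ⊗ quo p a ⊕ const (ev p a)
    quo-≈ []      a = ≈-sym (≈-trans (⊕-cong (⊗-zeroʳ (lin a)) 0∷[]≈[]) (⊕-identityˡ []))
    quo-≈ (c ∷ p) a = go c p
      where
      open ≈R
      go : ∀ c p → c ∷ p ≈ lin a ⊗ horner p a ⊕ const (c + a * ev p a)
      go c []      = begin
        const c ≈⟨ ∷-cong (sym (trans (cong (c +_) (zeroʳ a)) (+-identityʳ c))) ≈-refl ⟩
        const (c + a * 0#) ≈⟨ ≈-trans (⊕-cong (⊗-zeroʳ (lin a)) ≈-refl) (⊕-identityˡ _) ⟨
        lin a ⊗ [] ⊕ const (c + a * 0#) ∎
      go c (d ∷ p) = let e = ev (d ∷ p) a ; h = horner p a in begin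
        c ∷ d ∷ p                                         ≈⟨ ∷-≈ c (d ∷ p) ⟩
        const c ⊕ X ⊗ (d ∷ p)                             ≈⟨ ⊕-cong ≈-refl (⊗-cong ≈-refl (go d p)) ⟩
        const c ⊕ X ⊗ (lin a ⊗ h ⊕ const e)               ≈⟨ ⊕-cong ≈-refl (⊗-cong ≈-refl (⊕-cong (⊗-cong (lin-≈ a) ≈-refl) ≈-refl)) ⟩
        const c ⊕ X ⊗ ((X ⊕ ⊖ const a) ⊗ h ⊕ const e)
          ≈⟨ PS.solve 5 (λ c X h e a → c PS.:+ X PS.:* ((X PS.:+ PS.:- a) PS.:* h PS.:+ e) PS.:=
               (X PS.:+ PS.:- a) PS.:* (e PS.:+ X PS.:* h) PS.:+ (c PS.:+ a PS.:* e)) ≈-refl (const c) X h (const e) (const a) ⟩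
        (X ⊕ ⊖ const a) ⊗ (const e ⊕ X ⊗ h) ⊕ (const c ⊕ const a ⊗ const e)
          ≈⟨ ⊕-cong (⊗-cong (lin-≈ a) (∷-≈ e h)) (≈-trans (const-+ c (a * e)) (⊕-cong (≈-refl {const c}) (const-* a e))) ⟨
        lin a ⊗ (e ∷ h) ⊕ const (c + a * e)               ∎

    factor : ∀ p a → ev p a ≡ 0# → p ≈ lin a ⊗ quo p a
    factor p a e = ≈-trans (quo-≈ p a) (≈-trans (⊕-cong ≈-refl (≈-trans (∷-cong e ≈-refl) 0∷[]≈[]))
      (≈-trans (⊕-comm (lin a ⊗ quo p a) []) (⊕-identityˡ _)))


    0∷⊗ : ∀ p r → (0# ∷ p) ⊗ r ≈ 0# ∷ p ⊗ r
    0∷⊗ p r = ≈-trans (≡⇒≈ (∷⊗ 0# p r)) (≈-trans (⊕-cong (mk≈ {r = []} λ n → trans (coef-scale 0# r n) (zeroˡ _)) ≈-refl) (⊕-identityˡ _))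

    private
      -- With a nonzero constant term c, the lowest coefficient of the product forces the lowest
      -- coefficient of the other factor to vanish; removing it leaves the same situation with a
      -- shorter list.
      domain-step : ∀ c p → ¬ c ≡ 0# → ∀ r → (c ∷ p) ⊗ r ≈ [] → r ≈ []
      domain-step c p c≢0 []      e = ≈-refl
      domain-step c p c≢0 (d ∷ r) e with a*b≡0 (trans (sym (coef-⊗ (c ∷ p) (d ∷ r) 0)) (at e 0))
      ... | inj₁ c≡0 = ⊥-elim (c≢0 c≡0)
      ... | inj₂ d≡0 = ≈-trans (∷-cong d≡0 (domain-step c p c≢0 r (tail-≈0 e'))) 0∷[]≈[]
        where
        e' : 0# ∷ (c ∷ p) ⊗ r ≈ []
        e' = ≈-trans (≈-sym (≈-trans (⊗-comm (c ∷ p) (0# ∷ r)) (≈-trans (0∷⊗ r (c ∷ p)) (∷-cong refl (⊗-comm r (c ∷ p))))))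
               (≈-trans (⊗-cong (≈-refl {c ∷ p}) (∷-cong (sym d≡0) ≈-refl)) e)

    -- Factors X are stripped from `p` until its constant term is nonzero or `p` is exhausted.
    domain : ∀ p r → p ⊗ r ≈ [] → p ≈ [] ⊎ r ≈ []
    domain []      r e = inj₁ ≈-refl
    domain (c ∷ p) r e with c ≟K 0#
    ... | no c≢0 = inj₂ (domain-step c p c≢0 r e)
    ... | yes refl with domain p r (tail-≈0 (≈-trans (≈-sym (0∷⊗ p r)) e))
    ...   | inj₁ p≈0 = inj₁ (≈-trans (∷-cong refl p≈0) 0∷[]≈[])
    ...   | inj₂ r≈0 = inj₂ r≈0

    ⊗-cancelˡ : ∀ p {r s} → ¬ p ≈ [] → p ⊗ r ≈ p ⊗ s → r ≈ s
    ⊗-cancelˡ p {r} {s} p≉0 e with domain p (r ⊕ ⊖ s)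
      (≈-trans (PS.solve 3 (λ p r s → p PS.:* (r PS.:+ PS.:- s) PS.:= p PS.:* r PS.:+ PS.:- (p PS.:* s)) ≈-refl p r s)
               (≈⇒⊖≈0 e))
    ... | inj₁ p≈0 = ⊥-elim (p≉0 p≈0)
    ... | inj₂ z = ⊖≈0⇒≈ z

    lin≉0 : ∀ a → ¬ lin a ≈ []
    lin≉0 a e = 1≢0 (at e 1)

    infixr 9 _^ᴾ_
    _^ᴾ_ : Poly → ℕ → Poly
    p ^ᴾ zero  = const 1#
    p ^ᴾ suc n = p ⊗ p ^ᴾ n

    ^ᴾ≉0 : ∀ p n → ¬ p ≈ [] → ¬ p ^ᴾ n ≈ []
    ^ᴾ≉0 p zero    p≉0 e = 1≢0 (at e 0)
    ^ᴾ≉0 p (suc n) p≉0 e with domain p (p ^ᴾ n) e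
    ... | inj₁ z = p≉0 z
    ... | inj₂ z = ^ᴾ≉0 p n p≉0 z

    ^ᴾ-+ : ∀ p m n → p ^ᴾ (m ℕ.+ n) ≈ p ^ᴾ m ⊗ p ^ᴾ n
    ^ᴾ-+ p zero n = ≈-sym (⊗-identityˡ _)
    ^ᴾ-+ p (suc m) n = ≈-trans (⊗-cong ≈-refl (^ᴾ-+ p m n)) (≈-sym (⊗-assoc p _ _))

    ev-^ : ∀ p n a → ev (p ^ᴾ n) a ≡ ev p a ^ n
    ev-^ p zero    a = ev-const 1# a
    ev-^ p (suc n) a = trans (ev-⊗ p (p ^ᴾ n) a) (cong (ev p a *_) (ev-^ p n a))

    -- The number m is the exponent to which the head of the list belongs.
    derₙ : ℕ → Poly → Poly
    derₙ m []      = []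
    derₙ m (c ∷ p) = ι m * c ∷ derₙ (suc m) p

    der : Poly → Poly
    der []      = []
    der (c ∷ p) = derₙ 1 p

    coef-der : ∀ p n → coef (der p) n ≡ ι (suc n) * coef p (suc n)
    coef-der []      n = sym (zeroʳ _)
    coef-der (c ∷ p) n = trans (go 1 p n) (cong (λ k → ι (suc k) * coef p n) refl)
      where
      go : ∀ m p n → coef (derₙ m p) n ≡ ι (m ℕ.+ n) * coef p n
      go m []      n       = sym (zeroʳ _)
      go m (c ∷ p) zero    = cong (λ k → ι k * c) (sym (ℕ.+-identityʳ m))
      go m (c ∷ p) (suc n) = trans (go (suc m) p n) (cong (λ k → ι k * coef p n) (sym (ℕ.+-suc m n)))

    length-der : ∀ p → length (der p) ≡ ℕ.pred (length p)
    length-der []      = refl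
    length-der (c ∷ p) = go 1 p
      where
      go : ∀ m p → length (derₙ m p) ≡ length p
      go m []      = refl
      go m (c ∷ p) = cong suc (go (suc m) p)

    der-cong : ∀ {p r} → p ≈ r → der p ≈ der r
    der-cong {p} {r} e = mk≈ λ n → trans (coef-der p n) (trans (cong (ι (suc n) *_) (at e (suc n))) (sym (coef-der r n)))

    der-⊕ : ∀ p r → der (p ⊕ r) ≈ der p ⊕ der r
    der-⊕ p r = mk≈ λ n → trans (coef-der (p ⊕ r) n) (trans (cong (ι (suc n) *_) (coef-⊕ p r (suc n)))
      (trans (distribˡ _ _ _) (trans (cong₂ _+_ (sym (coef-der p n)) (sym (coef-der r n))) (sym (coef-⊕ (der p) (der r) n)))))

    der-scale : ∀ c p → der (scale c p) ≈ const c ⊗ der p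
    der-scale c p = ≈-trans (mk≈ λ n → trans (coef-der (scale c p) n) (trans (cong (ι (suc n) *_) (coef-scale c p (suc n)))
      (trans (solve 3 (λ i c p → i :* (c :* p) := c :* (i :* p)) refl _ _ _)
      (trans (cong (c *_) (sym (coef-der p n))) (sym (coef-scale c (der p) n)))))) (≈-sym (const⊗ c (der p)))

    der-∷ : ∀ c p → der (c ∷ p) ≈ p ⊕ X ⊗ der p
    der-∷ c p = ≈-trans (mk≈ λ n → trans (coef-der (c ∷ p) n) (trans (go n) (sym (coef-⊕ p (0# ∷ der p) n))))
      (⊕-cong ≈-refl (≈-sym (X⊗ (der p))))
      where
      go : ∀ n → ι (suc n) * coef p n ≡ coef p n + coef (0# ∷ der p) n
      go zero    = trans (cong (_* coef p 0) ι-1) (trans (*-identityˡ _) (sym (+-identityʳ _)))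
      go (suc n) = trans (cong (_* coef p (suc n)) (ι-suc (suc n)))
        (trans (distribʳ _ _ _) (cong₂ _+_ (*-identityˡ _) (sym (coef-der p n))))

    leibniz : ∀ p r → der (p ⊗ r) ≈ der p ⊗ r ⊕ p ⊗ der r
    leibniz []      r = ≈-trans (der-cong (≡⇒≈ ([]⊗ r))) (≈-sym (≈-trans (⊕-cong (≡⇒≈ ([]⊗ r)) (≡⇒≈ ([]⊗ (der r)))) (⊕-identityˡ [])))
    leibniz (c ∷ p) r = begin
      der ((c ∷ p) ⊗ r)                                   ≡⟨ cong der (∷⊗ c p r) ⟩
      der (scale c r ⊕ (0# ∷ p ⊗ r))                      ≈⟨ der-⊕ (scale c r) _ ⟩
      der (scale c r) ⊕ der (0# ∷ p ⊗ r)                  ≈⟨ ⊕-cong (der-scale c r) (der-∷ 0# (p ⊗ r)) ⟩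
      const c ⊗ der r ⊕ (p ⊗ r ⊕ X ⊗ der (p ⊗ r))         ≈⟨ ⊕-cong ≈-refl (⊕-cong ≈-refl (⊗-cong (≈-refl {X}) (leibniz p r))) ⟩
      const c ⊗ der r ⊕ (p ⊗ r ⊕ X ⊗ (der p ⊗ r ⊕ p ⊗ der r))
        ≈⟨ PS.solve 6 (λ c p r X p' r' → c PS.:* r' PS.:+ (p PS.:* r PS.:+ X PS.:* (p' PS.:* r PS.:+ p PS.:* r')) PS.:=
              (p PS.:+ X PS.:* p') PS.:* r PS.:+ (c PS.:+ X PS.:* p) PS.:* r') ≈-refl (const c) p r X (der p) (der r) ⟩
      (p ⊕ X ⊗ der p) ⊗ r ⊕ (const c ⊕ X ⊗ p) ⊗ der r     ≈⟨ ⊕-cong (⊗-cong (der-∷ c p) ≈-refl) (⊗-cong (∷-≈ c p) ≈-refl) ⟨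
      der (c ∷ p) ⊗ r ⊕ (c ∷ p) ⊗ der r                   ∎
      where open ≈R

    der-^ : ∀ p n → der (p ^ᴾ suc n) ≈ const (ι (suc n)) ⊗ (p ^ᴾ n ⊗ der p)
    der-^ p zero = begin
      der (p ⊗ const 1#)                 ≈⟨ der-cong (⊗-comm p (const 1#)) ⟩
      der (const 1# ⊗ p)                 ≈⟨ der-cong (⊗-identityˡ p) ⟩
      der p                              ≈⟨ ⊗-identityˡ (der p) ⟨
      const 1# ⊗ der p                   ≈⟨ ⊗-identityˡ _ ⟨
      const 1# ⊗ (const 1# ⊗ der p)      ≈⟨ ⊗-cong (∷-cong ι-1 (≈-refl {[]})) ≈-refl ⟨
      const (ι 1) ⊗ (const 1# ⊗ der p)   ∎
      where open ≈R
    der-^ p (suc n) = begin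
      der (p ⊗ (p ⊗ p ^ᴾ n))             ≈⟨ leibniz p _ ⟩
      der p ⊗ (p ⊗ p ^ᴾ n) ⊕ p ⊗ der (p ^ᴾ suc n)  ≈⟨ ⊕-cong ≈-refl (⊗-cong ≈-refl (der-^ p n)) ⟩
      der p ⊗ (p ⊗ p ^ᴾ n) ⊕ p ⊗ (const (ι (suc n)) ⊗ (p ^ᴾ n ⊗ der p))
        ≈⟨ PS.solve 4 (λ d p P i → d PS.:* (p PS.:* P) PS.:+ p PS.:* (i PS.:* (P PS.:* d)) PS.:=
             (PS.con (ℤ.+ 1) PS.:+ i) PS.:* ((p PS.:* P) PS.:* d)) ≈-refl (der p) p (p ^ᴾ n) (const (ι (suc n))) ⟩
      ((const 1# ⊕ []) ⊕ const (ι (suc n))) ⊗ ((p ⊗ p ^ᴾ n) ⊗ der p)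
        ≈⟨ ⊗-cong (≈-trans (∷-cong (ι-suc (suc n)) (≈-refl {[]})) (≈-trans (const-+ 1# _) (⊕-cong (≈-sym (≈-trans (⊕-comm _ []) (⊕-identityˡ _))) ≈-refl))) ≈-refl ⟨
      const (ι (suc (suc n))) ⊗ ((p ⊗ p ^ᴾ n) ⊗ der p) ∎
      where open ≈R
            import Data.Integer as ℤ

    abstract
      length-⊕ : ∀ p r → length (p ⊕ r) ≡ length p ⊔ length r
      length-⊕ []      r       = refl
      length-⊕ (c ∷ p) []      = refl
      length-⊕ (c ∷ p) (d ∷ r) = cong suc (length-⊕ p r)

      length-⊖ : ∀ p → length (⊖ p) ≡ length p
      length-⊖ p = L.length-map _ p

      -- Lengths stand for degrees throughout: length at most `suc a` means degree at most a, and no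
      -- leading coefficient ever has to be shown nonzero.
      length-⊗ : ∀ p r {a b} → length p ≤ suc a → length r ≤ suc b → length (p ⊗ r) ≤ suc (a ℕ.+ b)
      length-⊗ []      r p≤ r≤ = z≤n
      length-⊗ (c ∷ p) r {a} {b} (s≤s p≤) r≤ = subst (_≤ suc (a ℕ.+ b)) (sym (length-⊕ (scale c r) (0# ∷ p ⊗ r)))
        (ℕ.⊔-lub (subst (_≤ suc (a ℕ.+ b)) (sym (L.length-map (c *_) r)) (ℕ.≤-trans r≤ (s≤s (ℕ.m≤n+m b a))))
                 (s≤s (go p a p≤)))
        where
        -- The tail gets one less than the head, which makes room for its multiplication by X.
        go : ∀ p a → length p ≤ a → length (p ⊗ r) ≤ a ℕ.+ b
        go []       a       _  = z≤n
        go (c ∷ p)  (suc a) le = length-⊗ (c ∷ p) r le r≤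

    coef-length : ∀ p n → length p ≤ n → coef p n ≡ 0#
    coef-length []      n       le = refl
    coef-length (c ∷ p) (suc n) (s≤s le) = coef-length p n le

-- Multiplicities of roots, counted and detected by derivatives

module RootMultiplicities where
  open PrimeFields
  open PolynomialRings
  open import Data.Nat as ℕ using (ℕ; zero; suc; z≤n; s≤s; _≤_; _<_)
  import Data.Nat.Properties as ℕ
  open import Data.List using ([]; _∷_; length)
  import Data.List.Relation.Unary.All as All
  open import Data.List.Relation.Unary.AllPairs using (_∷_; [])
  open import Data.List.Relation.Unary.Any using (here; there)
  open import Data.List.Relation.Unary.Unique.Propositional using (Unique)
  open import Data.List.Membership.Propositional using (_∈_)
  open import Data.Product using (_,_; _×_; ∃-syntax)
  open import Data.Sum using (inj₁; inj₂)
  open import Data.Empty using (⊥-elim)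
  open import Relation.Nullary using (¬_; yes; no)
  open import Relation.Binary.PropositionalEquality

  module Multiplicities {q : ℕ} (𝔽 : PrimeField q) where
    open FieldProperties 𝔽
    open Polynomials 𝔽

    ev-lin-self : ∀ a → ev (lin a) a ≡ 0#
    ev-lin-self a = trans (ev-lin a a) (-‿inverseʳ a)

    ev-lin⊗ : ∀ a p → ev (lin a ⊗ p) a ≡ 0#
    ev-lin⊗ a p = trans (ev-⊗ (lin a) p a) (trans (cong (_* ev p a) (ev-lin-self a)) (zeroˡ _))

    swap : ∀ p r s → p ⊗ (r ⊗ s) ≈ r ⊗ (p ⊗ s)
    swap = PS.solve 3 (λ p r s → p PS.:* (r PS.:* s) PS.:= r PS.:* (p PS.:* s)) ≈-refl

    -- Evaluation at b kills `W`, because b - a is nonzero; then one factor X - b cancels on both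
    -- sides and the exponent drops.
    coprime-lin : ∀ k {a b} V W → ¬ a ≡ b → lin b ^ᴾ k ⊗ V ≈ lin a ⊗ W → ∃[ V' ] W ≈ lin b ^ᴾ k ⊗ V'
    coprime-lin zero    V W a≢b e = W , ≈-sym (⊗-identityˡ W)
    coprime-lin (suc k) {a} {b} V W a≢b e =
      let V' , e' = coprime-lin k V (quo W b) a≢b cancelled
      in V' , ≈-trans W≈ (≈-trans (⊗-cong ≈-refl e') (≈-sym (⊗-assoc (lin b) _ V')))
      where
      W[b]≡0 : ev W b ≡ 0#
      W[b]≡0 with a*b≡0 (trans (sym (ev-⊗ (lin a) W b)) (trans (sym (ev-cong b e))
        (trans (ev-cong b (⊗-assoc (lin b) (lin b ^ᴾ k) V)) (ev-lin⊗ b _))))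
      ... | inj₁ z = ⊥-elim (a≢b (sym (a-b≡0 (trans (sym (ev-lin a b)) z))))
      ... | inj₂ z = z
      W≈ : W ≈ lin b ⊗ quo W b
      W≈ = factor W b W[b]≡0
      cancelled : lin b ^ᴾ k ⊗ V ≈ lin a ⊗ quo W b
      cancelled = ⊗-cancelˡ (lin b) (lin≉0 b) (begin
        lin b ⊗ (lin b ^ᴾ k ⊗ V)    ≈⟨ ⊗-assoc (lin b) (lin b ^ᴾ k) V ⟨
        lin b ^ᴾ suc k ⊗ V          ≈⟨ e ⟩
        lin a ⊗ W                   ≈⟨ ⊗-cong (≈-refl {lin a}) W≈ ⟩
        lin a ⊗ (lin b ⊗ quo W b)   ≈⟨ swap (lin a) (lin b) (quo W b) ⟩
        lin b ⊗ (lin a ⊗ quo W b)   ∎)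
        where open ≈R

    coprime-lin^ : ∀ m k {a b} V U → ¬ a ≡ b → lin b ^ᴾ k ⊗ V ≈ lin a ^ᴾ m ⊗ U → ∃[ V' ] U ≈ lin b ^ᴾ k ⊗ V'
    coprime-lin^ zero    k V U a≢b e = V , ≈-trans (≈-sym (⊗-identityˡ U)) (≈-sym e)
    coprime-lin^ (suc m) k {a} V U a≢b e =
      let V' , e' = coprime-lin k V (lin a ^ᴾ m ⊗ U) a≢b (≈-trans e (⊗-assoc (lin a) _ U))
      in coprime-lin^ m k V' U a≢b (≈-sym e')

    ≉0⇒nonempty : ∀ p → ¬ p ≈ [] → suc (ℕ.pred (length p)) ≡ length p
    ≉0⇒nonempty []      p≉0 = ⊥-elim (p≉0 ≈-refl)
    ≉0⇒nonempty (_ ∷ _) p≉0 = refl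

    -- `U` is known only up to ≈ and may carry trailing zeros. Dividing `Q` itself by Horner's
    -- scheme gives a representative whose length is shorter by exactly one for each factor, as the
    -- degree count requires.
    quotient : ∀ M a Q U → ¬ Q ≈ [] → Q ≈ lin a ^ᴾ M ⊗ U → ∃[ U' ] U' ≈ U × length U' ℕ.+ M ≡ length Q
    quotient zero    a Q U Q≉0 e = Q , ≈-trans e (⊗-identityˡ U) , ℕ.+-identityʳ _
    quotient (suc M) a Q U Q≉0 e =
      let U' , e₁ , e₂ = quotient M a (quo Q a) U quo≉0 quo≈
      in U' , e₁ , trans (ℕ.+-suc (length U') M)
           (trans (cong suc (trans e₂ (length-quo Q a))) (≉0⇒nonempty Q Q≉0))
      where
      Q≈ : Q ≈ lin a ⊗ quo Q a
      Q≈ = factor Q a (trans (ev-cong a (≈-trans e (⊗-assoc (lin a) _ U))) (ev-lin⊗ a _))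
      quo≈ : quo Q a ≈ lin a ^ᴾ M ⊗ U
      quo≈ = ⊗-cancelˡ (lin a) (lin≉0 a) (≈-trans (≈-sym Q≈) (≈-trans e (⊗-assoc (lin a) _ U)))
      quo≉0 : ¬ quo Q a ≈ []
      quo≉0 z = Q≉0 (≈-trans Q≈ (≈-trans (⊗-cong ≈-refl z) (⊗-zeroʳ (lin a))))

    -- Powers of X - a for distinct a are coprime, so after one of them has been divided out the
    -- others still divide the quotient; every division shortens the list by `M`.
    root-bound : ∀ Z M Q → Unique Z → ¬ Q ≈ [] → (∀ {a} → a ∈ Z → ∃[ U ] Q ≈ lin a ^ᴾ M ⊗ U) →
      length Z ℕ.* M < length Q
    root-bound []      M Q uniq Q≉0 div = subst (1 ≤_) (≉0⇒nonempty Q Q≉0) (s≤s z≤n)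
    root-bound (a ∷ Z) M Q (a∉Z ∷ uniq) Q≉0 div =
      let U , Q≈ = div (here refl)
          U' , U'≈U , len = quotient M a Q U Q≉0 Q≈
          Q≈' = ≈-trans Q≈ (⊗-cong ≈-refl (≈-sym U'≈U))
          U'≉0 = λ z → Q≉0 (≈-trans Q≈' (≈-trans (⊗-cong ≈-refl z) (⊗-zeroʳ (lin a ^ᴾ M))))
          ih = root-bound Z M U' uniq U'≉0 λ {b} b∈Z →
                 let V , Q≈V = div (there b∈Z)
                 in coprime-lin^ M M V U' (All.lookup a∉Z b∈Z) (≈-trans (≈-sym Q≈V) Q≈')
      in ℕ.<-≤-trans (subst (_< M ℕ.+ length U') refl (ℕ.+-monoʳ-< M ih))
           (ℕ.≤-reflexive (trans (ℕ.+-comm M _) len))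

    -- If Q_l = f^l Q^(l) then Q_(l+1) = f Q_l' − l f' Q_l.
    derive : Poly → ℕ → Poly → Poly
    derive f l P = f ⊗ der P ⊕ ⊖ (const (ι l) ⊗ (der f ⊗ P))

    derives : Poly → ℕ → ℕ → Poly → Poly
    derives f l zero    P = P
    derives f l (suc k) P = derives f (suc l) k (derive f l P)

    derive-cong : ∀ f l {P P'} → P ≈ P' → derive f l P ≈ derive f l P'
    derive-cong f l e = ⊕-cong (⊗-cong ≈-refl (der-cong e)) (⊖-cong (⊗-cong ≈-refl (⊗-cong ≈-refl e)))

    derives-cong : ∀ f l k {P P'} → P ≈ P' → derives f l k P ≈ derives f l k P'
    derives-cong f l zero    e = e
    derives-cong f l (suc k) e = derives-cong f (suc l) k (derive-cong f l e)

    -- By the product rule the exponent drops by one. The value of the new cofactor at a comes from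
    -- differentiating the power alone, all other terms keeping a factor X - a.
    derive-lin^ : ∀ f l k a P U → P ≈ lin a ^ᴾ suc k ⊗ U →
      ∃[ U' ] derive f l P ≈ lin a ^ᴾ k ⊗ U' × ev U' a ≡ ι (suc k) * (ev f a * ev U a)
    derive-lin^ f l k a P U e = U' , eq , ev-eq
      where
      L = lin a ; i = const (ι (suc k)) ; il = const (ι l)
      R = f ⊗ der U ⊕ ⊖ (il ⊗ (der f ⊗ U))
      U' = i ⊗ (der L ⊗ (f ⊗ U)) ⊕ L ⊗ R
      eq : derive f l P ≈ L ^ᴾ k ⊗ U'
      eq = ≈-trans (derive-cong f l e) (≈-trans
        (⊕-cong (⊗-cong ≈-refl (≈-trans (leibniz (L ^ᴾ suc k) U) (⊕-cong (⊗-cong (der-^ L k) ≈-refl) ≈-refl))) ≈-refl)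
        (PS.solve 9 (λ f i Lk dL U L dU il df →
            f PS.:* ((i PS.:* (Lk PS.:* dL)) PS.:* U PS.:+ (L PS.:* Lk) PS.:* dU) PS.:+ PS.:- (il PS.:* (df PS.:* ((L PS.:* Lk) PS.:* U)))
            PS.:= Lk PS.:* (i PS.:* (dL PS.:* (f PS.:* U)) PS.:+ L PS.:* (f PS.:* dU PS.:+ PS.:- (il PS.:* (df PS.:* U)))))
          ≈-refl f i (L ^ᴾ k) (der L) U L (der U) il (der f)))
      ev-derL : ev (der L) a ≡ 1#
      ev-derL = trans (ev-const _ a) (trans (cong (_* 1#) ι-1) (*-identityʳ 1#))
      ev-eq : ev U' a ≡ ι (suc k) * (ev f a * ev U a)
      ev-eq = trans (ev-⊕ _ (L ⊗ R) a) (trans (cong₂ _+_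
        (trans (ev-⊗ i _ a) (cong₂ _*_ (ev-const _ a) (trans (ev-⊗ (der L) _ a)
          (trans (cong₂ _*_ ev-derL (ev-⊗ f U a)) (*-identityˡ _)))))
        (ev-lin⊗ a R)) (+-identityʳ _))

    -- Iterating `derive-lin^` gives the value k! f(a)^k U(a), and k! is nonzero modulo q because k
    -- < q.
    derives≢0 : ∀ f a k l P U → k < q → ¬ ev f a ≡ 0# → ¬ ev U a ≡ 0# → P ≈ lin a ^ᴾ k ⊗ U →
      ¬ ev (derives f l k P) a ≡ 0#
    derives≢0 f a zero    l P U k<q f≢0 U≢0 e z =
      U≢0 (trans (ev-cong a (≈-sym (≈-trans e (⊗-identityˡ U)))) z)
    derives≢0 f a (suc k) l P U k<q f≢0 U≢0 e =
      let U' , e' , evU' = derive-lin^ f l k a P U e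
      in derives≢0 f a k (suc l) _ U' (ℕ.<-trans (ℕ.n<1+n k) k<q) f≢0
           (λ z → *-nonzero (ι-suc≢0 k k<q) (*-nonzero f≢0 U≢0) (trans (sym evU') z)) e'

    -- In characteristic q ordinary derivatives detect multiplicities up to q. The factor f^k of the
    -- k-th iterate is harmless where f does not vanish.
    vanishing⇒divides : ∀ f a Q M → M ≤ q → ¬ ev f a ≡ 0# → (∀ k → k < M → ev (derives f 0 k Q) a ≡ 0#) →
      ∃[ U ] Q ≈ lin a ^ᴾ M ⊗ U
    vanishing⇒divides f a Q zero    M≤q f≢0 v = Q , ≈-sym (⊗-identityˡ Q)
    vanishing⇒divides f a Q (suc M) M≤q f≢0 v
      with vanishing⇒divides f a Q M (ℕ.<⇒≤ M≤q) f≢0 (λ k k<M → v k (ℕ.m<n⇒m<1+n k<M))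
    ... | U , e with ev U a ≟K 0#
    ...   | yes z = quo U a , ≈-trans e (≈-trans (⊗-cong ≈-refl (factor U a z))
                      (PS.solve 3 (λ M L u → M PS.:* (L PS.:* u) PS.:= (L PS.:* M) PS.:* u) ≈-refl (lin a ^ᴾ M) (lin a) (quo U a)))
    -- Here a is a root of multiplicity exactly `M`, contrary to the vanishing of the `M`-th
    -- iterate.
    ...   | no nz = ⊥-elim (derives≢0 f a M 0 Q U M≤q f≢0 nz e (v M (ℕ.n<1+n M)))

-- Stepanov's method

module StepanovMethod where
  open PrimeFields
  open PolynomialRings
  open RootMultiplicities
  open import Data.Nat as ℕ using (ℕ; zero; suc; z≤n; s≤s; _≤_; _<_)
  import Data.Nat.Properties as ℕ
  open import Data.Fin as F using (Fin; zero; suc; toℕ; combine; _↑ˡ_; _↑ʳ_; splitAt; finToFun; funToFin)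
  import Data.Fin.Properties as F
  open import Data.List using ([]; length; tabulate)
  open import Data.List.Properties using (length-tabulate)
  open import Data.List.Relation.Unary.Unique.Propositional using (Unique)
  open import Data.List.Membership.Propositional using (_∈_)
  open import Data.Product using (_,_; _×_; ∃-syntax; proj₁; proj₂)
  open import Data.Sum using (inj₁; inj₂; [_,_]′)
  open import Data.Empty using (⊥-elim)
  open import Function using (_∘_)
  open import Relation.Nullary using (¬_; Dec; yes; no)
  open import Relation.Binary.PropositionalEquality

  module Independence {q : ℕ} (𝔽 : PrimeField q) where
    open FieldProperties 𝔽
    open Polynomials 𝔽
    open Multiplicities 𝔽

    -- Divisibility by X^N, read off from the coefficients.
    LowZero : ℕ → Poly → Set
    LowZero N p = ∀ n → n < N → coef p n ≡ 0#

    low-⊗ : ∀ {N} p r → LowZero N p → LowZero N (p ⊗ r)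
    low-⊗ p r low n n<N = trans (coef-⊗ p r n)
      (conv-zeroˡ (coef p) (coef r) n λ m m≤n → low m (ℕ.≤-<-trans m≤n n<N))

    low-⊕ : ∀ {N} p r → LowZero N p → LowZero N r → LowZero N (p ⊕ r)
    low-⊕ p r a b n n<N = trans (coef-⊕ p r n) (trans (cong₂ _+_ (a n n<N) (b n n<N)) (+-identityˡ _))

    low-≈ : ∀ {N p r} → p ≈ r → LowZero N p → LowZero N r
    low-≈ e low n n<N = trans (sym (at e n)) (low n n<N)

    low-X^ : ∀ N → LowZero N (X ^ᴾ N)
    low-X^ (suc N) zero    _         = at (X⊗ (X ^ᴾ N)) 0
    low-X^ (suc N) (suc n) (s≤s n<N) = trans (at (X⊗ (X ^ᴾ N)) (suc n)) (low-X^ N n n<N)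

    low⇒≈0 : ∀ {N} p → length p ≤ N → LowZero N p → p ≈ []
    low⇒≈0 {N} p len low = mk≈ λ n → go n (n ℕ.<? N)
      where
      go : ∀ n → Dec (n < N) → coef p n ≡ 0#
      go n (yes n<N) = low n n<N
      go n (no n≮N)  = coef-length p n (ℕ.≤-trans len (ℕ.≮⇒≥ n≮N))

    coef₀-^ : ∀ p n → ¬ coef p 0 ≡ 0# → ¬ coef (p ^ᴾ n) 0 ≡ 0#
    coef₀-^ p zero    p≢0 = 1≢0
    coef₀-^ p (suc n) p≢0 e = *-nonzero p≢0 (coef₀-^ p n p≢0) (trans (sym (coef-⊗ p (p ^ᴾ n) 0)) e)

    const≈0 : ∀ {c} → c ≡ 0# → const c ≈ []
    const≈0 e = ≈-trans (∷-cong e ≈-refl) 0∷[]≈[]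

    const≉0 : ∀ {c} → ¬ c ≡ 0# → ¬ const c ≈ []
    const≉0 c≢0 e = c≢0 (at e 0)

    der-^q : ∀ p → der (p ^ᴾ q) ≈ []
    der-^q p = subst (λ n → der (p ^ᴾ n) ≈ []) suc-pred
      (≈-trans (der-^ p _) (≈-trans (⊗-cong (const≈0 (trans (cong ι suc-pred) ι-q)) ≈-refl) (≡⇒≈ ([]⊗ _))))
      where
      suc-pred : suc (ℕ.pred q) ≡ q
      suc-pred = ℕ.suc-pred q {{ℕ.>-nonZero (ℕ.<-trans (s≤s z≤n) 1<q)}}

    -- The derivative of a q-th power vanishes, so n + 1 times this coefficient is zero, and n + 1
    -- is nonzero below q. Thus a q-th power is congruent to its constant term modulo X^q.
    coef-^q : ∀ p n → suc n < q → coef (p ^ᴾ q) (suc n) ≡ 0#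
    coef-^q p n n<q with a*b≡0 (trans (sym (coef-der (p ^ᴾ q) n)) (at (der-^q p) n))
    ... | inj₁ z = ⊥-elim (ι-suc≢0 n n<q z)
    ... | inj₂ z = z

    square≈0 : ∀ p → p ⊗ p ≈ [] → p ≈ []
    square≈0 p e with domain p p e
    ... | inj₁ z = z
    ... | inj₂ z = z

    ev-divisible : ∀ {P} a R → P ≈ lin a ⊗ R → ev P a ≡ 0#
    ev-divisible a R e = trans (ev-cong a e) (ev-lin⊗ a R)

    ev-square≡0 : ∀ {P a} s {c} → ¬ c ≡ 0# → ev P a ≡ c * (ev s a * ev s a) → ev P a ≡ 0# → ev s a ≡ 0#
    ev-square≡0 s c≢0 e z = [ (λ p → p) , (λ p → p) ]′ (a*b≡0 ([ (λ p → ⊥-elim (c≢0 p)) , (λ p → p) ]′ (a*b≡0 (trans (sym e) z))))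

    -- Since f has a simple zero, f r² and κ s² have zeros of different parity there.
    f⊗r²≈κs² : ∀ {f a H κ} → f ≈ lin a ⊗ H → ¬ ev H a ≡ 0# → ¬ κ ≡ 0# →
      ∀ n r s → length r ≤ n → f ⊗ (r ⊗ r) ≈ const κ ⊗ (s ⊗ s) → r ≈ [] × s ≈ []
    f⊗r²≈κs² {f} {a} {H} {κ} f≈ H≢0 κ≢0 zero    []  s len e =
      ≈-refl , [ (λ z → ⊥-elim (const≉0 κ≢0 z)) , square≈0 s ]′ (domain (const κ) (s ⊗ s)
        (≈-trans (≈-sym e) (≈-trans (⊗-cong (≈-refl {f}) (≡⇒≈ ([]⊗ []))) (⊗-zeroʳ f))))
    f⊗r²≈κs² {f} {a} {H} {κ} f≈ H≢0 κ≢0 (suc n) r s len e =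
      ≈-trans r≈ (≈-trans (⊗-cong (≈-refl {lin a}) (proj₁ ih)) (⊗-zeroʳ (lin a))) ,
      ≈-trans s≈ (≈-trans (⊗-cong (≈-refl {lin a}) (proj₂ ih)) (⊗-zeroʳ (lin a)))
      where
      open ≈R
      L k : Poly
      L = lin a
      k = const κ
      s[a]≡0 : ev s a ≡ 0#
      s[a]≡0 = ev-square≡0 {k ⊗ (s ⊗ s)} s κ≢0 (trans (ev-⊗ k (s ⊗ s) a) (cong₂ _*_ (ev-const κ a) (ev-⊗ s s a)))
        (ev-divisible a (H ⊗ (r ⊗ r)) (begin
          k ⊗ (s ⊗ s)                ≈⟨ e ⟨
          f ⊗ (r ⊗ r)                ≈⟨ ⊗-cong f≈ (≈-refl {r ⊗ r}) ⟩
          L ⊗ H ⊗ (r ⊗ r)            ≈⟨ ⊗-assoc L H (r ⊗ r) ⟩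
          L ⊗ (H ⊗ (r ⊗ r))          ∎))
      s₁ : Poly
      s₁ = quo s a
      s≈ : s ≈ L ⊗ s₁
      s≈ = factor s a s[a]≡0
      e₁ : H ⊗ (r ⊗ r) ≈ L ⊗ (k ⊗ (s₁ ⊗ s₁))
      e₁ = ⊗-cancelˡ L (lin≉0 a) (begin
        L ⊗ (H ⊗ (r ⊗ r))            ≈⟨ ⊗-assoc L H (r ⊗ r) ⟨
        L ⊗ H ⊗ (r ⊗ r)              ≈⟨ ⊗-cong f≈ (≈-refl {r ⊗ r}) ⟨
        f ⊗ (r ⊗ r)                  ≈⟨ e ⟩
        k ⊗ (s ⊗ s)                  ≈⟨ ⊗-cong (≈-refl {k}) (⊗-cong s≈ s≈) ⟩
        k ⊗ ((L ⊗ s₁) ⊗ (L ⊗ s₁))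
          ≈⟨ PS.solve 3 (λ k L s → k PS.:* ((L PS.:* s) PS.:* (L PS.:* s)) PS.:= L PS.:* (L PS.:* (k PS.:* (s PS.:* s)))) ≈-refl k L s₁ ⟩
        L ⊗ (L ⊗ (k ⊗ (s₁ ⊗ s₁)))    ∎)
      r[a]≡0 : ev r a ≡ 0#
      r[a]≡0 = ev-square≡0 {H ⊗ (r ⊗ r)} r H≢0 (trans (ev-⊗ H (r ⊗ r) a) (cong (ev H a *_) (ev-⊗ r r a)))
        (ev-divisible a (k ⊗ (s₁ ⊗ s₁)) e₁)
      r₁ : Poly
      r₁ = quo r a
      r≈ : r ≈ L ⊗ r₁
      r≈ = factor r a r[a]≡0
      e₂ : f ⊗ (r₁ ⊗ r₁) ≈ k ⊗ (s₁ ⊗ s₁)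
      e₂ = ⊗-cancelˡ L (lin≉0 a) (begin
        L ⊗ (f ⊗ (r₁ ⊗ r₁))          ≈⟨ ⊗-cong (≈-refl {L}) (⊗-cong f≈ (≈-refl {r₁ ⊗ r₁})) ⟩
        L ⊗ ((L ⊗ H) ⊗ (r₁ ⊗ r₁))
          ≈⟨ PS.solve 3 (λ H L s → L PS.:* ((L PS.:* H) PS.:* (s PS.:* s)) PS.:= H PS.:* ((L PS.:* s) PS.:* (L PS.:* s))) ≈-refl H L r₁ ⟩
        H ⊗ ((L ⊗ r₁) ⊗ (L ⊗ r₁))    ≈⟨ ⊗-cong (≈-refl {H}) (⊗-cong r≈ r≈) ⟨
        H ⊗ (r ⊗ r)                  ≈⟨ e₁ ⟩
        L ⊗ (k ⊗ (s₁ ⊗ s₁))          ∎)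
      -- Both r and s have lost a factor X - a and satisfy the original equation again; the descent
      -- runs on the length of r.
      ih : r₁ ≈ [] × s₁ ≈ []
      ih = f⊗r²≈κs² f≈ H≢0 κ≢0 n r₁ s₁ (subst (_≤ n) (sym (length-quo r a)) (ℕ.pred-mono-≤ len)) e₂

    length-^ : ∀ p n {d} → length p ≤ suc d → length (p ^ᴾ n) ≤ suc (n ℕ.* d)
    length-^ p zero    len = s≤s z≤n
    length-^ p (suc n) len = length-⊗ p (p ^ᴾ n) len (length-^ p n len)

    length-⊕≤ : ∀ p r {b} → length p ≤ b → length r ≤ b → length (p ⊕ r) ≤ b
    length-⊕≤ p r p≤ r≤ = subst (_≤ _) (sym (length-⊕ p r)) (ℕ.⊔-lub p≤ r≤)

    length-const⊗ : ∀ c p {b} → length p ≤ suc b → length (const c ⊗ p) ≤ suc b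
    length-const⊗ c p len = length-⊗ (const c) p (s≤s z≤n) len

  module _ {q : ℕ} (𝔽 : PrimeField q) where
    open FieldProperties 𝔽
    open Polynomials 𝔽

    HasLinearFactor : Poly → K → Poly → Set
    HasLinearFactor f a H = f ≈ lin a ⊗ H

    NonzeroAt : Poly → K → Set
    NonzeroAt f a = ¬ ev f a ≡ 0#

    HasConstantTerm : Poly → Set
    HasConstantTerm f = ¬ coef f 0 ≡ 0#

  -- Here h' = (q - 3) / 2, and m' + 1 bounds the degree of `f`. The zero a₀ of `f` is simple, which
  -- makes 1 and f^h independent over polynomials of small degree. Fermat's little theorem is a
  -- parameter because its proof relies on the congruence for q-th powers above.
  module Stepanov {q : ℕ} (𝔽 : PrimeField q) (h' : ℕ) (q≡ : q ≡ suc (suc h' ℕ.+ suc h'))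
      (fermat : ∀ a → FieldProperties._^_ 𝔽 a q ≡ a)
      (f : Polynomials.Poly 𝔽) (m' : ℕ) (length-f : length f ≤ suc (suc m'))
      (a₀ : Fin q) (H : Polynomials.Poly 𝔽)
      (f≈ : HasLinearFactor 𝔽 f a₀ H)
      (H≢0 : NonzeroAt 𝔽 H a₀)
      (f₀≢0 : HasConstantTerm 𝔽 f)
    where
    open FieldProperties 𝔽
    open Polynomials 𝔽
    open Multiplicities 𝔽
    open Independence 𝔽

    h : ℕ
    h = suc h'

    g z : Poly
    g = f ^ᴾ h
    z = X ^ᴾ q

    z≉0 : ¬ z ≈ []
    z≉0 = ^ᴾ≉0 X q λ e → 1≢0 (at e 1)

    ev-z : ∀ a → ev z a ≡ a
    ev-z a = trans (ev-^ X q a) (trans (cong (_^ q) ev-X) (fermat a))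
      where
      ev-X : ev X a ≡ a
      ev-X = trans (+-identityˡ _) (trans (cong (a *_) (ev-const 1# a)) (*-identityʳ a))

    κ : K
    κ = coef (f ^ᴾ q) 0

    f^q≈ : f ^ᴾ q ≈ f ⊗ (g ⊗ g)
    f^q≈ = ≈-trans (≡⇒≈ (cong (f ^ᴾ_) q≡)) (⊗-cong (≈-refl {f}) (^ᴾ-+ f h h))

    low-f^q : LowZero q (f ^ᴾ q ⊕ ⊖ const κ)
    low-f^q n n<q = trans (coef-⊕ (f ^ᴾ q) _ n) (trans (cong (coef (f ^ᴾ q) n +_) (coef-⊖ (const κ) n)) (go n n<q))
      where
      go : ∀ n → n < q → coef (f ^ᴾ q) n + - coef (const κ) n ≡ 0#
      go zero    n<q = -‿inverseʳ κ
      go (suc n) n<q = trans (cong₂ _+_ (coef-^q f n n<q) -0#≈0#) (+-identityˡ _)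

    -- Multiplying r + s g by (r - s g) f gives f r² - f g² s², and f g² = f^q is congruent to κ
    -- modulo X^q. So f r² - κ s² vanishes modulo X^q; its degree is below q, hence it is zero, and
    -- the parity of the zero at a₀ forces r = s = 0.
    independent : ∀ α r s → length r ≤ suc α → length s ≤ suc α → suc (suc m' ℕ.+ (α ℕ.+ α)) ≤ q →
      LowZero q (r ⊕ s ⊗ g) → r ≈ [] × s ≈ []
    independent α r s len-r len-s α≤ low =
      f⊗r²≈κs² f≈ H≢0 (coef₀-^ f q f₀≢0) (suc α) r s len-r (⊖≈0⇒≈ D≈0)
      where
      D : Poly
      D = f ⊗ (r ⊗ r) ⊕ ⊖ (const κ ⊗ (s ⊗ s))
      D≈ : D ≈ (r ⊕ s ⊗ g) ⊗ ((r ⊕ ⊖ (s ⊗ g)) ⊗ f) ⊕ (f ^ᴾ q ⊕ ⊖ const κ) ⊗ (s ⊗ s)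
      D≈ = ≈-trans
        (PS.solve 5 (λ f r k s g → f PS.:* (r PS.:* r) PS.:+ PS.:- (k PS.:* (s PS.:* s)) PS.:=
           (r PS.:+ s PS.:* g) PS.:* ((r PS.:+ PS.:- (s PS.:* g)) PS.:* f) PS.:+ (f PS.:* (g PS.:* g) PS.:+ PS.:- k) PS.:* (s PS.:* s))
           ≈-refl f r (const κ) s g)
        (⊕-cong ≈-refl (⊗-cong (⊕-cong (≈-sym f^q≈) ≈-refl) ≈-refl))
      low-D : LowZero q D
      low-D = low-≈ (≈-sym D≈) (low-⊕ _ _ (low-⊗ _ _ low) (low-⊗ _ _ low-f^q))
      len-D : length D ≤ suc (suc m' ℕ.+ (α ℕ.+ α))
      len-D = length-⊕≤ _ _ (length-⊗ f (r ⊗ r) length-f (length-⊗ r r len-r len-r))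
        (subst (_≤ _) (sym (length-⊖ (const κ ⊗ (s ⊗ s))))
          (ℕ.≤-trans (length-const⊗ κ (s ⊗ s) (length-⊗ s s len-s len-s)) (s≤s (ℕ.m≤n+m _ (suc m')))))
      D≈0 : D ≈ []
      D≈0 = low⇒≈0 D (ℕ.≤-trans len-D α≤) low-D

    Family : ℕ → Set
    Family J' = Fin (suc J') → Poly × Poly

    _⟦_⟧ : Poly × Poly → Poly → Poly
    (r , s) ⟦ y ⟧ = r ⊕ s ⊗ y

    -- The sum of (r_j + s_j g) X^(q j), by Horner's scheme in z = X^q. Its degree is large, but on
    -- the field it agrees with a polynomial of small degree wherever g is constant.
    W : ∀ J' → Family J' → Poly
    W zero     w = w zero ⟦ g ⟧
    W (suc J') w = w zero ⟦ g ⟧ ⊕ z ⊗ W J' (w ∘ suc)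

    Bounded : ∀ {J'} → ℕ → Family J' → Set
    Bounded d w = ∀ j → length (proj₁ (w j)) ≤ suc d × length (proj₂ (w j)) ≤ suc d

    length-W : ∀ J' (w : Family J') {α} → Bounded α w → length (W J' w) ≤ suc (α ℕ.+ h ℕ.* suc m' ℕ.+ J' ℕ.* q)
    length-W J' w {α} bd = go J' w bd
      where
      head : ∀ (w : Poly × Poly) → length (proj₁ w) ≤ suc α × length (proj₂ w) ≤ suc α → length (w ⟦ g ⟧) ≤ suc (α ℕ.+ h ℕ.* suc m')
      head (r , s) (br , bs) = length-⊕≤ r (s ⊗ g) (ℕ.≤-trans br (s≤s (ℕ.m≤m+n α _)))
        (length-⊗ s g bs (length-^ f h length-f))
      go : ∀ J' (w : Family J') → Bounded α w → length (W J' w) ≤ suc (α ℕ.+ h ℕ.* suc m' ℕ.+ J' ℕ.* q)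
      go zero     w bd = ℕ.≤-trans (head (w zero) (bd zero)) (s≤s (ℕ.m≤m+n _ 0))
      go (suc J') w bd = length-⊕≤ (w zero ⟦ g ⟧) _ (ℕ.≤-trans (head (w zero) (bd zero)) (s≤s (ℕ.m≤m+n _ _)))
        (ℕ.≤-trans (length-⊗ z _ (subst (λ k → length z ≤ suc k) (ℕ.*-identityʳ q) (length-^ X q ℕ.≤-refl)) (go J' (w ∘ suc) (bd ∘ suc)))
                   (s≤s (ℕ.≤-reflexive (trans (ℕ.+-comm q _) (trans (ℕ.+-assoc (α ℕ.+ h ℕ.* suc m') _ q) (cong (α ℕ.+ h ℕ.* suc m' ℕ.+_) (ℕ.+-comm (J' ℕ.* q) q)))))))

    low-z⊗ : ∀ p → LowZero q (z ⊗ p)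
    low-z⊗ p = low-⊗ z p (low-X^ q)

    -- Modulo X^q only the lowest pair survives and is determined by `independent`; that pair is
    -- subtracted, z is cancelled, and the argument repeats.
    W-injective : ∀ J' (w w' : Family J') α → suc (suc m' ℕ.+ (α ℕ.+ α)) ≤ q → Bounded α w → Bounded α w' →
      W J' w ≈ W J' w' → ∀ j → proj₁ (w j) ≈ proj₁ (w' j) × proj₂ (w j) ≈ proj₂ (w' j)
    W-injective J' w w' α α≤ bd bd' = go J' w w' bd bd'
      where
      head : ∀ (w w' : Poly × Poly) →
        length (proj₁ w) ≤ suc α × length (proj₂ w) ≤ suc α → length (proj₁ w') ≤ suc α × length (proj₂ w') ≤ suc α →
        LowZero q (w ⟦ g ⟧ ⊕ ⊖ (w' ⟦ g ⟧)) → proj₁ w ≈ proj₁ w' × proj₂ w ≈ proj₂ w'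
      head (r , s) (r' , s') (br , bs) (br' , bs') low =
        let r≈ , s≈ = independent α (r ⊕ ⊖ r') (s ⊕ ⊖ s') (len r r' br br') (len s s' bs bs') α≤
              (low-≈ (PS.solve 5 (λ r s r' s' g → (r PS.:+ s PS.:* g) PS.:+ PS.:- (r' PS.:+ s' PS.:* g) PS.:=
                        (r PS.:+ PS.:- r') PS.:+ (s PS.:+ PS.:- s') PS.:* g) ≈-refl r s r' s' g) low)
        in ⊖≈0⇒≈ r≈ , ⊖≈0⇒≈ s≈
        where
        len : ∀ p p' → length p ≤ suc α → length p' ≤ suc α → length (p ⊕ ⊖ p') ≤ suc α
        len p p' b b' = length-⊕≤ p (⊖ p') b (subst (_≤ suc α) (sym (length-⊖ p')) b')
      go : ∀ J' (w w' : Family J') → Bounded α w → Bounded α w' →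
        W J' w ≈ W J' w' → ∀ j → proj₁ (w j) ≈ proj₁ (w' j) × proj₂ (w j) ≈ proj₂ (w' j)
      go zero w w' bd bd' e zero = head (w zero) (w' zero) (bd zero) (bd' zero) λ n _ → at (≈⇒⊖≈0 e) n
      go (suc J') w w' bd bd' e = λ { zero → hd ; (suc j) → go J' (w ∘ suc) (w' ∘ suc) (bd ∘ suc) (bd' ∘ suc) tl j }
        where
        V = W J' (w ∘ suc) ; V' = W J' (w' ∘ suc)
        w₀ = w zero ⟦ g ⟧ ; w₀' = w' zero ⟦ g ⟧
        hd : proj₁ (w zero) ≈ proj₁ (w' zero) × proj₂ (w zero) ≈ proj₂ (w' zero)
        hd = head (w zero) (w' zero) (bd zero) (bd' zero) (low-≈ (begin
            z ⊗ (V' ⊕ ⊖ V)                                          ≈⟨ ⊕-identityˡ _ ⟨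
            [] ⊕ z ⊗ (V' ⊕ ⊖ V)                                     ≈⟨ ⊕-cong (≈⇒⊖≈0 e) ≈-refl ⟨
            ((w₀ ⊕ z ⊗ V) ⊕ ⊖ (w₀' ⊕ z ⊗ V')) ⊕ z ⊗ (V' ⊕ ⊖ V)
              ≈⟨ PS.solve 5 (λ w w' z V V' → ((w PS.:+ z PS.:* V) PS.:+ PS.:- (w' PS.:+ z PS.:* V')) PS.:+ z PS.:* (V' PS.:+ PS.:- V) PS.:=
                   w PS.:+ PS.:- w') ≈-refl w₀ w₀' z V V' ⟩
            w₀ ⊕ ⊖ w₀'                                              ∎) (low-z⊗ (V' ⊕ ⊖ V)))
          where open ≈R
        tl : V ≈ V'
        tl = ⊗-cancelˡ z z≉0 (begin
            z ⊗ V                      ≈⟨ PS.solve 2 (λ w v → v PS.:= (w PS.:+ v) PS.:+ PS.:- w) ≈-refl w₀ (z ⊗ V) ⟩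
            (w₀ ⊕ z ⊗ V) ⊕ ⊖ w₀        ≈⟨ ⊕-cong e (⊖-cong (⊕-cong (proj₁ hd) (⊗-cong (proj₂ hd) ≈-refl))) ⟩
            (w₀' ⊕ z ⊗ V') ⊕ ⊖ w₀'     ≈⟨ PS.solve 2 (λ w v → v PS.:= (w PS.:+ v) PS.:+ PS.:- w) ≈-refl w₀' (z ⊗ V') ⟨
            z ⊗ V'                     ∎)
          where open ≈R

    f⊗der-g : f ⊗ der g ≈ const (ι h) ⊗ (der f ⊗ g)
    f⊗der-g = ≈-trans (⊗-cong (≈-refl {f}) (der-^ f h'))
      (PS.solve 4 (λ f i g d → f PS.:* (i PS.:* (g PS.:* d)) PS.:= i PS.:* (d PS.:* (f PS.:* g))) ≈-refl f (const (ι h)) (f ^ᴾ h') (der f))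

    -- Since f g' = h f' g, the operator `derive` preserves the polynomials r + s g; this is its
    -- action on the pair (r , s).
    step : ℕ → Poly × Poly → Poly × Poly
    step l (r , s) = derive f l r , derive f l s ⊕ const (ι h) ⊗ (der f ⊗ s)

    derive-head : ∀ l w → derive f l (w ⟦ g ⟧) ≈ step l w ⟦ g ⟧
    derive-head l (r , s) = begin
      f ⊗ der (r ⊕ s ⊗ g) ⊕ ⊖ (il ⊗ (der f ⊗ (r ⊕ s ⊗ g)))
        ≈⟨ ⊕-cong (⊗-cong (≈-refl {f}) (≈-trans (der-⊕ r (s ⊗ g)) (⊕-cong ≈-refl (leibniz s g)))) ≈-refl ⟩
      f ⊗ (der r ⊕ (der s ⊗ g ⊕ s ⊗ der g)) ⊕ ⊖ (il ⊗ (der f ⊗ (r ⊕ s ⊗ g)))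
        ≈⟨ PS.solve 9 (λ f dr ds g s dg il df r →
             f PS.:* (dr PS.:+ (ds PS.:* g PS.:+ s PS.:* dg)) PS.:+ PS.:- (il PS.:* (df PS.:* (r PS.:+ s PS.:* g))) PS.:=
             ((f PS.:* dr PS.:+ PS.:- (il PS.:* (df PS.:* r))) PS.:+ (f PS.:* ds PS.:+ PS.:- (il PS.:* (df PS.:* s))) PS.:* g) PS.:+ s PS.:* (f PS.:* dg))
           ≈-refl f (der r) (der s) g s (der g) il (der f) r ⟩
      (derive f l r ⊕ derive f l s ⊗ g) ⊕ s ⊗ (f ⊗ der g)
        ≈⟨ ⊕-cong ≈-refl (⊗-cong (≈-refl {s}) f⊗der-g) ⟩
      (derive f l r ⊕ derive f l s ⊗ g) ⊕ s ⊗ (const (ι h) ⊗ (der f ⊗ g))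
        ≈⟨ PS.solve 6 (λ a b g s i d → (a PS.:+ b PS.:* g) PS.:+ s PS.:* (i PS.:* (d PS.:* g)) PS.:= a PS.:+ (b PS.:+ i PS.:* (d PS.:* s)) PS.:* g)
           ≈-refl (derive f l r) (derive f l s) g s (const (ι h)) (der f) ⟩
      derive f l r ⊕ (derive f l s ⊕ const (ι h) ⊗ (der f ⊗ s)) ⊗ g ∎
      where open ≈R
            il = const (ι l)

    -- The derivative of X^q is zero, so z behaves as a constant and `derive` acts on each pair
    -- separately.
    derive-W : ∀ J' (w : Family J') l → derive f l (W J' w) ≈ W J' (step l ∘ w)
    derive-W zero     w l = derive-head l (w zero)
    derive-W (suc J') w l = begin
      f ⊗ der (w₀ ⊕ z ⊗ V) ⊕ ⊖ (il ⊗ (der f ⊗ (w₀ ⊕ z ⊗ V)))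
        ≈⟨ ⊕-cong (⊗-cong (≈-refl {f}) (≈-trans (der-⊕ w₀ (z ⊗ V)) (⊕-cong ≈-refl
             (≈-trans (leibniz z V) (≈-trans (⊕-cong (≈-trans (⊗-cong (der-^q X) ≈-refl) (≡⇒≈ ([]⊗ V))) ≈-refl) (⊕-identityˡ _)))))) ≈-refl ⟩
      f ⊗ (der w₀ ⊕ z ⊗ der V) ⊕ ⊖ (il ⊗ (der f ⊗ (w₀ ⊕ z ⊗ V)))
        ≈⟨ ⊕-cong (PS.solve 4 (λ f dw z dV → f PS.:* (dw PS.:+ z PS.:* dV) PS.:= f PS.:* dw PS.:+ z PS.:* (f PS.:* dV)) ≈-refl f (der w₀) z (der V)) ≈-refl ⟩
      (f ⊗ der w₀ ⊕ z ⊗ (f ⊗ der V)) ⊕ ⊖ (il ⊗ (der f ⊗ (w₀ ⊕ z ⊗ V)))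
        ≈⟨ PS.solve 7 (λ A z B il df w V → (A PS.:+ z PS.:* B) PS.:+ PS.:- (il PS.:* (df PS.:* (w PS.:+ z PS.:* V))) PS.:=
             (A PS.:+ PS.:- (il PS.:* (df PS.:* w))) PS.:+ z PS.:* (B PS.:+ PS.:- (il PS.:* (df PS.:* V)))) ≈-refl (f ⊗ der w₀) z (f ⊗ der V) il (der f) w₀ V ⟩
      derive f l w₀ ⊕ z ⊗ derive f l V
        ≈⟨ ⊕-cong (derive-head l (w zero)) (⊗-cong (≈-refl {z}) (derive-W J' (w ∘ suc) l)) ⟩
      step l (w zero) ⟦ g ⟧ ⊕ z ⊗ W J' (step l ∘ w ∘ suc) ∎
      where open ≈R
            il = const (ι l)
            w₀ = w zero ⟦ g ⟧
            V = W J' (w ∘ suc)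

    steps : ℕ → ℕ → Poly × Poly → Poly × Poly
    steps l zero    w = w
    steps l (suc k) w = steps (suc l) k (step l w)

    derives-W : ∀ J' (w : Family J') l k → derives f l k (W J' w) ≈ W J' (steps l k ∘ w)
    derives-W J' w l zero    = ≈-refl
    derives-W J' w l (suc k) = ≈-trans (derives-cong f (suc l) k (derive-W J' w l)) (derives-W J' (step l ∘ w) (suc l) k)

    -- What `W` becomes at a point a with f(a)^h = χ: there g has the value χ and X^q the value a,
    -- so the degree collapses to that of the pairs plus J'.
    T : K → ∀ J' → Family J' → Poly
    T χ zero     w = w zero ⟦ const χ ⟧
    T χ (suc J') w = w zero ⟦ const χ ⟧ ⊕ X ⊗ T χ J' (w ∘ suc)

    ev-W : ∀ {a χ} → ev g a ≡ χ → ∀ J' (w : Family J') → ev (W J' w) a ≡ ev (T χ J' w) a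
    ev-W {a} {χ} e J' w = go J' w
      where
      head : ∀ w → ev (w ⟦ g ⟧) a ≡ ev (w ⟦ const χ ⟧) a
      head (r , s) = trans (ev-⊕ r _ a) (trans (cong (ev r a +_) (trans (ev-⊗ s g a)
        (trans (cong (ev s a *_) (trans e (sym (ev-const χ a)))) (sym (ev-⊗ s (const χ) a))))) (sym (ev-⊕ r _ a)))
      ev-X : ev z a ≡ ev X a
      ev-X = trans (ev-z a) (sym (trans (+-identityˡ _) (trans (cong (a *_) (ev-const 1# a)) (*-identityʳ a))))
      go : ∀ J' (w : Family J') → ev (W J' w) a ≡ ev (T χ J' w) a
      go zero     w = head (w zero)
      go (suc J') w = trans (ev-⊕ (w zero ⟦ g ⟧) _ a) (trans (cong₂ _+_ (head (w zero))
        (trans (ev-⊗ z _ a) (trans (cong₂ _*_ ev-X (go J' (w ∘ suc))) (sym (ev-⊗ X _ a))))) (sym (ev-⊕ (w zero ⟦ const χ ⟧) _ a)))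

    -- The degree bound is written d + 1 so that a derivative may lose one degree; as `f` has degree
    -- at most m' + 1, each step then costs m'.
    step-bound : ∀ l w d → length (proj₁ w) ≤ suc (suc d) × length (proj₂ w) ≤ suc (suc d) →
      length (proj₁ (step l w)) ≤ suc (suc d ℕ.+ m') × length (proj₂ (step l w)) ≤ suc (suc d ℕ.+ m')
    step-bound l (r , s) d (br , bs) = derive-bound r br ,
      length-⊕≤ (derive f l s) _ (derive-bound s bs) (length-const⊗ (ι h) (der f ⊗ s) (derf⊗ s bs))
      where
      len-der : ∀ p {n} → length p ≤ suc n → length (der p) ≤ n
      len-der p len = subst (_≤ _) (sym (length-der p)) (ℕ.pred-mono-≤ len)
      derf⊗ : ∀ p → length p ≤ suc (suc d) → length (der f ⊗ p) ≤ suc (suc d ℕ.+ m')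
      derf⊗ p b = subst (λ n → length (der f ⊗ p) ≤ suc n) (ℕ.+-comm m' (suc d)) (length-⊗ (der f) p (len-der f length-f) b)
      derive-bound : ∀ p → length p ≤ suc (suc d) → length (derive f l p) ≤ suc (suc d ℕ.+ m')
      derive-bound p b = length-⊕≤ (f ⊗ der p) _
        (subst (λ n → length (f ⊗ der p) ≤ suc (suc n)) (ℕ.+-comm m' d) (length-⊗ f (der p) length-f (len-der p b)))
        (subst (_≤ _) (sym (length-⊖ (const (ι l) ⊗ (der f ⊗ p)))) (length-const⊗ (ι l) (der f ⊗ p) (derf⊗ p b)))

    steps-bound : ∀ k l w d → length (proj₁ w) ≤ suc (suc d) × length (proj₂ w) ≤ suc (suc d) →
      length (proj₁ (steps l k w)) ≤ suc (suc d ℕ.+ k ℕ.* m') × length (proj₂ (steps l k w)) ≤ suc (suc d ℕ.+ k ℕ.* m')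
    steps-bound zero    l w d bd = subst (λ n → length (proj₁ w) ≤ suc n × length (proj₂ w) ≤ suc n) (sym (ℕ.+-identityʳ (suc d))) bd
    steps-bound (suc k) l w d bd = subst (λ n → length (proj₁ (steps l (suc k) w)) ≤ suc n × length (proj₂ (steps l (suc k) w)) ≤ suc n)
      (ℕ.+-assoc (suc d) m' (k ℕ.* m')) (steps-bound k (suc l) (step l w) (d ℕ.+ m') (step-bound l w d bd))

    length-T : ∀ χ J' (w : Family J') d → Bounded d w → length (T χ J' w) ≤ suc d ℕ.+ J'
    length-T χ J' w d bd = go J' w bd
      where
      head : ∀ w → length (proj₁ w) ≤ suc d × length (proj₂ w) ≤ suc d → length (w ⟦ const χ ⟧) ≤ suc d
      head (r , s) (br , bs) = length-⊕≤ r (s ⊗ const χ) br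
        (subst (λ n → length (s ⊗ const χ) ≤ suc n) (ℕ.+-identityʳ d) (length-⊗ s (const χ) bs (s≤s z≤n)))
      go : ∀ J' (w : Family J') → Bounded d w → length (T χ J' w) ≤ suc d ℕ.+ J'
      go zero     w bd = ℕ.≤-trans (head (w zero) (bd zero)) (ℕ.m≤m+n _ _)
      go (suc J') w bd = length-⊕≤ (w zero ⟦ const χ ⟧) _ (ℕ.≤-trans (head (w zero) (bd zero)) (ℕ.m≤m+n _ _))
        (subst (λ n → length (X ⊗ T χ J' (w ∘ suc)) ≤ suc n) (sym (ℕ.+-suc d J')) (length-⊗ X _ {1} {d ℕ.+ J'} ℕ.≤-refl (go J' (w ∘ suc) (bd ∘ suc))))

    der-⊖ : ∀ p → der (⊖ p) ≈ ⊖ der p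
    der-⊖ p = mk≈ λ n → trans (coef-der (⊖ p) n) (trans (cong (ι (suc n) *_) (coef-⊖ p (suc n)))
      (trans (sym (-‿distribʳ-* _ _)) (trans (cong (λ c → - c) (sym (coef-der p n))) (sym (coef-⊖ (der p) n)))))

    derive-⊖ : ∀ l P P' → derive f l (P ⊕ ⊖ P') ≈ derive f l P ⊕ ⊖ derive f l P'
    derive-⊖ l P P' = ≈-trans
      (⊕-cong (⊗-cong (≈-refl {f}) (≈-trans (der-⊕ P (⊖ P')) (⊕-cong (≈-refl {der P}) (der-⊖ P')))) ≈-refl)
      (PS.solve 7 (λ f dP dP' il df P P' →
          f PS.:* (dP PS.:+ PS.:- dP') PS.:+ PS.:- (il PS.:* (df PS.:* (P PS.:+ PS.:- P'))) PS.:=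
          (f PS.:* dP PS.:+ PS.:- (il PS.:* (df PS.:* P))) PS.:+ PS.:- (f PS.:* dP' PS.:+ PS.:- (il PS.:* (df PS.:* P'))))
        ≈-refl f (der P) (der P') (const (ι l)) (der f) P P')

    derives-⊖ : ∀ k l P P' → derives f l k (P ⊕ ⊖ P') ≈ derives f l k P ⊕ ⊖ derives f l k P'
    derives-⊖ zero    l P P' = ≈-refl
    derives-⊖ (suc k) l P P' = ≈-trans (derives-cong f (suc l) k (derive-⊖ l P P')) (derives-⊖ k (suc l) (derive f l P) (derive f l P'))

    coef-tabulate : ∀ {n} (v : Fin n → K) i → coef (tabulate v) (toℕ i) ≡ v i
    coef-tabulate v zero    = refl
    coef-tabulate v (suc i) = coef-tabulate (v ∘ suc) i

    funToFin-cong : ∀ {m n} {u v : Fin m → Fin n} → (∀ i → u i ≡ v i) → funToFin u ≡ funToFin v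
    funToFin-cong {zero}  e = refl
    funToFin-cong {suc m} e = cong₂ combine (e zero) (funToFin-cong (e ∘ suc))

    -- The number of coefficients of the `T` attached to the iterates k < M. Their vanishing makes
    -- all these iterates vanish at every relevant point at once, however many points there are.
    conditions : ℕ → ℕ → ℕ → ℕ
    conditions d J' zero    = 0
    conditions d J' (suc M) = conditions d J' M ℕ.+ (suc (suc d ℕ.+ M ℕ.* m') ℕ.+ J')

    -- No linear system is solved: two coefficient vectors with the same `code` exist by counting,
    -- and the difference of their `W` is the auxiliary polynomial.
    module Counting (d J' : ℕ) (χ : K) where

      U : ℕ
      U = suc J' ℕ.* (2 ℕ.* suc (suc d))

      slice : (Fin U → K) → Fin (suc J') → Fin 2 → Fin (suc (suc d)) → K
      slice v j b i = v (combine j (combine b i))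

      family : (Fin U → K) → Family J'
      family v j = tabulate (slice v j zero) , tabulate (slice v j (suc zero))

      family-bounded : ∀ v → Bounded (suc d) (family v)
      family-bounded v j = ℕ.≤-reflexive (length-tabulate (slice v j zero)) , ℕ.≤-reflexive (length-tabulate (slice v j (suc zero)))

      Tᵥ : ℕ → (Fin U → K) → Poly
      Tᵥ k v = T χ J' (steps 0 k ∘ family v)

      length-Tᵥ : ∀ k v → length (Tᵥ k v) ≤ suc (suc d ℕ.+ k ℕ.* m') ℕ.+ J'
      length-Tᵥ k v = length-T χ J' (steps 0 k ∘ family v) (suc d ℕ.+ k ℕ.* m') λ j →
        steps-bound k 0 (family v j) d (family-bounded v j)

      code : ∀ M → (Fin U → K) → Fin (conditions d J' M) → K
      code (suc M) v i = [ code M v , (λ n → coef (Tᵥ M v) (toℕ n)) ]′ (splitAt (conditions d J' M) i)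

      code⇒≈ : ∀ M v v' → (∀ i → code M v i ≡ code M v' i) → ∀ k → k < M → Tᵥ k v ≈ Tᵥ k v'
      code⇒≈ (suc M) v v' e k (s≤s k≤M) = [ earlier , (λ { refl → last }) ]′ (ℕ.m≤n⇒m<n∨m≡n k≤M)
        where
        N = conditions d J' M
        B = suc (suc d ℕ.+ M ℕ.* m') ℕ.+ J'
        earlier : k < M → Tᵥ k v ≈ Tᵥ k v'
        earlier = code⇒≈ M v v' (λ i → trans (sym (left v i)) (trans (e (i ↑ˡ B)) (left v' i))) k
          where
          left : ∀ v i → code (suc M) v (i ↑ˡ B) ≡ code M v i
          left v i = cong [ code M v , (λ n → coef (Tᵥ M v) (toℕ n)) ]′ (F.splitAt-↑ˡ N i B)
        last : Tᵥ M v ≈ Tᵥ M v'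
        last = mk≈ λ n → go n (n ℕ.<? B)
          where
          right : ∀ v (i : Fin B) → code (suc M) v (N ↑ʳ i) ≡ coef (Tᵥ M v) (toℕ i)
          right v i = cong [ code M v , (λ n → coef (Tᵥ M v) (toℕ n)) ]′ (F.splitAt-↑ʳ N B i)
          go : ∀ n → Dec (n < B) → coef (Tᵥ M v) n ≡ coef (Tᵥ M v') n
          go n (yes n<B) = subst (λ n → coef (Tᵥ M v) n ≡ coef (Tᵥ M v') n) (F.toℕ-fromℕ< n<B)
            (trans (sym (right v (F.fromℕ< n<B))) (trans (e (N ↑ʳ F.fromℕ< n<B)) (right v' (F.fromℕ< n<B))))
          go n (no n≮B) = trans (coef-length (Tᵥ M v) n (ℕ.≤-trans (length-Tᵥ M v) (ℕ.≮⇒≥ n≮B)))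
            (sym (coef-length (Tᵥ M v') n (ℕ.≤-trans (length-Tᵥ M v') (ℕ.≮⇒≥ n≮B))))

      -- The auxiliary polynomial is nonzero by `W-injective`, has a root of multiplicity `M` at
      -- each point of `Z`, and has degree at most (d + 1) + h (m' + 1) + J' q.
      point-bound : ∀ M → M ≤ q → suc (suc m' ℕ.+ (suc d ℕ.+ suc d)) ≤ q → conditions d J' M < U →
        ∀ Z → Unique Z → (∀ {a} → a ∈ Z → ¬ ev f a ≡ 0# × ev f a ^ h ≡ χ) →
        length Z ℕ.* M ≤ suc d ℕ.+ h ℕ.* suc m' ℕ.+ J' ℕ.* q
      point-bound M M≤q d≤ few Z uniq Zχ
        -- There are q^U vectors but only q^(conditions d J' M) codes.
        with F.pigeonhole (ℕ.^-monoʳ-< q 1<q few) (λ i → funToFin (code M (finToFun {q} {U} i)))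
      ... | i , j , i<j , same = ℕ.≤-pred (ℕ.≤-trans (root-bound Z M Q uniq Q≉0 divides) length-Q)
        where
        v v' : Fin U → K
        v  = finToFun i
        v' = finToFun j
        P P' Q : Poly
        P  = W J' (family v)
        P' = W J' (family v')
        Q  = P ⊕ ⊖ P'
        code≡ : ∀ n → code M v n ≡ code M v' n
        code≡ n = trans (sym (F.finToFun-funToFin (code M v) n)) (trans (cong (λ x → finToFun x n) same) (F.finToFun-funToFin (code M v') n))
        Q≉0 : ¬ Q ≈ []
        Q≉0 e = F.<⇒≢ i<j (trans (sym (F.funToFin-finToFin {U} {q} i)) (trans (funToFin-cong v≗v') (F.funToFin-finToFin {U} {q} j)))
          where
          w≈ : ∀ j → proj₁ (family v j) ≈ proj₁ (family v' j) × proj₂ (family v j) ≈ proj₂ (family v' j)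
          w≈ = W-injective J' (family v) (family v') (suc d) d≤ (family-bounded v) (family-bounded v') (⊖≈0⇒≈ e)
          at-combine : ∀ (j : Fin (suc J')) (b : Fin 2) (i : Fin (suc (suc d))) → v (combine j (combine b i)) ≡ v' (combine j (combine b i))
          at-combine j zero i = trans (sym (coef-tabulate (slice v j zero) i)) (trans (at (proj₁ (w≈ j)) (toℕ i)) (coef-tabulate (slice v' j zero) i))
          at-combine j (suc zero) i = trans (sym (coef-tabulate (slice v j (suc zero)) i)) (trans (at (proj₂ (w≈ j)) (toℕ i)) (coef-tabulate (slice v' j (suc zero)) i))
          v≗v' : ∀ x → v x ≡ v' x
          v≗v' x with F.combine-surjective {suc J'} {2 ℕ.* suc (suc d)} x
          ... | a , y , refl with F.combine-surjective {2} {suc (suc d)} y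
          ...   | b , c , refl = at-combine a b c
        -- At a point of `Z` the k-th iterates of the two `W` take the values of `Tᵥ k v` and
        -- `Tᵥ k v'`, which agree by the choice of v and v'.
        vanish : ∀ {a} → a ∈ Z → ∀ k → k < M → ev (derives f 0 k Q) a ≡ 0#
        vanish {a} a∈Z k k<M = trans (ev-cong a (derives-⊖ k 0 P P')) (trans (ev-⊕ (derives f 0 k P) (⊖ derives f 0 k P') a)
          (trans (cong₂ _+_ (value v) (trans (ev-⊖ (derives f 0 k P') a) (cong (λ c → - c) (trans (value v') (sym (ev-cong a (code⇒≈ M v v' code≡ k k<M)))))))
          (-‿inverseʳ _)))
          where
          value : ∀ v → ev (derives f 0 k (W J' (family v))) a ≡ ev (Tᵥ k v) a
          value v = trans (ev-cong a (derives-W J' (family v) 0 k))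
            (ev-W (trans (ev-^ f h a) (proj₂ (Zχ a∈Z))) J' (steps 0 k ∘ family v))
        divides : ∀ {a} → a ∈ Z → ∃[ V ] Q ≈ lin a ^ᴾ M ⊗ V
        divides {a} a∈Z = vanishing⇒divides f a Q M M≤q (proj₁ (Zχ a∈Z)) (vanish a∈Z)
        length-Q : length Q ≤ suc (suc d ℕ.+ h ℕ.* suc m' ℕ.+ J' ℕ.* q)
        length-Q = length-⊕≤ P (⊖ P') (length-W J' (family v) {suc d} (family-bounded v))
          (subst (_≤ _) (sym (length-⊖ P')) (length-W J' (family v') {suc d} (family-bounded v')))

-- Fermat's little theorem and the quadratic character

module QuadraticResidues where
  open PrimeFields
  open PolynomialRings
  open RootMultiplicities
  open StepanovMethod
  open import Data.Nat as ℕ using (ℕ; zero; suc; z≤n; s≤s; _≤_; _<_)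
  import Data.Nat.Properties as ℕ
  open import Data.Fin as F using (zero; suc; toℕ)
  import Data.Fin.Properties as F
  open import Data.List using ([]; _∷_; length; allFin)
  import Data.List.Properties as L
  open import Data.List.Relation.Unary.Unique.Propositional using (Unique)
  import Data.List.Relation.Unary.Unique.Propositional.Properties as Unique
  open import Data.List.Membership.Propositional using (_∈_)
  import Data.List.Membership.Propositional.Properties as ∈
  open import Data.Sign as Sign using (Sign)
  open import Data.Product using (_,_; ∃-syntax)
  open import Data.Sum using ([_,_]′)
  open import Data.Empty using (⊥-elim)
  open import Relation.Nullary using (¬_; Dec; yes; no)
  open import Relation.Binary using (tri<; tri≈; tri>)
  open import Relation.Binary.PropositionalEquality

  module Fermat {q : ℕ} (𝔽 : PrimeField q) where
    open FieldProperties 𝔽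
    open Polynomials 𝔽
    open Independence 𝔽

    ^-+ : ∀ a m n → a ^ (m ℕ.+ n) ≡ a ^ m * a ^ n
    ^-+ a zero    n = sym (*-identityˡ _)
    ^-+ a (suc m) n = trans (cong (a *_) (^-+ a m n)) (sym (*-assoc a _ _))

    ^-* : ∀ a m n → a ^ (m ℕ.* n) ≡ (a ^ n) ^ m
    ^-* a zero    n = refl
    ^-* a (suc m) n = trans (^-+ a n (m ℕ.* n)) (cong (a ^ n *_) (^-* a m n))

    *-^ : ∀ a b n → (a * b) ^ n ≡ a ^ n * b ^ n
    *-^ a b zero    = sym (*-identityˡ _)
    *-^ a b (suc n) = trans (cong (a * b *_) (*-^ a b n))
      (solve 4 (λ a b x y → a :* b :* (x :* y) := a :* x :* (b :* y)) refl a b (a ^ n) (b ^ n))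

    1^ : ∀ n → 1# ^ n ≡ 1#
    1^ zero    = refl
    1^ (suc n) = trans (*-identityˡ _) (1^ n)

    ^-nonzero : ∀ {a} n → ¬ a ≡ 0# → ¬ a ^ n ≡ 0#
    ^-nonzero zero    a≢0 = 1≢0
    ^-nonzero (suc n) a≢0 = *-nonzero a≢0 (^-nonzero n a≢0)

    length-linear^ : ∀ c n → length ((c ∷ 1# ∷ []) ^ᴾ n) ≤ suc n
    length-linear^ c n = subst (λ k → length ((c ∷ 1# ∷ []) ^ᴾ n) ≤ suc k) (ℕ.*-identityʳ n)
      (length-^ (c ∷ 1# ∷ []) n ℕ.≤-refl)

    leading : ∀ c n → coef ((c ∷ 1# ∷ []) ^ᴾ n) n ≡ 1#
    leading c zero    = refl
    leading c (suc n) = trans (cong (λ p → coef p (suc n)) (∷⊗ c (1# ∷ []) R))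
      (trans (coef-⊕ (scale c R) (0# ∷ const 1# ⊗ R) (suc n))
      (trans (cong₂ _+_ (trans (coef-scale c R (suc n)) (trans (cong (c *_) (coef-length R (suc n) (length-linear^ c n))) (zeroʳ c)))
                        (trans (at (⊗-identityˡ R) n) (leading c n)))
             (+-identityˡ _)))
      where R = (c ∷ 1# ∷ []) ^ᴾ n

    0<q : 0 < q
    0<q = ℕ.<-trans (s≤s z≤n) 1<q

    -- Both (1 + X)^q and 1 + X^q have constant and leading coefficient 1; the coefficients in
    -- between vanish by `coef-^q`, those beyond by degree.
    freshman : ∀ a → (1# + a) ^ q ≡ 1# + a ^ q
    freshman a = trans (cong (_^ q) (sym (ev-1+ 1#))) (trans (sym (ev-^ P q a)) (trans (ev-cong a P^q≈)
      (trans (ev-⊕ (const 1#) (X ^ᴾ q) a) (cong₂ _+_ (ev-const 1# a) (trans (ev-^ X q a) (cong (_^ q) (trans (ev-1+ 0#) (+-identityˡ a))))))))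
      where
      P : Poly
      P = 1# ∷ 1# ∷ []
      ev-1+ : ∀ c → ev (c ∷ 1# ∷ []) a ≡ c + a
      ev-1+ c = cong (c +_) (trans (cong (a *_) (ev-const 1# a)) (*-identityʳ a))
      coef₀ : ∀ n → coef (P ^ᴾ n) 0 ≡ 1#
      coef₀ zero    = refl
      coef₀ (suc n) = trans (coef-⊗ P (P ^ᴾ n) 0) (trans (*-identityˡ _) (coef₀ n))
      go : ∀ n → coef (P ^ᴾ q) n ≡ coef (const 1#) n + coef (X ^ᴾ q) n
      go zero = trans (coef₀ q) (sym (trans (cong (1# +_) (low-X^ q 0 0<q)) (+-identityʳ 1#)))
      go (suc n) with ℕ.<-cmp (suc n) q
      ... | tri< n<q _ _ = trans (coef-^q P n n<q) (sym (trans (+-identityˡ _) (low-X^ q (suc n) n<q)))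
      ... | tri≈ _ n≡q _ = trans (subst (λ k → coef (P ^ᴾ q) k ≡ 1#) (sym n≡q) (leading 1# q))
                                 (sym (trans (+-identityˡ _) (subst (λ k → coef (X ^ᴾ q) k ≡ 1#) (sym n≡q) (leading 0# q))))
      ... | tri> _ _ n>q = trans (coef-length (P ^ᴾ q) (suc n) (ℕ.≤-trans (length-linear^ 1# q) n>q))
                                 (sym (trans (+-identityˡ _) (coef-length (X ^ᴾ q) (suc n) (ℕ.≤-trans (length-linear^ 0# q) n>q))))
      P^q≈ : P ^ᴾ q ≈ const 1# ⊕ X ^ᴾ q
      P^q≈ = mk≈ λ n → trans (go n) (sym (coef-⊕ (const 1#) (X ^ᴾ q) n))

    0^q : 0# ^ q ≡ 0#
    0^q = subst (λ n → 0# ^ n ≡ 0#) (ℕ.suc-pred q {{ℕ.>-nonZero 0<q}}) (zeroˡ _)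

    -- Every element is a sum of ones, so `freshman` gives the identity by induction on the number
    -- of ones.
    fermat : ∀ a → a ^ q ≡ a
    fermat a = subst (λ x → x ^ q ≡ x) (ι-toℕ a) (go (toℕ a))
      where
      go : ∀ n → ι n ^ q ≡ ι n
      go zero    = trans (cong (_^ q) ι-0) (trans 0^q (sym ι-0))
      go (suc n) = trans (cong (_^ q) (ι-suc n)) (trans (freshman (ι n)) (trans (cong (1# +_) (go n)) (sym (ι-suc n))))

  module QuadraticCharacter {q : ℕ} (𝔽 : PrimeField q) (h : ℕ) (0<h : 0 < h) (q≡ : q ≡ suc (h ℕ.+ h)) where
    open FieldProperties 𝔽
    open Fermat 𝔽

    value : Sign → K
    value Sign.+ = 1#
    value Sign.- = - 1#

    -- Euler's criterion, taken as the definition of the quadratic character. As a relation it holds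
    -- for no sign at 0, and it can be transported along field identities without evaluating a
    -- power.
    record HasSign (a : K) (s : Sign) : Set where
      constructor hasSign
      field power : a ^ h ≡ value s
    open HasSign public

    value-* : ∀ s t → value s * value t ≡ value (s Sign.* t)
    value-* Sign.+ t      = *-identityˡ _
    value-* Sign.- Sign.+ = *-identityʳ _
    value-* Sign.- Sign.- = trans (sym (-‿distribˡ-* 1# (- 1#))) (trans (cong (λ c → - c) (*-identityˡ _)) (-‿involutive 1#))

    sign-* : ∀ {a b s t} → HasSign a s → HasSign b t → HasSign (a * b) (s Sign.* t)
    sign-* {a} {b} {s} {t} (hasSign p) (hasSign r) = hasSign (trans (*-^ a b h) (trans (cong₂ _*_ p r) (value-* s t)))

    q≢2 : 2 < q
    q≢2 = subst (2 <_) (sym q≡) (s≤s (ℕ.+-mono-≤ 0<h 0<h))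

    -1≢1 : ¬ 1# ≡ - 1#
    -1≢1 e = ι-suc≢0 1 q≢2 (trans (ι-suc 1) (trans (cong₂ _+_ e ι-1) (-‿inverseˡ 1#)))

    value-injective : ∀ {s t} → value s ≡ value t → s ≡ t
    value-injective {Sign.+} {Sign.+} e = refl
    value-injective {Sign.+} {Sign.-} e = ⊥-elim (-1≢1 e)
    value-injective {Sign.-} {Sign.+} e = ⊥-elim (-1≢1 (sym e))
    value-injective {Sign.-} {Sign.-} e = refl

    sign-unique : ∀ {a s t} → HasSign a s → HasSign a t → s ≡ t
    sign-unique (hasSign p) (hasSign r) = value-injective (trans (sym p) r)

    value≢0 : ∀ s → ¬ value s ≡ 0#
    value≢0 Sign.+ = 1≢0
    value≢0 Sign.- e = 1≢0 (trans (sym (-‿involutive 1#)) (trans (cong (λ c → - c) e) -0#≈0#))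

    sign⇒≢0 : ∀ {a s} → HasSign a s → ¬ a ≡ 0#
    sign⇒≢0 {a} {s} (hasSign p) a≡0 = value≢0 s (trans (sym p) (trans (cong (_^ h) a≡0)
      (subst (λ n → 0# ^ n ≡ 0#) (ℕ.suc-pred h {{ℕ.>-nonZero 0<h}}) (zeroˡ _))))

    euler : ∀ {a} → ¬ a ≡ 0# → a ^ h * a ^ h ≡ 1#
    euler {a} a≢0 = *-cancelˡ a a≢0 (trans (cong (a *_) (sym (^-+ a h h)))
      (trans (cong (a ^_) (sym q≡)) (trans (fermat a) (sym (*-identityʳ a)))))

    has-sign : ∀ {a} → ¬ a ≡ 0# → ∃[ s ] HasSign a s
    has-sign {a} a≢0 = [ (λ z → Sign.+ , hasSign (a-b≡0 z)) , (λ z → Sign.- , hasSign (a+b≡0 z)) ]′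
      (a*b≡0 (trans (solve 2 (λ x y → (x :- y) :* (x :+ y) := x :* x :- y :* y) refl (a ^ h) 1#)
        (trans (cong₂ _-_ (euler a≢0) (*-identityˡ 1#)) (-‿inverseʳ 1#))))
      where
      a+b≡0 : ∀ {x} → x + 1# ≡ 0# → x ≡ - 1#
      a+b≡0 {x} e = trans (solve 2 (λ x y → x := (x :+ y) :- y) refl x 1#) (trans (cong (_- 1#) e) (+-identityˡ _))

    sign-1 : HasSign 1# Sign.+
    sign-1 = hasSign (1^ h)

    -- For q ≡ 1 modulo 8 the exponent (q - 1) / 2 is a multiple of 4.
    sign-fourth-root : ∀ {a} n → h ≡ 4 ℕ.* n → a ^ 4 ≡ 1# → HasSign a Sign.+
    sign-fourth-root {a} n h≡ e = hasSign (trans (cong (a ^_) (trans h≡ (ℕ.*-comm 4 n)))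
      (trans (^-* a n 4) (trans (cong (_^ n) e) (1^ n))))

    -- Otherwise X (X^h - 1), of degree h + 1 < q, would vanish on the whole field.
    nonresidue : ∃[ g ] HasSign g Sign.-
    nonresidue with F.any? (λ a → a ^ h ≟K - 1#)
    ... | yes (g , e) = g , hasSign e
    ... | no none = ⊥-elim (ℕ.<-irrefl refl (ℕ.<-≤-trans (root-bound (allFin q) 1 Q (Unique.allFin⁺ q) Q≉0 divides) length-Q))
      where
      open Polynomials 𝔽
      open Multiplicities 𝔽
      open Independence 𝔽
      R Q : Poly
      R = X ^ᴾ h ⊕ ⊖ const 1#
      Q = X ⊗ R
      length-R : length R ≤ suc h
      length-R = length-⊕≤ (X ^ᴾ h) (⊖ const 1#) (length-linear^ 0# h)
        (ℕ.≤-trans (ℕ.≤-reflexive (length-⊖ (const 1#))) (s≤s z≤n))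
      length-Q : length Q ≤ length (allFin q) ℕ.* 1
      length-Q = ℕ.≤-trans (length-⊗ X R {1} {h} ℕ.≤-refl length-R)
        (subst (suc (suc h) ≤_) (sym (trans (ℕ.*-identityʳ _) (trans (L.length-tabulate {n = q} (λ i → i)) q≡))) (s≤s (ℕ.+-monoˡ-≤ h 0<h)))
      Q≉0 : ¬ Q ≈ []
      Q≉0 e = 1≢0 (trans (sym R[h]) (trans (sym (at (X⊗ R) (suc h))) (at e (suc h))))
        where
        const[h] : coef (const 1#) h ≡ 0#
        const[h] = coef-length (const 1#) h 0<h
        R[h] : coef R h ≡ 1#
        R[h] = trans (coef-⊕ (X ^ᴾ h) (⊖ const 1#) h) (trans (cong₂ _+_ (leading 0# h)
          (trans (coef-⊖ (const 1#) h) (trans (cong (λ c → - c) const[h]) -0#≈0#))) (+-identityʳ 1#))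
      ev-X : ∀ a → ev X a ≡ a
      ev-X a = trans (+-identityˡ _) (trans (cong (a *_) (ev-const 1# a)) (*-identityʳ a))
      ev-Q : ∀ a → ev Q a ≡ 0#
      ev-Q a = trans (ev-⊗ X R a) (go (a ≟K 0#))
        where
        go : Dec (a ≡ 0#) → ev X a * ev R a ≡ 0#
        go (yes a≡0) = trans (cong (_* ev R a) (trans (ev-X a) a≡0)) (zeroˡ _)
        go (no a≢0) with has-sign a≢0
        ... | Sign.- , s = ⊥-elim (none (a , power s))
        ... | Sign.+ , s = trans (cong (ev X a *_) (trans (ev-⊕ (X ^ᴾ h) (⊖ const 1#) a)
              (trans (cong₂ _+_ (trans (ev-^ X h a) (trans (cong (_^ h) (ev-X a)) (power s))) (trans (ev-⊖ (const 1#) a) (cong (λ c → - c) (ev-const 1# a))))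
              (-‿inverseʳ 1#)))) (zeroʳ _)
      divides : ∀ {a} → a ∈ allFin q → ∃[ U ] Q ≈ lin a ^ᴾ 1 ⊗ U
      divides {a} _ = quo Q a , ≈-trans (factor Q a (ev-Q a))
        (⊗-cong (≈-sym (≈-trans (⊗-comm (lin a) (const 1#)) (⊗-identityˡ (lin a)))) (≈-refl {quo Q a}))

-- The constants, and the expansion of sign patterns into characters

module SignExpansions where
  open PrimeFields
  open PolynomialRings
  open StepanovMethod
  open QuadraticResidues
  open import Data.Nat as ℕ using (ℕ; zero; suc; z≤n; s≤s; _≤_; _<_; ⌊_/2⌋)
  import Data.Nat.Properties as ℕ
  open import Data.Nat.Solver using (module +-*-Solver)
  open import Data.Bool using (Bool; true; false; _xor_; _∧_; T)
  open import Data.Unit using (tt)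
  open import Data.Fin using (zero; suc)
  open import Data.List using (List; []; _∷_; length)
  open import Data.List.Relation.Unary.Unique.Propositional using (Unique)
  import Data.List.Relation.Unary.Unique.Propositional.Properties as Unique
  open import Data.List.Relation.Unary.All as All using (All; []; _∷_)
  open import Data.List.Relation.Unary.AllPairs using ([]; _∷_)
  open import Data.List.Relation.Unary.Any as Any using (Any; here; there)
  open import Data.List.Membership.Propositional using (_∈_; lose; find)
  import Data.List.Membership.Propositional.Properties as ∈
  open import Data.Vec as Vec using (Vec; []; _∷_)
  open import Data.Sign as Sign using (Sign)
  import Data.Sign.Properties as Sign
  open import Data.Product using (_,_; _×_; ∃-syntax; proj₁; proj₂)
  open import Data.Empty using (⊥-elim)
  open import Relation.Nullary using (¬_; yes; no)
  open import Relation.Binary.PropositionalEquality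

  -- The triangular number 0 + 1 + ... + (M - 1). It enters because the k-th iterate of `step`
  -- raises the degree by k m'.
  tri : ℕ → ℕ
  tri zero    = 0
  tri (suc M) = tri M ℕ.+ M

  -- This is ⌈(m' + 1) / 2⌉, the amount e by which the number J' + 1 of pairs exceeds M / 2. When M²
  -- / 2 is close to the degree bound of the pairs, having more unknowns than conditions asks for 2
  -- e ≥ m' + 1.
  excess : ℕ → ℕ
  excess m' = suc ⌊ m' /2⌋

  -- The coefficient of h that remains of twice the point bound after M (h + h) has been taken away.
  weight : ℕ → ℕ
  weight m' = 2 ℕ.* m' ℕ.+ 4 ℕ.* excess m'

  -- The parameters are opaque so that no numeral is ever unfolded.
  abstract
    M₀ b₀ A₀ C₀ V₀ : ℕ
    -- The expansions used later have total weight at most 2178, and 2 M₀ has to exceed this by at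
    -- least 3; M₀ is the least even number that does. The existence of the auxiliary polynomial
    -- then requires about M₀² < 2 A₀, hence A₀ near 600000.
    M₀ = 1092
    b₀ = 540
    A₀ = 599996
    C₀ = 9826
    V₀ = 2181

    M₀≡ : M₀ ≡ 2 ℕ.* b₀ ℕ.+ 12
    M₀≡ = refl

    M₀≤A₀ : M₀ ≤ A₀
    M₀≤A₀ = ℕ.≤ᵇ⇒≤ 1092 599996 tt

    A₀≤ : ∀ {n} → 599996 ≤ n → A₀ ≤ n
    A₀≤ le = le

    V₀≥ : ∀ {n} → n ≤ 2181 → n ≤ V₀
    V₀≥ le = le

    V₀≡ : V₀ ℕ.+ 3 ≡ 2 ℕ.* M₀
    V₀≡ = refl

    -- The 5 is the value of `excess m'` at m' = 8, the largest case.
    C₀≥ : 2 ℕ.* b₀ ℕ.+ 2 ℕ.* 5 ℕ.+ 8 ℕ.* M₀ ≤ C₀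
    C₀≥ = ℕ.≤ᵇ⇒≤ 9826 9826 tt

    -- Each of up to 128 = 2⁷ terms of an expansion contributes C₀; the multiple 3 h, with h ≥ 4 +
    -- A₀, must absorb them all.
    gap : 128 ℕ.* C₀ ℕ.+ 8 ℕ.* M₀ < 3 ℕ.* (4 ℕ.+ A₀)
    gap = ℕ.<ᵇ⇒< 1266464 1800000 tt

    -- Nine numerical cases; the tightest is m' = 1, with 1191918 < 1199992.
    numeric : ∀ m' → m' ≤ 8 → M₀ ℕ.* (5 ℕ.+ b₀ ℕ.+ excess m') ℕ.+ m' ℕ.* tri M₀ < (2 ℕ.* excess m') ℕ.* A₀
    numeric 0 _ = ℕ.<ᵇ⇒< _ _ tt
    numeric 1 _ = ℕ.<ᵇ⇒< _ _ tt
    numeric 2 _ = ℕ.<ᵇ⇒< _ _ tt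
    numeric 3 _ = ℕ.<ᵇ⇒< _ _ tt
    numeric 4 _ = ℕ.<ᵇ⇒< _ _ tt
    numeric 5 _ = ℕ.<ᵇ⇒< _ _ tt
    numeric 6 _ = ℕ.<ᵇ⇒< _ _ tt
    numeric 7 _ = ℕ.<ᵇ⇒< _ _ tt
    numeric 8 _ = ℕ.<ᵇ⇒< _ _ tt
    numeric (suc (suc (suc (suc (suc (suc (suc (suc (suc m'))))))))) (s≤s (s≤s (s≤s (s≤s (s≤s (s≤s (s≤s (s≤s ()))))))))

  -- With A = d + 2 there are M (A + J') + m' t conditions and 2 (J' + 1) A = (M + 2 e) A unknowns.
  -- The terms M A cancel and leave M J' + m' t < 2 e A, which is monotone in A.
  few-conditions : ∀ d M J' e m' t → suc J' ℕ.* 2 ≡ M ℕ.+ 2 ℕ.* e → A₀ ≤ suc (suc d) →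
    M ℕ.* J' ℕ.+ m' ℕ.* t < (2 ℕ.* e) ℕ.* A₀ →
    M ℕ.* (suc (suc d) ℕ.+ J') ℕ.+ m' ℕ.* t < suc J' ℕ.* (2 ℕ.* suc (suc d))
  few-conditions d M J' e m' t J≡ A≤ num = begin-strict
    M ℕ.* (A ℕ.+ J') ℕ.+ m' ℕ.* t             ≡⟨ cong (ℕ._+ m' ℕ.* t) (ℕ.*-distribˡ-+ M A J') ⟩
    M ℕ.* A ℕ.+ M ℕ.* J' ℕ.+ m' ℕ.* t         ≡⟨ ℕ.+-assoc (M ℕ.* A) _ _ ⟩
    M ℕ.* A ℕ.+ (M ℕ.* J' ℕ.+ m' ℕ.* t)       <⟨ ℕ.+-monoʳ-< (M ℕ.* A) num ⟩
    M ℕ.* A ℕ.+ (2 ℕ.* e) ℕ.* A₀          ≤⟨ ℕ.+-monoʳ-≤ (M ℕ.* A) (ℕ.*-monoʳ-≤ (2 ℕ.* e) A≤) ⟩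
    M ℕ.* A ℕ.+ (2 ℕ.* e) ℕ.* A               ≡⟨ ℕ.*-distribʳ-+ A M (2 ℕ.* e) ⟨
    (M ℕ.+ 2 ℕ.* e) ℕ.* A                     ≡⟨ cong (ℕ._* A) J≡ ⟨
    suc J' ℕ.* 2 ℕ.* A                        ≡⟨ ℕ.*-assoc (suc J') 2 A ⟩
    suc J' ℕ.* (2 ℕ.* A)                      ∎
    where
    open ℕ.≤-Reasoning
    A = suc (suc d)

  degree-arith : ∀ d → 10 ℕ.+ (suc d ℕ.+ suc d) ≡ (6 ℕ.+ d) ℕ.+ (6 ℕ.+ d)
  degree-arith = solve 1 (λ d → con 10 :+ ((con 1 :+ d) :+ (con 1 :+ d)) := (con 6 :+ d) :+ (con 6 :+ d)) refl
    where open +-*-Solver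

  conditions-arith : ∀ M d J m t → (M ℕ.* (suc (suc d) ℕ.+ J) ℕ.+ m ℕ.* t) ℕ.+ (suc (suc d ℕ.+ M ℕ.* m) ℕ.+ J) ≡
    suc M ℕ.* (suc (suc d) ℕ.+ J) ℕ.+ m ℕ.* (t ℕ.+ M)
  conditions-arith = solve 5 (λ M A J m t → (M :* (con 2 :+ A :+ J) :+ m :* t) :+ (con 2 :+ A :+ M :* m :+ J) :=
            ((con 2 :+ A :+ J) :+ M :* (con 2 :+ A :+ J)) :+ m :* (t :+ M)) refl
    where open +-*-Solver

  -- With β the point bound and w h + C the resulting bound for the character sum.
  β : ℕ → ℕ → ℕ → ℕ
  β h m' M = h ℕ.* (M ℕ.+ m' ℕ.+ 2 ℕ.* excess m') ℕ.+ (b₀ ℕ.+ excess m')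

  -- The 5 in J' = 5 + b + e is chosen so that d + 1 = h - 5 is compensated by the constant term of
  -- J' q = J' (2 h + 1).
  point-arith : ∀ d m b e → suc d ℕ.+ (6 ℕ.+ d) ℕ.* suc m ℕ.+ (5 ℕ.+ b ℕ.+ e) ℕ.* suc ((6 ℕ.+ d) ℕ.+ (6 ℕ.+ d)) ≡
    (6 ℕ.+ d) ℕ.* (2 ℕ.* b ℕ.+ 12 ℕ.+ m ℕ.+ 2 ℕ.* e) ℕ.+ (b ℕ.+ e)
  point-arith = solve 4 (λ d m b e →
    con 1 :+ d :+ (con 6 :+ d) :* (con 1 :+ m) :+ (con 5 :+ b :+ e) :* (con 1 :+ ((con 6 :+ d) :+ (con 6 :+ d))) :=
    (con 6 :+ d) :* (con 2 :* b :+ con 12 :+ m :+ con 2 :* e) :+ (b :+ e)) refl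
    where open +-*-Solver

  sum-arith : ∀ h m e M b → 2 ℕ.* (h ℕ.* (M ℕ.+ m ℕ.+ 2 ℕ.* e) ℕ.+ (b ℕ.+ e)) ℕ.+ 8 ℕ.* M ≡
    ((2 ℕ.* m ℕ.+ 4 ℕ.* e) ℕ.* h ℕ.+ (2 ℕ.* b ℕ.+ 2 ℕ.* e ℕ.+ 8 ℕ.* M)) ℕ.+ M ℕ.* (h ℕ.+ h)
  sum-arith = solve 5 (λ h m e M b → con 2 :* (h :* (M :+ m :+ con 2 :* e) :+ (b :+ e)) :+ con 8 :* M :=
    ((con 2 :* m :+ con 4 :* e) :* h :+ (con 2 :* b :+ con 2 :* e :+ con 8 :* M)) :+ M :* (h :+ h)) refl
    where open +-*-Solver

  ∑ : ∀ {A : Set} → (A → ℕ) → List A → ℕ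
  ∑ f []       = 0
  ∑ f (x ∷ xs) = f x ℕ.+ ∑ f xs

  ∑-+ : ∀ {A : Set} (f g : A → ℕ) xs → ∑ (λ x → f x ℕ.+ g x) xs ≡ ∑ f xs ℕ.+ ∑ g xs
  ∑-+ f g []       = refl
  ∑-+ f g (x ∷ xs) = trans (cong (f x ℕ.+ g x ℕ.+_) (∑-+ f g xs))
    (solve 4 (λ a b c d → a :+ b :+ (c :+ d) := a :+ c :+ (b :+ d)) refl (f x) (g x) (∑ f xs) (∑ g xs))
    where open +-*-Solver

  ∑-cong : ∀ {A : Set} {f g : A → ℕ} xs → (∀ x → x ∈ xs → f x ≡ g x) → ∑ f xs ≡ ∑ g xs
  ∑-cong []       e = refl
  ∑-cong (x ∷ xs) e = cong₂ ℕ._+_ (e x (here refl)) (∑-cong xs λ y y∈ → e y (there y∈))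

  -- A subset of the roots. The symmetric difference `_⊻_` corresponds to multiplying characters,
  -- since squares of signs drop out.
  Mask : ℕ → Set
  Mask = Vec Bool

  select : ∀ {A : Set} {n} → Mask n → Vec A n → List A
  select []          []       = []
  select (true  ∷ μ) (x ∷ xs) = x ∷ select μ xs
  select (false ∷ μ) (x ∷ xs) = select μ xs

  infixl 6 _⊻_
  _⊻_ : ∀ {n} → Mask n → Mask n → Mask n
  _⊻_ = Vec.zipWith _xor_

  size : ∀ {n} → Mask n → ℕ
  size []          = 0
  size (true  ∷ μ) = suc (size μ)
  size (false ∷ μ) = size μ

  size≤ : ∀ {n} (μ : Mask n) → size μ ≤ n
  size≤ []          = z≤n
  size≤ (true  ∷ μ) = s≤s (size≤ μ)
  size≤ (false ∷ μ) = ℕ.m≤n⇒m≤1+n (size≤ μ)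

  length-select : ∀ {A : Set} {n} (μ : Mask n) (xs : Vec A n) → length (select μ xs) ≡ size μ
  length-select []          []       = refl
  length-select (true  ∷ μ) (x ∷ xs) = cong suc (length-select μ xs)
  length-select (false ∷ μ) (x ∷ xs) = length-select μ xs

  All-select : ∀ {A : Set} {P : A → Set} {n} (μ : Mask n) (xs : Vec A n) → All P (Vec.toList xs) → All P (select μ xs)
  All-select []          []       []       = []
  All-select (true  ∷ μ) (x ∷ xs) (p ∷ ps) = p ∷ All-select μ xs ps
  All-select (false ∷ μ) (x ∷ xs) (p ∷ ps) = All-select μ xs ps

  Unique-select : ∀ {A : Set} {n} (μ : Mask n) (xs : Vec A n) → Unique (Vec.toList xs) → Unique (select μ xs)
  Unique-select []          []       []       = []
  Unique-select (true  ∷ μ) (x ∷ xs) (p ∷ ps) = All-select μ xs p ∷ Unique-select μ xs ps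
  Unique-select (false ∷ μ) (x ∷ xs) (p ∷ ps) = Unique-select μ xs ps

  ∏ : ∀ {n} → Mask n → Vec Sign n → Sign
  ∏ []          []       = Sign.+
  ∏ (true  ∷ μ) (t ∷ ts) = t Sign.* ∏ μ ts
  ∏ (false ∷ μ) (t ∷ ts) = ∏ μ ts

  ∏-⊻ : ∀ {n} (μ ν : Mask n) ts → ∏ (μ ⊻ ν) ts ≡ ∏ μ ts Sign.* ∏ ν ts
  ∏-⊻ []          []          []       = refl
  ∏-⊻ (true  ∷ μ) (true  ∷ ν) (t ∷ ts) = trans (∏-⊻ μ ν ts) (cancel t (∏ μ ts) (∏ ν ts))
    where
    cancel : ∀ t a b → a Sign.* b ≡ t Sign.* a Sign.* (t Sign.* b)
    cancel Sign.+ a b = refl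
    cancel Sign.- Sign.+ Sign.+ = refl
    cancel Sign.- Sign.+ Sign.- = refl
    cancel Sign.- Sign.- Sign.+ = refl
    cancel Sign.- Sign.- Sign.- = refl
  ∏-⊻ (true  ∷ μ) (false ∷ ν) (t ∷ ts) = trans (cong (t Sign.*_) (∏-⊻ μ ν ts)) (sym (Sign.*-assoc t (∏ μ ts) (∏ ν ts)))
  ∏-⊻ (false ∷ μ) (true  ∷ ν) (t ∷ ts) = trans (cong (t Sign.*_) (∏-⊻ μ ν ts))
    (trans (sym (Sign.*-assoc t (∏ μ ts) (∏ ν ts))) (trans (cong (Sign._* ∏ ν ts) (Sign.*-comm t (∏ μ ts))) (Sign.*-assoc (∏ μ ts) t (∏ ν ts))))
  ∏-⊻ (false ∷ μ) (false ∷ ν) (t ∷ ts) = ∏-⊻ μ ν ts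

  indicator : Sign → Sign → ℕ
  indicator Sign.+ Sign.+ = 1
  indicator Sign.+ Sign.- = 0
  indicator Sign.- Sign.+ = 0
  indicator Sign.- Sign.- = 1

  Condition : ℕ → Set
  Condition n = Mask n × Sign

  -- part + cs μ t − part − cs μ t is the expansion of ∏ μ t · ∏ (1 + s · ∏ m t) over (m , s) in cs.
  part : ∀ {n} → Sign → List (Condition n) → Mask n → Vec Sign n → ℕ
  part σ []             μ t = indicator σ (∏ μ t)
  part σ ((m , s) ∷ cs) μ t = part σ cs μ t ℕ.+ part (σ Sign.* s) cs (μ ⊻ m) t

  -- Multiplying both the expanded product and the sign σ by ∏ ν t changes nothing, so the two parts
  -- can be compared across masks.
  part-twist : ∀ {n} (cs : List (Condition n)) σ μ ν t → part (σ Sign.* ∏ ν t) cs (μ ⊻ ν) t ≡ part σ cs μ t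
  part-twist [] σ μ ν t = trans (cong (indicator (σ Sign.* ∏ ν t)) (∏-⊻ μ ν t)) (go σ (∏ μ t) (∏ ν t))
    where
    go : ∀ σ a b → indicator (σ Sign.* b) (a Sign.* b) ≡ indicator σ a
    go Sign.+ Sign.+ Sign.+ = refl
    go Sign.+ Sign.+ Sign.- = refl
    go Sign.+ Sign.- Sign.+ = refl
    go Sign.+ Sign.- Sign.- = refl
    go Sign.- Sign.+ Sign.+ = refl
    go Sign.- Sign.+ Sign.- = refl
    go Sign.- Sign.- Sign.+ = refl
    go Sign.- Sign.- Sign.- = refl
  part-twist ((m , s) ∷ cs) σ μ ν t = cong₂ ℕ._+_ (part-twist cs σ μ ν t)
    (trans (cong₂ (λ x y → part x cs y t) (signs σ (∏ ν t) s) (masks μ ν m)) (part-twist cs (σ Sign.* s) (μ ⊻ m) ν t))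
    where
    signs : ∀ a b c → a Sign.* b Sign.* c ≡ a Sign.* c Sign.* b
    signs a b c = trans (Sign.*-assoc a b c) (trans (cong (a Sign.*_) (Sign.*-comm b c)) (sym (Sign.*-assoc a c b)))
    bits : ∀ a b c → (a xor b) xor c ≡ (a xor c) xor b
    bits false false c = lemma c
      where lemma : ∀ c → c ≡ c xor false
            lemma false = refl
            lemma true = refl
    bits false true false = refl
    bits false true true = refl
    bits true false false = refl
    bits true false true = refl
    bits true true false = refl
    bits true true true = refl
    masks : ∀ {n} (a b c : Mask n) → (a ⊻ b) ⊻ c ≡ (a ⊻ c) ⊻ b
    masks []      []      []      = refl
    masks (a ∷ as) (b ∷ bs) (c ∷ cs) = cong₂ _∷_ (bits a b c) (masks as bs cs)

  -- A violated condition contributes the factor 1 - 1 = 0 to the product, so the positive and the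
  -- negative part of the expansion coincide.
  part-violated : ∀ {n} (cs : List (Condition n)) μ t → Any (λ (m , s) → ¬ ∏ m t ≡ s) cs → ∀ σ →
    part σ cs μ t ≡ part (Sign.opposite σ) cs μ t
  part-violated ((m , s) ∷ cs) μ t (there v) σ = cong₂ ℕ._+_ (part-violated cs μ t v σ)
    (trans (part-violated cs (μ ⊻ m) t v (σ Sign.* s)) (cong (λ x → part x cs (μ ⊻ m) t) (sign-opp σ s)))
    where
    sign-opp : ∀ a b → Sign.opposite (a Sign.* b) ≡ Sign.opposite a Sign.* b
    sign-opp Sign.+ b = refl
    sign-opp Sign.- Sign.+ = refl
    sign-opp Sign.- Sign.- = refl
  -- The two summands exchange their roles: as ∏ m t is opposite to s, the second summand for σ is
  -- the first one for the opposite of σ, and conversely.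
  part-violated ((m , s) ∷ cs) μ t (here v) σ = trans (ℕ.+-comm (part σ cs μ t) _) (cong₂ ℕ._+_
    (trans (cong (λ x → part x cs (μ ⊻ m) t) (e₁ σ s (∏ m t) v)) (part-twist cs (Sign.opposite σ) μ m t))
    (sym (trans (cong (λ x → part x cs (μ ⊻ m) t) (e₂ σ s (∏ m t) v)) (part-twist cs σ μ m t))))
    where
    e₁ : ∀ a s x → ¬ x ≡ s → a Sign.* s ≡ Sign.opposite a Sign.* x
    e₁ a Sign.+ Sign.+ v = ⊥-elim (v refl)
    e₁ Sign.+ Sign.+ Sign.- v = refl
    e₁ Sign.- Sign.+ Sign.- v = refl
    e₁ Sign.+ Sign.- Sign.+ v = refl
    e₁ Sign.- Sign.- Sign.+ v = refl
    e₁ a Sign.- Sign.- v = ⊥-elim (v refl)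
    e₂ : ∀ a s x → ¬ x ≡ s → Sign.opposite a Sign.* s ≡ a Sign.* x
    e₂ a Sign.+ Sign.+ v = ⊥-elim (v refl)
    e₂ Sign.+ Sign.+ Sign.- v = refl
    e₂ Sign.- Sign.+ Sign.- v = refl
    e₂ Sign.+ Sign.- Sign.+ v = refl
    e₂ Sign.- Sign.- Sign.+ v = refl
    e₂ a Sign.- Sign.- v = ⊥-elim (v refl)

  -- Bounds for the sums of the characters attached to the masks that occur in the expansion.
  module Expansion {A : Set} {n : ℕ} (xs : List A) (t : A → Vec Sign n) (M : ℕ) (w : ℕ → ℕ) (h C : ℕ)
      (bound : ∀ (μ : Mask n) m' → size μ ≡ suc m' → ∀ σ →
        M ℕ.* ∑ (λ x → indicator σ (∏ μ (t x))) xs ≤ M ℕ.* ∑ (λ x → indicator (Sign.opposite σ) (∏ μ (t x))) xs ℕ.+ (w m' ℕ.* h ℕ.+ C))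
    where

    S : Sign → List (Condition n) → Mask n → ℕ
    S σ cs μ = ∑ (λ x → part σ cs μ (t x)) xs

    -- Every mask reached from μ by the conditions is nonempty, so each term is a sum over a
    -- nontrivial character.
    nontrivial : List (Condition n) → Mask n → Bool
    nontrivial []             μ = 0 ℕ.<ᵇ size μ
    nontrivial ((m , s) ∷ cs) μ = nontrivial cs μ ∧ nontrivial cs (μ ⊻ m)

    total : List (Condition n) → Mask n → ℕ
    total []             μ = w (ℕ.pred (size μ))
    total ((m , s) ∷ cs) μ = total cs μ ℕ.+ total cs (μ ⊻ m)

    terms : List (Condition n) → ℕ
    terms []       = 1
    terms (_ ∷ cs) = terms cs ℕ.+ terms cs

    private
      ∧-T : ∀ a b → T (a ∧ b) → T a × T b
      ∧-T true true _ = tt , tt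

      combine-arith : ∀ a b c d e f → (a ℕ.+ (c ℕ.* h ℕ.+ e ℕ.* C)) ℕ.+ (b ℕ.+ (d ℕ.* h ℕ.+ f ℕ.* C)) ≡ (a ℕ.+ b) ℕ.+ ((c ℕ.+ d) ℕ.* h ℕ.+ (e ℕ.+ f) ℕ.* C)
      combine-arith a b c d e f = solve 8 (λ a b c d e f h C → (a :+ (c :* h :+ e :* C)) :+ (b :+ (d :* h :+ f :* C)) :=
        (a :+ b) :+ ((c :+ d) :* h :+ (e :+ f) :* C)) refl a b c d e f h C
        where open +-*-Solver

    S-∷ : ∀ σ m s cs μ → M ℕ.* S σ ((m , s) ∷ cs) μ ≡ M ℕ.* S σ cs μ ℕ.+ M ℕ.* S (σ Sign.* s) cs (μ ⊻ m)
    S-∷ σ m s cs μ = trans (cong (M ℕ.*_) (∑-+ (λ x → part σ cs μ (t x)) (λ x → part (σ Sign.* s) cs (μ ⊻ m) (t x)) xs)) (ℕ.*-distribˡ-+ M _ _)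

    S-bound : ∀ cs μ → T (nontrivial cs μ) → ∀ σ →
      M ℕ.* S σ cs μ ≤ M ℕ.* S (Sign.opposite σ) cs μ ℕ.+ (total cs μ ℕ.* h ℕ.+ terms cs ℕ.* C)
    S-bound [] μ nt σ = base (size μ) refl nt
      where
      base : ∀ k → size μ ≡ k → T (0 ℕ.<ᵇ k) → M ℕ.* S σ [] μ ≤ M ℕ.* S (Sign.opposite σ) [] μ ℕ.+ (w (ℕ.pred (size μ)) ℕ.* h ℕ.+ 1 ℕ.* C)
      base (suc m') e _ = subst₂ (λ k c → M ℕ.* S σ [] μ ≤ M ℕ.* S (Sign.opposite σ) [] μ ℕ.+ (w (ℕ.pred k) ℕ.* h ℕ.+ c)) (sym e) (sym (ℕ.*-identityˡ C)) (bound μ m' e σ)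
    S-bound ((m , s) ∷ cs) μ nt σ = begin
      M ℕ.* S σ ((m , s) ∷ cs) μ                              ≡⟨ S-∷ σ m s cs μ ⟩
      M ℕ.* S σ cs μ ℕ.+ M ℕ.* S (σ Sign.* s) cs (μ ⊻ m)
        ≤⟨ ℕ.+-mono-≤ (S-bound cs μ (proj₁ nts) σ) (S-bound cs (μ ⊻ m) (proj₂ nts) (σ Sign.* s)) ⟩
      _                                                       ≡⟨ combine-arith (M ℕ.* S (Sign.opposite σ) cs μ) (M ℕ.* S (Sign.opposite (σ Sign.* s)) cs (μ ⊻ m)) (total cs μ) (total cs (μ ⊻ m)) (terms cs) (terms cs) ⟩
      M ℕ.* S (Sign.opposite σ) cs μ ℕ.+ M ℕ.* S (Sign.opposite (σ Sign.* s)) cs (μ ⊻ m) ℕ.+ R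
        ≡⟨ cong (λ z → M ℕ.* S (Sign.opposite σ) cs μ ℕ.+ M ℕ.* S z cs (μ ⊻ m) ℕ.+ R) (sign-opp σ s) ⟩
      M ℕ.* S (Sign.opposite σ) cs μ ℕ.+ M ℕ.* S (Sign.opposite σ Sign.* s) cs (μ ⊻ m) ℕ.+ R
        ≡⟨ cong (ℕ._+ R) (S-∷ (Sign.opposite σ) m s cs μ) ⟨
      M ℕ.* S (Sign.opposite σ) ((m , s) ∷ cs) μ ℕ.+ R        ∎
      where
      open ℕ.≤-Reasoning
      nts = ∧-T (nontrivial cs μ) _ nt
      R = (total cs μ ℕ.+ total cs (μ ⊻ m)) ℕ.* h ℕ.+ (terms cs ℕ.+ terms cs) ℕ.* C
      sign-opp : ∀ a b → Sign.opposite (a Sign.* b) ≡ Sign.opposite a Sign.* b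
      sign-opp Sign.+ b = refl
      sign-opp Sign.- Sign.+ = refl
      sign-opp Sign.- Sign.- = refl

    ∅ : Mask n
    ∅ = Vec.replicate n false

    -- The same for the expansion started at the empty mask, whose own term is the main term and is
    -- exempted.
    nontrivial₀ : List (Condition n) → Bool
    nontrivial₀ []             = true
    nontrivial₀ ((m , s) ∷ cs) = nontrivial₀ cs ∧ nontrivial cs (∅ ⊻ m)

    total₀ : List (Condition n) → ℕ
    total₀ []             = 0
    total₀ ((m , s) ∷ cs) = total₀ cs ℕ.+ total cs (∅ ⊻ m)

    ∏-∅ : ∀ {n} (t : Vec Sign n) → ∏ (Vec.replicate n false) t ≡ Sign.+
    ∏-∅ []      = refl
    ∏-∅ (_ ∷ t) = ∏-∅ t

    -- The empty mask contributes `length xs` and every other mask only an error term. Negative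
    -- parts stand on the other side, which keeps the inequality within ℕ.
    lower-bound : ∀ cs → T (nontrivial₀ cs) →
      M ℕ.* length xs ℕ.+ M ℕ.* S Sign.- cs ∅ ≤ M ℕ.* S Sign.+ cs ∅ ℕ.+ (total₀ cs ℕ.* h ℕ.+ terms cs ℕ.* C)
    lower-bound [] nt = ℕ.≤-trans (ℕ.≤-reflexive (trans (cong₂ ℕ._+_ (cong (M ℕ.*_) (sym (all-one xs))) (trans (cong (M ℕ.*_) (all-zero xs)) (ℕ.*-zeroʳ M))) (ℕ.+-identityʳ _)))
      (ℕ.m≤m+n _ _)
      where
      all-one : ∀ xs → ∑ (λ x → indicator Sign.+ (∏ ∅ (t x))) xs ≡ length xs
      all-one []       = refl
      all-one (x ∷ xs) = cong₂ ℕ._+_ (cong (indicator Sign.+) (∏-∅ (t x))) (all-one xs)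
      all-zero : ∀ xs → ∑ (λ x → indicator Sign.- (∏ ∅ (t x))) xs ≡ 0
      all-zero []       = refl
      all-zero (x ∷ xs) = cong₂ ℕ._+_ (cong (indicator Sign.-) (∏-∅ (t x))) (all-zero xs)
    lower-bound ((m , s) ∷ cs) nt = begin
      M ℕ.* length xs ℕ.+ M ℕ.* S Sign.- ((m , s) ∷ cs) ∅
        ≡⟨ trans (cong (M ℕ.* length xs ℕ.+_) (S-∷ Sign.- m s cs ∅)) (sym (ℕ.+-assoc (M ℕ.* length xs) _ _)) ⟩
      M ℕ.* length xs ℕ.+ M ℕ.* S Sign.- cs ∅ ℕ.+ M ℕ.* S (Sign.- Sign.* s) cs (∅ ⊻ m)
        ≤⟨ ℕ.+-mono-≤ (lower-bound cs (proj₁ nts)) (S-bound cs (∅ ⊻ m) (proj₂ nts) (Sign.- Sign.* s)) ⟩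
      _ ≡⟨ combine-arith (M ℕ.* S Sign.+ cs ∅) (M ℕ.* S (Sign.opposite (Sign.- Sign.* s)) cs (∅ ⊻ m)) (total₀ cs) (total cs (∅ ⊻ m)) (terms cs) (terms cs) ⟩
      M ℕ.* S Sign.+ cs ∅ ℕ.+ M ℕ.* S (Sign.opposite (Sign.- Sign.* s)) cs (∅ ⊻ m) ℕ.+ R
        ≡⟨ cong (λ z → M ℕ.* S Sign.+ cs ∅ ℕ.+ M ℕ.* S z cs (∅ ⊻ m) ℕ.+ R) (Sign.opposite-selfInverse (opp s)) ⟩
      M ℕ.* S Sign.+ cs ∅ ℕ.+ M ℕ.* S (Sign.+ Sign.* s) cs (∅ ⊻ m) ℕ.+ R
        ≡⟨ cong (ℕ._+ R) (S-∷ Sign.+ m s cs ∅) ⟨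
      M ℕ.* S Sign.+ ((m , s) ∷ cs) ∅ ℕ.+ R ∎
      where
      open ℕ.≤-Reasoning
      nts = ∧-T (nontrivial₀ cs) _ nt
      R = (total₀ cs ℕ.+ total cs (∅ ⊻ m)) ℕ.* h ℕ.+ (terms cs ℕ.+ terms cs) ℕ.* C
      opp : ∀ s → Sign.opposite s ≡ Sign.- Sign.* s
      opp Sign.+ = refl
      opp Sign.- = refl

    -- If no x met all conditions, the two parts would be equal and the main term would not exceed
    -- the error terms.
    realize : ∀ cs → T (nontrivial₀ cs) → total₀ cs ℕ.* h ℕ.+ terms cs ℕ.* C < M ℕ.* length xs →
      ∃[ x ] x ∈ xs × All (λ (m , s) → ∏ m (t x) ≡ s) cs
    realize cs nt lt with Any.any? (λ x → All.all? (λ (m , s) → ∏ m (t x) Sign.≟ s) cs) xs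
    ... | yes found = find found
    ... | no none = ⊥-elim (ℕ.<⇒≱ lt (ℕ.+-cancelʳ-≤ (M ℕ.* S Sign.- cs ∅) _ _
        (ℕ.≤-trans (lower-bound cs nt) (ℕ.≤-reflexive (trans (ℕ.+-comm _ (total₀ cs ℕ.* h ℕ.+ terms cs ℕ.* C)) (cong (λ z → total₀ cs ℕ.* h ℕ.+ terms cs ℕ.* C ℕ.+ M ℕ.* z) balanced))))))
      where
      balanced : S Sign.+ cs ∅ ≡ S Sign.- cs ∅
      balanced = ∑-cong xs λ x x∈ → part-violated cs ∅ (t x)
        (violated cs (t x) λ all → none (lose x∈ all)) Sign.+
        where
        violated : ∀ cs t → ¬ All (λ (m , s) → ∏ m t ≡ s) cs → Any (λ (m , s) → ¬ ∏ m t ≡ s) cs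
        violated []             t ¬all = ⊥-elim (¬all [])
        violated ((m , s) ∷ cs) t ¬all with ∏ m t Sign.≟ s
        ... | yes e = there (violated cs t λ all → ¬all (e ∷ all))
        ... | no ne = here ne

  module RootPolynomials {q : ℕ} (𝔽 : PrimeField q) (h : ℕ) (0<h : 0 < h) (q≡ : q ≡ suc (h ℕ.+ h)) where
    open FieldProperties 𝔽
    open Polynomials 𝔽
    open QuadraticCharacter 𝔽 h 0<h q≡

    rootPoly : List K → Poly
    rootPoly []       = const 1#
    rootPoly (a ∷ as) = lin a ⊗ rootPoly as

    length-rootPoly : ∀ as → length (rootPoly as) ≤ suc (length as)
    length-rootPoly []       = ℕ.≤-refl
    length-rootPoly (a ∷ as) = length-⊗ (lin a) (rootPoly as) {1} ℕ.≤-refl (length-rootPoly as)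

    ev-rootPoly≢0 : ∀ {u} as → All (λ a → ¬ u ≡ a) as → ¬ ev (rootPoly as) u ≡ 0#
    ev-rootPoly≢0 {u} []       []          e = 1≢0 (trans (sym (ev-const 1# u)) e)
    ev-rootPoly≢0 {u} (a ∷ as) (u≢a ∷ u∉as) e =
      *-nonzero (λ z → u≢a (a-b≡0 (trans (sym (ev-lin a u)) z))) (ev-rootPoly≢0 as u∉as)
                (trans (sym (ev-⊗ (lin a) (rootPoly as) u)) e)

    coef₀-rootPoly≢0 : ∀ as → All (λ a → ¬ a ≡ 0#) as → ¬ coef (rootPoly as) 0 ≡ 0#
    coef₀-rootPoly≢0 []       []           = 1≢0
    coef₀-rootPoly≢0 (a ∷ as) (a≢0 ∷ as≢0) e =
      *-nonzero (λ z → a≢0 (trans (sym (-‿involutive a)) (trans (cong (λ c → - c) z) -0#≈0#)))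
                (coef₀-rootPoly≢0 as as≢0) (trans (sym (coef-⊗ (lin a) (rootPoly as) 0)) e)

  -- Writing h = 6 + d uses the smallest shift for which pairs of degree at most d + 1 and up to
  -- nine roots satisfy the degree condition m' + 2 + 2 (d + 1) ≤ q of `point-bound`.
  module CharacterSums {q : ℕ} (𝔽 : PrimeField q) (d : ℕ) (q≡ : q ≡ suc ((6 ℕ.+ d) ℕ.+ (6 ℕ.+ d))) where
    open FieldProperties 𝔽
    open Polynomials 𝔽
    open QuadraticCharacter 𝔽 (6 ℕ.+ d) (s≤s z≤n) q≡
    open RootPolynomials 𝔽 (6 ℕ.+ d) (s≤s z≤n) q≡
    open Fermat 𝔽 using (fermat)

    h : ℕ
    h = 6 ℕ.+ d

    point-count : ∀ M J' → M ≤ q → ∀ a as → Unique (a ∷ as) → All (λ a → ¬ a ≡ 0#) (a ∷ as) → length as ≤ 8 →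
      M ℕ.* (suc (suc d) ℕ.+ J') ℕ.+ length as ℕ.* tri M < suc J' ℕ.* (2 ℕ.* suc (suc d)) →
      ∀ s Z → Unique Z → (∀ {u} → u ∈ Z → All (λ a → ¬ u ≡ a) (a ∷ as) × HasSign (ev (rootPoly (a ∷ as)) u) s) →
      length Z ℕ.* M ≤ suc d ℕ.+ h ℕ.* suc (length as) ℕ.+ J' ℕ.* q
    point-count M J' M≤q a as (a∉as ∷ _) nz as≤8 few s Z uniq Zs =
      point-bound M M≤q d≤ (subst (_< _) (sym (conditions≡ M)) few) Z uniq λ u∈Z →
        ev-rootPoly≢0 (a ∷ as) (proj₁ (Zs u∈Z)) , power (proj₂ (Zs u∈Z))
      where
      open Stepanov 𝔽 (5 ℕ.+ d) q≡ fermat (rootPoly (a ∷ as)) (length as) (length-rootPoly (a ∷ as))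
        a (rootPoly as) ≈-refl (ev-rootPoly≢0 as a∉as) (coef₀-rootPoly≢0 (a ∷ as) nz) using (conditions; module Counting)
      open Counting d J' (value s)
      d≤ : suc (suc (length as) ℕ.+ (suc d ℕ.+ suc d)) ≤ q
      d≤ = subst (suc (suc (length as) ℕ.+ (suc d ℕ.+ suc d)) ≤_) (sym q≡) (s≤s
        (ℕ.≤-trans (ℕ.+-monoˡ-≤ (suc d ℕ.+ suc d) (s≤s (ℕ.≤-trans as≤8 (ℕ.m≤m+n 8 1))))
          (ℕ.≤-reflexive (degree-arith d))))
      conditions≡ : ∀ M → conditions d J' M ≡ M ℕ.* (suc (suc d) ℕ.+ J') ℕ.+ length as ℕ.* tri M
      conditions≡ zero    = sym (ℕ.*-zeroʳ (length as))
      conditions≡ (suc M) = trans (cong (ℕ._+ (suc (suc d ℕ.+ M ℕ.* length as) ℕ.+ J')) (conditions≡ M))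
        (conditions-arith M d J' (length as) (tri M))

-- Existence of prescribed sign patterns

module PatternExistence where
  open PrimeFields
  open PolynomialRings
  open QuadraticResidues
  open SignExpansions
  open import Data.Nat as ℕ using (ℕ; suc; z≤n; s≤s; _≤_; _<_)
  import Data.Nat.Properties as ℕ
  open import Data.Nat.Solver using (module +-*-Solver)
  open import Data.Bool using (true; false; T)
  open import Data.Fin as F using (Fin; suc)
  import Data.Fin.Properties as F
  open import Data.List using (List; []; _∷_; length; allFin; filter)
  import Data.List.Properties as L
  open import Data.List.Relation.Unary.Unique.Propositional using (Unique)
  import Data.List.Relation.Unary.Unique.Propositional.Properties as Unique
  open import Data.List.Relation.Unary.All as All using (All; []; _∷_)
  open import Data.List.Relation.Unary.AllPairs using ([]; _∷_)
  open import Data.List.Membership.Propositional using (_∈_)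
  import Data.List.Membership.Propositional.Properties as ∈
  open import Data.Vec as Vec using (Vec; []; _∷_)
  open import Data.Sign as Sign using (Sign)
  import Data.Sign.Properties as Sign
  open import Data.Product using (_,_; _×_; ∃-syntax)
  open import Data.Empty using (⊥-elim)
  open import Relation.Nullary using (¬_; yes; no; ¬?)
  open import Relation.Binary.PropositionalEquality

  length-filter-≢ : ∀ {n} (a : Fin n) xs → Unique xs → length xs ≤ suc (length (filter (λ x → ¬? (x F.≟ a)) xs))
  length-filter-≢ a []       uniq = z≤n
  length-filter-≢ a (x ∷ xs) (x∉ ∷ uniq) with x F.≟ a
  ... | no  _    = s≤s (length-filter-≢ a xs uniq)
  ... | yes refl = s≤s (ℕ.≤-reflexive (cong length (sym (L.filter-all (λ y → ¬? (y F.≟ a)) (All.map (λ ne e → ne (sym e)) x∉)))))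

  ∑-indicator : ∀ {A : Set} (f : A → Sign) σ xs → ∑ (λ x → indicator σ (f x)) xs ≡ length (filter (λ x → f x Sign.≟ σ) xs)
  ∑-indicator f σ []       = refl
  ∑-indicator f σ (x ∷ xs) with f x | σ
  ... | Sign.+ | Sign.+ = cong suc (∑-indicator f Sign.+ xs)
  ... | Sign.+ | Sign.- = ∑-indicator f Sign.- xs
  ... | Sign.- | Sign.+ = ∑-indicator f Sign.+ xs
  ... | Sign.- | Sign.- = cong suc (∑-indicator f Sign.- xs)

  ∑-both : ∀ {A : Set} (f : A → Sign) σ xs → ∑ (λ x → indicator σ (f x)) xs ℕ.+ ∑ (λ x → indicator (Sign.opposite σ) (f x)) xs ≡ length xs
  ∑-both f σ []       = refl
  ∑-both f σ (x ∷ xs) with f x | σ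
  ... | Sign.+ | Sign.+ = cong suc (∑-both f Sign.+ xs)
  ... | Sign.+ | Sign.- = trans (ℕ.+-suc _ _) (cong suc (∑-both f Sign.- xs))
  ... | Sign.- | Sign.+ = trans (ℕ.+-suc _ _) (cong suc (∑-both f Sign.+ xs))
  ... | Sign.- | Sign.- = cong suc (∑-both f Sign.- xs)

  -- P - N = 2 P - len with len at least 2 h - 8, so an upper bound for one class of points already
  -- bounds the character sum.
  difference-bound : ∀ M h P N len β W → P ℕ.+ N ≡ len → h ℕ.+ h ≤ len ℕ.+ 8 → P ℕ.* M ≤ β →
    2 ℕ.* β ℕ.+ 8 ℕ.* M ≤ W ℕ.+ M ℕ.* (h ℕ.+ h) → M ℕ.* P ≤ M ℕ.* N ℕ.+ W
  difference-bound M h P N len β W P+N len≥ PM≤ W≥ = ℕ.+-cancelʳ-≤ (M ℕ.* P ℕ.+ 8 ℕ.* M) _ _ (begin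
    M ℕ.* P ℕ.+ (M ℕ.* P ℕ.+ 8 ℕ.* M)         ≡⟨ solve 2 (λ M P → M :* P :+ (M :* P :+ con 8 :* M) := con 2 :* (P :* M) :+ con 8 :* M) refl M P ⟩
    2 ℕ.* (P ℕ.* M) ℕ.+ 8 ℕ.* M               ≤⟨ ℕ.+-monoˡ-≤ (8 ℕ.* M) (ℕ.*-monoʳ-≤ 2 PM≤) ⟩
    2 ℕ.* β ℕ.+ 8 ℕ.* M                       ≤⟨ W≥ ⟩
    W ℕ.+ M ℕ.* (h ℕ.+ h)                     ≤⟨ ℕ.+-monoʳ-≤ W (ℕ.*-monoʳ-≤ M len≥) ⟩
    W ℕ.+ M ℕ.* (len ℕ.+ 8)                   ≡⟨ cong (λ l → W ℕ.+ M ℕ.* (l ℕ.+ 8)) P+N ⟨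
    W ℕ.+ M ℕ.* (P ℕ.+ N ℕ.+ 8)               ≡⟨ solve 4 (λ W M P N → W :+ M :* (P :+ N :+ con 8) := M :* N :+ W :+ (M :* P :+ con 8 :* M)) refl W M P N ⟩
    M ℕ.* N ℕ.+ W ℕ.+ (M ℕ.* P ℕ.+ 8 ℕ.* M)   ∎)
    where
    open ℕ.≤-Reasoning
    open +-*-Solver

  -- The main term M₀ len is about 2 M₀ h = (V₀ + 3) h: the part V₀ h pays for the weights and 3 h
  -- for all constant terms.
  margin : ∀ v k len h → v ≤ V₀ → k ≤ 128 → 4 ℕ.+ A₀ ≤ h → h ℕ.+ h ≤ len ℕ.+ 8 → v ℕ.* h ℕ.+ k ℕ.* C₀ < M₀ ℕ.* len
  margin v k len h v≤ k≤ h≥ len≥ = ℕ.+-cancelʳ-< (8 ℕ.* M₀) _ _ (begin-strict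
    v ℕ.* h ℕ.+ k ℕ.* C₀ ℕ.+ 8 ℕ.* M₀          ≤⟨ ℕ.+-monoˡ-≤ (8 ℕ.* M₀) (ℕ.+-mono-≤ (ℕ.*-monoˡ-≤ h v≤) (ℕ.*-monoˡ-≤ C₀ k≤)) ⟩
    V₀ ℕ.* h ℕ.+ 128 ℕ.* C₀ ℕ.+ 8 ℕ.* M₀       ≡⟨ ℕ.+-assoc (V₀ ℕ.* h) (128 ℕ.* C₀) (8 ℕ.* M₀) ⟩
    V₀ ℕ.* h ℕ.+ (128 ℕ.* C₀ ℕ.+ 8 ℕ.* M₀)     <⟨ ℕ.+-monoʳ-< (V₀ ℕ.* h) (ℕ.<-≤-trans gap (ℕ.*-monoʳ-≤ 3 h≥)) ⟩
    V₀ ℕ.* h ℕ.+ 3 ℕ.* h                       ≡⟨ ℕ.*-distribʳ-+ h V₀ 3 ⟨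
    (V₀ ℕ.+ 3) ℕ.* h                           ≡⟨ cong (ℕ._* h) V₀≡ ⟩
    2 ℕ.* M₀ ℕ.* h                             ≡⟨ solve 2 (λ M h → con 2 :* M :* h := M :* (h :+ h)) refl M₀ h ⟩
    M₀ ℕ.* (h ℕ.+ h)                           ≤⟨ ℕ.*-monoʳ-≤ M₀ len≥ ⟩
    M₀ ℕ.* (len ℕ.+ 8)                         ≡⟨ solve 2 (λ M l → M :* (l :+ con 8) := M :* l :+ con 8 :* M) refl M₀ len ⟩
    M₀ ℕ.* len ℕ.+ 8 ℕ.* M₀                    ∎)
    where
    open ℕ.≤-Reasoning
    open +-*-Solver

  J-arith : ∀ b e → suc (5 ℕ.+ b ℕ.+ e) ℕ.* 2 ≡ 2 ℕ.* b ℕ.+ 12 ℕ.+ 2 ℕ.* e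
  J-arith = solve 2 (λ b e → (con 6 :+ b :+ e) :* con 2 := con 2 :* b :+ con 12 :+ con 2 :* e) refl
    where open +-*-Solver

  module SignPatterns {q : ℕ} (𝔽 : PrimeField q) (d : ℕ) (q≡ : q ≡ suc ((6 ℕ.+ d) ℕ.+ (6 ℕ.+ d))) (d≥ : A₀ ≤ suc (suc d))
      {n : ℕ} (n≤9 : n ≤ 9) (ρs : Vec (Fin q) n) (ρ-unique : Unique (Vec.toList ρs))
      (ρ≢0 : All (λ ρ → ¬ ρ ≡ PrimeField.0# 𝔽) (Vec.toList ρs)) where
    open FieldProperties 𝔽
    open Polynomials 𝔽
    open QuadraticCharacter 𝔽 (6 ℕ.+ d) (s≤s z≤n) q≡
    open RootPolynomials 𝔽 (6 ℕ.+ d) (s≤s z≤n) q≡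
    open CharacterSums 𝔽 d q≡

    -- A total function, so that vectors of signs can be formed; its value - at 0 is a default that
    -- the list `points` never meets.
    sgn : K → Sign
    sgn a with a ^ h ≟K 1#
    ... | yes _ = Sign.+
    ... | no  _ = Sign.-

    sgn-correct : ∀ {a} → ¬ a ≡ 0# → HasSign a (sgn a)
    sgn-correct {a} a≢0 with a ^ h ≟K 1# | has-sign a≢0
    ... | yes p | _          = hasSign p
    ... | no ¬p | Sign.+ , p = ⊥-elim (¬p (power p))
    ... | no ¬p | Sign.- , p = p

    avoiding : List K → List K
    avoiding []       = allFin q
    avoiding (a ∷ as) = filter (λ x → ¬? (x F.≟ a)) (avoiding as)

    avoiding-unique : ∀ as → Unique (avoiding as)
    avoiding-unique []       = Unique.allFin⁺ q
    avoiding-unique (a ∷ as) = Unique.filter⁺ _ (avoiding-unique as)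

    avoiding-length : ∀ as → q ≤ length (avoiding as) ℕ.+ length as
    avoiding-length []       = ℕ.≤-reflexive (sym (trans (ℕ.+-identityʳ _) (L.length-tabulate {n = q} (λ i → i))))
    avoiding-length (a ∷ as) = ℕ.≤-trans (avoiding-length as) (ℕ.≤-trans
      (ℕ.+-monoˡ-≤ (length as) (length-filter-≢ a (avoiding as) (avoiding-unique as)))
      (ℕ.≤-reflexive (sym (ℕ.+-suc _ (length as)))))

    avoiding-correct : ∀ as {u} → u ∈ avoiding as → All (λ a → ¬ u ≡ a) as
    avoiding-correct []       _  = []
    avoiding-correct (a ∷ as) {u} u∈ =
      let u∈' , u≢a = ∈.∈-filter⁻ (λ x → ¬? (x F.≟ a)) {xs = avoiding as} u∈ in u≢a ∷ avoiding-correct as u∈'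

    points : List K
    points = avoiding (Vec.toList ρs)

    signs : K → Vec Sign n
    signs u = Vec.map (λ ρ → sgn (u - ρ)) ρs

    sign-rootPoly : ∀ {n} (μ : Mask n) (ρs : Vec K n) u → All (λ a → ¬ u ≡ a) (Vec.toList ρs) →
      HasSign (ev (rootPoly (select μ ρs)) u) (∏ μ (Vec.map (λ ρ → sgn (u - ρ)) ρs))
    sign-rootPoly []          []       u []        = subst (λ a → HasSign a Sign.+) (sym (ev-const 1# u)) sign-1
    sign-rootPoly (false ∷ μ) (ρ ∷ ρs) u (_ ∷ ps)  = sign-rootPoly μ ρs u ps
    sign-rootPoly (true  ∷ μ) (ρ ∷ ρs) u (u≢ρ ∷ ps) = subst (λ a → HasSign a (∏ (true ∷ μ) (Vec.map (λ ρ → sgn (u - ρ)) (ρ ∷ ρs)))) (sym (trans (ev-⊗ (lin ρ) (rootPoly (select μ ρs)) u) (cong (_* ev (rootPoly (select μ ρs)) u) (ev-lin ρ u))))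
      (sign-* {s = sgn (u - ρ)} {t = ∏ μ (Vec.map (λ ρ → sgn (u - ρ)) ρs)} (sgn-correct (λ z → u≢ρ (a-b≡0 z))) (sign-rootPoly μ ρs u ps))

    -- At most nine of the q = 2 h + 1 elements are removed.
    length-points : h ℕ.+ h ≤ length points ℕ.+ 8
    length-points = ℕ.≤-pred (ℕ.≤-trans (ℕ.≤-reflexive (sym q≡)) (ℕ.≤-trans (avoiding-length (Vec.toList ρs))
      (ℕ.≤-trans (ℕ.+-monoʳ-≤ (length points) (ℕ.≤-trans (ℕ.≤-reflexive (length-toList ρs)) n≤9)) (ℕ.≤-reflexive (ℕ.+-suc _ 8)))))
      where
      length-toList : ∀ {n} (xs : Vec K n) → length (Vec.toList xs) ≡ n
      length-toList []       = refl
      length-toList (_ ∷ xs) = cong suc (length-toList xs)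

    count-bound : ∀ (μ : Mask n) m' → size μ ≡ suc m' → ∀ σ →
      length (filter (λ u → ∏ μ (signs u) Sign.≟ σ) points) ℕ.* M₀ ≤ β h m' M₀
    count-bound μ m' sz σ = go (select μ ρs) refl (trans (length-select μ ρs) sz)
      where
      Z : List K
      Z = filter (λ u → ∏ μ (signs u) Sign.≟ σ) points
      m'≤8 : m' ≤ 8
      m'≤8 = ℕ.≤-pred (ℕ.≤-trans (ℕ.≤-reflexive (sym sz)) (ℕ.≤-trans (size≤ μ) n≤9))
      M≤q : M₀ ≤ q
      M≤q = subst (M₀ ≤_) (sym q≡) (ℕ.≤-trans M₀≤A₀ (ℕ.≤-trans d≥ (ℕ.≤-trans (ℕ.m≤n+m (suc (suc d)) 5) (ℕ.m≤m+n (7 ℕ.+ d) (6 ℕ.+ d)))))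
      -- Naming the selected roots by a variable lets them be matched as a nonempty list, whose head
      -- serves as the simple zero in Stepanov's method.
      go : ∀ as → select μ ρs ≡ as → length as ≡ suc m' → length Z ℕ.* M₀ ≤ β h m' M₀
      go (a ∷ as) eq len = ℕ.≤-trans
        (point-count M₀ (5 ℕ.+ b₀ ℕ.+ excess m') M≤q a as
          (subst Unique eq (Unique-select μ ρs ρ-unique)) (subst (All (λ a → ¬ a ≡ 0#)) eq (All-select μ ρs ρ≢0))
          (subst (_≤ 8) (sym len') m'≤8)
          (subst (λ k → M₀ ℕ.* (suc (suc d) ℕ.+ (5 ℕ.+ b₀ ℕ.+ excess m')) ℕ.+ k ℕ.* tri M₀ < suc (5 ℕ.+ b₀ ℕ.+ excess m') ℕ.* (2 ℕ.* suc (suc d))) (sym len')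
            (few-conditions d M₀ (5 ℕ.+ b₀ ℕ.+ excess m') (excess m') m' (tri M₀)
              (trans (J-arith b₀ (excess m')) (cong (ℕ._+ 2 ℕ.* excess m') (sym M₀≡)))
              d≥ (numeric m' m'≤8)))
          σ Z (Unique.filter⁺ _ (avoiding-unique (Vec.toList ρs)))
          λ {u} u∈ → let u∈' , s = ∈.∈-filter⁻ (λ u → ∏ μ (signs u) Sign.≟ σ) {xs = points} u∈
                         u∉ = avoiding-correct (Vec.toList ρs) u∈'
                     in subst (λ as → All (λ a → ¬ u ≡ a) as × HasSign (ev (rootPoly as) u) σ) eq
                          (All-select μ ρs u∉ , subst (HasSign (ev (rootPoly (select μ ρs)) u)) s (sign-rootPoly μ ρs u u∉)))
        (ℕ.≤-reflexive (trans (cong₂ (λ k r → suc d ℕ.+ h ℕ.* suc k ℕ.+ (5 ℕ.+ b₀ ℕ.+ excess m') ℕ.* r) len' q≡) (trans (point-arith d m' b₀ (excess m'))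
          (cong (λ M → h ℕ.* (M ℕ.+ m' ℕ.+ 2 ℕ.* excess m') ℕ.+ (b₀ ℕ.+ excess m')) (sym M₀≡)))))
        where
        len' : length as ≡ m'
        len' = ℕ.suc-injective len

    excess≤5 : ∀ m' → m' ≤ 8 → excess m' ≤ 5
    excess≤5 m' le = s≤s (ℕ.⌊n/2⌋-mono le)

    sum-bound : ∀ (μ : Mask n) m' → size μ ≡ suc m' → ∀ σ →
      M₀ ℕ.* ∑ (λ u → indicator σ (∏ μ (signs u))) points ≤
      M₀ ℕ.* ∑ (λ u → indicator (Sign.opposite σ) (∏ μ (signs u))) points ℕ.+ (weight m' ℕ.* h ℕ.+ C₀)
    sum-bound μ m' sz σ = difference-bound M₀ h (∑ (λ u → indicator σ (∏ μ (signs u))) points) (∑ (λ u → indicator (Sign.opposite σ) (∏ μ (signs u))) points)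
      (length points) (β h m' M₀) (weight m' ℕ.* h ℕ.+ C₀)
      (∑-both (λ u → ∏ μ (signs u)) σ points) length-points
      (subst (λ k → k ℕ.* M₀ ≤ β h m' M₀) (sym (∑-indicator (λ u → ∏ μ (signs u)) σ points)) (count-bound μ m' sz σ))
      (ℕ.≤-trans (ℕ.≤-reflexive (sum-arith h m' (excess m') M₀ b₀))
        (ℕ.+-monoˡ-≤ (M₀ ℕ.* (h ℕ.+ h)) (ℕ.+-monoʳ-≤ (weight m' ℕ.* h)
          (ℕ.≤-trans (ℕ.+-monoˡ-≤ (8 ℕ.* M₀) (ℕ.+-monoʳ-≤ (2 ℕ.* b₀) (ℕ.*-monoʳ-≤ 2 (excess≤5 m' (ℕ.≤-pred (ℕ.≤-trans (ℕ.≤-reflexive (sym sz)) (ℕ.≤-trans (size≤ μ) n≤9))))))) C₀≥))))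

    open Expansion points signs M₀ weight h C₀ sum-bound public

    pattern-exists : ∀ cs → T (nontrivial₀ cs) → total₀ cs ≤ V₀ → terms cs ≤ 128 →
      ∃[ u ] All (λ ρ → ¬ u ≡ ρ) (Vec.toList ρs) × All (λ (m , s) → ∏ m (signs u) ≡ s) cs
    pattern-exists cs nt tot trm =
      let u , u∈ , conds = realize cs nt (margin (total₀ cs) (terms cs) (length points) h tot trm (ℕ.+-monoʳ-≤ 4 d≥) length-points)
      in u , avoiding-correct (Vec.toList ρs) u∈ , conds

-- The base block, its differences, and the representatives that multiply it

module BaseBlocks where
  open PrimeFields
  open QuadraticResidues
  open SignExpansions using (∑; ∑-+; ∑-cong; indicator)
  open import Data.Nat as ℕ using (ℕ; suc; _<_)
  import Data.Nat.Properties as ℕ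
  open import Data.Nat.DivMod using (_mod_; _%_; _/_; m≡m%n+[m/n]*n; m%n<n)
  open import Data.Sign as Sign using (Sign)
  import Data.Sign.Properties as Sign
  import Data.List.Relation.Unary.Unique.Propositional.Properties as Unique
  import Data.List.Membership.Propositional.Properties as ∈
  open import Data.Sum using (inj₁; inj₂)
  open import Data.Nat.Solver using (module +-*-Solver)
  open import Data.Bool using (Bool; true; false; _∧_; T; if_then_else_; not; T?)
  open import Data.Unit using (tt)
  open import Data.Maybe using (Maybe; just; nothing)
  import Data.Maybe.Properties as Maybe
  open import Data.Fin as F using (Fin; suc; toℕ)
  open import Data.Fin.Patterns
  import Data.Fin.Properties as F
  open import Data.List using (List; []; _∷_; _++_; length; map; concatMap; allFin; filter; cartesianProduct)
  open import Data.Bool.ListAction using (any)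
  import Data.List.Properties as L
  import Data.List as L using (lookup)
  open import Data.List.Relation.Unary.Unique.Propositional using (Unique)
  open import Data.List.Relation.Unary.All as All using (All; []; _∷_)
  import Data.List.Relation.Unary.All.Properties as All
  open import Data.List.Relation.Unary.AllPairs using ([]; _∷_; allPairs?)
  open import Data.List.Relation.Unary.Any using (Any; here; there)
  open import Data.List.Relation.Unary.Any.Properties using (any⁻)
  open import Data.List.Membership.Propositional using (_∈_)
  open import Data.Product using (_,_; _×_; ∃-syntax; proj₁; proj₂)
  import Data.Product.Properties as ×
  open import Data.List.Relation.Binary.Pointwise using (Pointwise; []; _∷_)
  open import Data.Empty using (⊥-elim)
  open import Function using (_∘_)
  open import Relation.Nullary using (¬_; Dec; yes; ¬?; does; toWitness; _→-dec_; _×-dec_)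
  open import Relation.Nullary.Decidable using (dec-true; dec-false)
  open import Relation.Binary using (DecidableEquality; tri<; tri≈; tri>)
  open import Relation.Binary.PropositionalEquality

  ind : Bool → ℕ
  ind b = if b then 1 else 0

  ∑-++ : ∀ {A : Set} (f : A → ℕ) xs ys → ∑ f (xs ++ ys) ≡ ∑ f xs ℕ.+ ∑ f ys
  ∑-++ f []       ys = refl
  ∑-++ f (x ∷ xs) ys = trans (cong (f x ℕ.+_) (∑-++ f xs ys)) (sym (ℕ.+-assoc (f x) _ _))

  ∑-map : ∀ {A B : Set} (f : B → ℕ) (g : A → B) xs → ∑ f (map g xs) ≡ ∑ (f ∘ g) xs
  ∑-map f g []       = refl
  ∑-map f g (x ∷ xs) = cong (f (g x) ℕ.+_) (∑-map f g xs)

  ∑-concatMap : ∀ {A B : Set} (f : B → ℕ) (g : A → List B) xs → ∑ f (concatMap g xs) ≡ ∑ (λ x → ∑ f (g x)) xs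
  ∑-concatMap f g []       = refl
  ∑-concatMap f g (x ∷ xs) = trans (∑-++ f (g x) (concatMap g xs)) (cong (∑ f (g x) ℕ.+_) (∑-concatMap f g xs))

  ∑-0 : ∀ {A : Set} (xs : List A) → ∑ (λ _ → 0) xs ≡ 0
  ∑-0 []       = refl
  ∑-0 (_ ∷ xs) = ∑-0 xs

  ∑-swap : ∀ {A B : Set} (f : A → B → ℕ) xs ys → ∑ (λ x → ∑ (f x) ys) xs ≡ ∑ (λ y → ∑ (λ x → f x y) xs) ys
  ∑-swap f []       ys = sym (∑-0 ys)
  ∑-swap f (x ∷ xs) ys = trans (cong (∑ (f x) ys ℕ.+_) (∑-swap f xs ys)) (sym (∑-+ (f x) (λ y → ∑ (λ x → f x y) xs) ys))

  ∑-*ˡ : ∀ {A : Set} c (f : A → ℕ) xs → ∑ (λ x → c ℕ.* f x) xs ≡ c ℕ.* ∑ f xs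
  ∑-*ˡ c f []       = sym (ℕ.*-zeroʳ c)
  ∑-*ˡ c f (x ∷ xs) = trans (cong (c ℕ.* f x ℕ.+_) (∑-*ˡ c f xs)) (sym (ℕ.*-distribˡ-+ c (f x) _))

  ∑-filter : ∀ {A : Set} {P : A → Set} (P? : ∀ x → Dec (P x)) (f : A → ℕ) xs →
    ∑ f (filter P? xs) ≡ ∑ (λ x → ind (does (P? x)) ℕ.* f x) xs
  ∑-filter P? f []       = refl
  ∑-filter P? f (x ∷ xs) with does (P? x)
  ... | true  = cong₂ ℕ._+_ (sym (ℕ.*-identityˡ (f x))) (∑-filter P? f xs)
  ... | false = ∑-filter P? f xs

  length-filter : ∀ {A : Set} {P : A → Set} (P? : ∀ x → Dec (P x)) xs → length (filter P? xs) ≡ ∑ (λ x → ind (does (P? x))) xs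
  length-filter P? []       = refl
  length-filter P? (x ∷ xs) with does (P? x)
  ... | true  = cong suc (length-filter P? xs)
  ... | false = length-filter P? xs

  ∑-single : ∀ {A : Set} (f : A → ℕ) {w} xs → Unique xs → w ∈ xs → (∀ x → ¬ x ≡ w → f x ≡ 0) → ∑ f xs ≡ f w
  ∑-single f (x ∷ xs) (x∉ ∷ uniq) (here refl) z =
    trans (cong (f x ℕ.+_) (trans (∑-cong xs λ y y∈ → z y λ y≡x → All.lookup x∉ y∈ (sym y≡x)) (∑-0 xs))) (ℕ.+-identityʳ _)
  ∑-single f (x ∷ xs) (x∉ ∷ uniq) (there w∈) z =
    cong₂ ℕ._+_ (z x (All.lookup x∉ w∈)) (∑-single f xs uniq w∈ z)

  unique-map : ∀ {A B : Set} (f : A → B) xs → (∀ {x y} → x ∈ xs → y ∈ xs → f x ≡ f y → x ≡ y) → Unique xs → Unique (map f xs)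
  unique-map f []       inj []          = []
  unique-map f (x ∷ xs) inj (x∉ ∷ uniq) =
    All.map⁺ (All.tabulate λ y∈ e → All.lookup x∉ y∈ (inj (here refl) (there y∈) e)) ∷
    unique-map f xs (λ x∈ y∈ → inj (there x∈) (there y∈)) uniq


  -- Equality of two explicit multisets, decided by evaluation: each entry of one list is found in
  -- the other and removed there.
  module Rearrangement {A : Set} (_==_ : A → A → Bool) (==⇒≡ : ∀ x y → T (x == y) → x ≡ y) where

    remove : A → List A → Maybe (List A)
    remove x []       = nothing
    remove x (y ∷ ys) with x == y | remove x ys
    ... | true  | _        = just ys
    ... | false | just zs  = just (y ∷ zs)
    ... | false | nothing  = nothing

    rearranges : List A → List A → Bool
    rearranges []       []       = true
    rearranges []       (_ ∷ _)  = false
    rearranges (x ∷ xs) ys with remove x ys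
    ... | just zs = rearranges xs zs
    ... | nothing = false

    ∑-remove : ∀ (f : A → ℕ) x ys {zs} → remove x ys ≡ just zs → ∑ f ys ≡ f x ℕ.+ ∑ f zs
    ∑-remove f x (y ∷ ys) e with x == y | ==⇒≡ x y | remove x ys | ∑-remove f x ys
    ∑-remove f x (y ∷ ys) refl | true  | eq | _       | _  = cong (λ z → f z ℕ.+ ∑ f ys) (sym (eq tt))
    ∑-remove f x (y ∷ ys) refl | false | _  | just zs | ih =
      trans (cong (f y ℕ.+_) (ih refl)) (solve 3 (λ a b c → a :+ (b :+ c) := b :+ (a :+ c)) refl (f y) (f x) (∑ f zs))
      where open +-*-Solver

    ∑-rearrange : ∀ (f : A → ℕ) xs ys → T (rearranges xs ys) → ∑ f xs ≡ ∑ f ys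
    ∑-rearrange f []       []  _ = refl
    ∑-rearrange f (x ∷ xs) ys  t with remove x ys in eq
    ... | just zs = trans (cong (f x ℕ.+_) (∑-rearrange f xs zs t)) (sym (∑-remove f x ys eq))

  module Multiplicity {A : Set} (_≟_ : DecidableEquality A) (_−_ : A → A → A) where

    pair : A → A → A → ℕ
    pair g x y = ind (not (does (y ≟ x))) ℕ.* ind (does ((x − y) ≟ g))

    mult-diffs : ∀ g B → mult _≟_ _−_ g (diffs _≟_ _−_ B) ≡ ∑ (λ x → ∑ (pair g x) B) B
    mult-diffs g B = trans (length-filter (λ x → x ≟ g) (diffs _≟_ _−_ B))
      (trans (∑-concatMap is-g (λ x → map (λ y → x − y) (others x)) B) (∑-cong B λ x _ →
        trans (∑-map is-g (λ y → x − y) (others x)) (∑-filter (λ y → ¬? (y ≟ x)) (λ y → is-g (x − y)) B)))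
      where
      is-g : A → ℕ
      is-g x = ind (does (x ≟ g))
      others : A → List A
      others x = filter (λ y → ¬? (y ≟ x)) B

    mult-allDiffs : ∀ g Bs → mult _≟_ _−_ g (allDiffs _≟_ _−_ Bs) ≡ ∑ (λ B → ∑ (λ x → ∑ (pair g x) B) B) Bs
    mult-allDiffs g Bs = trans (length-filter (λ x → x ≟ g) (allDiffs _≟_ _−_ Bs))
      (trans (∑-concatMap (λ x → ind (does (x ≟ g))) (diffs _≟_ _−_) Bs) (∑-cong Bs λ B _ →
        trans (sym (length-filter (λ x → x ≟ g) (diffs _≟_ _−_ B))) (mult-diffs g B)))

  -- The points of the base block: nothing is (0 , 0) and just (j , k) is (± 2^j , i^k y_j), with sign (−1)^k.
  Pt : Set
  Pt = Maybe (Fin 4 × Fin 4)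

  _≟Pt_ : DecidableEquality Pt
  _≟Pt_ = Maybe.≡-dec (×.≡-dec F._≟_ F._≟_)

  abstract
    points : List Pt
    points = nothing ∷ map just (cartesianProduct (allFin 4) (allFin 4))

    points-unique : Unique points
    points-unique = toWitness {a? = allPairs? (λ P R → ¬? (P ≟Pt R)) points} tt

    length-points : length points ≡ 17
    length-points = refl

  -- As a multiset: 0 once and each nonzero square modulo 17 twice, as 2 has order 8 and 2⁴ = - 1.
  -- This is a Paley strong difference family: every d, 0 included, is a difference of two distinct
  -- points of the block exactly sixteen times.
  xc : Pt → Fin 17
  xc nothing         = 0F
  xc (just (j , k)) = lookup j k
    where
    double : Fin 4 → ℕ
    double 0F = 1
    double 1F = 2
    double 2F = 4
    double 3F = 8
    lookup : Fin 4 → Fin 4 → Fin 17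
    lookup j 0F = double j mod 17
    lookup j 1F = (17 ℕ.∸ double j) mod 17
    lookup j 2F = double j mod 17
    lookup j 3F = (17 ℕ.∸ double j) mod 17

  infixl 6 _⊞_ _⊟_
  _⊞_ _⊟_ : Fin 4 → Fin 4 → Fin 4
  a ⊞ b = (toℕ a ℕ.+ toℕ b) mod 4
  a ⊟ b = (toℕ a ℕ.+ (4 ℕ.∸ toℕ b)) mod 4

  -- mono j stands for y_j and diff j l r for y_j − i^r y_l.
  data Form : Set where
    mono : Fin 4 → Form
    diff : Fin 4 → Fin 4 → Fin 4 → Form

  -- A difference y_P − y_R of two points as a power of i times a form.
  sameRay : Fin 4 → Fin 4 → Fin 4 → Maybe (Form × Fin 4)
  sameRay j k 0F = nothing
  sameRay j k 1F = just (diff j j 3F , k ⊞ 3F)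
  sameRay j k 2F = just (diff j j 2F , k)
  sameRay j k 3F = just (diff j j 3F , k)

  -- The two indices are put in order at the price of - 1 = i², and the remaining power of i is
  -- extracted; equal points give `nothing`.
  form : Pt → Pt → Maybe (Form × Fin 4)
  form nothing        nothing        = nothing
  form nothing        (just (l , m)) = just (mono l , m ⊞ 2F)
  form (just (j , k)) nothing        = just (mono j , k)
  form (just (j , k)) (just (l , m)) with F.compare j l
  ... | F.equal _       = sameRay j k (m ⊟ k)
  ... | F.less _ _      = just (diff j l (m ⊟ k) , k)
  ... | F.greater _ _   = just (diff l j (k ⊟ m) , m ⊞ 2F)

  -- The row of index d lists the forms that occur, up to powers of i, over the difference d of
  -- first coordinates. The first row stems from distinct points with the same first coordinate.
  quadruples : List (List Form)
  quadruples =
    (diff 0F 0F 2F ∷ diff 1F 1F 2F ∷ diff 2F 2F 2F ∷ diff 3F 3F 2F ∷ []) ∷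
    (mono 0F ∷ diff 3F 3F 3F ∷ diff 0F 1F 0F ∷ diff 0F 1F 2F ∷ []) ∷
    (mono 1F ∷ diff 0F 0F 3F ∷ diff 1F 2F 0F ∷ diff 1F 2F 2F ∷ []) ∷
    (diff 0F 1F 1F ∷ diff 0F 1F 3F ∷ diff 0F 2F 0F ∷ diff 0F 2F 2F ∷ []) ∷
    (mono 2F ∷ diff 1F 1F 3F ∷ diff 2F 3F 0F ∷ diff 2F 3F 2F ∷ []) ∷
    (diff 0F 2F 1F ∷ diff 0F 2F 3F ∷ diff 2F 3F 1F ∷ diff 2F 3F 3F ∷ []) ∷
    (diff 1F 2F 1F ∷ diff 1F 2F 3F ∷ diff 1F 3F 0F ∷ diff 1F 3F 2F ∷ []) ∷
    (diff 0F 3F 0F ∷ diff 0F 3F 2F ∷ diff 1F 3F 1F ∷ diff 1F 3F 3F ∷ []) ∷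
    (mono 3F ∷ diff 2F 2F 3F ∷ diff 0F 3F 1F ∷ diff 0F 3F 3F ∷ []) ∷ []

  _==_ : Form × Fin 4 → Form × Fin 4 → Bool
  (mono j , e)     == (mono j' , e')       = does (j F.≟ j') ∧ does (e F.≟ e')
  (diff j l r , e) == (diff j' l' r' , e') = (does (j F.≟ j') ∧ does (l F.≟ l')) ∧ (does (r F.≟ r') ∧ does (e F.≟ e'))
  (mono _ , _)     == (diff _ _ _ , _)     = false
  (diff _ _ _ , _) == (mono _ , _)         = false

  ==⇒≡ : ∀ x y → T (x == y) → x ≡ y
  ==⇒≡ (mono j , e) (mono j' , e') t with j F.≟ j' | e F.≟ e'
  ... | yes refl | yes refl = refl
  ==⇒≡ (diff j l r , e) (diff j' l' r' , e') t with j F.≟ j' | l F.≟ l' | r F.≟ r' | e F.≟ e'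
  ... | yes refl | yes refl | yes refl | yes refl = refl

  open Rearrangement _==_ ==⇒≡

  expand : List Form → List (Form × Fin 4)
  expand = concatMap (λ a → map (a ,_) (allFin 4))

  toList : Maybe (Form × Fin 4) → List (Form × Fin 4)
  toList nothing  = []
  toList (just a) = a ∷ []

  entries : Fin 17 → List (Form × Fin 4)
  entries d = concatMap (λ P → concatMap (λ R → if does (subₙ (xc P) (xc R) F.≟ d) then toList (form P R) else []) points) points

  -- The smaller of d and 17 - d: exchanging the two points negates d and multiplies the second
  -- coordinate by i².
  index : Fin 17 → Fin 9
  index d = (toℕ d ℕ.⊓ (17 ℕ.∸ toℕ d)) mod 9

  quadruple : Fin 17 → List Form
  quadruple d = L.lookup quadruples (index d)

  abstract
    -- The symmetry (x , z) ↦ (- x , i z) followed by exchanging the two points fixes d and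
    -- multiplies the difference by - i, so the sixteen differences over d form full orbits under
    -- powers of i. All seventeen values of d are checked by evaluation.
    entries-quadruple : ∀ d → T (rearranges (entries d) (expand (quadruple d)))
    entries-quadruple = toWitness {a? = F.all? λ d → T? (rearranges (entries d) (expand (quadruple d)))} tt

  ⊟-⊞ : ∀ m k → m ≡ k ⊞ (m ⊟ k)
  ⊟-⊞ = toWitness {a? = F.all? λ m → F.all? λ k → m F.≟ k ⊞ (m ⊟ k)} tt

  module FormValues {q : ℕ} (𝔽 : PrimeField q) (i : Fin q) (i*i≡-1 : PrimeField._*_ 𝔽 i i ≡ PrimeField.-_ 𝔽 (PrimeField.1# 𝔽))
      (y : Fin 4 → Fin q) where
    open FieldProperties 𝔽
    open Fermat 𝔽 using (^-+; ^-*; 1^)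

    ipow : Fin 4 → K
    ipow e = i ^ toℕ e

    ipow1 : ipow 1F ≡ i
    ipow1 = *-identityʳ i

    ipow2 : ipow 2F ≡ - 1#
    ipow2 = trans (cong (i *_) ipow1) i*i≡-1

    -1*-1 : - 1# * - 1# ≡ 1#
    -1*-1 = trans (sym (-‿distribˡ-* 1# (- 1#))) (trans (cong (λ c → - c) (*-identityˡ _)) (-‿involutive 1#))

    ipow3 : ipow 3F ≡ - i
    ipow3 = trans (cong (i *_) ipow2) (trans (sym (-‿distribʳ-* i 1#)) (cong (λ c → - c) (*-identityʳ i)))

    i^4 : i ^ 4 ≡ 1#
    i^4 = trans (^-+ i 2 2) (trans (cong₂ _*_ ipow2 ipow2) -1*-1)

    ipow-⊞ : ∀ a b → ipow (a ⊞ b) ≡ ipow a * ipow b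
    ipow-⊞ a b = trans (cong (i ^_) (F.toℕ-fromℕ< (m%n<n (toℕ a ℕ.+ toℕ b) 4))) (trans (sym (begin
      i ^ m                                        ≡⟨ cong (i ^_) (m≡m%n+[m/n]*n m 4) ⟩
      i ^ (m % 4 ℕ.+ m / 4 ℕ.* 4)                  ≡⟨ ^-+ i (m % 4) (m / 4 ℕ.* 4) ⟩
      i ^ (m % 4) * i ^ (m / 4 ℕ.* 4)              ≡⟨ cong (i ^ (m % 4) *_) (trans (^-* i (m / 4) 4) (trans (cong (_^ (m / 4)) i^4) (1^ (m / 4)))) ⟩
      i ^ (m % 4) * 1#                             ≡⟨ *-identityʳ _ ⟩
      i ^ (m % 4)                                  ∎)) (^-+ i (toℕ a) (toℕ b)))
      where
      open ≡-Reasoning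
      m = toℕ a ℕ.+ toℕ b

    yc : Pt → K
    yc nothing        = 0#
    yc (just (j , k)) = ipow k * y j

    val : Form → K
    val (mono j)     = y j
    val (diff j l r) = y j - ipow r * y l

    neg-ipow : ∀ e a → ipow (e ⊞ 2F) * a ≡ - (ipow e * a)
    neg-ipow e a = trans (cong (_* a) (trans (ipow-⊞ e 2F) (cong (ipow e *_) ipow2)))
      (trans (cong (_* a) (trans (sym (-‿distribʳ-* (ipow e) 1#)) (cong (λ c → - c) (*-identityʳ _)))) (sym (-‿distribˡ-* _ a)))

    sameRay-correct : ∀ j k r {a e} → sameRay j k r ≡ just (a , e) → ipow k * y j - ipow (k ⊞ r) * y j ≡ ipow e * val a
    -- The ratio i is reduced to the ratio i³ by 1 - i = - i (1 + i).
    sameRay-correct j k 1F refl = begin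
      ipow k * y j - ipow (k ⊞ 1F) * y j             ≡⟨ cong (λ c → ipow k * y j - c * y j) (trans (ipow-⊞ k 1F) (cong (ipow k *_) ipow1)) ⟩
      ipow k * y j - ipow k * i * y j                ≡⟨ solve 3 (λ k i y → k :* y :- k :* i :* y := k :* (:- (i :* y) :+ y)) refl (ipow k) i (y j) ⟩
      ipow k * (- (i * y j) + y j)                   ≡⟨ cong (λ c → ipow k * (- (i * y j) + c)) -i*i*y ⟨
      ipow k * (- (i * y j) + - (i * i * y j))       ≡⟨ solve 3 (λ k i y → k :* (:- (i :* y) :+ :- (i :* i :* y)) := k :* (:- i) :* (y :- (:- i) :* y)) refl (ipow k) i (y j) ⟩
      ipow k * - i * (y j - - i * y j)               ≡⟨ cong (λ c → ipow k * c * (y j - c * y j)) ipow3 ⟨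
      ipow k * ipow 3F * (y j - ipow 3F * y j)       ≡⟨ cong (_* (y j - ipow 3F * y j)) (ipow-⊞ k 3F) ⟨
      ipow (k ⊞ 3F) * (y j - ipow 3F * y j)          ∎
      where
      open ≡-Reasoning
      -i*i*y : - (i * i * y j) ≡ y j
      -i*i*y = trans (cong (λ c → - (c * y j)) i*i≡-1) (trans (cong (λ c → - c) (sym (-‿distribˡ-* 1# (y j))))
        (trans (-‿involutive _) (*-identityˡ _)))
    sameRay-correct j k 2F refl = same-⊞ j k 2F
      where
      same-⊞ : ∀ j k r → ipow k * y j - ipow (k ⊞ r) * y j ≡ ipow k * (y j - ipow r * y j)
      same-⊞ j k r = trans (cong (λ c → ipow k * y j - c * y j) (ipow-⊞ k r))
        (solve 3 (λ k r y → k :* y :- k :* r :* y := k :* (y :- r :* y)) refl (ipow k) (ipow r) (y j))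
    sameRay-correct j k 3F refl = trans (cong (λ c → ipow k * y j - c * y j) (ipow-⊞ k 3F))
        (solve 3 (λ k r y → k :* y :- k :* r :* y := k :* (y :- r :* y)) refl (ipow k) (ipow 3F) (y j))

    distinct-rays : ∀ j k l m → ipow k * y j - ipow m * y l ≡ ipow k * (y j - ipow (m ⊟ k) * y l)
    distinct-rays j k l m = trans (cong (λ c → ipow k * y j - c * y l) (trans (cong ipow (⊟-⊞ m k)) (ipow-⊞ k (m ⊟ k))))
      (solve 4 (λ k r y z → k :* y :- k :* r :* z := k :* (y :- r :* z)) refl (ipow k) (ipow (m ⊟ k)) (y j) (y l))

    form-just : ∀ P R {a e} → form P R ≡ just (a , e) → yc P - yc R ≡ ipow e * val a
    form-just nothing (just (l , m)) refl = trans (+-identityˡ _) (sym (neg-ipow m (y l)))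
    form-just (just (j , k)) nothing refl = trans (cong (ipow k * y j +_) -0#≈0#) (+-identityʳ _)
    form-just (just (j , k)) (just (l , m)) e with F.compare j l
    form-just (just (j , k)) (just (l , m)) e    | F.equal _ =
      trans (cong (λ c → ipow k * y j - ipow c * y j) (⊟-⊞ m k)) (sameRay-correct j k (m ⊟ k) e)
    form-just (just (j , k)) (just (l , m)) refl | F.less _ _ = distinct-rays j k l m
    form-just (just (j , k)) (just (l , m)) refl | F.greater _ _ =
      trans (solve 2 (λ a b → a :- b := :- (b :- a)) refl (ipow k * y j) (ipow m * y l))
        (trans (cong (λ c → - c) (distinct-rays l m j k)) (sym (neg-ipow m _)))

  form-nothing : ∀ P R → form P R ≡ nothing → P ≡ R
  form-nothing nothing nothing e = refl
  form-nothing (just (j , k)) (just (l , m)) e with F.compare j l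
  ... | F.equal _ = cong (λ m → just (j , m)) (go (m ⊟ k) refl e)
    where
    k≡m : ∀ m k → m ⊟ k ≡ 0F → k ≡ m
    k≡m = toWitness {a? = F.all? λ m → F.all? λ k → (m ⊟ k F.≟ 0F) →-dec (k F.≟ m)} tt
    go : ∀ r → m ⊟ k ≡ r → sameRay j k r ≡ nothing → k ≡ m
    go 0F e _ = k≡m m k e
    go 1F _ ()
    go 2F _ ()
    go 3F _ ()

  -- Balanced quadruples have nonzero entries, so a form that occurs in one of them cannot vanish.
  -- This will separate the second coordinates of distinct points.
  listed : Maybe (Form × Fin 4) → Bool
  listed nothing        = true
  listed (just (a , _)) = any (any (λ b → (a , 0F) == (b , 0F))) quadruples

  abstract
    forms-listed : All (λ P → All (λ R → T (listed (form P R))) points) points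
    forms-listed = toWitness {a? = All.all? (λ P → All.all? (λ R → T? (listed (form P R))) points) points} tt

  regroup : ∀ c a a' b d d' e → c ℕ.* (a ℕ.* b) ℕ.+ (c ℕ.* (d' ℕ.* e) ℕ.+ (c ℕ.* (a' ℕ.* b) ℕ.+ (c ℕ.* (d ℕ.* e) ℕ.+ 0))) ≡
    c ℕ.* ((a ℕ.+ a') ℕ.* b ℕ.+ (d ℕ.+ d') ℕ.* e)
  regroup = solve 7 (λ c a a' b d d' e → c :* (a :* b) :+ (c :* (d' :* e) :+ (c :* (a' :* b) :+ (c :* (d :* e) :+ con 0))) :=
    c :* ((a :+ a') :* b :+ (d :+ d') :* e)) refl
    where open +-*-Solver

  module Transversal {q : ℕ} (𝔽 : PrimeField q) (n : ℕ) (0<4n : 0 < 4 ℕ.* n) (q≡ : q ≡ suc (4 ℕ.* n ℕ.+ 4 ℕ.* n))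
      (i : Fin q) (i*i≡-1 : PrimeField._*_ 𝔽 i i ≡ PrimeField.-_ 𝔽 (PrimeField.1# 𝔽)) where
    open FieldProperties 𝔽
    open QuadraticCharacter 𝔽 (4 ℕ.* n) 0<4n q≡

    h : ℕ
    h = 4 ℕ.* n

    i-sign : HasSign i Sign.+
    i-sign = sign-fourth-root n refl (FormValues.i^4 𝔽 i i*i≡-1 (λ _ → 0#))

    -1-sign : HasSign (- 1#) Sign.+
    -1-sign = subst (λ a → HasSign a Sign.+) i*i≡-1 (sign-* i-sign i-sign)

    -x≡ : ∀ x → - x ≡ - 1# * x
    -x≡ x = sym (trans (sym (-‿distribˡ-* 1# x)) (cong (λ c → - c) (*-identityˡ x)))

    neg-sign : ∀ {x s} → HasSign x s → HasSign (- x) s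
    neg-sign {x} {s} p = subst (λ a → HasSign a s) (sym (-x≡ x)) (sign-* -1-sign p)

    i*-sign : ∀ {x s} → HasSign x s → HasSign (i * x) s
    i*-sign p = sign-* i-sign p

    i*i* : ∀ x → i * (i * x) ≡ - x
    i*i* x = trans (sym (*-assoc i i x)) (trans (cong (_* x) i*i≡-1) (sym (-x≡ x)))

    i*- : ∀ x → i * - x ≡ - (i * x)
    i*- x = sym (-‿distribʳ-* i x)

    -- An invariant of the pair ± x that tells different pairs apart, so that comparing it with its
    -- value at i x selects one of the pairs ± x and ± i x.
    low : K → ℕ
    low x = toℕ x ℕ.⊓ toℕ (- x)

    low-neg : ∀ x → low (- x) ≡ low x
    low-neg x = trans (cong (λ c → toℕ (- x) ℕ.⊓ toℕ c) (-‿involutive x)) (ℕ.⊓-comm (toℕ (- x)) (toℕ x))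

    Square? : (x : K) → Dec (x ^ h ≡ 1#)
    Square? x = x ^ h ≟K 1#

    Half? : (x : K) → Dec (toℕ x < toℕ (- x))
    Half? x = toℕ x ℕ.<? toℕ (- x)

    Quarter? : (x : K) → Dec (low x < low (i * x))
    Quarter? x = low x ℕ.<? low (i * x)

    -- Representatives of the nonzero squares modulo the fourth roots of unity.
    Rep? : (x : K) → Dec (x ^ h ≡ 1# × toℕ x < toℕ (- x) × low x < low (i * x))
    Rep? x = Square? x ×-dec (Half? x ×-dec Quarter? x)

    reps : List K
    reps = filter Rep? (allFin q)

    χ⁺ half quarter rep : K → ℕ
    χ⁺ x      = ind (does (Square? x))
    half x    = ind (does (Half? x))
    quarter x = ind (does (Quarter? x))
    rep x     = ind (does (Rep? x))

    ind-∧ : ∀ a b → ind (a ∧ b) ≡ ind a ℕ.* ind b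
    ind-∧ false b = refl
    ind-∧ true  b = sym (ℕ.*-identityˡ _)

    rep≡ : ∀ x → rep x ≡ χ⁺ x ℕ.* (half x ℕ.* quarter x)
    rep≡ x = trans (ind-∧ (does (Square? x)) _) (cong (χ⁺ x ℕ.*_) (ind-∧ (does (Half? x)) _))

    trichotomy : ∀ a b → ¬ a ≡ b → ind (does (a ℕ.<? b)) ℕ.+ ind (does (b ℕ.<? a)) ≡ 1
    trichotomy a b a≢b with ℕ.<-cmp a b
    ... | tri< a<b _ b≮a = cong₂ (λ x y → ind x ℕ.+ ind y) (dec-true (a ℕ.<? b) a<b) (dec-false (b ℕ.<? a) b≮a)
    ... | tri≈ _ a≡b _   = ⊥-elim (a≢b a≡b)
    ... | tri> a≮b _ b<a = cong₂ (λ x y → ind x ℕ.+ ind y) (dec-false (a ℕ.<? b) a≮b) (dec-true (b ℕ.<? a) b<a)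

    2≢0 : ¬ 1# + 1# ≡ 0#
    2≢0 e = -1≢1 (trans (solve 1 (λ a → a := (a :+ a) :- a) refl 1#) (trans (cong (_- 1#) e) (+-identityˡ _)))

    x≢-x : ∀ {x} → ¬ x ≡ 0# → ¬ x ≡ - x
    x≢-x {x} x≢0 e = *-nonzero 2≢0 x≢0 (trans (distribʳ x 1# 1#)
      (trans (cong₂ _+_ (*-identityˡ x) (trans (*-identityˡ x) e)) (-‿inverseʳ x)))

    x≢ix : ∀ {x} → ¬ x ≡ 0# → ¬ x ≡ i * x
    x≢ix {x} x≢0 e = x≢-x x≢0 (trans e (trans (cong (i *_) e) (i*i* x)))

    x≢-ix : ∀ {x} → ¬ x ≡ 0# → ¬ x ≡ - (i * x)
    x≢-ix {x} x≢0 e = x≢-x x≢0 (trans e (trans (cong (λ c → - (i * c)) e) (trans (cong (λ c → - c) (i*- (i * x)))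
      (trans (-‿involutive _) (i*i* x)))))

    half-sum : ∀ {x} → ¬ x ≡ 0# → half x ℕ.+ half (- x) ≡ 1
    half-sum {x} x≢0 = trans (cong (λ c → half x ℕ.+ ind (does (toℕ (- x) ℕ.<? toℕ c))) (-‿involutive x))
      (trichotomy (toℕ x) (toℕ (- x)) (x≢-x x≢0 ∘ F.toℕ-injective))

    low≢ : ∀ {x} → ¬ x ≡ 0# → ¬ low x ≡ low (i * x)
    low≢ {x} x≢0 e with ℕ.⊓-sel (toℕ x) (toℕ (- x)) | ℕ.⊓-sel (toℕ (i * x)) (toℕ (- (i * x)))
    ... | inj₁ a | inj₁ b = x≢ix x≢0 (F.toℕ-injective (trans (sym a) (trans e b)))
    ... | inj₁ a | inj₂ b = x≢-ix x≢0 (F.toℕ-injective (trans (sym a) (trans e b)))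
    ... | inj₂ a | inj₁ b = x≢-ix x≢0 (trans (sym (-‿involutive x)) (cong (λ c → - c) (F.toℕ-injective (trans (sym a) (trans e b)))))
    ... | inj₂ a | inj₂ b = x≢ix x≢0 (trans (sym (-‿involutive x)) (trans (cong (λ c → - c) (F.toℕ-injective (trans (sym a) (trans e b)))) (-‿involutive _)))

    quarter-neg : ∀ x → quarter (- x) ≡ quarter x
    quarter-neg x = cong₂ (λ a b → ind (does (a ℕ.<? b))) (low-neg x) (trans (cong low (i*- x)) (low-neg (i * x)))

    quarter-sum : ∀ {x} → ¬ x ≡ 0# → quarter x ℕ.+ quarter (i * x) ≡ 1
    quarter-sum {x} x≢0 = trans (cong (λ c → quarter x ℕ.+ ind (does (low (i * x) ℕ.<? c))) (trans (cong low (i*i* x)) (low-neg x)))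
      (trichotomy (low x) (low (i * x)) (low≢ x≢0))

    χ⁺-sign : ∀ {x s} → HasSign x s → χ⁺ x ≡ indicator Sign.+ s
    χ⁺-sign {x} {Sign.+} p = cong ind (dec-true (Square? x) (power p))
    χ⁺-sign {x} {Sign.-} p = cong ind (dec-false (Square? x) λ e → -1≢1 (trans (sym e) (power p)))

    -- One element is chosen from each of the pairs ± w and ± i w, and then one of the two pairs.
    -- All four elements have the sign of w because i is a square, so a square orbit contains one
    -- representative and a nonsquare orbit none.
    orbit-sum : ∀ {w s} → HasSign w s → rep w ℕ.+ (rep (- (i * w)) ℕ.+ (rep (- w) ℕ.+ (rep (i * w) ℕ.+ 0))) ≡ indicator Sign.+ s
    orbit-sum {w} {s} p = begin
      rep w ℕ.+ (rep (- (i * w)) ℕ.+ (rep (- w) ℕ.+ (rep (i * w) ℕ.+ 0)))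
        ≡⟨ cong₂ ℕ._+_ (expand-rep p refl) (cong₂ ℕ._+_ (expand-rep (neg-sign (i*-sign p)) (quarter-neg (i * w)))
             (cong₂ ℕ._+_ (expand-rep (neg-sign p) (quarter-neg w)) (cong (ℕ._+ 0) (expand-rep (i*-sign p) refl)))) ⟩
      c ℕ.* (half w ℕ.* quarter w) ℕ.+ (c ℕ.* (half (- (i * w)) ℕ.* quarter (i * w)) ℕ.+
        (c ℕ.* (half (- w) ℕ.* quarter w) ℕ.+ (c ℕ.* (half (i * w) ℕ.* quarter (i * w)) ℕ.+ 0)))
        ≡⟨ regroup c (half w) (half (- w)) (quarter w) (half (i * w)) (half (- (i * w))) (quarter (i * w)) ⟩
      c ℕ.* ((half w ℕ.+ half (- w)) ℕ.* quarter w ℕ.+ (half (i * w) ℕ.+ half (- (i * w))) ℕ.* quarter (i * w))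
        ≡⟨ cong (c ℕ.*_) (cong₂ (λ a b → a ℕ.* quarter w ℕ.+ b ℕ.* quarter (i * w)) (half-sum w≢0) (half-sum (*-nonzero i≢0 w≢0))) ⟩
      c ℕ.* (1 ℕ.* quarter w ℕ.+ 1 ℕ.* quarter (i * w))
        ≡⟨ cong (c ℕ.*_) (cong₂ ℕ._+_ (ℕ.*-identityˡ (quarter w)) (ℕ.*-identityˡ (quarter (i * w)))) ⟩
      c ℕ.* (quarter w ℕ.+ quarter (i * w))
        ≡⟨ cong (c ℕ.*_) (quarter-sum w≢0) ⟩
      c ℕ.* 1 ≡⟨ ℕ.*-identityʳ c ⟩
      c ∎
      where
      open ≡-Reasoning
      c = indicator Sign.+ s
      w≢0 : ¬ w ≡ 0#
      w≢0 = sign⇒≢0 p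
      i≢0 : ¬ i ≡ 0#
      i≢0 = sign⇒≢0 i-sign
      expand-rep : ∀ {x b} → HasSign x s → quarter x ≡ b → rep x ≡ c ℕ.* (half x ℕ.* b)
      expand-rep {x} p e = trans (rep≡ x) (cong₂ (λ a b → a ℕ.* (half x ℕ.* b)) (χ⁺-sign p) e)

    hits : K → K → ℕ
    hits z δ = ∑ (λ s → ind (does (s * δ ≟K z))) reps

    hits-0 : ∀ {z} → ¬ z ≡ 0# → hits z 0# ≡ 0
    hits-0 {z} z≢0 = trans (∑-cong reps λ s _ → cong ind (dec-false (s * 0# ≟K z) λ e → z≢0 (trans (sym e) (zeroʳ s)))) (∑-0 reps)

    hits-rep : ∀ {z δ} w → ¬ δ ≡ 0# → w * δ ≡ z → hits z δ ≡ rep w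
    hits-rep {z} {δ} w δ≢0 e = trans (∑-filter Rep? (λ s → ind (does (s * δ ≟K z))) (allFin q))
      (trans (∑-single (λ s → rep s ℕ.* ind (does (s * δ ≟K z))) (allFin q) (Unique.allFin⁺ q) (∈.∈-allFin w)
         λ x x≢w → trans (cong (rep x ℕ.*_) (cong ind (dec-false (x * δ ≟K z) λ e' →
           x≢w (*-cancelˡ δ δ≢0 (trans (*-comm δ x) (trans e' (trans (sym e) (*-comm w δ)))))))) (ℕ.*-zeroʳ (rep x)))
       (trans (cong (rep w ℕ.*_) (cong ind (dec-true (w * δ ≟K z) e))) (ℕ.*-identityʳ (rep w))))

    open FormValues 𝔽 i i*i≡-1 (λ _ → 0#) using (ipow; ipow1; ipow2; ipow3)

    -- s i^e δ = z means s = i^(- e) w for w = z / δ, so the count runs over the orbit of w under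
    -- powers of i and is 1 or 0 according as w is a square or not.
    hits-orbit : ∀ {z δ s ζ} → HasSign δ s → HasSign z ζ → ∑ (λ e → hits z (ipow e * δ)) (allFin 4) ≡ indicator ζ s
    hits-orbit {z} {δ} {s} {ζ} δs zζ = trans
      (cong₂ ℕ._+_ (hits-rep w (scaled 0F) (trans (cong (w *_) (*-identityˡ δ)) wδ))
      (cong₂ ℕ._+_ (hits-rep (- (i * w)) (scaled 1F) (trans (cong (λ c → - (i * w) * (c * δ)) ipow1)
           (trans (solve 3 (λ i w d → :- (i :* w) :* (i :* d) := :- (i :* (i :* (w :* d)))) refl i w δ)
             (trans (cong (λ c → - c) (i*i* (w * δ))) (trans (-‿involutive _) wδ)))))
      (cong₂ ℕ._+_ (hits-rep (- w) (scaled 2F) (trans (cong (λ c → - w * (c * δ)) ipow2)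
           (trans (cong (- w *_) (sym (-x≡ δ))) (trans (solve 2 (λ w d → :- w :* :- d := w :* d) refl w δ) wδ))))
      (cong (ℕ._+ 0) (hits-rep (i * w) (scaled 3F) (trans (cong (λ c → i * w * (c * δ)) ipow3)
           (trans (solve 3 (λ i w d → i :* w :* (:- i :* d) := :- (i :* (i :* (w :* d)))) refl i w δ)
             (trans (cong (λ c → - c) (i*i* (w * δ))) (trans (-‿involutive _) wδ)))))))))
      (trans (orbit-sum w-sign) (signs ζ s))
      where
      δ≢0 : ¬ δ ≡ 0#
      δ≢0 = sign⇒≢0 δs
      scaled : ∀ e → ¬ ipow e * δ ≡ 0#
      scaled e = *-nonzero (^-nonzero (toℕ e) (sign⇒≢0 i-sign)) δ≢0
        where open Fermat 𝔽 using (^-nonzero)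
      δ⁻¹ w : K
      -- The exponent is q - 2.
      δ⁻¹ = δ ^ (h ℕ.+ ℕ.pred h)
      w = z * δ⁻¹
      δ⁻¹*δ : δ⁻¹ * δ ≡ 1#
      δ⁻¹*δ = trans (*-comm δ⁻¹ δ) (trans (cong (δ ^_) (trans (sym (ℕ.+-suc h (ℕ.pred h))) (cong (h ℕ.+_) (ℕ.suc-pred h {{ℕ.>-nonZero 0<4n}}))))
        (trans (^-+ δ h h) (euler δ≢0)))
        where open Fermat 𝔽 using (^-+)
      wδ : w * δ ≡ z
      wδ = trans (*-assoc z δ⁻¹ δ) (trans (cong (z *_) δ⁻¹*δ) (*-identityʳ z))
      w-sign : HasSign w (ζ Sign.* s)
      w-sign = subst (HasSign w) (cancel t s ζ (sign-unique {w * δ} {t Sign.* s} {ζ} (sign-* {w} {δ} {t} {s} wt δs) (subst (λ a → HasSign a ζ) (sym wδ) zζ))) wt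
        where
        signed : ∃[ t ] HasSign w t
        signed = has-sign {w} (λ w≡0 → sign⇒≢0 {z} {ζ} zζ (trans (sym wδ) (trans (cong (_* δ) w≡0) (zeroˡ δ))))
        t = proj₁ signed
        wt = proj₂ signed
        cancel : ∀ t s ζ → t Sign.* s ≡ ζ → t ≡ ζ Sign.* s
        cancel t s _ refl = trans (sym (Sign.*-identityʳ t)) (trans (cong (t Sign.*_) (sym (Sign.s*s≡+ s))) (sym (Sign.*-assoc t s s)))
      signs : ∀ ζ s → indicator Sign.+ (ζ Sign.* s) ≡ indicator ζ s
      signs Sign.+ s = refl
      signs Sign.- Sign.+ = refl
      signs Sign.- Sign.- = refl

    -- Two squares and two nonsquares. The list of signs is existential so that it may come from
    -- algebraic rules for large q and from computed Euler powers for small q.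
    Balanced : List K → Set
    Balanced xs = ∃[ ss ] Pointwise HasSign xs ss × (∀ ζ → ∑ (indicator ζ) ss ≡ 2)

    balanced-hits : ∀ {z ζ} → HasSign z ζ → ∀ xs → Balanced xs → ∑ (λ δ → ∑ (λ e → hits z (ipow e * δ)) (allFin 4)) xs ≡ 2
    balanced-hits {z} {ζ} zζ xs (ss , signs , two) = trans (go signs) (two ζ)
      where
      go : ∀ {xs ss} → Pointwise HasSign xs ss → ∑ (λ δ → ∑ (λ e → hits z (ipow e * δ)) (allFin 4)) xs ≡ ∑ (indicator ζ) ss
      go []       = refl
      go (p ∷ ps) = cong₂ ℕ._+_ (hits-orbit p zζ) (go ps)

    balanced⇒≢0 : ∀ {xs x} → Balanced xs → x ∈ xs → ¬ x ≡ 0#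
    balanced⇒≢0 (ss , signs , _) = go signs
      where
      go : ∀ {xs ss x} → Pointwise HasSign xs ss → x ∈ xs → ¬ x ≡ 0#
      go (p ∷ _)  (here refl) = sign⇒≢0 p
      go (_ ∷ ps) (there x∈)  = go ps x∈

    module _ (y : Fin 4 → K) where
      open FormValues 𝔽 i i*i≡-1 y using (yc; val; form-just)

      Good : Set
      Good = All (λ Q → Balanced (map val Q)) quadruples

      -- Pairs of equal points have difference 0, which is never carried to a nonzero z; they can
      -- therefore be absent from `entries`.
      entries-sum : ∀ {z} → ¬ z ≡ 0# → ∀ d →
        ∑ (λ P → ∑ (λ R → ind (does (subₙ (xc P) (xc R) F.≟ d)) ℕ.* hits z (yc P - yc R)) points) points ≡
        ∑ (λ (a , e) → hits z (ipow e * val a)) (entries d)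
      entries-sum {z} z≢0 d = sym (trans (∑-concatMap f (λ P → concatMap (entry P) points) points)
        (∑-cong points λ P _ → trans (∑-concatMap f (entry P) points) (∑-cong points λ R _ → go P R (does (subₙ (xc P) (xc R) F.≟ d)))))
        where
        f : Form × Fin 4 → ℕ
        f (a , e) = hits z (ipow e * val a)
        entry : Pt → Pt → List (Form × Fin 4)
        entry P R = if does (subₙ (xc P) (xc R) F.≟ d) then toList (form P R) else []
        go : ∀ P R b → ∑ f (if b then toList (form P R) else []) ≡ ind b ℕ.* hits z (yc P - yc R)
        go P R false = refl
        go P R true = go' (form P R) refl
          where
          go' : ∀ m → form P R ≡ m → ∑ f (toList m) ≡ hits z (yc P - yc R) ℕ.+ 0
          go' nothing eq = sym (trans (ℕ.+-identityʳ _) (trans (cong (hits z) (trans (cong (λ R → yc P - yc R) (sym (form-nothing P R eq))) (-‿inverseʳ (yc P)))) (hits-0 z≢0)))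
          go' (just (a , e)) eq = cong (ℕ._+ 0) (cong (hits z) (sym (form-just P R eq)))

      good-count : Good → ∀ {z} → ¬ z ≡ 0# → ∀ d →
        ∑ (λ P → ∑ (λ R → ind (does (subₙ (xc P) (xc R) F.≟ d)) ℕ.* hits z (yc P - yc R)) points) points ≡ 2
      good-count good {z} z≢0 d = trans (entries-sum z≢0 d)
        (trans (∑-rearrange (λ (a , e) → hits z (ipow e * val a)) (entries d) (expand (quadruple d)) (entries-quadruple d))
        (trans (∑-concatMap (λ (a , e) → hits z (ipow e * val a)) (λ a → map (a ,_) (allFin 4)) (quadruple d))
        (trans (sym (∑-map (λ δ → ∑ (λ e → hits z (ipow e * δ)) (allFin 4)) val (quadruple d)))
          (balanced-hits {z} {proj₁ (has-sign z≢0)} (proj₂ (has-sign z≢0)) (map val (quadruple d)) (balanced-at (index d))))))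
        where
        balanced-at : ∀ k → Balanced (map val (L.lookup quadruples k))
        balanced-at k = All.lookup good (∈.∈-lookup {xs = quadruples} k)

      listed⇒≢0 : Good → ∀ a e → T (listed (just (a , e))) → ¬ val a ≡ 0#
      listed⇒≢0 good a e t = go quadruples good (any⁻ _ quadruples t)
        where
        in-list : ∀ Q → Any (λ b → T ((a , 0F) == (b , 0F))) Q → val a ∈ map val Q
        in-list (b ∷ Q) (here t)  = here (cong (λ x → val (proj₁ x)) (==⇒≡ (a , 0F) (b , 0F) t))
        in-list (b ∷ Q) (there f) = there (in-list Q f)
        go : ∀ Qs → All (λ Q → Balanced (map val Q)) Qs → Any (λ Q → T (any (λ b → (a , 0F) == (b , 0F)) Q)) Qs → ¬ val a ≡ 0#
        go (Q ∷ _)  (b ∷ _)  (here t)  = balanced⇒≢0 b (in-list Q (any⁻ _ Q t))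
        go (_ ∷ Qs) (_ ∷ bs) (there f) = go Qs bs f

      good-injective : Good → ∀ P R → P ∈ points → R ∈ points → yc P ≡ yc R → P ≡ R
      good-injective good P R P∈ R∈ yP≡yR = go (form P R) refl (All.lookup (All.lookup forms-listed P∈) R∈)
        where
        open Fermat 𝔽 using (^-nonzero)
        go : ∀ m → form P R ≡ m → T (listed m) → P ≡ R
        go nothing        eq t = form-nothing P R eq
        go (just (a , e)) eq t = ⊥-elim (*-nonzero {ipow e} {val a} (^-nonzero (toℕ e) (sign⇒≢0 {i} {Sign.+} i-sign)) (listed⇒≢0 good a e t)
          (trans (sym (form-just P R eq)) (trans (cong (λ c → yc P - c) (sym yP≡yR)) (-‿inverseʳ (yc P)))))

-- The relative difference family

module Families where
  open import Data.Nat using (ℕ)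
  open import Defs
  open PrimeFields
  open QuadraticResidues
  open SignExpansions using (∑; ∑-cong)
  open BaseBlocks
  open import Data.Nat as ℕ using (ℕ; suc; _<_)
  import Data.Nat.Properties as ℕ
  open import Data.Nat.Primality using (Prime)
  open import Data.Bool using (not)
  open import Data.Fin as F using (Fin; toℕ)
  import Data.Fin.Properties as F
  open import Data.List using (List; length; map; allFin)
  import Data.List.Properties as L
  open import Data.List.Relation.Unary.Unique.Propositional using (Unique)
  open import Data.List.Relation.Unary.All as All using (All)
  import Data.List.Relation.Unary.All.Properties as All
  open import Data.List.Membership.Propositional using (_∈_)
  import Data.List.Membership.Propositional.Properties as ∈
  open import Data.Sign as Sign using (Sign)
  open import Data.Product using (_,_; _×_; proj₁; proj₂; Σ)
  open import Function using (mk⇔)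
  open import Relation.Nullary using (¬_; Dec; yes; no; does; _×-dec_)
  open import Relation.Nullary.Decidable using (dec-false; does-⇔)
  open import Relation.Binary.PropositionalEquality

  module Construction (q : ℕ) (pq : Prime q) (n : ℕ) (0<4n : 0 < 4 ℕ.* n) (q≡ : q ≡ suc (4 ℕ.* n ℕ.+ 4 ℕ.* n)) where
    open IntegersModulo q pq using (primeField; subₙ≡; toℕ-0)
    open FieldProperties primeField

    module Family (i : K) (i*i≡-1 : i * i ≡ - 1#) (y : Fin 4 → K)
        (good : Transversal.Good primeField n 0<4n q≡ i i*i≡-1 y) where
      open Transversal primeField n 0<4n q≡ i i*i≡-1
      open FormValues primeField i i*i≡-1 y using (yc)
      open QuadraticCharacter primeField (4 ℕ.* n) 0<4n q≡ using (sign⇒≢0; hasSign)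
      open Multiplicity (_≟G_ {q}) (subG q pq)

      element : K → Pt → G q
      element s P = xc P , s * yc P

      block : K → List (G q)
      block s = map (element s) points

      blocks : List (List (G q))
      blocks = map block reps

      rep≢0 : ∀ {s} → s ∈ reps → ¬ s ≡ 0#
      rep≢0 {s} s∈ = sign⇒≢0 {s} {Sign.+} (hasSign (proj₁ (proj₂ (∈.∈-filter⁻ Rep? {xs = allFin q} s∈))))

      element-injective : ∀ {s P R} → ¬ s ≡ 0# → P ∈ points → R ∈ points → element s P ≡ element s R → P ≡ R
      element-injective {s} {P} {R} s≢0 P∈ R∈ e = good-injective y good P R P∈ R∈ (*-cancelˡ s s≢0 (cong proj₂ e))

      valid-block : ∀ {s} → s ∈ reps → length (block s) ≡ 17 × Unique (block s)
      valid-block {s} s∈ = trans (L.length-map (element s) points) length-points ,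
        unique-map (element s) points (λ P∈ R∈ → element-injective (rep≢0 s∈) P∈ R∈) points-unique

      difference : ∀ s P R → proj₂ (subG q pq (element s P) (element s R)) ≡ s * (yc P - yc R)
      difference s P R = trans (subₙ≡ (s * yc P) (s * yc R)) (trans (cong (s * yc P +_) (-‿distribʳ-* s (yc R))) (sym (distribˡ s (yc P) (- yc R))))

      mult-blocks : ∀ g → mult _≟G_ (subG q pq) g (allDiffs _≟G_ (subG q pq) blocks) ≡
        ∑ (λ s → ∑ (λ P → ∑ (λ R → pair g (element s P) (element s R)) points) points) reps
      mult-blocks g = trans (mult-allDiffs g blocks) (trans (∑-map (λ B → ∑ (λ x → ∑ (pair g x) B) B) block reps)
        (∑-cong reps λ s _ → trans (∑-map (λ x → ∑ (pair g x) (block s)) (element s) points)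
          (∑-cong points λ P _ → ∑-map (pair g (element s P)) (element s) points)))

      -- Distinct points have distinct second coordinates already in the base block, and
      -- multiplication by a nonzero s preserves this.
      inside : ∀ g → InN pq g → mult _≟G_ (subG q pq) g (allDiffs _≟G_ (subG q pq) blocks) ≡ 0
      inside (d , z) z≡0 = trans (mult-blocks (d , z))
        (trans (∑-cong reps λ s s∈ → trans (∑-cong points λ P P∈ → trans (∑-cong points λ R R∈ →
          vanish s P R s∈ P∈ R∈ (element s R ≟G element s P)) (∑-0 points)) (∑-0 points)) (∑-0 reps))
        where
        z≡0# : z ≡ 0#
        z≡0# = F.toℕ-injective (trans z≡0 (sym toℕ-0))
        vanish : ∀ s P R → s ∈ reps → P ∈ points → R ∈ points → (same : Dec (element s R ≡ element s P)) →
          ind (not (does same)) ℕ.* ind (does (subG q pq (element s P) (element s R) ≟G (d , z))) ≡ 0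
        vanish s P R s∈ P∈ R∈ (yes _)   = refl
        vanish s P R s∈ P∈ R∈ (no R≢P) = cong (λ b → 1 ℕ.* ind b) (dec-false (subG q pq (element s P) (element s R) ≟G (d , z)) λ e →
          *-nonzero (rep≢0 s∈) (λ yP-yR → R≢P (cong (element s) (sym (good-injective y good P R P∈ R∈ (a-b≡0 yP-yR)))))
            (trans (sym (difference s P R)) (trans (cong proj₂ e) z≡0#)))

      -- The first coordinate of a difference does not involve s, so it factors out of the sum over
      -- the representatives, and what is left of that sum is `hits`.
      outside : ∀ g → ¬ InN pq g → mult _≟G_ (subG q pq) g (allDiffs _≟G_ (subG q pq) blocks) ≡ 2
      outside (d , z) z∉N = begin
        mult _≟G_ (subG q pq) (d , z) (allDiffs _≟G_ (subG q pq) blocks)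
          ≡⟨ mult-blocks (d , z) ⟩
        ∑ (λ s → ∑ (λ P → ∑ (λ R → pair (d , z) (element s P) (element s R)) points) points) reps
          ≡⟨ ∑-cong reps (λ s _ → ∑-cong points λ P _ → ∑-cong points λ R _ → split s P R (element s R ≟G element s P)) ⟩
        ∑ (λ s → ∑ (λ P → ∑ (λ R → X P R ℕ.* Z s P R) points) points) reps
          ≡⟨ ∑-swap (λ s P → ∑ (λ R → X P R ℕ.* Z s P R) points) reps points ⟩
        ∑ (λ P → ∑ (λ s → ∑ (λ R → X P R ℕ.* Z s P R) points) reps) points
          ≡⟨ ∑-cong points (λ P _ → ∑-swap (λ s R → X P R ℕ.* Z s P R) reps points) ⟩
        ∑ (λ P → ∑ (λ R → ∑ (λ s → X P R ℕ.* Z s P R) reps) points) points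
          ≡⟨ ∑-cong points (λ P _ → ∑-cong points λ R _ → ∑-*ˡ (X P R) (λ s → Z s P R) reps) ⟩
        ∑ (λ P → ∑ (λ R → X P R ℕ.* hits z (yc P - yc R)) points) points
          ≡⟨ good-count y good z≢0 d ⟩
        2 ∎
        where
        open ≡-Reasoning
        z≢0 : ¬ z ≡ 0#
        z≢0 e = z∉N (trans (cong toℕ e) toℕ-0)
        X : Pt → Pt → ℕ
        X P R = ind (does (subₙ (xc P) (xc R) F.≟ d))
        Z : K → Pt → Pt → ℕ
        Z s P R = ind (does (s * (yc P - yc R) ≟K z))
        split : ∀ s P R → (same : Dec (element s R ≡ element s P)) →
          ind (not (does same)) ℕ.* ind (does (subG q pq (element s P) (element s R) ≟G (d , z))) ≡ X P R ℕ.* Z s P R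
        -- Equal elements are discarded on the left; on the right their difference is 0 and thus not
        -- z.
        split s P R (yes e) = sym (trans (cong (λ b → X P R ℕ.* ind b) (dec-false (s * (yc P - yc R) ≟K z) λ e' →
          z≢0 (trans (sym e') (trans (distribˡ s (yc P) (- yc R)) (trans (cong₂ _+_ (sym (cong proj₂ e)) (sym (-‿distribʳ-* s (yc R)))) (-‿inverseʳ _))))))
          (ℕ.*-zeroʳ (X P R)))
        split s P R (no _) = trans (ℕ.*-identityˡ _) (trans (cong ind (does-⇔
            (mk⇔ (λ e → cong proj₁ e , trans (sym (difference s P R)) (cong proj₂ e))
                 (λ (e₁ , e₂) → cong₂ _,_ e₁ (trans (difference s P R) e₂)))
            (subG q pq (element s P) (element s R) ≟G (d , z)) ((subₙ (xc P) (xc R) F.≟ d) ×-dec (s * (yc P - yc R) ≟K z))))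
          (ind-∧ (does (subₙ (xc P) (xc R) F.≟ d)) _))

      family : Σ (List (List (G q))) (IsRelativeDF _≟G_ (subG q pq) (InN pq) 17 2)
      family = blocks , All.map⁺ (All.tabulate valid-block) , inside , outside

-- Sign conditions for y = (1 , c , ε , ε c)

module SignConditions where
  open PrimeFields
  open QuadraticResidues
  open SignExpansions using (∑; indicator)
  open BaseBlocks
  open import Data.Nat as ℕ using (ℕ; zero; suc; _<_)
  import Data.Nat.Properties as ℕ
  open import Data.Bool using (Bool; true; false; _∧_; _∨_; not; T; T?)
  open import Data.Bool.Properties using (T-∧)
  open import Data.Unit using (tt)
  open import Data.Fin as F using (Fin; toℕ; zero; suc)
  open import Data.Fin.Patterns
  import Data.Fin.Properties as F
  open import Data.List using (List; []; _∷_; map)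
  open import Data.List.Relation.Unary.All as All using (All; []; _∷_)
  open import Data.List.Relation.Binary.Pointwise using (Pointwise; []; _∷_)
  open import Data.Vec as Vec using (Vec; []; _∷_)
  open import Data.Sign as Sign using (Sign)
  import Data.Sign.Properties as Sign
  open import Data.Product using (_,_; ∃-syntax; proj₁; proj₂; Σ)
  open import Function using (_∘_; Equivalence)
  open import Relation.Nullary using (does; toWitness)
  open import Relation.Binary.PropositionalEquality

  -- Signs of ε, 1 + ε², 1 + ε and of c − ρ for ρ = 0, ±1, ±i, ±ε, ±iε, in this order.
  record Signs : Set where
    constructor signs
    field
      ω τ s : Sign
      t : Vec Sign 9

  balancedSigns : List Sign → Bool
  balancedSigns ss = (∑ (indicator Sign.+) ss ℕ.≡ᵇ 2) ∧ (∑ (indicator Sign.-) ss ℕ.≡ᵇ 2)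

  balancedSigns⇒two : ∀ ss → T (balancedSigns ss) → ∀ ζ → ∑ (indicator ζ) ss ≡ 2
  balancedSigns⇒two ss t Sign.+ = ℕ.≡ᵇ⇒≡ _ 2 (proj₁ (Equivalence.to T-∧ t))
  balancedSigns⇒two ss t Sign.- = ℕ.≡ᵇ⇒≡ _ 2 (proj₂ (Equivalence.to (T-∧ {∑ (indicator Sign.+) ss ℕ.≡ᵇ 2}) t))

  module _ (Σ : Signs) where
    open Signs Σ

    root : Fin 9 → Sign
    root = Vec.lookup t

    monoSign : Fin 4 → Sign
    monoSign 0F = Sign.+
    monoSign 1F = root 0F
    monoSign 2F = ω
    monoSign 3F = ω Sign.* root 0F

    sign01 sign02 sign03 sign12 : Fin 4 → Sign
    sign01 0F = root 1F
    sign01 1F = root 4F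
    sign01 2F = root 2F
    sign01 3F = root 3F
    sign02 0F = τ Sign.* s
    sign02 1F = s Sign.* ω
    sign02 2F = s
    sign02 3F = τ Sign.* s Sign.* ω
    sign03 0F = ω Sign.* root 8F
    sign03 1F = ω Sign.* root 6F
    sign03 2F = ω Sign.* root 7F
    sign03 3F = ω Sign.* root 5F
    sign12 0F = root 5F
    sign12 1F = root 7F
    sign12 2F = root 6F
    sign12 3F = root 8F

    -- The last two clauses express y_j - i² y_j = 2 y_j, with 2 a square, and y_j - i³ y_j = (1 +
    -- i) y_j.
    formSign : Form → Sign
    formSign (mono j)        = monoSign j
    formSign (diff 0F 1F r)  = sign01 r
    formSign (diff 0F 2F r)  = sign02 r
    formSign (diff 0F 3F r)  = sign03 r
    formSign (diff 1F 2F r)  = sign12 r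
    formSign (diff 1F 3F r)  = sign02 r Sign.* root 0F
    formSign (diff 2F 3F r)  = ω Sign.* sign01 r
    formSign (diff j  _  2F) = monoSign j
    formSign (diff j  _  _)  = τ Sign.* monoSign j

    allBalanced : List (List Form) → Bool
    allBalanced []       = true
    allBalanced (Q ∷ Qs) = balancedSigns (map formSign Q) ∧ allBalanced Qs

  balanced4 : Sign → Sign → Sign → Sign → Bool
  balanced4 Sign.+ Sign.+ Sign.- Sign.- = true
  balanced4 Sign.+ Sign.- Sign.+ Sign.- = true
  balanced4 Sign.+ Sign.- Sign.- Sign.+ = true
  balanced4 Sign.- Sign.+ Sign.+ Sign.- = true
  balanced4 Sign.- Sign.+ Sign.- Sign.+ = true
  balanced4 Sign.- Sign.- Sign.+ Sign.+ = true
  balanced4 _ _ _ _ = false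

  -- Up to a common sign the nine quadruples reduce to five.
  goodSigns : Signs → Bool
  goodSigns (signs ω τ s (t₀ ∷ t₁ ∷ t₂ ∷ t₃ ∷ t₄ ∷ t₅ ∷ t₆ ∷ t₇ ∷ t₈ ∷ [])) =
    balanced4 Sign.+ t₀ ω (ω Sign.* t₀) ∧ (balanced4 Sign.+ (τ Sign.* ω Sign.* t₀) t₁ t₂ ∧ (balanced4 t₀ τ t₅ t₆ ∧
    (balanced4 t₃ t₄ (τ Sign.* s) s ∧ balanced4 t₇ t₈ (τ Sign.* s Sign.* t₀) (s Sign.* t₀))))

  -- A Boolean, so that statements about all 2^n sign vectors are settled by evaluation.
  forallSigns : ∀ n → (Vec Sign n → Bool) → Bool
  forallSigns zero    P = P []
  forallSigns (suc n) P = forallSigns n (λ t → P (Sign.+ ∷ t)) ∧ forallSigns n (λ t → P (Sign.- ∷ t))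

  forallSigns-sound : ∀ n P → T (forallSigns n P) → ∀ t → T (P t)
  forallSigns-sound zero    P p []            = p
  forallSigns-sound (suc n) P p (Sign.+ ∷ t) = forallSigns-sound n (λ t → P (Sign.+ ∷ t)) (proj₁ (Equivalence.to T-∧ p)) t
  forallSigns-sound (suc n) P p (Sign.- ∷ t) = forallSigns-sound n (λ t → P (Sign.- ∷ t))
    (proj₂ (Equivalence.to (T-∧ {forallSigns n (λ t → P (Sign.+ ∷ t))}) p)) t

  goodSigns⇒balanced : ∀ Σ → T (goodSigns Σ) → T (allBalanced Σ quadruples)
  goodSigns⇒balanced (signs ω τ s t@(_ ∷ _ ∷ _ ∷ _ ∷ _ ∷ _ ∷ _ ∷ _ ∷ _ ∷ [])) =
    decide (goodSigns (signs ω τ s t)) (allBalanced (signs ω τ s t) quadruples) (forallSigns-sound 12 implication check (ω ∷ τ ∷ s ∷ t))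
    where
    implication : Vec Sign 12 → Bool
    implication (ω ∷ τ ∷ s ∷ t) = not (goodSigns (signs ω τ s t)) ∨ allBalanced (signs ω τ s t) quadruples
    abstract
      check : T (forallSigns 12 implication)
      check = tt
    decide : ∀ a b → T (not a ∨ b) → T a → T b
    decide true true _ _ = tt

  -- The forms to which `formSign` applies: indices in order, and for equal indices one of the two
  -- normalized ratios i² and i³.
  Proper : Form → Bool
  Proper (mono _)       = true
  Proper (diff j l r) = (toℕ j ℕ.<ᵇ toℕ l) ∨ (does (j F.≟ l) ∧ (2 ℕ.≤ᵇ toℕ r))

  proper-quadruples : All (All (T ∘ Proper)) quadruples
  proper-quadruples = toWitness {a? = All.all? (All.all? (λ a → T? (Proper a))) quadruples} tt

  module EighthRoot {q : ℕ} (𝔽 : PrimeField q) (n : ℕ) (0<4n : 0 < 4 ℕ.* n) (q≡ : q ≡ suc (4 ℕ.* n ℕ.+ 4 ℕ.* n))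
      (ε : Fin q) (ii≡-1 : IsPrimitiveEighthRoot 𝔽 ε) (c : Fin q) where
    open FieldProperties 𝔽
    open QuadraticCharacter 𝔽 (4 ℕ.* n) 0<4n q≡

    i : K
    i = ε * ε

    open Transversal 𝔽 n 0<4n q≡ i ii≡-1 using (i-sign; -1-sign; neg-sign; i*-sign; Good; Balanced)

    y : Fin 4 → K
    y 0F = 1#
    y 1F = c
    y 2F = ε
    y 3F = ε * c

    open FormValues 𝔽 i ii≡-1 y

    -ii≡1 : - (i * i) ≡ 1#
    -ii≡1 = trans (cong (λ x → - x) ii≡-1) (-‿involutive 1#)

    roots : Vec K 9
    roots = 0# ∷ 1# ∷ - 1# ∷ i ∷ - i ∷ ε ∷ - ε ∷ i * ε ∷ - (i * ε) ∷ []

    sign-by : ∀ {a b s} → a ≡ b → HasSign b s → HasSign a s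
    sign-by e p = subst (λ x → HasSign x _) (sym e) p

    sign-cancel : ∀ {a b u v} → HasSign (a * b) u → HasSign b v → HasSign a (u Sign.* v)
    sign-cancel {a} {b} {u} {v} p r = subst (HasSign a) (cancel w u v (sign-unique (sign-* aw r) p)) aw
      where
      signed : ∃[ w ] HasSign a w
      signed = has-sign {a} (λ a≡0 → sign⇒≢0 p (trans (cong (_* b) a≡0) (zeroˡ b)))
      w : Sign
      w = proj₁ signed
      aw : HasSign a w
      aw = proj₂ signed
      cancel : ∀ w u v → w Sign.* v ≡ u → w ≡ u Sign.* v
      cancel w _ v refl = trans (sym (Sign.*-identityʳ w)) (trans (cong (w Sign.*_) (sym (Sign.s*s≡+ v))) (sym (Sign.*-assoc w v v)))

    module _ (Σ : Signs) (ε-sign : HasSign ε (Signs.ω Σ)) (1+i-sign : HasSign (1# + i) (Signs.τ Σ)) (1+ε-sign : HasSign (1# + ε) (Signs.s Σ))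
        (root-sign : ∀ k → HasSign (c - Vec.lookup roots k) (root Σ k)) where
      open Signs Σ

      -- 1 - i = - i (1 + i), and - i is a square.
      1-i-sign : HasSign (1# - i) τ
      1-i-sign = sign-by (trans (cong (_- i) (sym -ii≡1)) (trans (cong (λ x → - (i * i) - x) (sym (*-identityʳ i)))
        (solve 2 (λ i o → :- (i :* i) :- i :* o := :- (i :* (o :+ i))) refl i 1#))) (neg-sign (i*-sign 1+i-sign))

      -- (1 - ε) (1 + ε) = 1 - i.
      1-ε-sign : HasSign (1# - ε) (τ Sign.* s)
      1-ε-sign = sign-cancel (sign-by (trans (solve 2 (λ o e → (o :- e) :* (o :+ e) := o :* o :- e :* e) refl 1# ε) (cong (_- i) (*-identityˡ 1#))) 1-i-sign) 1+ε-sign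

      -- (1 + i)² = 2 i, and i is a square.
      2-sign : HasSign (1# + 1#) Sign.+
      2-sign = sign-cancel {b = i} (sign-by 2i (subst (HasSign _) (Sign.s*s≡+ τ) (sign-* 1+i-sign 1+i-sign))) i-sign
        where
        2i : (1# + 1#) * i ≡ (1# + i) * (1# + i)
        2i = sym (trans (solve 2 (λ o i → (o :+ i) :* (o :+ i) := o :* o :+ (i :* i :+ (o :+ o) :* i)) refl 1# i)
          (trans (cong₂ _+_ (*-identityˡ 1#) (cong (_+ (1# + 1#) * i) ii≡-1))
          (trans (sym (+-assoc 1# (- 1#) _)) (trans (cong (_+ (1# + 1#) * i) (-‿inverseʳ 1#)) (+-identityˡ _)))))

      -- Multiplication by ε turns 1 - i ε into ε + 1, as i ε² = - 1.
      1-iε-sign : HasSign (1# - i * ε) (s Sign.* ω)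
      1-iε-sign = sign-cancel {b = ε} (sign-by (trans (solve 2 (λ o e → (o :- e :* e :* e) :* e := o :* e :- e :* e :* (e :* e)) refl 1# ε)
        (trans (cong₂ _+_ (*-identityˡ ε) -ii≡1) (+-comm ε 1#))) 1+ε-sign) ε-sign

      1+iε-sign : HasSign (1# + i * ε) (τ Sign.* s Sign.* ω)
      1+iε-sign = sign-cancel {b = ε} (sign-by (trans (solve 2 (λ o e → (o :+ e :* e :* e) :* e := o :* e :+ e :* e :* (e :* e)) refl 1# ε)
        (trans (cong₂ _+_ (*-identityˡ ε) ii≡-1) (solve 2 (λ o e → e :- o := :- (o :- e)) refl 1# ε))) (neg-sign 1-ε-sign)) ε-sign

      iε-sign : HasSign (i * ε) ω
      iε-sign = i*-sign ε-sign

      mono-sign : ∀ j → HasSign (y j) (monoSign Σ j)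
      mono-sign 0F = sign-1
      mono-sign 1F = sign-by (trans (sym (+-identityʳ c)) (cong (c +_) (sym -0#≈0#))) (root-sign 0F)
      mono-sign 2F = ε-sign
      mono-sign 3F = sign-* ε-sign (mono-sign 1F)

      rotate : ∀ r a b → a - ipow r * b ≡ Vec.lookup ((a - b) ∷ (a - i * b) ∷ (a + b) ∷ (a + i * b) ∷ []) r
      rotate 0F a b = cong (λ x → a - x) (*-identityˡ b)
      rotate 1F a b = cong (λ x → a - x * b) ipow1
      rotate 2F a b = trans (cong (λ x → a - x * b) ipow2) (cong (a +_) (trans (cong (λ x → - x) (trans (sym (-‿distribˡ-* 1# b)) (cong (λ x → - x) (*-identityˡ b)))) (-‿involutive b)))
      rotate 3F a b = trans (cong (λ x → a - x * b) ipow3) (solve 3 (λ a i b → a :- (:- i) :* b := a :+ i :* b) refl a i b)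

      -- Writing 1 as - i² = - ε⁴ turns 1 + x into the product of some c - ρ with a factor of known
      -- sign.
      with-ii : ∀ x {b s} → - (i * i) + x ≡ b → HasSign b s → HasSign (1# + x) s
      with-ii x e p = sign-by (trans (cong (_+ x) (sym -ii≡1)) e) p

      sign-01 : ∀ r → HasSign (1# - ipow r * c) (sign01 Σ r)
      sign-01 r = sign-by (rotate r 1# c) (go r)
        where
        go : ∀ r → HasSign (Vec.lookup ((1# - c) ∷ (1# - i * c) ∷ (1# + c) ∷ (1# + i * c) ∷ []) r) (sign01 Σ r)
        go 0F = sign-by (solve 2 (λ o c → o :- c := :- (c :- o)) refl 1# c) (neg-sign (root-sign 1F))
        go 1F = with-ii (- (i * c)) (solve 2 (λ i c → :- (i :* i) :+ :- (i :* c) := :- (i :* (c :- :- i))) refl i c) (neg-sign (i*-sign (root-sign 4F)))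
        go 2F = sign-by (solve 2 (λ o c → o :+ c := c :- :- o) refl 1# c) (root-sign 2F)
        go 3F = with-ii (i * c) (solve 2 (λ i c → :- (i :* i) :+ i :* c := i :* (c :- i)) refl i c) (i*-sign (root-sign 3F))

      sign-02 : ∀ r → HasSign (1# - ipow r * ε) (sign02 Σ r)
      sign-02 r = sign-by (rotate r 1# ε) (go r)
        where
        go : ∀ r → HasSign (Vec.lookup ((1# - ε) ∷ (1# - i * ε) ∷ (1# + ε) ∷ (1# + i * ε) ∷ []) r) (sign02 Σ r)
        go 0F = 1-ε-sign
        go 1F = 1-iε-sign
        go 2F = 1+ε-sign
        go 3F = 1+iε-sign

      sign-03 : ∀ r → HasSign (1# - ipow r * (ε * c)) (sign03 Σ r)
      sign-03 r = sign-by (rotate r 1# (ε * c)) (go r)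
        where
        go : ∀ r → HasSign (Vec.lookup ((1# - ε * c) ∷ (1# - i * (ε * c)) ∷ (1# + ε * c) ∷ (1# + i * (ε * c)) ∷ []) r) (sign03 Σ r)
        go 0F = with-ii (- (ε * c)) (solve 2 (λ e c → :- ((e :* e) :* (e :* e)) :+ :- (e :* c) := :- (e :* (c :- :- (e :* e :* e)))) refl ε c)
                  (neg-sign (sign-* ε-sign (root-sign 8F)))
        go 1F = with-ii (- (i * (ε * c))) (solve 2 (λ e c → :- ((e :* e) :* (e :* e)) :+ :- (e :* e :* (e :* c)) := :- (e :* e :* e :* (c :- :- e))) refl ε c)
                  (neg-sign (sign-* iε-sign (root-sign 6F)))
        go 2F = with-ii (ε * c) (solve 2 (λ e c → :- ((e :* e) :* (e :* e)) :+ e :* c := e :* (c :- e :* e :* e)) refl ε c)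
                  (sign-* ε-sign (root-sign 7F))
        go 3F = with-ii (i * (ε * c)) (solve 2 (λ e c → :- ((e :* e) :* (e :* e)) :+ e :* e :* (e :* c) := e :* e :* e :* (c :- e)) refl ε c)
                  (sign-* iε-sign (root-sign 5F))

      sign-12 : ∀ r → HasSign (c - ipow r * ε) (sign12 Σ r)
      sign-12 r = sign-by (rotate r c ε) (go r)
        where
        go : ∀ r → HasSign (Vec.lookup ((c - ε) ∷ (c - i * ε) ∷ (c + ε) ∷ (c + i * ε) ∷ []) r) (sign12 Σ r)
        go 0F = root-sign 5F
        go 1F = root-sign 7F
        go 2F = sign-by (cong (c +_) (sym (-‿involutive ε))) (root-sign 6F)
        go 3F = sign-by (cong (c +_) (sym (-‿involutive (i * ε)))) (root-sign 8F)

      sign-jj2 : ∀ j → HasSign (y j - ipow 2F * y j) (monoSign Σ j)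
      sign-jj2 j = sign-by (trans (rotate 2F (y j) (y j)) (trans (cong₂ _+_ (sym (*-identityˡ (y j))) (sym (*-identityˡ (y j)))) (sym (distribʳ (y j) 1# 1#))))
        (sign-* 2-sign (mono-sign j))

      sign-jj3 : ∀ j → HasSign (y j - ipow 3F * y j) (τ Sign.* monoSign Σ j)
      sign-jj3 j = sign-by (trans (rotate 3F (y j) (y j)) (trans (cong (_+ i * y j) (sym (*-identityˡ (y j)))) (sym (distribʳ (y j) 1# i))))
        (sign-* 1+i-sign (mono-sign j))

      form-sign : ∀ a → T (Proper a) → HasSign (val a) (formSign Σ a)
      form-sign (mono j)         _ = mono-sign j
      form-sign (diff 0F 1F r)   _ = sign-01 r
      form-sign (diff 0F 2F r)   _ = sign-02 r
      form-sign (diff 0F 3F r)   _ = sign-03 r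
      form-sign (diff 1F 2F r)   _ = sign-12 r
      form-sign (diff 1F 3F r)   _ = sign-by (trans (cong (_- ipow r * (ε * c)) (sym (*-identityˡ c)))
        (solve 4 (λ o c p e → o :* c :- p :* (e :* c) := (o :- p :* e) :* c) refl 1# c (ipow r) ε)) (sign-* (sign-02 r) (mono-sign 1F))
      form-sign (diff 2F 3F r)   _ = sign-by (trans (cong (_- ipow r * (ε * c)) (sym (*-identityʳ ε)))
        (solve 4 (λ o c p e → e :* o :- p :* (e :* c) := e :* (o :- p :* c)) refl 1# c (ipow r) ε)) (sign-* ε-sign (sign-01 r))
      form-sign (diff 0F 0F 2F)  _ = sign-jj2 0F
      form-sign (diff 1F 1F 2F)  _ = sign-jj2 1F
      form-sign (diff 2F 2F 2F)  _ = sign-jj2 2F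
      form-sign (diff 3F 3F 2F)  _ = sign-jj2 3F
      form-sign (diff 0F 0F 3F)  _ = sign-jj3 0F
      form-sign (diff 1F 1F 3F)  _ = sign-jj3 1F
      form-sign (diff 2F 2F 3F)  _ = sign-jj3 2F
      form-sign (diff 3F 3F 3F)  _ = sign-jj3 3F

      good : T (goodSigns Σ) → Good y
      good ok = go quadruples proper-quadruples (goodSigns⇒balanced Σ ok)
        where
        pointwise : ∀ Q → All (T ∘ Proper) Q → Pointwise HasSign (map val Q) (map (formSign Σ) Q)
        pointwise []      []       = []
        pointwise (a ∷ Q) (p ∷ ps) = form-sign a p ∷ pointwise Q ps
        go : ∀ Qs → All (All (T ∘ Proper)) Qs → T (allBalanced Σ Qs) → All (λ Q → Balanced (map val Q)) Qs
        go []       []       t = []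
        go (Q ∷ Qs) (p ∷ ps) t =
          let t₁ , t₂ = Equivalence.to (T-∧ {balancedSigns (map (formSign Σ) Q)}) t
          in (map (formSign Σ) Q , pointwise Q p , balancedSigns⇒two (map (formSign Σ) Q) t₁) ∷ go Qs ps t₂

-- Large fields

module LargeFields where
  open PrimeFields
  open QuadraticResidues
  open SignExpansions using (Mask; Condition; ∏; A₀; A₀≤; V₀≥)
  open PatternExistence using (module SignPatterns)
  open BaseBlocks
  open SignConditions
  open import Data.Nat as ℕ using (ℕ; zero; suc; z≤n; s≤s; _≤_; _<_)
  import Data.Nat.Properties as ℕ
  open import Data.Nat.Divisibility using (∣⇒≤)
  open import Data.Bool using (Bool; true; false; _∨_; not; T)
  open import Data.Unit using (tt)
  open import Data.Fin using (Fin; zero; suc)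
  open import Data.Fin.Patterns
  open import Data.List using (List; []; _∷_; map)
  open import Data.List.Relation.Unary.All as All using (All; []; _∷_)
  import Data.List.Relation.Unary.All.Properties as All
  open import Data.List.Relation.Unary.AllPairs using ([]; _∷_; allPairs?)
  open import Data.List.Relation.Unary.Unique.Propositional using (Unique)
  import Data.List.Relation.Unary.Unique.Propositional.Properties as Unique
  open import Data.Bool.ListAction using (all)
  open import Data.Vec as Vec using (Vec; []; _∷_)
  open import Data.Sign as Sign using (Sign)
  import Data.Sign.Properties as Sign
  open import Data.Product using (_,_; _×_; ∃-syntax; proj₁; proj₂; Σ)
  open import Data.Sum using (_⊎_; inj₁; inj₂; [_,_]′)
  open import Data.Empty using (⊥-elim)
  open import Relation.Nullary using (¬_; yes; no; does; toWitness; ¬?)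
  open import Relation.Binary using (tri<; tri≈; tri>)
  open import Relation.Binary.PropositionalEquality

  -- The positions refer to the order 0, 1, −1, i, −i, ε, −ε, iε, −iε of the roots.
  m₀ m₃₄ m₇₈ m₁₂ m₅ m₆ m₁ m₂ m₅₆ m₃ m₄ m₇ m₈ m₃₅ m₄₅ m₃₇ m₃₈ : Mask 9
  m₀ = true ∷ false ∷ false ∷ false ∷ false ∷ false ∷ false ∷ false ∷ false ∷ []
  m₃₄ = false ∷ false ∷ false ∷ true ∷ true ∷ false ∷ false ∷ false ∷ false ∷ []
  m₇₈ = false ∷ false ∷ false ∷ false ∷ false ∷ false ∷ false ∷ true ∷ true ∷ []
  m₁₂ = false ∷ true ∷ true ∷ false ∷ false ∷ false ∷ false ∷ false ∷ false ∷ []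
  m₅ = false ∷ false ∷ false ∷ false ∷ false ∷ true ∷ false ∷ false ∷ false ∷ []
  m₆ = false ∷ false ∷ false ∷ false ∷ false ∷ false ∷ true ∷ false ∷ false ∷ []
  m₁ = false ∷ true ∷ false ∷ false ∷ false ∷ false ∷ false ∷ false ∷ false ∷ []
  m₂ = false ∷ false ∷ true ∷ false ∷ false ∷ false ∷ false ∷ false ∷ false ∷ []
  m₅₆ = false ∷ false ∷ false ∷ false ∷ false ∷ true ∷ true ∷ false ∷ false ∷ []
  m₃ = false ∷ false ∷ false ∷ true ∷ false ∷ false ∷ false ∷ false ∷ false ∷ []
  m₄ = false ∷ false ∷ false ∷ false ∷ true ∷ false ∷ false ∷ false ∷ false ∷ []
  m₇ = false ∷ false ∷ false ∷ false ∷ false ∷ false ∷ false ∷ true ∷ false ∷ []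
  m₈ = false ∷ false ∷ false ∷ false ∷ false ∷ false ∷ false ∷ false ∷ true ∷ []
  m₃₅ = false ∷ false ∷ false ∷ true ∷ false ∷ true ∷ false ∷ false ∷ false ∷ []
  m₄₅ = false ∷ false ∷ false ∷ false ∷ true ∷ true ∷ false ∷ false ∷ false ∷ []
  m₃₇ = false ∷ false ∷ false ∷ true ∷ false ∷ false ∷ false ∷ true ∷ false ∷ []
  m₃₈ = false ∷ false ∷ false ∷ true ∷ false ∷ false ∷ false ∷ false ∷ true ∷ []

  -- For τ = - the last two quadruples of `goodSigns` are balanced as soon as t₃ t₄ = t₇ t₈ = -. For
  -- τ = + they fix all four of these signs, which together with ω = - would amount to eight
  -- conditions. In that case four of the signs, t₃, t₄, t₅, t₆ or t₃, t₄, t₇, t₈, are only required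
  -- to be equal: their common value decides whether ε or ε³ succeeds. So seven conditions suffice,
  -- and the expansions have at most 2⁷ terms.
  conditions : Sign → Sign → Sign → List (Condition 9)
  conditions Sign.- Sign.- _ =
    (m₀ , Sign.-) ∷ (m₃₄ , Sign.-) ∷ (m₇₈ , Sign.-) ∷ (m₁₂ , Sign.-) ∷
    (m₅ , Sign.+) ∷ (m₆ , Sign.+) ∷ []
  conditions Sign.+ Sign.- _ =
    (m₀ , Sign.-) ∷ (m₁ , Sign.-) ∷ (m₂ , Sign.-) ∷ (m₅ , Sign.+) ∷ (m₆ , Sign.+) ∷
    (m₃₄ , Sign.-) ∷ (m₇₈ , Sign.-) ∷ []
  conditions Sign.+ Sign.+ s =
    (m₀ , Sign.-) ∷ (m₁₂ , Sign.-) ∷ (m₅₆ , Sign.-) ∷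
    (m₃ , Sign.opposite s) ∷ (m₄ , Sign.opposite s) ∷ (m₇ , s) ∷ (m₈ , s) ∷ []
  conditions Sign.- Sign.+ Sign.+ =
    (m₀ , Sign.+) ∷ (m₁₂ , Sign.-) ∷ (m₇ , Sign.-) ∷ (m₈ , Sign.-) ∷
    (m₅₆ , Sign.+) ∷ (m₃₅ , Sign.+) ∷ (m₄₅ , Sign.+) ∷ []
  conditions Sign.- Sign.+ Sign.- =
    (m₀ , Sign.+) ∷ (m₁₂ , Sign.-) ∷ (m₅ , Sign.-) ∷ (m₆ , Sign.-) ∷
    (m₃₄ , Sign.+) ∷ (m₃₇ , Sign.+) ∷ (m₃₈ , Sign.+) ∷ []

  satisfied : List (Condition 9) → Vec Sign 9 → Bool
  satisfied cs t = all (λ (m , s) → does (∏ m t Sign.≟ s)) cs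

  -- The effect of replacing ε by ε³ = iε, hence i by −i.
  twist : Signs → Signs
  twist (signs ω τ s (t₀ ∷ t₁ ∷ t₂ ∷ t₃ ∷ t₄ ∷ t₅ ∷ t₆ ∷ t₇ ∷ t₈ ∷ [])) =
    signs ω τ (τ Sign.* s Sign.* ω) (t₀ ∷ t₁ ∷ t₂ ∷ t₄ ∷ t₃ ∷ t₇ ∷ t₈ ∷ t₅ ∷ t₆ ∷ [])

  sufficient : Sign → Sign → Sign → Vec Sign 9 → Bool
  sufficient ω τ s t = not (satisfied (conditions ω τ s) t) ∨ (goodSigns (signs ω τ s t) ∨ goodSigns (twist (signs ω τ s t)))

  satisfied⁺ : ∀ cs t → All (λ (m , s) → ∏ m t ≡ s) cs → T (satisfied cs t)
  satisfied⁺ []             t []       = tt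
  satisfied⁺ ((m , s) ∷ cs) t (e ∷ es) with ∏ m t Sign.≟ s
  ... | yes _ = satisfied⁺ cs t es
  ... | no ne = ⊥-elim (ne e)


  abstract
    check : ∀ ω τ s → T (forallSigns 9 (sufficient ω τ s))
    check Sign.+ Sign.+ Sign.+ = tt
    check Sign.+ Sign.+ Sign.- = tt
    check Sign.+ Sign.- Sign.+ = tt
    check Sign.+ Sign.- Sign.- = tt
    check Sign.- Sign.+ Sign.+ = tt
    check Sign.- Sign.+ Sign.- = tt
    check Sign.- Sign.- Sign.+ = tt
    check Sign.- Sign.- Sign.- = tt

  conditions-sufficient : ∀ ω τ s t → All (λ (m , s) → ∏ m t ≡ s) (conditions ω τ s) →
    T (goodSigns (signs ω τ s t)) ⊎ T (goodSigns (twist (signs ω τ s t)))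
  conditions-sufficient ω τ s t conds =
    decide (satisfied (conditions ω τ s) t) (goodSigns (signs ω τ s t)) (goodSigns (twist (signs ω τ s t)))
      (forallSigns-sound 9 (sufficient ω τ s) (check ω τ s) t) (satisfied⁺ (conditions ω τ s) t conds)
    where
    decide : ∀ a b c → T (not a ∨ (b ∨ c)) → T a → T b ⊎ T c
    decide true true  c    _ _ = inj₁ tt
    decide true false true _ _ = inj₂ tt

  module Units {q : ℕ} (𝔽 : PrimeField q) (n : ℕ) (0<4n : 0 < 4 ℕ.* n) (q≡ : q ≡ suc (4 ℕ.* n ℕ.+ 4 ℕ.* n))
      (ε : Fin q) (ii≡-1 : IsPrimitiveEighthRoot 𝔽 ε) where
    open FieldProperties 𝔽
    open QuadraticCharacter 𝔽 (4 ℕ.* n) 0<4n q≡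

    i : K
    i = ε * ε

    -1≢0 : ¬ - 1# ≡ 0#
    -1≢0 = value≢0 Sign.-

    i≢0 : ¬ i ≡ 0#
    i≢0 e = -1≢0 (trans (sym ii≡-1) (trans (cong (_* i) e) (zeroˡ i)))

    ε≢0 : ¬ ε ≡ 0#
    ε≢0 e = i≢0 (trans (cong (_* ε) e) (zeroˡ ε))

    1+x≡0 : ∀ {x} → 1# + x ≡ 0# → x * x ≡ 1#
    1+x≡0 {x} e = trans (cong (λ y → y * y) x≡-1) (trans (sym (-‿distribˡ-* 1# (- 1#))) (trans (cong (λ y → - y) (*-identityˡ _)) (-‿involutive 1#)))
      where
      x≡-1 : x ≡ - 1#
      x≡-1 = trans (solve 2 (λ o x → x := (o :+ x) :- o) refl 1# x) (trans (cong (_- 1#) e) (+-identityˡ _))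

    1+i≢0 : ¬ 1# + i ≡ 0#
    1+i≢0 e = -1≢1 (trans (sym (1+x≡0 e)) ii≡-1)

    1+ε≢0 : ¬ 1# + ε ≡ 0#
    1+ε≢0 e = -1≢1 (trans (sym (trans (cong (λ x → x * x) (1+x≡0 e)) (*-identityˡ 1#))) ii≡-1)

  module Conclusion {q : ℕ} (𝔽 : PrimeField q) (n : ℕ) (0<4n : 0 < 4 ℕ.* n) (q≡ : q ≡ suc (4 ℕ.* n ℕ.+ 4 ℕ.* n))
      (ε : Fin q) (ii≡-1 : IsPrimitiveEighthRoot 𝔽 ε) (c : Fin q) where
    open FieldProperties 𝔽
    open QuadraticCharacter 𝔽 (4 ℕ.* n) 0<4n q≡
    module E = EighthRoot 𝔽 n 0<4n q≡ ε ii≡-1 c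

    i ε³ i³ : K
    i = ε * ε
    ε³ = i * ε
    i³ = ε³ * ε³

    i³≡-i : i³ ≡ - i
    i³≡-i = trans (solve 2 (λ i e → i :* e :* (i :* e) := i :* i :* (e :* e)) refl i ε)
      (trans (cong (_* i) ii≡-1) (trans (sym (-‿distribˡ-* 1# i)) (cong (λ y → - y) (*-identityˡ i))))

    i³i³≡-1 : i³ * i³ ≡ - 1#
    i³i³≡-1 = trans (cong₂ _*_ i³≡-i i³≡-i) (trans (solve 1 (λ i → :- i :* :- i := i :* i) refl i) ii≡-1)

    i³ε³≡ε : i³ * ε³ ≡ ε
    i³ε³≡ε = trans (cong (_* ε³) i³≡-i) (trans (solve 2 (λ i e → :- i :* (i :* e) := :- (i :* i) :* e) refl i ε)
      (trans (cong (λ x → - x * ε) ii≡-1) (trans (cong (_* ε) (-‿involutive 1#)) (*-identityˡ ε))))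

    module E³ = EighthRoot 𝔽 n 0<4n q≡ ε³ i³i³≡-1 c

    GoodField : Set
    GoodField = ∃[ i ] Σ (i * i ≡ - 1#) λ ii → ∃[ y ] Transversal.Good 𝔽 n 0<4n q≡ i ii y

    -- The element ε³ = i ε is a primitive eighth root too; its list of roots is a permutation of
    -- that of ε, so the same c serves both.
    conclude : ∀ {ω τ s} t → HasSign ε ω → HasSign (1# + i) τ → HasSign (1# + ε) s →
      (∀ k → HasSign (c - Vec.lookup E.roots k) (Vec.lookup t k)) →
      T (goodSigns (signs ω τ s t)) ⊎ T (goodSigns (twist (signs ω τ s t))) → GoodField
    conclude {ω} {τ} {s} t@(t₀ ∷ t₁ ∷ t₂ ∷ t₃ ∷ t₄ ∷ t₅ ∷ t₆ ∷ t₇ ∷ t₈ ∷ []) ε-sign 1+i-sign 1+ε-sign t-sign =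
      [ (λ ok → i , ii≡-1 , E.y , E.good S ε-sign 1+i-sign 1+ε-sign t-sign ok) ,
        (λ ok → i³ , i³i³≡-1 , E³.y , E³.good (twist S)
           (E.iε-sign S ε-sign 1+i-sign 1+ε-sign t-sign)
           (E.sign-by (cong (1# +_) i³≡-i) (E.1-i-sign S ε-sign 1+i-sign 1+ε-sign t-sign))
           (E.1+iε-sign S ε-sign 1+i-sign 1+ε-sign t-sign) twisted ok) ]′
      where
      S : Signs
      S = signs ω τ s t
      twisted : ∀ k → HasSign (c - Vec.lookup E³.roots k) (root (twist S) k)
      twisted 0F = t-sign 0F
      twisted 1F = t-sign 1F
      twisted 2F = t-sign 2F
      twisted 3F = E.sign-by (cong (λ x → c - x) i³≡-i) (t-sign 4F)
      twisted 4F = E.sign-by (cong (λ x → c - x) (trans (cong (λ x → - x) i³≡-i) (-‿involutive i))) (t-sign 3F)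
      twisted 5F = t-sign 7F
      twisted 6F = t-sign 8F
      twisted 7F = E.sign-by (cong (λ x → c - x) i³ε³≡ε) (t-sign 5F)
      twisted 8F = E.sign-by (cong (λ x → c - - x) i³ε³≡ε) (t-sign 6F)

  module LargeField {q : ℕ} (𝔽 : PrimeField q) (n : ℕ) (0<4n : 0 < 4 ℕ.* n) (q≡ : q ≡ suc (4 ℕ.* n ℕ.+ 4 ℕ.* n))
      (large : 600000 ≤ 4 ℕ.* n) where
    open FieldProperties 𝔽
    open Fermat 𝔽
    open QuadraticCharacter 𝔽 (4 ℕ.* n) 0<4n q≡

    g : K
    g = proj₁ nonresidue

    ε i : K
    -- ε⁴ = g^(4 n) = g^h = - 1, as g is a nonresidue.
    ε = g ^ n
    i = ε * ε

    ii≡-1 : i * i ≡ - 1#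
    ii≡-1 = trans (solve 2 (λ e o → e :* e :* (e :* e) := e :* (e :* (e :* e))) refl ε 1#)
      (trans (cong (λ x → ε * (ε * (ε * x))) (sym (*-identityʳ ε))) (trans (sym (^-* g 4 n)) (power (proj₂ nonresidue))))

    open Transversal 𝔽 n 0<4n q≡ i ii≡-1 using (2≢0; Good)

    open Units 𝔽 n 0<4n q≡ ε ii≡-1 using (ε≢0; 1+i≢0; 1+ε≢0)

    ε^4 : ε ^ 4 ≡ - 1#
    ε^4 = trans (cong (λ x → ε * (ε * (ε * x))) (*-identityʳ ε)) (trans (solve 1 (λ e → e :* (e :* (e :* e)) := e :* e :* (e :* e)) refl ε) ii≡-1)

    ε^8 : ε ^ 8 ≡ 1#
    ε^8 = trans (^-+ ε 4 4) (trans (cong₂ _*_ ε^4 ε^4) (trans (sym (-‿distribˡ-* 1# (- 1#))) (trans (cong (λ y → - y) (*-identityˡ _)) (-‿involutive 1#))))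

    -- Every d with 0 < d < 8 has a multiple congruent to 4 modulo 8, at which the power of ε is -
    -- 1.
    ε^≢1 : ∀ d → 0 < d → d < 8 → ¬ ε ^ d ≡ 1#
    ε^≢1 d 0<d d<8 e = go d 0<d d<8 e
      where
      odd : ∀ d m k → m ℕ.* d ≡ 4 ℕ.+ k ℕ.* 8 → ¬ ε ^ d ≡ 1#
      odd d m k eq e = -1≢1 (begin
        1#                       ≡⟨ 1^ m ⟨
        1# ^ m                   ≡⟨ cong (_^ m) e ⟨
        (ε ^ d) ^ m              ≡⟨ ^-* ε m d ⟨
        ε ^ (m ℕ.* d)            ≡⟨ cong (ε ^_) eq ⟩
        ε ^ (4 ℕ.+ k ℕ.* 8)      ≡⟨ ^-+ ε 4 (k ℕ.* 8) ⟩
        ε ^ 4 * ε ^ (k ℕ.* 8)    ≡⟨ cong₂ _*_ ε^4 (trans (^-* ε k 8) (trans (cong (_^ k) ε^8) (1^ k))) ⟩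
        - 1# * 1#                ≡⟨ *-identityʳ _ ⟩
        - 1#                     ∎)
        where open ≡-Reasoning
      go : ∀ d → 0 < d → d < 8 → ¬ ε ^ d ≡ 1#
      go 1 _ _ = odd 1 4 0 refl
      go 2 _ _ = odd 2 2 0 refl
      go 3 _ _ = odd 3 4 1 refl
      go 4 _ _ = odd 4 1 0 refl
      go 5 _ _ = odd 5 4 2 refl
      go 6 _ _ = odd 6 2 1 refl
      go 7 _ _ = odd 7 4 3 refl
      go (suc (suc (suc (suc (suc (suc (suc (suc d)))))))) _ (s≤s (s≤s (s≤s (s≤s (s≤s (s≤s (s≤s (s≤s ()))))))))

    ε^-injective : ∀ {a b} → a < 8 → b < 8 → ε ^ a ≡ ε ^ b → a ≡ b
    ε^-injective {a} {b} a<8 b<8 e with ℕ.<-cmp a b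
    ... | tri≈ _ a≡b _ = a≡b
    ... | tri< a<b _ _ = ⊥-elim (impossible a<b b<8 e)
      where
      impossible : ∀ {a b} → a < b → b < 8 → ¬ ε ^ a ≡ ε ^ b
      impossible {a} {b} a<b b<8 e = ε^≢1 (b ℕ.∸ a) (ℕ.m<n⇒0<n∸m a<b) (ℕ.≤-<-trans (ℕ.m∸n≤m b a) b<8)
        (sym (*-cancelˡ (ε ^ a) (^-nonzero a ε≢0) (trans (*-identityʳ _) (trans e (trans (cong (ε ^_) (sym (ℕ.m+[n∸m]≡n (ℕ.<⇒≤ a<b)))) (^-+ ε a (b ℕ.∸ a)))))))
    ... | tri> _ _ b<a = ⊥-elim (impossible b<a a<8 (sym e))
      where
      impossible : ∀ {a b} → a < b → b < 8 → ¬ ε ^ a ≡ ε ^ b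
      impossible {a} {b} a<b b<8 e = ε^≢1 (b ℕ.∸ a) (ℕ.m<n⇒0<n∸m a<b) (ℕ.≤-<-trans (ℕ.m∸n≤m b a) b<8)
        (sym (*-cancelˡ (ε ^ a) (^-nonzero a ε≢0) (trans (*-identityʳ _) (trans e (trans (cong (ε ^_) (sym (ℕ.m+[n∸m]≡n (ℕ.<⇒≤ a<b)))) (^-+ ε a (b ℕ.∸ a)))))))

    roots : Vec K 9
    roots = EighthRoot.roots 𝔽 n 0<4n q≡ ε ii≡-1 0#

    -- The nonzero roots 1, - 1, i, - i, ε, - ε, i ε, - i ε as powers of ε, which reduces their
    -- distinctness to that of these numbers.
    exponents : List ℕ
    exponents = 0 ∷ 4 ∷ 2 ∷ 6 ∷ 1 ∷ 5 ∷ 3 ∷ 7 ∷ []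

    exponents<8 : All (_< 8) exponents
    exponents<8 = toWitness {a? = All.all? (ℕ._<? 8) exponents} tt

    exponents-unique : Unique exponents
    exponents-unique = toWitness {a? = allPairs? (λ a b → ¬? (a ℕ.≟ b)) exponents} tt

    roots≡ : Vec.toList roots ≡ 0# ∷ map (ε ^_) exponents
    roots≡ = cong₂ (λ a b → 0# ∷ 1# ∷ a ∷ b) (sym ε^4) (cong₂ (λ a b → a ∷ b) (sym ε²) (cong₂ (λ a b → a ∷ b) (neg 2 ε²)
      (cong₂ (λ a b → a ∷ b) (sym ε¹) (cong₂ (λ a b → a ∷ b) (neg 1 ε¹) (cong₂ (λ a b → a ∷ b) (sym ε³) (cong₂ (λ a b → a ∷ b) (neg 3 ε³) refl))))))
      where
      ε¹ : ε ^ 1 ≡ ε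
      ε¹ = *-identityʳ ε
      ε² : ε ^ 2 ≡ i
      ε² = cong (ε *_) ε¹
      ε³ : ε ^ 3 ≡ i * ε
      ε³ = trans (cong (ε *_) ε²) (*-comm ε i)
      neg : ∀ k {x} → ε ^ k ≡ x → - x ≡ ε ^ (4 ℕ.+ k)
      neg k {x} e = sym (trans (^-+ ε 4 k) (trans (cong₂ _*_ ε^4 e) (trans (sym (-‿distribˡ-* 1# x)) (cong (λ y → - y) (*-identityˡ x)))))

    roots-unique : Unique (Vec.toList roots)
    roots-unique = subst Unique (sym roots≡)
      (All.map⁺ {xs = exponents} {f = ε ^_} (All.tabulate (λ {k} _ e → ^-nonzero k ε≢0 (sym e))) ∷
       unique-map (ε ^_) exponents (λ a∈ b∈ → ε^-injective (All.lookup exponents<8 a∈) (All.lookup exponents<8 b∈)) exponents-unique)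

    -- The shift c = u + 2 moves all roots away from 0.
    a : K
    a = 1# + 1#

    ι2≡a : ι 2 ≡ a
    ι2≡a = trans (ι-suc 1) (cong (1# +_) ι-1)

    ι-^ : ∀ m k → ι m ^ k ≡ ι (m ℕ.^ k)
    ι-^ m zero    = sym ι-1
    ι-^ m (suc k) = trans (cong (ι m *_) (ι-^ m k)) (ι-* m (m ℕ.^ k))

    255<q : 255 < q
    255<q = ℕ.<-≤-trans (ℕ.<-≤-trans (ℕ.<ᵇ⇒< 255 600000 tt) large) (ℕ.≤-trans (ℕ.≤-trans (ℕ.m≤m+n (4 ℕ.* n) (4 ℕ.* n)) (ℕ.n≤1+n _)) (ℕ.≤-reflexive (sym q≡)))

    -- 2⁸ - 1 = 255 < q is not divisible by q. As every nonzero root satisfies ρ⁸ = 1, the element 2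
    -- is not among the roots.
    a^8≢1 : ¬ a ^ 8 ≡ 1#
    a^8≢1 e = ℕ.<⇒≱ 255<q (∣⇒≤ (ι≡0⇒∣ 255 (trans (solve 2 (λ o x → x := (o :+ x) :- o) refl 1# (ι 255))
      (trans (cong (_- 1#) (trans (sym (ι-suc 255)) (trans (sym (ι-^ 2 8)) (trans (cong (_^ 8) ι2≡a) e)))) (-‿inverseʳ 1#)))))

    shifted : Vec K 9
    shifted = Vec.map (_- a) roots

    toList-map : ∀ {m} (xs : Vec K m) → Vec.toList (Vec.map (_- a) xs) ≡ map (_- a) (Vec.toList xs)
    toList-map []       = refl
    toList-map (x ∷ xs) = cong ((x - a) ∷_) (toList-map xs)

    shift-injective : ∀ {x y} → x - a ≡ y - a → x ≡ y
    shift-injective {x} {y} e = trans (solve 2 (λ x a → x := (x :- a) :+ a) refl x a)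
      (trans (cong (_+ a) e) (solve 2 (λ y a → (y :- a) :+ a := y) refl y a))

    shifted-unique : Unique (Vec.toList shifted)
    shifted-unique = subst Unique (sym (toList-map roots)) (Unique.map⁺ shift-injective roots-unique)

    shifted≢0 : All (λ ρ → ¬ ρ ≡ 0#) (Vec.toList shifted)
    shifted≢0 = subst (All (λ ρ → ¬ ρ ≡ 0#)) (sym (toList-map roots)) (All.map⁺ (subst (All (λ ρ → ¬ ρ - a ≡ 0#)) (sym roots≡)
      ((λ e → 2≢0 (sym (a-b≡0 e))) ∷ All.map⁺ {xs = exponents} {f = ε ^_} (All.tabulate λ {k} _ e → a^8≢1 (trans (cong (_^ 8) (sym (a-b≡0 e)))
        (trans (sym (^-* ε 8 k)) (trans (cong (ε ^_) (ℕ.*-comm 8 k)) (trans (^-* ε k 8) (trans (cong (_^ k) ε^8) (1^ k))))))))))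

    d : ℕ
    d = 4 ℕ.* n ℕ.∸ 6

    6+d≡ : 6 ℕ.+ d ≡ 4 ℕ.* n
    6+d≡ = ℕ.m+[n∸m]≡n (ℕ.≤-trans (ℕ.≤ᵇ⇒≤ 6 600000 tt) large)

    q≡d : q ≡ suc ((6 ℕ.+ d) ℕ.+ (6 ℕ.+ d))
    q≡d = trans q≡ (cong (λ h → suc (h ℕ.+ h)) (sym 6+d≡))

    d≥ : A₀ ≤ suc (suc d)
    d≥ = A₀≤ (ℕ.+-cancelˡ-≤ 4 _ _ (ℕ.≤-trans large (ℕ.≤-reflexive (sym 6+d≡))))

    module QC′ = QuadraticCharacter 𝔽 (6 ℕ.+ d) (s≤s z≤n) q≡d
    module SP = SignPatterns 𝔽 d q≡d d≥ {9} ℕ.≤-refl shifted shifted-unique shifted≢0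

    -- The exponents 6 + d and 4 n are equal, but not by definition.
    transport : ∀ {x s} → QC′.HasSign x s → HasSign x s
    transport {x} {s} p = hasSign (trans (cong (x ^_) (sym 6+d≡)) (trans (QC′.power p) (values s)))
      where
      values : ∀ s → QC′.value s ≡ value s
      values Sign.+ = refl
      values Sign.- = refl

    abstract
      ε-signed : ∃[ s ] HasSign ε s
      ε-signed = has-sign ε≢0

      1+i-signed : ∃[ s ] HasSign (1# + i) s
      1+i-signed = has-sign 1+i≢0

      1+ε-signed : ∃[ s ] HasSign (1# + ε) s
      1+ε-signed = has-sign 1+ε≢0

    ω τ s : Sign
    ω = proj₁ ε-signed
    τ = proj₁ 1+i-signed
    s = proj₁ 1+ε-signed

    -- The largest total weight is 2178, attained in every case with seven conditions.
    numeric-check : ∀ ω τ s → T (SP.nontrivial₀ (conditions ω τ s)) × SP.total₀ (conditions ω τ s) ≤ 2181 × SP.terms (conditions ω τ s) ≤ 128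
    numeric-check Sign.+ Sign.+ Sign.+ = tt , ℕ.≤ᵇ⇒≤ _ _ tt , ℕ.≤ᵇ⇒≤ _ _ tt
    numeric-check Sign.+ Sign.+ Sign.- = tt , ℕ.≤ᵇ⇒≤ _ _ tt , ℕ.≤ᵇ⇒≤ _ _ tt
    numeric-check Sign.+ Sign.- _      = tt , ℕ.≤ᵇ⇒≤ _ _ tt , ℕ.≤ᵇ⇒≤ _ _ tt
    numeric-check Sign.- Sign.+ Sign.+ = tt , ℕ.≤ᵇ⇒≤ _ _ tt , ℕ.≤ᵇ⇒≤ _ _ tt
    numeric-check Sign.- Sign.+ Sign.- = tt , ℕ.≤ᵇ⇒≤ _ _ tt , ℕ.≤ᵇ⇒≤ _ _ tt
    numeric-check Sign.- Sign.- _      = tt , ℕ.≤ᵇ⇒≤ _ _ tt , ℕ.≤ᵇ⇒≤ _ _ tt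

    abstract
      admissible : ∃[ u ] All (λ ρ → ¬ u ≡ ρ) (Vec.toList shifted) × All (λ (m , s) → ∏ m (SP.signs u) ≡ s) (conditions ω τ s)
      admissible = let nt , tot , trm = numeric-check ω τ s in SP.pattern-exists (conditions ω τ s) nt (V₀≥ tot) trm

    u c : K
    u = proj₁ admissible
    c = u + a

    t : Vec Sign 9
    t = SP.signs u

    t-sign : ∀ k → HasSign (c - Vec.lookup roots k) (Vec.lookup t k)
    t-sign k = go roots (proj₁ (proj₂ admissible)) k
      where
      go : ∀ {m} (ρs : Vec K m) → All (λ ρ → ¬ u ≡ ρ) (Vec.toList (Vec.map (_- a) ρs)) → ∀ k →
        HasSign (c - Vec.lookup ρs k) (Vec.lookup (Vec.map (λ ρ → SP.sgn (u - ρ)) (Vec.map (_- a) ρs)) k)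
      go (ρ ∷ ρs) (u≢ ∷ _)  zero    = subst (λ x → HasSign x (SP.sgn (u - (ρ - a)))) (solve 3 (λ u ρ a → u :- (ρ :- a) := (u :+ a) :- ρ) refl u ρ a)
        (transport (SP.sgn-correct (λ z → u≢ (a-b≡0 z))))
      go (ρ ∷ ρs) (_ ∷ u∉) (suc k) = go ρs u∉ k

    good-field : Conclusion.GoodField 𝔽 n 0<4n q≡ ε ii≡-1 c
    good-field = Conclusion.conclude 𝔽 n 0<4n q≡ ε ii≡-1 c t (proj₂ ε-signed) (proj₂ 1+i-signed) (proj₂ 1+ε-signed)
      t-sign (conditions-sufficient ω τ s t (proj₂ (proj₂ admissible)))

-- Tests by computation for small fields

module Computation where
  open BaseBlocks using (Form; mono; diff; quadruples)
  open SignConditions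
  open LargeFields
  open import Agda.Builtin.Nat using (mod-helper; div-helper)
  open import Agda.Builtin.Strict using (primForce)
  open import Data.Nat as ℕ using (ℕ; zero; suc; _+_; _*_; _∸_; _≡ᵇ_; _<ᵇ_)
  open import Data.Bool using (Bool; true; false; _∧_; _∨_; not; if_then_else_)
  open import Data.Bool.ListAction using (any)
  open import Data.List using (List; []; _∷_; map)
  open import Data.Product using (_,_; _×_)
  open import Data.Vec as Vec using (Vec; []; _∷_)
  open import Data.Sign as Sign using (Sign)

  -- Arithmetic modulo suc p.
  reduce : ℕ → ℕ → ℕ
  reduce p x = mod-helper 0 p x p

  -- Digits in base 4, least significant first.
  data Digits : Set where
    end : Digits
    d0 d1 d2 d3 : Digits → Digits

  decode : Digits → ℕ
  decode end    = 0
  decode (d0 e) = 4 * decode e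
  decode (d1 e) = 1 + 4 * decode e
  decode (d2 e) = 2 + 4 * decode e
  decode (d3 e) = 3 + 4 * decode e

  increment : Digits → Digits
  increment end    = d1 end
  increment (d0 e) = d1 e
  increment (d1 e) = d2 e
  increment (d2 e) = d3 e
  increment (d3 e) = d0 (increment e)

  digits : ℕ → Digits
  digits zero    = end
  digits (suc n) = increment (digits n)

  fourth : ℕ → ℕ → ℕ
  fourth p r = reduce p (r * r * r * r)

  fourthTimes : ℕ → ℕ → ℕ → ℕ
  fourthTimes p y r = reduce p (r * r * r * r * y)

  -- Base 4 costs one reduction per digit, the intermediate products staying unreduced.
  powmod : ℕ → ℕ → Digits → ℕ
  powmod p x end    = 1
  powmod p x (d0 e) = fourth p (powmod p x e)
  powmod p x (d1 e) = fourthTimes p x (powmod p x e)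
  powmod p x (d2 e) = fourthTimes p (x * x) (powmod p x e)
  powmod p x (d3 e) = fourthTimes p (x * x * x) (powmod p x e)

  -- For p = 8 k, Euler's exponent is 4 k; e holds the digits of k.
  eulerPower : ℕ → Digits → ℕ → ℕ
  eulerPower p e x = powmod p x (d0 e)

  -- Anything but 1 counts as -; the residue 0 is excluded separately by `nonzero`.
  signOf : ℕ → Sign
  signOf (suc zero) = Sign.+
  signOf _          = Sign.-

  eulerSign : ℕ → Digits → ℕ → Sign
  eulerSign p e x = signOf (eulerPower p e x)

  -- The residues c − ρ for the nine roots ρ.
  residues : ℕ → ℕ → ℕ → ℕ → Vec ℕ 9
  residues p i ε c = c ∷ c + p ∷ c + 1 ∷ c + (suc p ∸ i) ∷ c + i ∷ c + (suc p ∸ ε) ∷ c + ε ∷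
    c + (suc p ∸ reduce p (i * ε)) ∷ c + reduce p (i * ε) ∷ []

  nonzero : ℕ → List ℕ → Bool
  nonzero p []       = true
  nonzero p (x ∷ xs) = (0 <ᵇ reduce p x) ∧ nonzero p xs

  accepted : Signs → Bool
  accepted S = goodSigns S ∨ goodSigns (twist S)

  test : ℕ → Digits → ℕ → ℕ → Sign → Sign → Sign → ℕ → Bool
  test p e i ε ω τ s c =
    accepted (signs ω τ s (Vec.map (eulerSign p e) (residues p i ε c))) ∧ nonzero p (Vec.toList (residues p i ε c))

  -- With steps of 255 a single nonzero byte, determining c modulo 255, is enough to guide the
  -- search.
  search : ℕ → ℕ → Digits → ℕ → ℕ → Sign → Sign → Sign → ℕ → Bool
  search zero    p e i ε ω τ s c = false
  search (suc f) p e i ε ω τ s c = test p e i ε ω τ s c ∨ search f p e i ε ω τ s (255 + c)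

  -- The power g ^ k is a primitive eighth root of unity when g is not a square.
  eighthRootFrom : ℕ → ℕ → Digits → ℕ → ℕ → ℕ
  eighthRootFrom zero    p e g r = reduce p r
  eighthRootFrom (suc f) p e g r with reduce p (r * r * r * r + 1)
  ... | zero  = reduce p r
  ... | suc _ = eighthRootFrom f p e (2 + g) (powmod p (2 + g) e)

  -- The candidates g are 3, 5, 7, .... Should the fuel run out, the returned value would at worst
  -- fail the test i² + 1 = 0 in `searchFrom`.
  eighthRoot : ℕ → Digits → ℕ
  eighthRoot p e = eighthRootFrom 100 p e 3 (powmod p 3 e)

  searchFrom : ℕ → ℕ → Digits → ℕ → ℕ → ℕ → Bool
  searchFrom f p e c ε i = (reduce p (i * i + 1) ≡ᵇ 0) ∧ search f p e i ε (eulerSign p e ε) (eulerSign p e (1 + i)) (eulerSign p e (1 + ε)) c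

  -- `primForce` evaluates i = ε² before it is shared by all later tests.
  rootSearch : ℕ → ℕ → Digits → ℕ → ℕ → Bool
  rootSearch f p e c ε = primForce (reduce p (ε * ε)) (searchFrom f p e c ε)

  witness : ℕ → ℕ → Digits → ℕ → Bool
  witness f p e c = primForce (eighthRoot p e) (rootSearch f p e c)

  divides? : ℕ → ℕ → Bool
  divides? p d = (1 <ᵇ d) ∧ ((d <ᵇ suc p) ∧ (reduce (ℕ.pred d) (suc p) ≡ᵇ 0))

  -- Started at 3 it tries odd divisors only, the number `suc p` = 8 k + 1 being odd.
  trialDivision : ℕ → ℕ → ℕ → Bool
  trialDivision zero    p d = false
  trialDivision (suc f) p d = divides? p d ∨ trialDivision f p (suc (suc d))

  -- A residue r = 3^h other than ± 1 refutes primality.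
  eulerRefutes : ℕ → ℕ → Bool
  eulerRefutes p r = not (r ≡ᵇ 1) ∧ not (r ≡ᵇ p)

  -- The hint 0 announces a composite number, a hint δ > 0 a search through δ, δ + 255, δ + 510, …
  hinted : ℕ → Digits → ℕ → Bool
  -- The 600 odd numbers from 3 to 1201 go beyond the square root of every number that is swept.
  hinted p e zero      = trialDivision 600 p 3
  hinted p e δ@(suc _) = witness 900 p e δ

  multiple? : ℕ → ℕ → Bool
  multiple? d p = reduce d (suc p) ≡ᵇ 0

  -- `multiple? d` tests divisibility by d + 1, so the divisors are 3, 5, 7, 11 and 13; the guard 12
  -- < p makes them proper.
  smallDivisor : ℕ → Bool
  smallDivisor p = (12 <ᵇ p) ∧ (multiple? 2 p ∨ (multiple? 4 p ∨ (multiple? 6 p ∨ (multiple? 10 p ∨ multiple? 12 p))))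

  -- Hints are consumed by the numbers suc (8 * k) that survive the first two tests. They are the digits
  -- in base 256 of the listed numbers, least significant first, below a leading digit 1.
  mutual
    sweep : ℕ → ℕ → Digits → ℕ → List ℕ → Bool
    sweep zero    k e w ws = true
    sweep (suc n) k e w ws = primForce (8 * k) (divisorTest n k e w ws)

    divisorTest : ℕ → ℕ → Digits → ℕ → List ℕ → ℕ → Bool
    divisorTest n k e w ws p = if smallDivisor p then sweep n (suc k) (increment e) w ws else eulerTest n k e w ws p

    eulerTest : ℕ → ℕ → Digits → ℕ → List ℕ → ℕ → Bool
    eulerTest n k e w ws p = if eulerRefutes p (eulerPower p e 3) then sweep n (suc k) (increment e) w ws else refill n k e w ws p

    refill : ℕ → ℕ → Digits → ℕ → List ℕ → ℕ → Bool
    -- Only the leading digit 1 is left of the current word, so the next one is opened.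
    refill n k e 1 (w ∷ ws) p = useHint n k e w ws p
    refill n k e w ws       p = useHint n k e w ws p

    useHint : ℕ → ℕ → Digits → ℕ → List ℕ → ℕ → Bool
    useHint n k e w ws p = hinted p e (mod-helper 0 255 w 255) ∧ primForce (div-helper 0 255 w 255) λ w' → sweep n (suc k) (increment e) w' ws

  -- The residues 1, i, p, q - i represent the powers of i, and subtraction is the addition of q
  -- minus a residue.
  entry : ℕ → ℕ → Vec ℕ 4 → Form → ℕ
  entry p i y (mono j)     = Vec.lookup y j
  entry p i y (diff j l r) = Vec.lookup y j + (suc p ∸ reduce p (Vec.lookup (1 ∷ i ∷ p ∷ suc p ∸ i ∷ []) r * Vec.lookup y l))

  quadruplesTest : ℕ → Digits → ℕ → Vec ℕ 4 → List (List Form) → Bool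
  quadruplesTest p e i y []       = true
  quadruplesTest p e i y (Q ∷ Qs) =
    (balancedSigns (map (eulerSign p e) (map (entry p i y) Q)) ∧ nonzero p (map (entry p i y) Q)) ∧ quadruplesTest p e i y Qs

  blockTest : ℕ → Digits → ℕ → Vec ℕ 4 → Bool
  blockTest p e i y = (reduce p (i * i + 1) ≡ᵇ 0) ∧ ((i <ᵇ suc p) ∧ quadruplesTest p e i y quadruples)

  -- k, a square root i of − 1 modulo 8 k + 1, and y.
  smallBlocks : List (ℕ × ℕ × Vec ℕ 4)
  smallBlocks =
    (2 , 13 , 1 ∷ 11 ∷ 15 ∷ 5 ∷ []) ∷ (5 , 9 , 1 ∷ 37 ∷ 26 ∷ 30 ∷ []) ∷
    (9 , 27 , 1 ∷ 42 ∷ 33 ∷ 16 ∷ []) ∷ (11 , 34 , 1 ∷ 64 ∷ 26 ∷ 43 ∷ []) ∷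
    (12 , 22 , 1 ∷ 77 ∷ 85 ∷ 71 ∷ []) ∷ (14 , 98 , 1 ∷ 35 ∷ 64 ∷ 110 ∷ []) ∷
    (17 , 100 , 1 ∷ 131 ∷ 120 ∷ 45 ∷ []) ∷ (24 , 112 , 1 ∷ 156 ∷ 58 ∷ 101 ∷ []) ∷
    (29 , 144 , 1 ∷ 66 ∷ 140 ∷ 165 ∷ []) ∷ (30 , 177 , 1 ∷ 18 ∷ 57 ∷ 62 ∷ []) ∷
    (32 , 241 , 1 ∷ 6 ∷ 93 ∷ 25 ∷ []) ∷ (35 , 228 , 1 ∷ 226 ∷ 89 ∷ 155 ∷ []) ∷
    (39 , 288 , 1 ∷ 177 ∷ 256 ∷ 62 ∷ []) ∷ (42 , 148 , 1 ∷ 258 ∷ 197 ∷ 185 ∷ []) ∷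
    (44 , 311 , 1 ∷ 288 ∷ 214 ∷ 51 ∷ []) ∷ (50 , 20 , 1 ∷ 285 ∷ 6 ∷ 182 ∷ []) ∷
    (51 , 266 , 1 ∷ 388 ∷ 54 ∷ 339 ∷ []) ∷ (54 , 179 , 1 ∷ 214 ∷ 15 ∷ 41 ∷ []) ∷
    (56 , 67 , 1 ∷ 383 ∷ 290 ∷ 413 ∷ []) ∷ (57 , 348 , 1 ∷ 45 ∷ 369 ∷ 144 ∷ []) ∷
    (65 , 235 , 1 ∷ 340 ∷ 225 ∷ 491 ∷ []) ∷ (71 , 483 , 1 ∷ 218 ∷ 348 ∷ 382 ∷ []) ∷
    (72 , 553 , 1 ∷ 330 ∷ 533 ∷ 517 ∷ []) ∷ (74 , 77 , 1 ∷ 230 ∷ 148 ∷ 115 ∷ []) ∷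
    (75 , 476 , 1 ∷ 329 ∷ 195 ∷ 236 ∷ []) ∷ (77 , 194 , 1 ∷ 301 ∷ 68 ∷ 353 ∷ []) ∷
    (80 , 487 , 1 ∷ 114 ∷ 209 ∷ 574 ∷ []) ∷ (84 , 58 , 1 ∷ 32 ∷ 10 ∷ 471 ∷ []) ∷
    (95 , 722 , 1 ∷ 495 ∷ 543 ∷ 607 ∷ []) ∷ (96 , 707 , 1 ∷ 23 ∷ 698 ∷ 3 ∷ []) ∷
    (101 , 491 , 1 ∷ 667 ∷ 100 ∷ 586 ∷ []) ∷ (107 , 207 , 1 ∷ 321 ∷ 474 ∷ 52 ∷ []) ∷
    []

  smallTest : ℕ → Bool
  -- The twenty odd numbers from 3 to 41 include a proper divisor of every composite number 8 k + 1
  -- below 864.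
  smallTest k = any (λ (k' , i , y) → (k' ≡ᵇ k) ∧ blockTest (8 * k) (digits k) i y) smallBlocks ∨ trialDivision 20 (8 * k) 3

  smallSweep : ℕ → Bool
  smallSweep zero    = true
  smallSweep (suc k) = ((k ≡ᵇ 0) ∨ smallTest k) ∧ smallSweep k

-- Soundness of the computations

module ComputationSoundness where
  open PrimeFields
  open QuadraticResidues
  open BaseBlocks
  open SignConditions
  open LargeFields
  open Computation
  open import Agda.Builtin.Nat using (mod-helper; div-helper)
  open import Agda.Builtin.Strict using (primForce; primForceLemma)
  open import Data.Nat as ℕ using (ℕ; zero; suc; z≤n; s≤s; _≤_; _<_; _∸_; _≡ᵇ_; _<ᵇ_)
  import Data.Nat.Properties as ℕ
  open import Data.Nat.DivMod using (m%n<n; m<n⇒m%n≡m)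
  open import Data.Nat.Divisibility using (m%n≡0⇒n∣m)
  open import Data.Nat.Primality using (Prime; prime⇒irreducible)
  open import Data.Bool using (Bool; true; false; _∧_; _∨_; not; T; if_then_else_)
  open import Data.Bool.ListAction using (any)
  open import Data.Fin using (Fin; toℕ; zero; suc)
  open import Data.Fin.Patterns
  open import Data.List using (List; []; _∷_; map)
  open import Data.List.Relation.Unary.All using (All; []; _∷_)
  open import Data.List.Relation.Unary.Any using (Any; here; there)
  open import Data.List.Relation.Unary.Any.Properties using (any⁻)
  open import Data.List.Relation.Binary.Pointwise using (Pointwise; []; _∷_)
  open import Data.Vec as Vec using (Vec; []; _∷_)
  open import Data.Sign as Sign using (Sign)
  open import Data.Product using (_,_; _×_; ∃-syntax; proj₁; proj₂; Σ)
  open import Data.Sum using (_⊎_; inj₁; inj₂; [_,_]′)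
  open import Data.Empty using (⊥; ⊥-elim)
  open import Data.Unit using (tt)
  open import Function using (_∘_)
  open import Relation.Nullary using (¬_)
  open import Relation.Binary.PropositionalEquality

  ∧-T : ∀ {a b} → T (a ∧ b) → T a × T b
  ∧-T {true} {true} _ = tt , tt

  ∨-T : ∀ a {b} → T (a ∨ b) → T a ⊎ T b
  ∨-T true  t = inj₁ tt
  ∨-T false t = inj₂ t

  not-T : ∀ {a} → T (not a) → ¬ T a
  not-T {true} () _

  force⁻ : ∀ {A : Set} (x : A) (f : A → Bool) → T (primForce x f) → T (f x)
  force⁻ x f = subst T (primForceLemma x f)

  decode-increment : ∀ e → decode (increment e) ≡ suc (decode e)
  decode-increment end    = refl
  decode-increment (d0 e) = refl
  decode-increment (d1 e) = refl
  decode-increment (d2 e) = refl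
  decode-increment (d3 e) = trans (cong (4 ℕ.*_) (decode-increment e)) (ℕ.*-suc 4 (decode e))

  decode-digits : ∀ n → decode (digits n) ≡ n
  decode-digits zero    = refl
  decode-digits (suc n) = trans (decode-increment (digits n)) (cong ℕ.suc (decode-digits n))

  q-split : ∀ k → suc (8 ℕ.* k) ≡ suc (4 ℕ.* k ℕ.+ 4 ℕ.* k)
  q-split k = cong ℕ.suc (ℕ.*-distribʳ-+ k 4 4)

  GoodAt : (k : ℕ) → Prime (suc (8 ℕ.* k)) → 0 < 4 ℕ.* k → Set
  GoodAt k pq 0<4k = ∃[ i ] Σ (i * i ≡ - 1#) λ ii → ∃[ y ] Transversal.Good (IntegersModulo.primeField _ pq) k 0<4k (q-split k) i ii y
    where open PrimeField (IntegersModulo.primeField _ pq)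

  module Soundness (k : ℕ) (pq : Prime (suc (8 ℕ.* k))) (0<4k : 0 < 4 ℕ.* k) where
    p q : ℕ
    p = 8 ℕ.* k
    q = suc p

    open IntegersModulo q pq using (primeField; ι-%; toℕ-ι)
    open FieldProperties primeField
    open Fermat primeField
    open QuadraticCharacter primeField (4 ℕ.* k) 0<4k (q-split k)

    reduce<q : ∀ x → reduce p x < q
    reduce<q x = m%n<n x q

    ι-reduce : ∀ x → ι (reduce p x) ≡ ι x
    ι-reduce x = ι-% x

    ι-injective : ∀ {m n} → m < q → n < q → ι m ≡ ι n → m ≡ n
    ι-injective {m} {n} m<q n<q e = trans (sym (m<n⇒m%n≡m m<q)) (trans (sym (toℕ-ι m)) (trans (cong toℕ e) (trans (toℕ-ι n) (m<n⇒m%n≡m n<q))))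

    fourth-power : ∀ x r m → ι r ≡ ι x ^ m → ι (r ℕ.* r ℕ.* r ℕ.* r) ≡ ι x ^ (4 ℕ.* m)
    fourth-power x r m eq =
      trans (extend (r ℕ.* r ℕ.* r) (m ℕ.+ m ℕ.+ m) (extend (r ℕ.* r) (m ℕ.+ m) (extend r m eq)))
        (cong (ι x ^_) (trans (cong (λ n → n ℕ.+ m ℕ.+ m) (cong (m ℕ.+_) (sym (ℕ.+-identityʳ m)))) (trans (ℕ.+-assoc (2 ℕ.* m) m m)
          (trans (cong (λ n → 2 ℕ.* m ℕ.+ (m ℕ.+ n)) (sym (ℕ.+-identityʳ m))) (sym (ℕ.*-distribʳ-+ m 2 2))))))
      where
      extend : ∀ a n → ι a ≡ ι x ^ n → ι (a ℕ.* r) ≡ ι x ^ (n ℕ.+ m)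
      extend a n e = trans (sym (ι-* a r)) (trans (cong₂ _*_ e eq) (sym (^-+ (ι x) n m)))

    times-power : ∀ x a n → ι a ≡ ι x ^ n → ∀ j y → ι y ≡ ι x ^ j → ι (a ℕ.* y) ≡ ι x ^ (j ℕ.+ n)
    times-power x a n e j y e′ = trans (sym (ι-* a y)) (trans (*-comm (ι a) (ι y)) (trans (cong₂ _*_ e′ e) (sym (^-+ (ι x) j n))))

    power-1 : ∀ x → ι x ≡ ι x ^ 1
    power-1 x = sym (*-identityʳ (ι x))

    power-2 : ∀ x → ι (x ℕ.* x) ≡ ι x ^ 2
    power-2 x = times-power x x 1 (power-1 x) 1 x (power-1 x)

    powmod-correct : ∀ x e → ι (powmod p x e) ≡ ι x ^ decode e
    fourthTimes-correct : ∀ x e j y → ι y ≡ ι x ^ j → ι (fourthTimes p y (powmod p x e)) ≡ ι x ^ (j ℕ.+ 4 ℕ.* decode e)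

    powmod-correct x end    = ι-1
    powmod-correct x (d0 e) = trans (ι-reduce _) (fourth-power x (powmod p x e) (decode e) (powmod-correct x e))
    powmod-correct x (d1 e) = fourthTimes-correct x e 1 x (power-1 x)
    powmod-correct x (d2 e) = fourthTimes-correct x e 2 (x ℕ.* x) (power-2 x)
    powmod-correct x (d3 e) = fourthTimes-correct x e 3 (x ℕ.* x ℕ.* x) (times-power x (x ℕ.* x) 2 (power-2 x) 1 x (power-1 x))

    fourthTimes-correct x e j y eq = trans (ι-reduce _)
      (times-power x _ (4 ℕ.* decode e) (fourth-power x (powmod p x e) (decode e) (powmod-correct x e)) j y eq)

    euler<q : ∀ e x → eulerPower p e x < q
    euler<q e x = reduce<q (powmod p x e ℕ.* powmod p x e ℕ.* powmod p x e ℕ.* powmod p x e)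

    euler-power : ∀ e x → decode e ≡ k → ι (eulerPower p e x) ≡ ι x ^ (4 ℕ.* k)
    euler-power e x e≡k = trans (powmod-correct x (d0 e)) (cong (λ n → ι x ^ (4 ℕ.* n)) e≡k)

    -- By `has-sign` the Euler power of a nonzero element is 1 or - 1, so a reduced residue other
    -- than 1 already proves the sign -.
    eulerSign-sound : ∀ x e → decode e ≡ k → ¬ ι x ≡ 0# → HasSign (ι x) (eulerSign p e x)
    eulerSign-sound x e ok x≢0 = go (eulerPower p e x) (euler<q e x) (euler-power e x ok) (has-sign x≢0)
      where
      not-one : ∀ {r} → r < q → ¬ r ≡ 1 → ι r ≡ ι x ^ (4 ℕ.* k) → ∃[ s ] HasSign (ι x) s → HasSign (ι x) Sign.-
      not-one r<q r≢1 eq (Sign.- , s) = s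
      not-one r<q r≢1 eq (Sign.+ , s) = ⊥-elim (r≢1 (ι-injective r<q 1<q (trans eq (trans (power s) (sym ι-1)))))
      go : ∀ r → r < q → ι r ≡ ι x ^ (4 ℕ.* k) → ∃[ s ] HasSign (ι x) s → HasSign (ι x) (signOf r)
      go 1             r<q eq _ = hasSign (trans (sym eq) ι-1)
      go 0             r<q eq s = not-one r<q (λ ()) eq s
      go (suc (suc r)) r<q eq s = not-one r<q (λ ()) eq s

    nonzero-sound : ∀ {x} → T (0 <ᵇ reduce p x) → ¬ ι x ≡ 0#
    nonzero-sound {x} t e = ℕ.<-irrefl (sym (ι-injective (reduce<q x) (ℕ.<-trans (s≤s z≤n) 1<q) (trans (ι-reduce x) (trans e (sym ι-0))))) (ℕ.<ᵇ⇒< 0 _ t)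

    ι-∸ : ∀ {m} → m ≤ q → ι (q ∸ m) ≡ - ι m
    ι-∸ {m} m≤q = trans (a≡[a+b]-b (ι (q ∸ m)) (ι m))
      (trans (cong (_- ι m) (trans (ι-+ (q ∸ m) m) (trans (cong ι (ℕ.m∸n+n≡m m≤q)) ι-q))) (+-identityˡ _))

    ι-p : ι p ≡ - 1#
    ι-p = trans (ι-∸ {1} (s≤s z≤n)) (cong (λ c → - c) ι-1)

    square-root-sound : ∀ i → T (reduce p (i ℕ.* i ℕ.+ 1) ≡ᵇ 0) → ι i * ι i ≡ - 1#
    square-root-sound i t = trans (a≡[a+b]-b (ι i * ι i) 1#)
      (trans (cong (_- 1#) (trans (cong₂ _+_ (ι-* i i) (sym ι-1)) (trans (ι-+ (i ℕ.* i) 1) (trans (sym (ι-reduce (i ℕ.* i ℕ.+ 1))) (trans (cong ι (ℕ.≡ᵇ⇒≡ _ 0 t)) ι-0)))))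
      (+-identityˡ _))

    not-divisible : ∀ d → 0 < d → suc d < q → ¬ reduce d q ≡ 0
    not-divisible d 0<d d<q e = [ (λ e → ℕ.<-irrefl (sym e) (s≤s 0<d)) , (λ e → ℕ.<-irrefl e d<q) ]′
      (prime⇒irreducible pq (m%n≡0⇒n∣m q (suc d) e))

    no-divisor : ∀ d → ¬ T (divides? p d)
    no-divisor (suc d) t = not-divisible d (ℕ.<ᵇ⇒< 0 d (proj₁ t₁)) (ℕ.<ᵇ⇒< (suc d) q (proj₁ t₂)) (ℕ.≡ᵇ⇒≡ _ 0 (proj₂ t₂))
      where
      t₁ = ∧-T {1 <ᵇ suc d} t
      t₂ = ∧-T {suc d <ᵇ q} (proj₂ t₁)

    no-small-divisor : ¬ T (smallDivisor p)
    no-small-divisor t = [ indivisible 2 tt , [ indivisible 4 tt , [ indivisible 6 tt , [ indivisible 10 tt , indivisible 12 tt ]′ ∘ ∨-T (multiple? 10 p) ]′ ∘ ∨-T (multiple? 6 p) ]′ ∘ ∨-T (multiple? 4 p) ]′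
      (∨-T (multiple? 2 p) (proj₂ t′))
      where
      t′ = ∧-T {12 <ᵇ p} t
      indivisible : ∀ d → T ((0 <ᵇ d) ∧ (d ℕ.≤ᵇ 12)) → ¬ T (multiple? d p)
      indivisible d b t = not-divisible d (ℕ.<ᵇ⇒< 0 d (proj₁ b′)) (s≤s (ℕ.≤-<-trans (ℕ.≤ᵇ⇒≤ d 12 (proj₂ b′)) (ℕ.<ᵇ⇒< 12 p (proj₁ t′)))) (ℕ.≡ᵇ⇒≡ _ 0 t)
        where b′ = ∧-T {0 <ᵇ d} b

    no-trial-divisor : ∀ f d → ¬ T (trialDivision f p d)
    no-trial-divisor (suc f) d t = [ no-divisor d , no-trial-divisor f (suc (suc d)) ]′ (∨-T (divides? p d) t)

    -- For prime q Euler's criterion leaves only 1 and p = q - 1 as residues of 3^(4 k); 3 is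
    -- nonzero in the field since q ≥ 9.
    not-euler-refuted : ∀ e → decode e ≡ k → ¬ T (eulerRefutes p (eulerPower p e 3))
    not-euler-refuted e ok t = go (has-sign ι3≢0)
      where
      r : ℕ
      r = eulerPower p e 3
      t′ = ∧-T {not (r ≡ᵇ 1)} t
      8≤p : 8 ≤ p
      8≤p = ℕ.*-monoʳ-≤ 8 {1} {k} (positive k 0<4k)
        where
        positive : ∀ k → 0 < 4 ℕ.* k → 1 ≤ k
        positive (suc k) _ = s≤s z≤n
      ι3≢0 : ¬ ι 3 ≡ 0#
      ι3≢0 = ι-suc≢0 2 (s≤s (ℕ.≤-trans (ℕ.≤ᵇ⇒≤ 3 8 tt) 8≤p))
      go : ∃[ s ] HasSign (ι 3) s → ⊥
      go (Sign.+ , s) = not-T {r ≡ᵇ 1} (proj₁ t′) (ℕ.≡⇒≡ᵇ r 1 (ι-injective (euler<q e 3) 1<q (trans (euler-power e 3 ok) (trans (power s) (sym ι-1)))))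
      go (Sign.- , s) = not-T {r ≡ᵇ p} (proj₂ t′) (ℕ.≡⇒≡ᵇ r p (ι-injective (euler<q e 3) (ℕ.n<1+n p) (trans (euler-power e 3 ok) (trans (power s) (sym ι-p)))))

    -- However ε was found, the test i² + 1 = 0 makes it a primitive eighth root, and the nonzero
    -- residues c - ρ have the signs given by their Euler powers.
    test-sound : ∀ e ε i c → decode e ≡ k → ε < q → i ≡ reduce p (ε ℕ.* ε) → T (reduce p (i ℕ.* i ℕ.+ 1) ≡ᵇ 0) →
      T (test p e i ε (eulerSign p e ε) (eulerSign p e (1 ℕ.+ i)) (eulerSign p e (1 ℕ.+ ε)) c) → GoodAt k pq 0<4k
    test-sound e ε i c ok ε<q i≡ ii t =
      Conclusion.conclude primeField k 0<4k (q-split k) (ι ε) ii≡-1 (ι c) ts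
        (eulerSign-sound ε e ok ε≢0)
        (subst (λ x → HasSign x _) (trans (sym (ι-+ 1 i)) (cong₂ _+_ ι-1 ι-i)) (eulerSign-sound (1 ℕ.+ i) e ok (λ z → 1+i≢0 (trans (cong₂ _+_ (sym ι-1) (sym ι-i)) (trans (ι-+ 1 i) z)))))
        (subst (λ x → HasSign x _) (trans (sym (ι-+ 1 ε)) (cong (_+ ι ε) ι-1)) (eulerSign-sound (1 ℕ.+ ε) e ok (λ z → 1+ε≢0 (trans (cong (_+ ι ε) (sym ι-1)) (trans (ι-+ 1 ε) z)))))
        t-sign (∨-T (goodSigns S) (proj₁ t′))
      where
      ι-i : ι i ≡ ι ε * ι ε
      ι-i = trans (cong ι i≡) (trans (ι-reduce (ε ℕ.* ε)) (sym (ι-* ε ε)))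
      ii≡-1 : (ι ε * ι ε) * (ι ε * ι ε) ≡ - 1#
      ii≡-1 = trans (cong₂ _*_ (sym ι-i) (sym ι-i)) (square-root-sound i ii)
      open Units primeField k 0<4k (q-split k) (ι ε) ii≡-1 using (ε≢0; 1+i≢0; 1+ε≢0)
      open EighthRoot primeField k 0<4k (q-split k) (ι ε) ii≡-1 (ι c) using (roots)
      rs : Vec ℕ 9
      rs = residues p i ε c
      ts : Vec Sign 9
      ts = Vec.map (eulerSign p e) rs
      S : Signs
      S = signs (eulerSign p e ε) (eulerSign p e (1 ℕ.+ i)) (eulerSign p e (1 ℕ.+ ε)) ts
      t′ : T (accepted S) × T (nonzero p (Vec.toList rs))
      t′ = ∧-T {accepted S} t
      iε : ℕ
      iε = reduce p (i ℕ.* ε)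
      ι-iε : ι iε ≡ ι ε * ι ε * ι ε
      ι-iε = trans (ι-reduce (i ℕ.* ε)) (trans (sym (ι-* i ε)) (cong (_* ι ε) ι-i))
      i<q : i < q
      i<q = subst (_< q) (sym i≡) (reduce<q (ε ℕ.* ε))
      minus : ∀ {m x} → m < q → ι m ≡ x → ι (c ℕ.+ (q ∸ m)) ≡ ι c - x
      minus {m} m<q e = trans (sym (ι-+ c (q ∸ m))) (cong (ι c +_) (trans (ι-∸ (ℕ.<⇒≤ m<q)) (cong (λ y → - y) e)))
      plus : ∀ {m x} → ι m ≡ x → ι (c ℕ.+ m) ≡ ι c - - x
      plus {m} e = trans (sym (ι-+ c m)) (cong (ι c +_) (trans e (sym (-‿involutive _))))
      values : ∀ j → ι (Vec.lookup rs j) ≡ ι c - Vec.lookup roots j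
      values 0F = sym (trans (cong (ι c +_) -0#≈0#) (+-identityʳ (ι c)))
      values 1F = trans (sym (ι-+ c p)) (cong (ι c +_) ι-p)
      values 2F = plus ι-1
      values 3F = minus i<q ι-i
      values 4F = plus ι-i
      values 5F = minus ε<q refl
      values 6F = plus refl
      values 7F = minus (reduce<q (i ℕ.* ε)) ι-iε
      values 8F = plus ι-iε
      t-sign : ∀ j → HasSign (ι c - Vec.lookup roots j) (Vec.lookup ts j)
      t-sign j = subst (λ x → HasSign x (Vec.lookup ts j)) (values j) (go rs (proj₂ t′) j)
        where
        go : ∀ {n} (xs : Vec ℕ n) → T (nonzero p (Vec.toList xs)) → ∀ j → HasSign (ι (Vec.lookup xs j)) (Vec.lookup (Vec.map (eulerSign p e) xs) j)
        go (x ∷ xs) t zero    = eulerSign-sound x e ok (nonzero-sound (proj₁ (∧-T {0 <ᵇ reduce p x} t)))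
        go (x ∷ xs) t (suc j) = go xs (proj₂ (∧-T {0 <ᵇ reduce p x} t)) j

    search-sound : ∀ f e ε i c → decode e ≡ k → ε < q → i ≡ reduce p (ε ℕ.* ε) → T (reduce p (i ℕ.* i ℕ.+ 1) ≡ᵇ 0) →
      T (search f p e i ε (eulerSign p e ε) (eulerSign p e (1 ℕ.+ i)) (eulerSign p e (1 ℕ.+ ε)) c) → GoodAt k pq 0<4k
    search-sound (suc f) e ε i c ok ε<q i≡ ii t =
      [ test-sound e ε i c ok ε<q i≡ ii , search-sound f e ε i (255 ℕ.+ c) ok ε<q i≡ ii ]′
        (∨-T (test p e i ε (eulerSign p e ε) (eulerSign p e (1 ℕ.+ i)) (eulerSign p e (1 ℕ.+ ε)) c) t)

    searchFrom-sound : ∀ f e c ε i → decode e ≡ k → ε < q → i ≡ reduce p (ε ℕ.* ε) → T (searchFrom f p e c ε i) → GoodAt k pq 0<4k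
    searchFrom-sound f e c ε i ok ε<q i≡ t = search-sound f e ε i c ok ε<q i≡ (proj₁ t′) (proj₂ t′)
      where t′ = ∧-T {reduce p (i ℕ.* i ℕ.+ 1) ≡ᵇ 0} {search f p e i ε (eulerSign p e ε) (eulerSign p e (1 ℕ.+ i)) (eulerSign p e (1 ℕ.+ ε)) c} t

    rootSearch-sound : ∀ f e c ε → decode e ≡ k → ε < q → T (rootSearch f p e c ε) → GoodAt k pq 0<4k
    rootSearch-sound f e c ε ok ε<q t =
      searchFrom-sound f e c ε (reduce p (ε ℕ.* ε)) ok ε<q refl (force⁻ (reduce p (ε ℕ.* ε)) (searchFrom f p e c ε) t)

    -- A reduced ε makes the truncated difference `suc p ∸ ε` represent - ε.
    eighthRootFrom<q : ∀ f e g r → eighthRootFrom f p e g r < q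
    eighthRootFrom<q zero    e g r = reduce<q r
    eighthRootFrom<q (suc f) e g r with reduce p (r ℕ.* r ℕ.* r ℕ.* r ℕ.+ 1)
    ... | zero  = reduce<q r
    ... | suc _ = eighthRootFrom<q f e (2 ℕ.+ g) (powmod p (2 ℕ.+ g) e)

    witness-sound : ∀ f e c → decode e ≡ k → T (witness f p e c) → GoodAt k pq 0<4k
    witness-sound f e c ok t = rootSearch-sound f e c (eighthRoot p e) ok
      (eighthRootFrom<q 100 e 3 (powmod p 3 e)) (force⁻ (eighthRoot p e) (rootSearch f p e c) t)

    hinted-sound : ∀ e δ → decode e ≡ k → T (hinted p e δ) → GoodAt k pq 0<4k
    hinted-sound e zero    ok t = ⊥-elim (no-trial-divisor 600 3 t)
    hinted-sound e (suc δ) ok t = witness-sound 900 e (suc δ) ok t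

    block-sound : ∀ e i y → decode e ≡ k → T (blockTest p e i y) → GoodAt k pq 0<4k
    block-sound e i y ok t = ι i , ii , ι ∘ Vec.lookup y , go quadruples (proj₂ t₃)
      where
      t₂ = ∧-T {reduce p (i ℕ.* i ℕ.+ 1) ≡ᵇ 0} t
      t₃ = ∧-T {i <ᵇ q} (proj₂ t₂)
      i<q : i < q
      i<q = ℕ.<ᵇ⇒< i q (proj₁ t₃)
      ii : ι i * ι i ≡ - 1#
      ii = square-root-sound i (proj₁ t₂)
      open FormValues primeField (ι i) ii (ι ∘ Vec.lookup y)
      open Transversal primeField k 0<4k (q-split k) (ι i) ii using (Balanced)
      powers : ∀ r → ι (Vec.lookup (1 ∷ i ∷ p ∷ q ∸ i ∷ []) r) ≡ ipow r
      powers 0F = ι-1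
      powers 1F = sym ipow1
      powers 2F = trans ι-p (sym ipow2)
      powers 3F = trans (ι-∸ (ℕ.<⇒≤ i<q)) (sym ipow3)
      product : Fin 4 → Fin 4 → ℕ
      product r l = Vec.lookup (1 ∷ i ∷ p ∷ q ∸ i ∷ []) r ℕ.* Vec.lookup y l
      entry-correct : ∀ a → ι (entry p i y a) ≡ val a
      entry-correct (mono j)     = refl
      entry-correct (diff j l r) = trans (sym (ι-+ (Vec.lookup y j) (q ∸ reduce p (product r l)))) (cong (ι (Vec.lookup y j) +_)
        (trans (ι-∸ (ℕ.<⇒≤ (reduce<q (product r l)))) (cong (λ x → - x) (trans (ι-reduce (product r l)) (trans (sym (ι-* (Vec.lookup (1 ∷ i ∷ p ∷ q ∸ i ∷ []) r) (Vec.lookup y l))) (cong (_* ι (Vec.lookup y l)) (powers r)))))))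
      pointwise : ∀ Q → T (nonzero p (map (entry p i y) Q)) → Pointwise HasSign (map val Q) (map (eulerSign p e) (map (entry p i y) Q))
      pointwise []      t = []
      pointwise (a ∷ Q) t = subst (λ x → HasSign x (eulerSign p e (entry p i y a))) (entry-correct a)
          (eulerSign-sound (entry p i y a) e ok (nonzero-sound (proj₁ t′))) ∷ pointwise Q (proj₂ t′)
        where t′ = ∧-T {0 <ᵇ reduce p (entry p i y a)} t
      go : ∀ Qs → T (quadruplesTest p e i y Qs) → All (λ Q → Balanced (map val Q)) Qs
      go []       t = []
      go (Q ∷ Qs) t = (map (eulerSign p e) (map (entry p i y) Q) , pointwise Q (proj₂ t₅) , balancedSigns⇒two (map (eulerSign p e) (map (entry p i y) Q)) (proj₁ t₅)) ∷ go Qs (proj₂ t₄)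
        where
        t₄ = ∧-T {balancedSigns (map (eulerSign p e) (map (entry p i y) Q)) ∧ nonzero p (map (entry p i y) Q)} t
        t₅ = ∧-T {balancedSigns (map (eulerSign p e) (map (entry p i y) Q))} (proj₁ t₄)

    small-sound : T (smallTest k) → GoodAt k pq 0<4k
    small-sound t = [ (λ t → go smallBlocks (any⁻ _ smallBlocks t)) , (λ t → ⊥-elim (no-trial-divisor 20 3 t)) ]′
      (∨-T (any (λ (k' , i , y) → (k' ≡ᵇ k) ∧ blockTest p (digits k) i y) smallBlocks) t)
      where
      go : ∀ bs → Any (λ (k' , i , y) → T ((k' ≡ᵇ k) ∧ blockTest p (digits k) i y)) bs → GoodAt k pq 0<4k
      go ((k' , i , y) ∷ _) (here t) = block-sound (digits k) i y (decode-digits k) (proj₂ (∧-T {k' ≡ᵇ k} t))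
      go (_ ∷ bs) (there ts) = go bs ts

  -- Primality is a hypothesis here, so for a composite number a refutation of primality is a
  -- certificate.
  Certified : ℕ → Set
  Certified k = (pq : Prime (suc (8 ℕ.* k))) (0<4k : 0 < 4 ℕ.* k) → GoodAt k pq 0<4k

  smallSweep-sound : ∀ n → T (smallSweep n) → ∀ k → k < n → Certified k
  smallSweep-sound (suc n) t k (s≤s k≤n) = [ (λ k<n → smallSweep-sound n (proj₂ t′) k k<n) , (λ { refl → last }) ]′ (ℕ.m≤n⇒m<n∨m≡n k≤n)
    where
    t′ = ∧-T {(n ≡ᵇ 0) ∨ smallTest n} t
    last : Certified n
    last pq 0<4n = [ (λ z → ⊥-elim (ℕ.<-irrefl (sym (cong (4 ℕ.*_) (ℕ.≡ᵇ⇒≡ n 0 z))) 0<4n)) , Soundness.small-sound n pq 0<4n ]′ (∨-T (n ≡ᵇ 0) (proj₁ t′))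

  -- Soundness holds for any hints whatsoever, so it is enough that the refilled word and list
  -- exist.
  refill⁻ : ∀ n k e w ws p → T (refill n k e w ws p) → ∃[ w' ] ∃[ ws' ] T (useHint n k e w' ws' p)
  refill⁻ n k e 1             (w ∷ ws) p t = w , ws , t
  refill⁻ n k e 1             []       p t = 1 , [] , t
  refill⁻ n k e 0             ws       p t = 0 , ws , t
  refill⁻ n k e (suc (suc w)) ws       p t = suc (suc w) , ws , t

  sweep-sound : ∀ n k₀ e w ws → decode e ≡ k₀ → T (sweep n k₀ e w ws) → ∀ k → k₀ ≤ k → k < k₀ ℕ.+ n → Certified k
  sweep-sound zero    k₀ e w ws e≡k₀ t k k₀≤k k< = ⊥-elim (ℕ.<-irrefl refl (ℕ.<-≤-trans k< (ℕ.≤-trans (ℕ.≤-reflexive (ℕ.+-identityʳ k₀)) k₀≤k)))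
  sweep-sound (suc n) k₀ e w ws e≡k₀ t k k₀≤k k< =
    [ (λ k₀<k → sweep-sound n (suc k₀) (increment e) _ _ (trans (decode-increment e) (cong ℕ.suc e≡k₀)) (proj₂ (proj₂ (proj₂ first)))
        k k₀<k (ℕ.<-≤-trans k< (ℕ.≤-reflexive (ℕ.+-suc k₀ n)))) ,
      (λ { refl → proj₁ first }) ]′ (ℕ.m≤n⇒m<n∨m≡n k₀≤k)
    where
    p = 8 ℕ.* k₀
    Result : Set
    Result = Certified k₀ × ∃[ w' ] ∃[ ws' ] T (sweep n (suc k₀) (increment e) w' ws')
    use : ∀ w ws → T (useHint n k₀ e w ws p) → Result
    use w ws t =
      (λ pq 0<4k → Soundness.hinted-sound k₀ pq 0<4k e (mod-helper 0 255 w 255) e≡k₀ (proj₁ t′)) ,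
      div-helper 0 255 w 255 , ws , force⁻ (div-helper 0 255 w 255) (λ w' → sweep n (suc k₀) (increment e) w' ws) (proj₂ t′)
      where t′ = ∧-T {hinted p e (mod-helper 0 255 w 255)} t
    -- Each conditional of the sweep is followed by matching on a Boolean that an equation ties to
    -- the test; a positive test refutes primality and consumes no hint.
    euler-step : ∀ b → eulerRefutes p (eulerPower p e 3) ≡ b → T (if b then sweep n (suc k₀) (increment e) w ws else refill n k₀ e w ws p) → Result
    euler-step true  eq t = (λ pq 0<4k → ⊥-elim (Soundness.not-euler-refuted k₀ pq 0<4k e e≡k₀ (subst T (sym eq) tt))) , w , ws , t
    euler-step false eq t = let w' , ws' , t″ = refill⁻ n k₀ e w ws p t in use w' ws' t″
    divisor-step : ∀ b → smallDivisor p ≡ b → T (if b then sweep n (suc k₀) (increment e) w ws else eulerTest n k₀ e w ws p) → Result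
    divisor-step true  eq t = (λ pq 0<4k → ⊥-elim (Soundness.no-small-divisor k₀ pq 0<4k (subst T (sym eq) tt))) , w , ws , t
    divisor-step false eq t = euler-step (eulerRefutes p (eulerPower p e 3)) refl t
    first : Result
    first = divisor-step (smallDivisor p) refl (force⁻ p (divisorTest n k₀ e w ws) t)

  -- Comparing types of the form T (sweep …) would evaluate the sweep again.
  record Sweeps (n k : ℕ) (e : Digits) (w : ℕ) (ws : List ℕ) : Set where
    constructor sweeps
    field
      success : T (sweep n k e w ws)

  sweeps-sound : ∀ n k₀ e w ws → decode e ≡ k₀ → Sweeps n k₀ e w ws → ∀ k → k₀ ≤ k → k < k₀ ℕ.+ n → Certified k
  sweeps-sound n k₀ e w ws e≡k₀ (sweeps t) = sweep-sound n k₀ e w ws e≡k₀ t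

-- Certificates for q up to 1.2 · 10⁶, and the conclusion

module Certificates where
  open import Defs
  open Families using (module Construction)
  open LargeFields using (module LargeField)
  open Computation
  open ComputationSoundness
  open import Data.Nat as ℕ using (ℕ; zero; suc; z≤n; s≤s; _≤_; _<_; _%_; _/_)
  import Data.Nat.Properties as ℕ
  open import Data.Nat.DivMod using (m≡m%n+[m/n]*n)
  open import Data.Nat.Primality using (Prime; ¬prime[1])
  open import Data.Bool using (T)
  open import Data.Unit using (tt)
  open import Data.Product using (Σ; _,_)
  open import Data.List using (List; []; _∷_)
  open import Data.Empty using (⊥-elim)
  open import Relation.Nullary using (Dec; yes; no)
  open import Relation.Binary.PropositionalEquality

  -- The base 4 digits of 108, the first k of the sweep; the later starting digits are those of
  -- 15098, 30088 and so on in steps of 14990.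
  start₀ : Digits
  start₀ = d0 (d3 (d2 (d1 end)))

  hints₀ : List ℕ
  hints₀ =
    0x12b3e17704a34171798af0d1b5d275706376d299e752d670b146c5e725816151a84269258251d0e5c34090f0e0e ∷
    0x10d3a313338063a2c7b0a00052924f95555692b66080d095f1e5eb64c03026245ac7b15727d581317150d544028 ∷
    0x116363b2e94237b2312e2233a9d076c13484334610e2e246d0d161c9e0516820a8c126f874b174d16058ab1165a ∷
    0x11e671222ba18d3f60e1e26343d5c30233bb44b5a2a0e4c1f1b2d38418e72c01716243bb27b0f3531294c451e14 ∷
    0x1041d9f0c3c3a2d6992232f981a126670300c6c47760bed0419150c291c17063d293343ed3c1c0d524d53739c50 ∷
    0x103bf8868702f260d38271750325576855e7166064e0e9d3a0e5e2f28261b17732a2e2705069d056f4b94332c00 ∷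
    0x1450e9e36872737043b38060e043957b3083c8bb244371a544f67151e3b2e131427df1f664d5834306d2cae2879 ∷
    0x141467e86377a0e13281f54077d3618d708be1c314b2b605e0437892218450d0af7042d9f25bd061a8439351d17 ∷
    0x1de5d17845c258b6c1729061e0e052e140f0613272b0a1ee5d960161b14e64f560b0d0729355739bb5f0b8b1d5d ∷
    0x10689991c1c7792660d23431b4c4c1453ac0db4175b332e3479555766a47b063e6541100a7544262f0b730d2f37 ∷
    0x1065015272749ac0d814027159f15d84f148229397b4821560ce32586f89b4d16384138211e22271c060c140a74 ∷
    0x107160b53460e40128d82eb8d344f0c2a1c6bb8221558a20b43915814a50566060c4c3f95292006cd7f144e0014 ∷
    0x174340cdcdf19884e10607b8c92250e579a35162958071c0f050d0d237b7e06392e6f0b3e0a2e6b17a42671c20c ∷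
    0x1840758122698172814143a320c37309b40c500895727120b2b203723179c2657ad0656760e381b1d542a3662cc ∷
    0x15c2b220461ab0cbb563b05062e1d6d4e1ca03655c54b441615b529286735852427161315da04b50b0d564d0e7b ∷
    0x10e1d5a142616a31222ed41182b105a48522f621621461b0b1e2618d138133823a4674e05e1c1050fc52520072c ∷
    0x11719120c8b619d0c140d961d3d0d142c56de59050b211e220b024c46030b15146d2226e5ed0088150a48267308 ∷
    0x137499b2c541633052a6a59292a58ab60a1223b000c680b5568303d0bbf2065278494c10c2c0a59f7183e218d1c ∷
    0x1371f0f6d5a5306379d12214ca328410dfb1d12210d8d8617143e2a8d4b17520b8d0622090e8370056006705400 ∷
    0x11d395e0c0ebb5a071b483556062d5d1d25431b6c5fb94e0b3e1c1521264f28b727834f293a0a398f3a4e0f1858 ∷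
    0x13a2e36302378340eed1319051d68192671342b0653149b362edb29070e043e221818473c0b270c1c3d5e13e630 ∷
    0x1ed0c0a272b3606f6082d17522b0c743a8837ae4dc60e44065f211c2d13421e1f46884b283a3c072f456b351f13 ∷
    0x1793a0f1e0f043b0c0b4233230d629e122a0525292646066f3f27cf0b2c690c1459f22d17271a6d1e2f09202da3 ∷
    0x172132439041e37cd28680659063b2c4804e292121e0e0c335c22353c921734860619766d46572c23904b4c482b ∷
    0x1824c5e41340c154b978cb58a134c067026b550c30d19202928d6292524c0e53f0ce3120641340e1e351684da2f ∷
    0x10e1e1b9f1b4b5b0d07ee0e3c30061a153a045e49090cfe501c046c0d7b17070c0a86353e841222150b43081d37 ∷
    0x145196d0d30233253046b2827cd2652371445ab81425f17430d2a0eda4e6614282f1e77344722cc362a2e2f390d ∷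
    0x1ab222b3337c9124e007025160b170525bc380b1b0f3b664c4d0b3a6ece06071c1485b15e120d0c3b0c132a4472 ∷
    0x10b6c470fae1a054e67057b0d067e8e413fcec02816e31b1fb01e370a6928554490287e0d918d087b5f429e1442 ∷
    0x158419b26262d5d21f4f84c244e2c0d131d3445260b045ea447056c1a2ef6cb041e4279451f9a2a873e0b1ece22 ∷
    0x148850b3f054c0e0494892dae4c482b5b86a76e0042d6252a3370164c29052e2730068a06bc9e5c2a17223b2a45 ∷
    0x1051e2f2258381c36990417b2221e4e0d2e730b0b2f0a073e73165789255222501b36121b2b5f07284d0c6e080d ∷
    0x1822d3ba5358d1a524d3d066dc23716074f2c943d49051b5a17ffc944944607762b154733190634144a541c063c ∷
    0x11544210e2738059a40251b1c4bc03a13d11e0d7b0a142848332bb81787222f463a393375275828245b07061645 ∷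
    0x1fd22766f5a4a1c0ba93843123e26ae6634d6720b2af0bd2f160f0bab34753035ec173a2a24352d465d14150429 ∷
    0x19658064c86066c0d242c294a042634060e0c9c3a172983d104040b0605885a152606281ea52035358427063417 ∷
    0x13c191f1b260243093252cd5d2ea6181d28b41e155a3402061c241696b38376220e256f19275303281a5742240c ∷
    0x12728a00f0630147e19ad4d940c151e0c41c61f4d53400c21ca360d2b212646390d0b4f540c9e26296a453fcf20 ∷
    0x16a2b262b0b067c67b412143d1220001c150c5e3f3d7edd0e5eb70b1f273c9f650662054916ce3e1d4d60d51f59 ∷
    0x161332714774d142ee2000d435b253048336d0bb61c0622130d1927377061540e2c074243102ec045180412550a ∷
    0x10557434e217bab57546ac01f990e3a17370e0d4969dd9771063c46450d1d2c785e05be050f61530b4c7d2b1029 ∷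
    0x11f0e190f06ca941d4539273710262a8f06db6b782f06531f21160d3245cc3f3b4b4e49706c3906821e6c382f4f ∷
    0x1828b584e2115202b6f2e4b33204e842414433e0c2c183d250d41a61847282e14340d0f38122809171a4e362cb4 ∷
    0x10b2b1b1f0d4e0470160029060e46053e3687261805a161142ccc8b275ed9a142efa909174d9212430f5e568543 ∷
    0x11202830806950d162012351727121ab856351d1b3897173e4315710d22c80e7c065b303d952c5c13704a3e2d18 ∷
    0x136b95d1c5d280c13351db646203645060b27cf19445f873b0e2214370d763a1b0ba40d79542d04727c419a0eda ∷
    0x1a73b258ab1132c3d2e0b58382b3940550f0e4656834f032f1f4e170d4b0d141504151597d112574b540d3e4659 ∷
    0x130053b0f406e5a1442629a5908432f439a2e2a4c0bc6265413040f201b0a26375756240618663ed8375c2f054b ∷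
    0x1a42760486c254feb43362c696688cd2c3a9b12265a01340c0d3a58f7346e3c120c8a280c0d0b56211467797e53 ∷
    0x15cb0882c1a142d6234183b48132b2d7334081d295f869d28c8c1770e56492237883045420f042f391a28070a69 ∷
    0x133120a4a22568f0be764363728bf1d5c1458196e1c25180c1713062b213428681a073a42041b307e295574eb16 ∷
    0x1250710561406a63d6e4f0d13165569582e3e0726870d4c1a1d2d150f4d3577d54aaf200a282d76210414302e4b ∷
    0x19e44142da82a4e177408274f55054de81750581b4334953d051096681f3739072853050616065a5c1c16376c1e ∷
    0x10b0c2f091a330f251b6e0b2d4a0d861f0c7d106728267627910e344a1a0b061740567c180eac5170ac24604973 ∷
    0x13b662e2f0e153b1a5da37c533b79eb0ed26f2505670fa16ee11c06770e3574363f1676761c151b172c07251572 ∷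
    0x1332f45561e0b23173d7060950b9316088599862f3c145e240d5a226b4305160d5a1a2f0f08b62834421c392650 ∷
    0x10c440d2d53152538144d722a3b572f128b0d351c108e280c10927129672a70044f669537100d19438bfbb5b334 ∷
    0x10b2043784a0f0f2e1f1712f2000e347b664a280d440c720d1810561d3e342a2a3506a51fb4bd05200430034893 ∷
    0x1d30e17051e55d667ae3838560c5014062b701c3d37183728e91b472899f81d413518154e1e073f1e6642a22c1b ∷
    0x1441855822c9b6028b007830b0e351e14602ffdb44dc92b2a1c0a0daf16db0b09870a770c69079c341b14023f10 ∷
    0x19e2013f50f17381e0e674a5c282a44d85a51a02966684328871be62a5c176206d0124d33671671506004056206 ∷
    0x1681f04363f921c6a3c1c53a5042944874b1a3a435705693b57435806451c674508061e552d64250d052c212868 ∷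
    0x10d7c0ae44d ∷
    []

  start₁ : Digits
  start₁ = d2 (d2 (d3 (d3 (d2 (d2 (d3 end))))))

  hints₁ : List ℕ
  hints₁ =
    0x142ca4d1c5a0b1897691ba1404b1a084b0c58071b0f147743d5712d278c1c042e68232d2dd55e2d29154b06d235 ∷
    0x17b3f8e1026146b070f1f072a335e20050d2e68053e166174060b47341c05348d340a2f4243a00dea0e31086c3f ∷
    0x1261835211239832f9d426d1c451d0f4d02121d2b70161d77941469462e0e9b0e1c0622205715130e5d069a3015 ∷
    0x13a400f190c742706b6191316cc252e962d2d442b78608a20272b20141619d7304f1d1906273f5e2b298ce5f610 ∷
    0x11e1d0e0973165843076c1f153a1f16bd3b6d357927281c0c220e7556313a4f97280f5e1214fa571f6073174ce9 ∷
    0x14c4b5b0a3c7e1d7e210d0566b128d2c31b0b7727b213820e691b280b97703c1a1406420cfe0b5f3e261b3c1945 ∷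
    0x145a12c91241e0417602b0b943908395b453c401910103a133f9a3c5d2f940aad1eb6f926240434423877162f0d ∷
    0x1b1b086b43d2e42a014120b051c2a5171a58450ef6906775c1e9a1b27b70c1f6717750f072e2b06843c44194fbc ∷
    0x197462f2ee4e0273e380f0cbb22365f06392e0c450e273b0f395ebf34363c7f3915341b863d3dd5520c06020616 ∷
    0x1120e289f06395069540b22954605662c352a061e4d27771d528e5d260c1d2b0b2c3c4a66154c3d1b3502b6048f ∷
    0x10e168d1d1f7ed01b2646500d6ea65f177228db2c4843088d1823277e29162914db8d380506170d29a2212c3913 ∷
    0x11b64fe2a6e774c0e1615169c380a34564334091db24e3ae6108e5f0b0d192a726cdd8c6a222eb43e67136f4c22 ∷
    0x1930d4b279c2e1e4d0032161e25061476b102b40c10772c23167d267f2005042d376e0e58490e3c067947dc1605 ∷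
    0x11e2b491b8d1c453eaf145ce5fdba2c4038154e6f162d1e35420dd0070b1b7b0625150e2b651448136d742a1416 ∷
    0x1b30c8386183709624527af2043111a282a7b1a2a291c1517332cab610b6fac06127b341c2825503b8412452e06 ∷
    0x146351f0d2b2c0b1734ea0d0b3ba10e43b84b59362a4e58b89eda73073b0f693b04075a18060d0b150a9b0b0632 ∷
    0x149051d3d450b27072f923c94c5270b07073309461f59653a040c6b1a81a80f0e7b431c871618581e170e3a1daf ∷
    0x1272813f9170e9e8772044905566f34220d2c04860627420e4b0c6005bd21bd205659372e656d1560287538603c ∷
    0x14c16067328660217bf801b582962177142299f1294215713052c8516737606b72a7c3f072f2262232fa9a51704 ∷
    0x1161e58b229172a1b3e4c04903b1e749804036f2e005506077d100d612a571571c6167237390a588e37450f1469 ∷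
    0x14c307c2b2f347d1d23050895380b541f5d14250c270c8c0616123e472b3c2181393727530a045c3f60240a5a4a ∷
    0x12b8522660c761f4f5728ab17509e362a0aba8a2f940f984d0b3b060ba4573f05b406160a88ec4b0d851c4f2f23 ∷
    0x1543f4c5e0654b11fcf146c83062a46938d8925dd6a1427796c39a8ce0b570f6e624698cd350416222a0d2a0da0 ∷
    0x1187c29cf1f5417031429100521886c4a430a3c660e1d512617436a09128e2c144c5e0d2229b86002334d82ed4c ∷
    0x12db10c18c35d3a0d225b1e2414fb3744823a180a0e2838661c3b22a58b14d2ad233c2149589914311e5a14825c ∷
    0x1103e1a1d891a5d965d45c60ece0e146a0c831b5306353a040b0d2a6f17078eb40a153735091e0e4e1e0603b11d ∷
    0x13b0826167c16104421e60d4c35265d534d831436578b653e08b53b8eef2b584e253817543eb841c22218715d73 ∷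
    0x10f234115302727165b1f510618062c2a06893d2797d82b0c743e2d20ec9a6fa12b38610c2f0d460a174e02675a ∷
    0x14d1f2fcb0b9f4f2605124c120d5d0c9514050a422b0b1fc46f0d4a827d0c1e14459e5306152214074f2f3b762b ∷
    0x1d627177514be1e5124c21e4c0573535720212a24196f0d0643043da5154f066b9b431e6a622f2c5f107c286a99 ∷
    0x11d1c175f1a0c33280d6033250f5a042f1a691d074b0c0b2223100e1b52593a1f150c3d273d9d2c712950702728 ∷
    0x10b2207bb9f4ea4340c060a940a0d1a1406141b0a37542e480c3c0e253e0b3a1c530a5c290a5d2760040e5d0b23 ∷
    0x11346066b2c42a8254758d20a120d1a2417550f107e5d2d9a34aa9ea02649723569193310324c0b5bb22cd30e34 ∷
    0x1065722201f2b445707c62e65c73e18293a46a90b002897201e730c22723a689728f4452915743b285214231c0d ∷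
    0x10c0e3d77107262020b151c0e0d850ba9380b1e391e49260c57aa0d170e555d323b458c0c0c4d15171444055d17 ∷
    0x1a8287587161a50080f1c739a2e210b0c1a4a0b833e0e47d6d717301a283c129872353d3dbb120585561dd64a5d ∷
    0x1480b59444fbf1793891b508429b743432f33282c3b4b5407620db8260b2726231e2805592083245fcf250e6d2d ∷
    0x10e0d261d9fb51c608f1c022a5d750b261c0c4e3806090a0c1a0e19c146140e16fe2648578a28295d6066053e2d ∷
    0x1251b07530d99130db7f02942710e733c9c153f66b3635a213a26732a140d0a26962d38a61f1c0e0d8e1f159d37 ∷
    0x13c399915273bd5085708712b42210c71466b1fde270637142c4d26342a2d1503441cc873224b7daf33260e27b4 ∷
    0x126694b1a225404de3b0c06171d5a2e04242e3e453f1ee46418141832b1330828222406c01d1d640f1684085f1d ∷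
    0x1021d0835cb8e0a360fae473c1907120b086a2946062e856c6a2a5a1d241e0f5b681f8c0c3c3b1b971e0436fa71 ∷
    0x1662d4c285f340da70d386a0d263707373f2c550519593c1ea60738b93b97135e054004ce3842217c3b0ceb0c3b ∷
    0x113064d0e0d5d68792fb88813050c15ee2d4a1734832906680c7a05182c912c58431c2a2913563e770421272a38 ∷
    0x17a079b06190f4b455d35d713a71b4fc683966c666e0b0f2a6c522e7985193d083f360577102538731d0d0c1036 ∷
    0x19be60c821c0654146bf655311b95e715703e1920eb34a42a390f9eba4c0f065a3402163a4a77ca4906172c9d22 ∷
    0x12a0d1609334d3dcc1ed0673092bf155c1e131c00642f271599130d2c2d371dc0350b684b0d17681d29fe0e7734 ∷
    0x10a1c2d2e047cd042268a632983160b141d0b1916714903120c1f2d6e1f0c0c316546061c0a421b2a68af170b50 ∷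
    0x11c0027792764cf170e261b14cc180b5f2c47447b2308741102191bac0b5c68172d52986bf856083728692d0c8e ∷
    0x166400d0b06c92ac51208226c21109c20187b00220c0c9d0d0c6d2266392e433c1f6c15521738041c2c821c150c ∷
    0x15684e32923421d7c2b70b72b263a1e0d120f292015407b373b314fd5b61754061e704472c228b542174adccb53 ∷
    0x18f16710d440e47d44206254b2e12dc0a253d3e34171b7167049935f9045e34cbb049af16ab1e3666582cb1770d ∷
    0x13d2e1d37060653652b2e095c3b664a2f1d0c0f1d2f3a6a8c229d27542b49281e171b55744316b5ac0c4c202f23 ∷
    0x15398be438c4719372854a37467f8bf46351c4e29476a0e040527372e071e55344d2e350e2de34c4c3bb60f0d04 ∷
    0x1180cb606299233ad352d530b0b1c432b283244d25d21af15b9565e12235b6c1d293a4c1f456a2616251e1a ∷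
    []

  start₂ : Digits
  start₂ = d0 (d2 (d0 (d2 (d1 (d1 (d3 (d1 end)))))))

  hints₂ : List ℕ
  hints₂ =
    0x10e198d580b0d564f3318f53b6422462ba60712061d067813064338167db0d4669b0a45502b0fe60b04231f5516 ∷
    0x1150e2a047c0aad242d3414552e9c22651710151b5d042114063c0d2ece059e35d52e29615b1b0e28362b0e580b ∷
    0x10d29093e0f340cc62260210628220b1d06467b3a136f1ddb4d538c0b2e3a1f9f5a5d93161a2437291e294d1f04 ∷
    0x105284e4b2739282715bb29d716342c1a43b40b7dca1980045f6b0126aab31e448b2728164c651f0c0b14360c85 ∷
    0x1082d444614740b13775a0a05061e0d079c2610f54e411a8351ce406f082e0a0d6a698b88052e161c041a4f0cbc ∷
    0x15b0c7e684c0f04524c1712156c50876b17150e42053e0b89103c1d0c0a9b173d461e8ba577165a431cd019170d ∷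
    0x16617748bbaa4dc1d59451de3bd062513278b2e1f1eb01766101eff5f0a4275235b0eb015361f667e7e2a0c570b ∷
    0x1000a1d5c15b314278c2e3a16530b185c695e1c342d0a2f25b00f4e6b4ac02b1e8e8a2610b20d222b9b50248eb6 ∷
    0x1349684abdf72df3b0ef41e082c18a4052728156e18581542210dcd3b690d079e818207801ac2273d39ee9a898d ∷
    0x1276f395f61059a044b473d672b244a52387d147e2c990a3626400617894c2efc899926484c3a0c1e8b36260c46 ∷
    0x1102e9d2f6047ad09410e2e3d22262e13363d3202720d5c251c14726036540e0d1222723a1d5c0e32150512de02 ∷
    0x137182652075624482e0b681c0517289a832b33271509491539a50e36781e330e532917a4125c1b0614c6bc0561 ∷
    0x1dc93151b770cb65f68ac3d185e1728b45b3217df278d2d101842023435060545066e2a0b940c0c425a0c04393c ∷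
    0x17b075314150db386161e0b261db817b8215f284a711c2efb487899a759944e822e892c0b5c0f67140b0b14265f ∷
    0x1a3b31c171cd00434bad21c0b1e397d4324286a229c4426175aa60d9c139587350e0b0e0e26373b881c775b2335 ∷
    0x1b20a1d5e2e220d4b0a57620d143b1d33615373239f34484a0d852b5836536a0b2a2e37bd0e26310d0c265c532a ∷
    0x116be921cc03094290c572c0c38251043228e96546b1f351c1d07bc3e202e590b0d7b0c1560277f163b140bbb27 ∷
    0x1ee5875181a58a05cb60e0fc9392a34292d0d220d0646235a3f2e5b13284010770d3e0f0409423644345b354f2e ∷
    0x12d0cd82b4f5fb7353aac220aab3049530d3f07293e6f5f0a235d1776292da43417e3141f0de41d20240c05050b ∷
    0x12325fd4910553007533322302d2c21063d232e440e1814347a1e39251029480d45189c202a373f2112b17a3015 ∷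
    0x122027f4bc12c353027b8a4693c7f16730a7e1a1b4f18660d392c0ba6395e580a6a3e17941b741c251d12687a8f ∷
    0x1d8281d300c201456e735140d14143ad5200776360a363b49134a373cd01e2c73533743062b8b0e1c74150b18af ∷
    0x138217c0a37145c222fabf40c410f2241307e519928cd606544426661392e870f8c190b36fa0d422ff382143c35 ∷
    0x1546e2a0b2629267b00062c06a7676d11750d15e52895005a0b072f66022d2d0d4e02453d221d5b1f0b8c27350c ∷
    0x10b06ae0b1118d6be0c0d1e1f0b241b14701e3e8520ad253a2f56180e2bb3430d0d501d0c64443b531760560c17 ∷
    0x16e051e0a233e178b14570b3b3a7c2c14c2831e880e1706934c1b1e172d1a8a1317ae0d1a6836b80d472f72691b ∷
    0x1135fc60d374b04b24d6906142e1c4f0570130e10552317822d1667ef0b5e0a721405139f5a0b7798ae14176a25 ∷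
    0x1241794155586670c37703e14439b0547722b6b0b1d0e65382d294e263a0f353b4677172f3c3337042e210b0cba ∷
    0x119810e515b060e8b0e82f73f0c221614ef0eba276606140f17604416cf54591614940d3eac0d305a060608b63a ∷
    0x1120668125d6f4b0613dd3a1b0a561c14020db90c3c0f15cc256e9d4d570d161084072b75290e383a0c0b9d3ead ∷
    0x1cb321c0645202537666604276b9eea462c5e62340d0706666636b61c73242a2a39434c81374416791c53eb6a6d ∷
    0x10d0c7a2f261724d96a5d270d5f0c1413023a096d4e1b140a5e1c0e1f8b3618fc170b58389d42be23b529363c2f ∷
    0x1fb0bb01c263f3e3428043ab51d8c1d1b0b2b382f38325e0c16bb65840d267e36128d0d22150795545a29ac386f ∷
    0x14c385b1c261d4f2a6a1776331859a4141806160d2c0d04050c2ca73935230c370a8207c60a0d052d21050d0cae ∷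
    0x15d479bcc865d4d4515061b0deb5543552abe178c6f5aba2f08a14a77160d95bf05842a1b0b1a6a440cc66a295e ∷
    0x1271e587632f42f422c621f365555422d56234b0f251f16ca07516def0dd6573af933058884144414351a0e1d24 ∷
    0x1375769178c0c3c1429ab92264b5e963a47a136881205303c77ae0c23466f0d1215805e06430e28063e18403344 ∷
    0x143301e1d5b2b460ab12e370e87254d090acf3c34dd1d0a473539304f2965169c4f505b4d23c54b100a731ede2d ∷
    0x18f060a456e59370c425022502b9c3cca1e6f44083aa6569ba7754304212e26272a2c103e3b290d1d286a16db02 ∷
    0x144ba1d0b3a3b39453904458c1e151e0b6e2b36285e160c0a7223552e435e4a024a29133b61860c601735077bbe ∷
    0x115760b381f530ea8042681ec103f17195f2a1c222789472c76260b0586732f106e834e6f5c893f14045c260605 ∷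
    0x12b1f1e3d10561f0e2e1d74243d40149bf2591b06835a312913660e27376b44045617000d2a1a2dae3aa195440c ∷
    0x19e2d6a4a2b59349e39490b11505b854660a478720a462421b9870d1fa405cd492710fea73008ad230216621f16 ∷
    0x150de059b3b301b293e172807000e52392f06123b693c4c482196a61c2e294c6049970e0e0d06a7130e280a6d67 ∷
    0x1561a2916ecc5152c104d3f050ef70d0e2e8829241d5bbc3e15172cd82c37281d5c37272c5b913b120d5d135304 ∷
    0x11c56d61a863969370750642b0671092815271e150f6a0f2d101a3d7d3d292716052c2f0e2b4d4c178d060dbca0 ∷
    0x116ba36238b17551414282e2016725c453e551205670d182f0736d29d020a230e70f7550673245d6c370d411e22 ∷
    0x118062d436f1a6f106614561d0e1d74350669063c46065d0a1de853153de60e6a41e80d471a043cd85f0406223d ∷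
    0x114450b463a0d1265040a0d239e2389cc160e0e36163f0b225d3668bd620d1869491b0d495c515d0684130b3325 ∷
    0x18b233b9e30fa1e02052156b7050b2a0c930c14450b343d069f934f360723062629255b43422a580b9a2b050ebc ∷
    0x1393a2914543a041e420b5c0b060c146925220eaf02262e740637a33d157e1d0b722b152b0d500f271e047d4519 ∷
    0x1055a002856250c144ad03b5a940e273e3d464fa046104a8e383e1c07431b2f44443f420bbd22371d0c1035162b ∷
    0x1057c262537150b121d2a2612199e4483042a186f2d3d ∷
    []

  start₃ : Digits
  start₃ = d2 (d1 (d1 (d0 (d0 (d0 (d3 (d2 end)))))))

  hints₃ : List ℕ
  hints₃ =
    0x12b0f0a184a270543361d3e14323453241217114507201ce37c191e31271719051c05430b02066a3085182d446c ∷
    0x11b554d2756b517b074a0282b0a9ddda61d4a990fba162ab10a1748030d37e5381b2c2c3806330b7e052b0b0d15 ∷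
    0x1943a380e140f0e34bf26260959c24a2c2624710c2dd9211cd5084b67270049e8d92353234c1c6f05065e942eda ∷
    0x12606185029064e2a3e59552826b121ae0e930d1d3774667c67a52f66530b1b231e4422ce210517180520b02883 ∷
    0x13029b763060caf16073828270d7316224c0f34e51c544f6e3a6d28062a042eb9067096434a07650d17a4573d3f ∷
    0x1729448231d12029b5942961c6d2a0d3b2b2a438b6c762f0d1b890e16a12c27460635436e334a170cb11810366f ∷
    0x10ea4044b3e342225252f370eef7d560c7bac67200e1c440cb227043c3b193bac9c1e5c02da2b1e454508454e20 ∷
    0x1621a1c1d511d1c3d444a769528354fa6820b0e2abbe51d6a201c36f82b1638700dd712b157650d15350f9f0e19 ∷
    0x10b16677e73d18ee90c2a1046b35e02132945b5372b1629066c042842450b220b6f8912791d064d96140d6644ad ∷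
    0x1c1270c5d0216583e58b67d1c9c1f1da50b0a720b61b60e2b0e0d455b6d0c13174d0e961ca39127835c73720768 ∷
    0x18726490d0d2a0c0b346920a54400040e6c25b11a748c200e7e4f27462f2215d3d07143cb3419ad054e5722266b ∷
    0x156f937150c713b6724b6151e6b5b577d38a41c260f2e390e192a271b27153538062806683933041093463e1622 ∷
    0x1663b0e07230cda9417c2ab0726778917219c3b54103724400a1b26b2e95ea43434371d195a5b351569c21326e6 ∷
    0x17e2f33171c3473640f240d0b153617103304270d02aeabb4283afb4ba0582c1a1e89760c6b140f3f5727923f14 ∷
    0x1261c5580281b264a901b8628a6804c1eb670220d3420282212132dc1691e77060c60b80c891e170bd51427046c ∷
    0x13a26360e221f0c13360e3d68940a0b2b2e60a728131a83b60c274be3065805d7c90e2d5e184551342e3c140d1e ∷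
    0x1304a2f0d0684141b38832c5f504729002a280c0a69410d550f3d056f05064d160c3b6306709d586b2c28074c7e ∷
    0x123161729eb052b9139c8062656075d162ce5b93cc09a70330e162b0b29062ab112c807597116421c993d1bab14 ∷
    0x13c5334255b17de4a060b06a5145f711e0b1f3b150ce72e8f26051b7407900ba8043e4f1c66e64a4c15144622bb ∷
    0x10e301851360e6804062d391e38292f3e4f3412acaa35451f17b319046d5b0c0b1eb4226c060506a7ee44225c3d ∷
    0x114ae612d2728d906830f221d423b0447760737050d43061e690e5615441e059d0c04797113234c0e1a0bcd4b3c ∷
    0x10c132a16070e4d992a206e2c46125f1b2c7b2d3a36123d260e14172935b0a40a2b160f391543935e06512f3921 ∷
    0x1090e7561025324a014b643d61554233715247c41377341256e341f61053c660e144a9c160a436ab62a182b0a3d ∷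
    0x1842e44447037566c2a0e46ae2f461d6b695c384d9c069c3c284b071c0c45734415585c3c1f7230147c62267008 ∷
    0x1d0186575069e0674b22d4b5314b1d18ce53516ec3a0d7702152d6c152a054c29e5002f38464d6d26332a15888e ∷
    0x1661e810b3e706842750e5d8267b8990d4c04140c0b3535a50d12ba357be6af5915ed9634692b0b2b680a261506 ∷
    0x1453a4a9e06101bdf223b4e365c82570b1245100508052a4d064d8d2f0a1b1f5660160b2e350c1a2046b865140c ∷
    0x12d06341b8e1cb039ea16073a330d47e41425c5190c050c0d372d0b897a18701453361817451527352a75ad15f3 ∷
    0x133f5052e149c05bd211c643d2a171785249d563c0d48cba427d11f1c7c474f161feba454b8223721308e170b1e ∷
    0x168161c0625a70c28b73e881e831e068f16a106dc175a2c6f142f8a094318ba24060f14382c082215ac085a8a0c ∷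
    0x15343483a307c830b1a431acfb7cb520674142105158a2f421e041c0e2e060c47190b5914586602b16d0f148b47 ∷
    0x15f0f06163d291688d4fc0513371eec4223043504230854cbb0acc130b41aaa1a595c471c6e43bc90fc171b4242 ∷
    0x1771b9c17541e274c1d372f5814710c2e0c589c42093b3cbe2b5d0d21443a8d1e490b1c29c21df11f14085c1d16 ∷
    0x1120e2d297310b03612350d73140ea114ac17795c0c05120a815f1b13493617368c174a22b8071654b3261a3b17 ∷
    0x1221d0b5fe4194572333716b2160d0e162819fccb135e5e1c308a2819190c351d4d0e0d0508703b0914504d8b05 ∷
    0x13300769e0b1d2a109c658746721e3f26e513cc173860383c4f3e0e1b684c0b0a1e7f6a16282f4c0a1506736d0c ∷
    0x107be1e15361d464d3bd348122d2725360b051f1e228a0a0a3b5099062b6a0a17d85f2118645f14294cba2e5a55 ∷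
    0x157172617d867b21925224fb21d6e06e2390c242452641a5258a60c0e2e0f0a6e112414364f390f0b380bb03a2f ∷
    0x11c43145922d54f9722680e3c3ba717094c162a0b575c29bf58750e12141a1d671f2f4b210f3e093a5b360a428b ∷
    0x13605b6acda063b06cf13073e1654b80ed006170d1f7e101738286f2816774e572e3530710b53174516ba5a5c12 ∷
    0x11d5e700b4a3d420c37660e0db34a2f3d2b3d170c2b29202e1fea14221d16ac4e3d453549875507275a0a120f15 ∷
    0x10c06171ad32929151c1e1d0d7ede0b2b2719a42218179220cd0d381c120c146622108653ec364b491c0b1e5318 ∷
    0x1361f22136d2a0cc318dc252bde2f072605361e1c142b9f43290b34e4420a6002420655cf27150f4f071d853529 ∷
    0x11d0bdf27222f0418222d5d15165530023a16ac1e7617425504291d062fcd2f0c1a2e1f4e7d21430f339e3c750e ∷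
    0x15f13390a341d4bd72e06059534414d2ead829e682b1c1c5b523a17988c0be41c204558273b1517064e061c7b93 ∷
    0x106940616100fc10cb2247f17ed1c350410150c268ab941112513220d0410743d0d173c162408158c0b2f29872f ∷
    0x115572021c05b7b0632b45615bd0628e30b21270b06228f053f5776845a26223415e64329431739189d0a3c2d17 ∷
    0x16c8019273562221a0a25558a3d9c4aeb740e4e3f465553172012a9950ed5403266205d214c051d04391f25dd0a ∷
    0x1440b516e77271e1327075a102c2a3c3776153067ac060f89711213581741a50b181d3e3912222814521e062f7b ∷
    0x17c0d0f1c530b2b5b5d8c2970101c3f07460e2c0a2f8306270d1b413f6a0e05334d15272214aec60d381cce7444 ∷
    0x13d8c0e0a451e00b8450feb370615dc601c0f22403c748091460c5d065a153d1522cc0b430a58970c3a0e2f0a04 ∷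
    0x1065367743b800639a01d8c1f19d513188437049a37462a3f1b263930191557c038670d3f ∷
    []

  start₄ : Digits
  start₄ = d0 (d1 (d2 (d2 (d2 (d2 (d2 (d3 end)))))))

  hints₄ : List ℕ
  hints₄ =
    0x18930544a14916c992c5434103582ca2b0d060e2817125a150e89350f0d0d0d240bb71b5d312f250da627150f0c ∷
    0x10f49130b38165dc9e91d520b7f47d4960a0ac640c60c39b0462a064c6c132f3e6e1ca807d38a99156b592f2c04 ∷
    0x144361d153d0c635889561c14298b82061729eb1e386609161d0b920b4e3c592c10684b2616202e0618071c843d ∷
    0x10fdb1b1d711b374b146b42861b665c0c43480c147c00680d1c370c8973171c0e0d2a592a027616490c1c191437 ∷
    0x128453d159b1c98148e4eb8c69a0e6b0d4d764d062b36d41a2f6d390de4141b1b411d042c4efd590c0d6434165e ∷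
    0x12569141a552cb635eb0d3f290aa60677184a2f06cd063d1b9f0c1c0d1a823a2a137e1c040d2c0e0d3bb9353b15 ∷
    0x10d2a2b1668d6af0b688614d126a225492a0b06284e4f3e571c0c3a333b0c0757692b0a220d0c16137d3488171d ∷
    0x10eab0b473242b8543c5e1b165d38bd3ad406052b6d2a58190e223f0d2267853c1e041772170b0a283b703e1557 ∷
    0x1901316d21a4659151e0c1bb02a7a1522065b150bda074f361c0e5865e712342c4e833b981907222b082b36393b ∷
    0x1422e0d5e4c3666530a250b870f0c892f2c68675f3828761b29327a0e0ccb1537ca2b34211a4c290ebc71262b21 ∷
    0x14daf29763415680c045b15142f27420e69380e92590c0ceb173814351f06433600169e5f0e058241430e3d823a ∷
    0x10e4e39a418102e1b0e33988d0f0f8c6604493ca9063d2a753b1d9d0522197b3b3c2d29390d04435f22183c1d17 ∷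
    0x1183e384a1ec1170f192a156e041c427b44222f3e0e218a69991e3528261cd062e153d44375bd2f39cb1913b705 ∷
    0x1c3360e344f2806fc2682b9a72e19706e103620760c583d47169425763a760f1c380c1d1c3fc72a14140bd8221d ∷
    0x11e1a5506ec6a9b2f5717676b0a4c8109067075223b5d1d5b52874f978b16cb7da6142b237b0a2858a6651e4e10 ∷
    0x19e855106232f2a2e1536364ac60a0e263a0a10182214361b2ced8626b30d1a0a0dd1530c130c1f361e750c1a5d ∷
    0x1158976537a6023314de7202b0512d5dc7c0aaf325316175c2b8d172507470a2a46953d1c1504216e2fba1e4029 ∷
    0x1374a600c12d30d271554e728290d4a84211d447416d4d11f2c3c174f3e520e2e6104050e10147077210c274e2d ∷
    0x1340b722e9c35463709234d7d17281703069a0b364e0d067e1821662310b07609b70d1c2b1e1ace0e5f2b364925 ∷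
    0x12ad25f43265e0a0e130e444b771644852a53590e4612602520450e560650483c1c1cd719801e87191f866105a0 ∷
    0x1213b1d4aa40b433c100e1f04c536145e680b207b1b59228ad446380cda3830160a66155327075c9f0504ad280e ∷
    0x15d390b499d811522b3066f587bae1ff60c469e35172042d797351bd3486db93f2b270c5526d44c5a2c280b170e ∷
    0x1202822371c4466090b0c200c076aa4446a14e4722d08420c3a4e8830791694c4154929323e4d04b314220e1717 ∷
    0x106153852072e074a17531c0c0559614d19680b150f56ea2e5a1b104e16871e0edd2458422907148805601a1f0e ∷
    0x13b0e9c3e2ff80560160c0a2d295c4429cd9c7a158c3e0b1b240a373e9712697c1f6e381ea2670b5deb351e0b4d ∷
    0x10d97270e064d572f3d3c2c4e4d0a0e595e6e671c9e4d0e4cb504360e5b6b0e12052e161814170b1fd2300e1e0d ∷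
    0x1170d144e4f1882b616a833576e601715183721042d161c645c670687187516c6212f1c4f1437203c2d5b052d1d ∷
    0x12f4e30141c16076a3e177e14060d2b4d15252a5b0b0f33b62678852a140c18260c16300d34282212a348371e7e ∷
    0x13a0c8b07e3422a0e161c141b2318411626171d2a0516464e091c0ce6671b47062f1b9b452e1b826f3756377572 ∷
    0x10bb9283a06094558e372102a0f3d2b277dbe89058b589207606605160c824e0a1e0b1036600d1276291b046a0c ∷
    0x14d67a62d3f3d421a205a1b5c09b50d2d3b8c2c0c4f081466bd1c9b233f0a3e1706674d6e2b1e340b290dac6619 ∷
    0x1ca22b7131e9e071eb3140c59454709532f7c04431f0a687edd55e56d2c1e286613396d2d1d200b32ba0e0f5474 ∷
    0x13cd25f2f5cd35a1542264c575e53840637716b2c3c065b2926172719270d16293427475f0416420b2d60422105 ∷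
    0x12c0c5d2b15274a46bc3e103d0c0542364d45063968414b2b06530c14313c2309101c130c184d06824a843f6243 ∷
    0x11e6c124520791c376917120c6a741f2a563659471a5327070c0a0fcd1d1d860f433d710c1c6b6c2adb92231f15 ∷
    0x1538d920c1b0c0a34593bfc0b0560061482200016ca0e165b26055f1b163f1d062706ce4a9c2c075a542239bee6 ∷
    0x12b94147e1a235d0bd339e74545073f0fbc4534250b6e4f2a1ed40b0f54684236072179414c6f851a0f2f5e22e1 ∷
    0x10b142b1b601f821702060b530da526700b7307555c062e15123667186b3e1e3d2771dc0dd999a6080e58422a26 ∷
    0x1e31b37180e0c2d1b28f521fe1409ed052bd40d0b65ec6f0a568616603d1833137116249b85d63416352c0e0715 ∷
    0x10c140da7300e3568156f172b0a82660c0c170739341b1b38240d1d42364c2e152831281c8b0e64ca1c4559158e ∷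
    0x1ad480d2e4b466b0e06225f866c0f1b1833b65f080b352bad380f6e1f05042b8e0d142f10e6605821d2b21a1e60 ∷
    0x1282b1d02392dd10f1b0c17c1e64b050b151024351c1b29a5060c1a04c63629370e0c042a271c0e3e0534174b15 ∷
    0x1337b4342ab1d39a65d0f3a721a04452e545fc242181b157c3749060f0d0e0e3b9d558a5c5e2a2d2e1f14041c3e ∷
    0x11a3537f0cb6c675e4e6a86380b2e354145260f3a3906482d8207461414233a156e0b746f8854280b5233413514 ∷
    0x11d271d293406370a1a754f49fb561ecd2e420ebf0a2930a6061b473aad2b723a1a34710526328b29142ca92d08 ∷
    0x11e1560164e9d4e0b14281b6a4444157b0d451d6a712f71233e6dad2d0a53070c2e2157950b99122c2b170b589c ∷
    0x160709b290ea4377da70c150c132f2c0435d902be2d7b122e8f163f2b79226019051e1e34863c452322082f3b70 ∷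
    0x11d1605450c5806871c0618916b08277110262e14520b8f266622470c30eaaa0b0c9b360a3d23683e043f590b0e ∷
    0x19855981c75d358d54417628817201b0c42818b2315d9991e454607ca460c835e5e1b0725141e848839263a1f22 ∷
    0x1282f0e0f6a5e21692d380c28270a76741ba50c70591e2b23172e0d1f832c3313b12b076d39533b40145c0a3c14 ∷
    0x13c291d30b536990d06661d223a9f3d09d259560c6d76 ∷
    []

  start₅ : Digits
  start₅ = d2 (d0 (d3 (d0 (d1 (d1 (d2 (d0 (d1 end))))))))

  hints₅ : List ℕ
  hints₅ =
    0x133132a49887a061a0e7d271e4c6a154c3f24041336710d40bb9f1b65525627f74ede1a1b5a34230e98483d0b09 ∷
    0x11b3c1d52101240671806435f291f194a075d071d2e102709a193221d1d4c8e6a15d61c37c24d2741174d4b9806 ∷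
    0x12b282718844426293b0b52346c3512430c3b04b7369a2a3b4a48510aac150c772a5a17202e9405043a51687114 ∷
    0x10e0b8d24721d042c086b7f5f142f2a092c9f072f27561322299a7c3507ba53a0071e2516161a439d140b04ae2d ∷
    0x1460c8a610d139a157805141f3d307f0c2232bb0d82b122552b29279c929d1e1b383a0b2a312b138938220d3b80 ∷
    0x1383f9d1334173e0c467162066ac004430d0bcc5e271f27135f4c1d130d061b3e195c99b60c72223732d08a1806 ∷
    0x16092280e1654131d14060d8e0b14e30e6a235304086406544225224a9cdf3b27a06c7a1d342e8e4c395c4f330c ∷
    0x1e20b5636054c0e1f7d83bc0d28278c152d1dc9210d16726f2520261d073366592629454d0b241e345e2f741614 ∷
    0x121394268131d0414ad8304fdb4a644023314c5d22f2d27471be3043adb1c0b566e4e5f4d72062d26451d871b2a ∷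
    0x1240b1e6967144e8d0631998a0d5c0f780cea08383a0a3e609b37150b3a18663a07b90f1e0e15ab67282e062e1c ∷
    0x11c15063f6557003ece0a5e1762b222633a71870e570e842f6f5614184e7c0795341f25144e883463090d0f1e54 ∷
    0x1216b0c440d6b1e4aedb6062b16a43e4788450e2102234a201e5a2d075f27270910b0721d38a20a102f0f4a1d10 ∷
    0x10a7c2f0d0777ac22e60c356e3da60e0c2046370e730a0949a06885a60504444d0d492226143baf0c1e0d1b521f ∷
    0x10f0543746f9f26b00513366f6c7e18740b435817070e42292a0b0e1f07285c040658178d1a36753b671d5481bc ∷
    0x10b5c4d7b262b0ea337a44538990673061e0e0b090d1b1c364606741da4b95316066721b4729e19e82402bb134a ∷
    0x119040c6a0c423c4e0457404b18177371342b2f5466140d0b1a1c2b100f4c0a3315590c2e6d08065b9f3b064d15 ∷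
    0x14b0e28081c0f0ac03e0a133a2f1a159c2f602b0e731c44145b0b5a0b56898b4e7917043e922705153534423310 ∷
    0x1355614440c980613060726063aa20e0814746d26103e37398460cb22132a306e05531c1bcb933a072866095d7b ∷
    0x10e612de32f1f2f690c195f2f250633379f061d271f46380dd42d15151e1e273a2c1d28043e2237363604192f33 ∷
    0x16e5a238434d237170e541b3c1c6a351a1704461b8d5e780e33690a1f15d40e06151d662c031354435a147d8b9f ∷
    0x1200a2c2d243314b139531b07772f0d573b1e2f2e1dca370b2d05360b0d1c1e144c05334609ea0c380d563ab94e ∷
    0x10f8f04535d1b234e726fed064d4fb72d235c352f169a4d380c0dea992d101e165018f615e810cc2f3c0c9e8e24 ∷
    0x135e958b895c41f0e0e47197277512c05369a6d046522c655cb2ea325b86e020d0c140a861246295c0d059d3849 ∷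
    0x15d8537bbba3b5c362adb0d69380688157d15a8aed30c0616143a151d3b2505953c2d122b8e3e06253c0c374628 ∷
    0x11e2231840e1f174e4f9594d222350ceb1d2a204a7676cb0e374d2e1e8b16063b0e105ba36b1c3d17282e9e0b67 ∷
    0x166182c4d3b6c5cd3970a542c0a063b43d28e0b262c82384e2736590816b90ecd4532363930505ca44c3d06941c ∷
    0x11b21a5521b232e34d6312209ad156d49d3cdc2c1ec0c2ab83c831939145ff2972b0d0eeb0c3710186f27173f18 ∷
    0x1a57226271c301c553e2d9b461a0c14192c361dc01b84bab91555567ba05f950e2a0b402b55454d1a852a728b34 ∷
    0x106232fb06a699c601b3d204c0c1e57432b1f807a431e44832e4171f80a66a70d3d0c600b6e633b583a3466b513 ∷
    0x138f71b8b843f153a371def057c21191f70491a849305234515100d4823071f5e0a100b0bdd3c0e44342d4a0635 ∷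
    0x139a22e0e2d29354e15082f856d75308b8d0da607226251ad02432f2634745bb049b4483de52a57882a562a061f ∷
    0x16f4a26bd04283e6b2b9f0a144356d41d9c07fe2867d818174cd9266a131d090ce9da12132829ab421a46321412 ∷
    0x19605563b947b5deb0e44251d9f0b2625341413104b3e77878526280036943c2a350d1c3d5e2c7c386070534a12 ∷
    0x12e295d4d6c3665360c5b2b064c1e8a6d57160c2c9b0620391d4c19302d269d341b244722071814061f26161ff9 ∷
    0x174121b74210c6e346eeed6921532414d1d0a09190605ca9c106016420f3054554f3e344e06c68a1b1728a3243d ∷
    0x13bd90b1cda02221b43224d2c5d16152f0b4bae36350c070d1dc2383e8e6616fc350b1416548f221f462a863e42 ∷
    0x18a1b292f162a39161617663f8b0b22302b0c283e2a6db55a56a15e341c1b44072d100d1e364869330e27363314 ∷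
    0x1141e0fae2107b71974adc2442460137030456bb70a822a04673e304c5b71067b372c89063c1348e43b25554e27 ∷
    0x1c00f07386438c2d15d2a4a1ddb0e57d92e46251d3068c28c0e4116167c97d73545b2352e5d10bd89d015183025 ∷
    0x14e893a4c359eb75e540515be064a213d1fad584ee48056673956061b2904152abd153938bd481d67523e471a0b ∷
    0x12f170c62772e5e06381f172e6d101b0559062c332fe51c7d1e530414573e6476057d141ced4607c6076f174538 ∷
    0x1080b461e0e0b200f222b7d1526ab031524462142b227221be308330c4e56265c571e257f0d8921443f67066672 ∷
    0x1700f1723120a0c392344835fdc5c0e562e069277851f292d947007debc2172346d4616191609294365bd733434 ∷
    0x1481b4e5b710c343c36120ce602d260060e0b280b14de0617385c1b711b09234f145c0c754fa92cee140a212946 ∷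
    0x10a3b462c178d0dbd22391b9f1639280c0b3b143d2b0e17241a3c0d977735b16ceb3d3326070a6e553550476d6b ∷
    0x12e9d46537e0a366c292b2639ec240027b41b392c6d9e229a12061854276792847df20a082e160c2e1e4b1e3a05 ∷
    0x10d0c2b2eedae0c5a160852150802581c261c62860b5e6e2939859b39233d0ace0fde0e126641469707104a6043 ∷
    0x13c2313713470531fb8246f360d1d411a342c7b201766550b26384472132e1f8d1d9f589135fc0425869039d90d ∷
    0x12e1595d59b0e0e44261d3d060a02551769973c0a27b7043c13356e2b544cbeac2d82793527a213275c3b3a3605 ∷
    0x13e2b3b8a8a0d165405086e1e3bdf8a5713664f6c880c2c425d1b16a5385fd31485 ∷
    []

  start₆ : Digits
  start₆ = d0 (d0 (d0 (d3 (d3 (d3 (d1 (d1 (d1 end))))))))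

  hints₆ : List ℕ
  hints₆ =
    0x1178d41b70b34f9150529331c17602559070b2d26311635005a7435b30b166a363b1b0c2b0e3a142e2f1a830a68 ∷
    0x1291622146756a63c13421d16171b6d14152a0e20721e334606490b929d06383c5227847e8d29191613211e2618 ∷
    0x11755164342163e99123b541ba8444b161c134e730f1b452b584cf5373b3a3928280c6923221026353c82029246 ∷
    0x1d62628240d6e4e209c8115555f35641eaf5044f31a04101f3816253f1d04316929ab191647628ebf887f0a5f0c ∷
    0x14385ea212285be501c572f4a27790c1e29d7505d2aed570cba4a1426c11b073e473b58161e2dda6c04677b291d ∷
    0x10f2a0c7d0d38141b3a0e166d14500dbc0be527650c4b505a4c5a45063e766e40354c1f17040a383cb042271613 ∷
    0x1343a0f1a0f442b1669448b1578085416831b43384e6f38209a0c1d816b1a28884c22411eb827526c130623162f ∷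
    0x13a5848054838f56a276a4d0d0e42256a35aa3e120b4b1a3929380c5d25128c4014bc0c2e6157132b161a48f94a ∷
    0x115151d313b440ab8070c603a351d862c04990989762608ac617c342fa95220dbae0c3b5c180e0b0b15b9251728 ∷
    0x12322443a2423070a040a0d1e4915277d6d6d0e0c9b06137835311e165606057510232d18b1540cb91b892d5245 ∷
    0x16e1a2bae0f1b391ccb0e1e18264c1d8322602608174c15a423091627550738167aab4e05d30b140c67930b7b19 ∷
    0x10d303b462e81140c7623592036ba4b98590d2b1b6fa50771166d374942761343bd98ba1ddb26482c332c172c84 ∷
    0x10a3b98647afd8d21222b72142645ec98590c14864e175224144006040b1d0b3d932abc1f163a041a880b22198a ∷
    0x10f3c2706530d8d9b2b280e1c8e241e062b566f702ad91412333b2f2c6a2522173e160e1c932e0b45c01de92a46 ∷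
    0x1354c14b152780c05384db40d2aa55c455e83600c671c2a06062b830c432a1aa41b4587136f222aa08923065f28 ∷
    0x1067baa0f27473d5b9e120c1eaa138a107037071e1626613716b23b0b43147054460e2c5a068db6543cb8e82006 ∷
    0x19a1d1544916506171d78b39949623c660c2c4a540507a422072c39061259ca450c056e2a1792467e432a2c4e35 ∷
    0x1183543939c2b4a6c07420a8bca0e4d272e740520523e8d0eab451f151b1c430bae38ad0b0607d535be206e2b3f ∷
    0x1451a2e4d244ec72156393925172205411d020da639139a1ff68855136c054f27070a123b2f35a01f1d061c3a2f ∷
    0x1544c2f506a3c83782e870d0d2105531488133e250b4c073d3f0a0b144314ff3d3950af06beeb1f12541d8543da ∷
    0x10b285b5c0f94af26071c35170b955f530c5928163c53183eb454403838286613a63a1e6b152934571d17750d74 ∷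
    0x15e6f04251e3b0506832c265b279906140e06136c387d5f152206032e6b155022b0a4361b2b260f0698181b3427 ∷
    0x15f2f4b308e0b024004250559b638144e0b04f80d0a2afe1e4eba3896050a0a0634071020041472055a29301226 ∷
    0x17859e4140dc04b1e1e152c4f5f25352d5b040656382b060d6d2e22058460752c360e14184698450d06a44b0a0d ∷
    0x12b0a164a2d1723335f2d0d179f152d0641335b3422b1470c142f34430d2ea5025b05890414392e0c2f27571de7 ∷
    0x1eee22f2a27705e061c981735d48d33130b063e0c5722d40a1716ad292935330f5e151e0a06194f22b30e171c15 ∷
    0x12e0a178636460d83d1d52e061258df3a1f06221d2f2c021c5a4c1c78152c340c2c3e501eb22010371b910ced0c ∷
    0x16d2f46169a200a2acc3e82854b2e44301e46241aae0f14552e3b5c0c9d381b2a2565392a3f0e6c585f77553b0e ∷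
    0x130561d5a05197014026ce915172a461f6c08851c4aa113178e5f436d170683382753c65b1435470a16041f4616 ∷
    0x139d3668d2d427f302626283d0617583a6a4a6e3522a6890d08040e160530044ac9284a490d414a7a75c2aa1a0b ∷
    0x14c050b15f8162d250ba41084412521061ea4394e48441522150243d6121438421c94621b4b3923355a1d583d06 ∷
    0x155223057221a1bd0350c5a54267e04181216253514a7726afebc0b5c5d231d5806192f05ac0d2756695c88700e ∷
    0x1391546ad382a96a30f1599220a3375128c0ca446743d690b323e1a074e0ee5303e27061e350dd25e0624ce0c06 ∷
    0x12c200b220e7e231d6949583069081b16b1621d460e2c6721140d3c8a1e412f0d0b7504697a4e101c3b38386e0c ∷
    0x14d440f13146d041e4f714b3e585614222f2b1e156b0c1b273d41164b0e1e0b25540b66d5674e3d751e15146d15 ∷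
    0x1aa3018166608475d342a2d0c1d222a340b74148ebc753c35a4684b2e6c300d2e574f0c8a1887ae8f4a7169345c ∷
    0x19b972e4d98066a4fa464056e37182e1a150d56db2e38157c8d142ee80e163ca0220d6817a5d60d7839221e1b89 ∷
    0x1162f0d4276040f056d7d37511f589318581b275e16e838074617d93a05674d342a2e0d4d1f1d45ec686c170d0b ∷
    0x1dc18530d052310155e0b956454b1953bb17275183b492e2e2a6a1d0d3706855920da15d9151b2d063315842b82 ∷
    0x16f080d1833af42201d0ce7543e4a38554a5e526e4c49460d45201b4a60450c7e356c26141ba0c07e3a54046206 ∷
    0x12a1a99654e060d5c0d12072a2f2d050c281639794b590b26352305ea4f980d247a14065e5a0e2c3460333c054b ∷
    0x17e37681a073a3b08a028167e201522737b0e23867345325a485417661e8006592b520e1a162804266ca914023a ∷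
    0x122463b074d2e0d191c0f3f3c3a202f751c98b13628a5390a121e83349669203c0e1c2f1b319e0bb66f20221218 ∷
    0x1be21eda32f22141483320f1737932a540aed1e8a57cc640639dbbb0d1d0c6c5e081c3434053c423c2f1da40b44 ∷
    0x15a070e5b5d252c88043d02171cb70c3e0e19220b2c483b22482d1529161e16840bec135f9427d3540e145c1416 ∷
    0x1068f2b2eba142c2e08334556299e1b1312f337d50d10a7706e1c3d571b9e40723b165846a03d523b0702137310 ∷
    0x123355f142d2d06589f17171e7e571a350af5120f1f030d4c18913c7b2e7710a6522f349d18050d3a0c060734a7 ∷
    0x1eb224115ae33165f7206173a2a55107c19100e3416073106052c4a0644c60d2a0ba47513961ab1253097552a0e ∷
    0x116240e3510182e0b3b49281d1529373b3e9e36be4036822469444f3c3e1212204436431b0eb606455327455d1f ∷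
    0x13b5c905c6d671d054a29 ∷
    []

  start₇ : Digits
  start₇ = d2 (d3 (d0 (d1 (d2 (d2 (d1 (d2 (d1 end))))))))

  hints₇ : List ℕ
  hints₇ =
    0x1bd123e2a4b66f82e279a1834f73f5d9d6c4d70061d0b19560cc02b8c3d1414731b3b483a352e87911d16132e1a ∷
    0x1289e1e0d894331808768654a1f9ebe7054101a34350e442213051bf8375f2b0b2c2b302610092d594f454d824a ∷
    0x154587007a8140d063d444e2645289d1623ce4417223755042c5c2c2a1c0e2a8ca5158b275c0d6b963a2d0c3428 ∷
    0x1d4154099ca4b6f22a41789418e1b44865e443d5b19057d2b280e30343c6f277c7e700b42e34f9b0c101d273b59 ∷
    0x14a5f2c45363067190522bb6a464b18c91c0e1a0ca936720b413c775d6a0c15ab3b3630570f6f3c883ad56e4618 ∷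
    0x14333790eb90c4e151e1d541d3ee4b9315a18d31bbe191d0b871e68040a594a0c191b055bb83f1c210b4b192227 ∷
    0x10c8dae3628a68e0e0d07272768641d0c225595621e42351f1f22160b1d2f14152a6a161844553e2940533a3760 ∷
    0x1064b2c3a3f66250e7029061e0a3c3a5844272c17fe0b161317378d2aed5f144f4c30570f5a5a8a27235804d329 ∷
    0x156892a6c4d045841281bb52b239639da3c1d21423a264a184c662e224b2d343657604a130d2e1a1623170a9542 ∷
    0x13c925110bc2a4254144e0606cb041cb775a9262243340b190e1327515b144a48180fae372356a03bab17342e0d ∷
    0x11c143e9a950d8a195c3727168091171c23121f28071b0c341c3439236b2705161313121d3d36605d071c2f452b ∷
    0x17e0ecd0ccc22066875264e2758ea19140627566e171f42147b423a47240c0d070269b0141b176616142a15ca2e ∷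
    0x13605187270342c1e071d063a648e2a1a312d5621421409452c9e7121020d2e4b3c5f86241c852e1282767d8112 ∷
    0x1140a41952815183a0bca0e051e2a153a1e0c2f31a6ed1e45fb994a541a9e0b155144560b9c35068a35584e8a48 ∷
    0x1253b39145f281f061e4e1d3d322714280c211c0c061b43270c2f0933a5e81e3662060b18165a0d0f67351c120e ∷
    0x11d028b6e0b26061e1a5670210c711d05263e2d4b843989dc753700a445050a8d2b21051c7e89a3b01d50532739 ∷
    0x114980e4f6c9b13550c9e6c0a10062d0d1d41132f06a71c3a2a051f5607173c4f4d08088a221d8a0c55d8044736 ∷
    0x1a706370b58284c2015261de7044d0715152c1542692645055a4e571b075ab53d623c1b16a1279b2a5924481d71 ∷
    0x1ca081612500e055ab16415be4006721ed158297f8b2f441053445f8217084d73da1f43933575230c68439a298b ∷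
    0x122348d2b06950629b18abb340b1731150e3ac2394e2f9a1e0cf9162d4f1e38060429be04bd6e934915132d071b ∷
    0x19e17126a0c441b591a2a0912050db0283f243a38f1022a16c66706d5391c140406131218bc344f22103894180f ∷
    0x11b04ed161f290a0b704b362f1ae95d0e555e134e580b7a0605232a5d530b30766e6f3c0d1e0e140c309e0f2afd ∷
    0x15f362e35567c4316144544d622183c7b2daab115250b45c58b0e53740e2717022f544a2d1c0207b8171d091614 ∷
    0x15a4d0f261b414554871b0486262db754220d086aa54ae30b772d133a7c2217f61237064507332d167904251b27 ∷
    0x151a415830a533116ac095c103a25220a925a17a0c96d4fa64e0245090b77681d2d8a1c3f75041eb406980c0f0b ∷
    0x10e2a6b15f75c3506071c174a5c740e5f3e532a091a155e38643c77060d0d237b5b7216362b9f4772100570143a ∷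
    0x10e1338796a0a481bb8340f1b0e72191b9a18cd73aa91762189582f2b5a3b28db051323060d0cc0102b1f2712b6 ∷
    0x1171056374c1d0f7cb1390b05283e15121e260a170e06064246080e051f41b7021b64503b170e1c3c0725372e21 ∷
    0x171954d4d16028a28942c0b5e15de1b1b2f0569193669160e1e41070e0c28135a382b123968211b2b4a5a730a98 ∷
    0x14a275fb75d2a3875173d6a50430c84777a280a2745130e1d36364687581d27161c473025ab0614060d6516390b ∷
    0x17b0caf29a6340e0516043b8b2228334205b645b6be2beb423a23172d9d0793095c087216223c290b540d1d9435 ∷
    0x1346b4d1550371f1dba9d1e182ef52241730f1991d4af272b251b1c5b371e1a042e391614ef72224e0bf816290d ∷
    0x1a6220f0f0d53652e4d067167422917f3b16a4173230dde5e340f26151b2d3c0e0c4aa6270fa7024a4104156b2a ∷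
    0x1420524352b548d0a430d0d3708771602148362495e4b170c3a78781b150d21172249483907233d530d8dc0150b ∷
    0x1153c151f40973f67423077127e2d7607160a66066c9d0647604d156d0d0d2a0b61452d0ede3a0e5c345e67b94f ∷
    0x11a26574a1b238d9c162085a5120db804574af7bd73180e5c22e485c1281499454926287d3d2bdf0a170c1e054b ∷
    0x10e101dbe3d3e090c0b164b1bac0e2b2d3b78e4126f581e0a2c05884a770e16ad66880e000b081d391b2b7e2027 ∷
    0x1f90d7f295229b9769c49041d8814140b0b723a20213c1507b1155d533d0e7133a6412715780e3d5f3f212c1d43 ∷
    0x1c3461a2b997a2f30382b0e5e15352f3e4a003617760d6a46237d2c2b104e2a34392dd1395524c01758263a0b53 ∷
    0x16d2e8c15760d24355b34d40c10345a6b2c0b0733131e39130ca7321f766a022ead9a84440c4e499f2c662bd317 ∷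
    0x19f3a1d5b5a076e373620520d0d3a57463646da472e121412379d0e1a4a2c971628952a94734b0c871e1d0d1a06 ∷
    0x13407259d1e0e8b8e22215daf14c60e26151e2a4315382d45157e1eb2081b0d5b5e1b5d274406ca6a0c0b22148b ∷
    0x1d26b4038e8280c0c273912669936491f10af37ee12612c4527347c020c173d694c561311d7309d16172765162e ∷
    0x1222c3b0e360a8d27156621728efa0e3c2f652c2007330e0587122010170256785a252e020a262e30595e071d68 ∷
    0x1340d696d0f4f4d0028c98a0b1c3d6e2c500e1907723e162a413eb9106f0c4ac804607ba8070e06388d15cd2a7e ∷
    0x12a040c1429aa571e05e7654a54294a26470c4b1e8f93a6ea0dbf486905401267394a0f6a0b0d0816b9062d5719 ∷
    0x13a4418a4261d07593e151025265946151f1f17440b391b099317d2b42647140b0c3ceb07890a1c0c4ea9a51527 ∷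
    0x14522591f06277adb7e2040a16b4517141f230b1933070d83210d2f29ad2b4a3e5c2e7723164e163a1414292365 ∷
    0x12a970ca58eee8e921dd440047029810267 ∷
    []

  start₈ : Digits
  start₈ = d0 (d3 (d1 (d3 (d0 (d1 (d1 (d3 (d1 end))))))))

  hints₈ : List ℕ
  hints₈ =
    0x10c392e1e2d381219d43932540f622a6d174f2d96573d2f5407272e14391389100e4c894f2d3a1d3b2879434f0a ∷
    0x11b1585699f1722be19824b0a55270c374ac736cdadfd4c2a1cdc10153c1d530472343f240668150c3ecd603704 ∷
    0x11e063b290815075c0d1b9c40fccd0e82131315781e5428b82521b614d84ca1bf183b2bf73d1076b60cd6962a1c ∷
    0x1160acf05054d43147d0e191d0b220f1d0c13730613ca0e598d41823a06684fcb140c390eae41130618f51e2e3d ∷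
    0x1041c34140b9d2f0f201415c60d0d42263a22351b4d5bb8440e294604075914da05361d368a462f120d041c4d1b ∷
    0x1090706360a3a151cee3e746d53220a4e381439143766134a141a1c6717002c8693286c2198b90d283cd6214546 ∷
    0x12e160615226820d8580b2c0c06490722271517ca940d851c0528039e4e0a0c14786c7e1f721c147e28362f1974 ∷
    0x107261ac938d256151e140e1e2e32070a690e722f691e951546141c14438f13107c0d0f4248294206690243b60a ∷
    0x11e0a3d1c1884271c15192614b174ac7b4f2854202d41281de44e1b05663f2b181f1b0535c75a942e2e44130d5c ∷
    0x13534270e3d0b0e5817873d0c0c41075328183c0c392406272a0d025c6d1344060dc5436a37140c0d3b67420d20 ∷
    0x15cb80f1ed36c834f0da00607212736102c179b281f292e2cd01e447f683503382c3e7206cc2c220a7e58135d2c ∷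
    0x11b4d07292659e30b1c5677767a06879f9a5e404a3e444d0d2d084b501e6815202e9928762268141a6f0c0a1484 ∷
    0x10b698e4a761232ba2a4a053d291e3a1821673d502c1b44062a0c0e94069e050e272242434bfe121b1e4b3a0a58 ∷
    0x145387e1d3c22643f45130a4f04be0525c14f0c0b1d5dee4b4d261f450670273c5db620313b131715231498369e ∷
    0x128283a6f3412261d7474060d171e1b1fb86a57111a931ddb0e4a0d262d18044c29be031213627b336b31695414 ∷
    0x10d9f642b5336732a0f27768c15b5db3d130c476d12384b600e3c23df189681289c22460626127113044c32a407 ∷
    0x109101dbf4d298a0c3e8d0b5c253a2c04f5062b5921aa170bac2710413d22150843520b060b0d050e2f6f26301e ∷
    0x13d928e731c022d9e6565275245aa70d8b64421522d0eb14b26a157164d443342e8931521050a554b120a542921 ∷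
    0x15cf93a0e6cf814d58506073ea04b693b0f471e771e132f2d2c2c2f0e1b1b06491c860e24690e202a1c2628511f ∷
    0x14a2d7e17d15f14363a1512293a71220ea504ac2c0537091d640b36041338373b395a054c74025924697a50430d ∷
    0x1137d362f54432e1e887eec6b1e64291729271c27710ebd1f5d120e1b8a2316976f5576154014183ca1bc053b2f ∷
    0x1a5e79a5526820f0fe015660c1d167a3e6f2a31234a7a053c15361d932b05223f22b51786b7a4d829291d2b2314 ∷
    0x106a7a3134b0d2a142457197f420d0a8b02c7549a0d1f6a046b2d4e1a3d0b2e0627fa1a580d1c3a45bc16333645 ∷
    0x19a14290b551c22340b8e052b0d25225a263c24930d1600148a380c17467b67592e550b177e2e56a322562e10a4 ∷
    0x1e5040c44854c075c3e1cd14e2a0c204f4127db1f6d38078a6f58d1663c3d06130707cf133c177dd93d12b30b19 ∷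
    0x134722e6c31172c050c2d395dd51b6e230b0e28340b650a3c6a292258275975d80f2f9b221fd857b28812285e34 ∷
    0x10a0f280d2f727e7a070dd42f29351372393c0c287b0e1b09041d221b0b2b331b0f84020d5d4d87351f256d3614 ∷
    0x11c261406177c564dee05382a830b3e1c194e0d0b1c2756862d23393428510db416185d29533f1a607245561413 ∷
    0x1262b152c1d1bb89a71227c4d264f0d566e2e3f9a100f38b84d061ded52d119fdcbb45d1b176a66310ba84b0d68 ∷
    0x11e2e4659171a533ed30f3c27415b21dc68d7173c231fe5100e682129c128250a7521cf852c520c140c0b34e443 ∷
    0x19e065d5a40388a1c0d254206755677ee3f28176a291d66050b352b18361655271e1e74474543c01d2e1e455821 ∷
    0x10b3536271b5f1f744c4c3789172816071fb96f36b127301b5942222e0b130c4e3d0c7f06eb3da5140a1a571d94 ∷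
    0x104277e1d0b821b5ec20aeb3e242fda4fdc7b07092a48ce6a02dadd765c45492d88100b410e46758c7f164b1816 ∷
    0x1396053160c25821f56372dc77115223f5995066f4a340e394aa64e0f147d0bea002e443b5a6d70aa19fe0e0e86 ∷
    0x14a720c833a43742c0e860f2a6c56b93d224ca7756919098815162b370c30143b45304219740a5d53580e72183b ∷
    0x10e49490715281f56150d23451b3b157d191335ade436ab1d6d2a2b5726051c541558ee6a1e650b264a352d7e4a ∷
    0x13e6813d94938252606455e0c453d56f8b6154a216f8a141c170a6a4a45695d05591b2627104de424383708e033 ∷
    0x13b25531599139d76074c1b26061d2a1b1a384e0745511c061a8b06071594130b3259152f4d40173b7c371f3414 ∷
    0x1580e2a208d0f06124734523b4e130d840b583d221814253757d73d174e2d0d9487773a1f1d2809ca2a752b7622 ∷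
    0x1145f1a264b1a4f4f0e371d1972160b33ac1e174f2f2c49341e0945770e0906071558045e274e1d4d6a4f736742 ∷
    0x187330e2c071b051b4f0492266859810e2443d72704af410e5866130543385505166f54201e182336508a161c3e ∷
    0x11e1e1e4b1540092f4a06303b067e1d3367053b174305393467391d3b4c8e0606ae206f25c3499b3a480ea64e2f ∷
    0x12369ac0a520d0d2a2c28141bb52607171513362b18b728b1301d9e45731d0dd8300e301d100b66288a1d16de20 ∷
    0x15e0a240d2a28c6f85a082d10a82d1b445b73060f6dc2432d02060ea22214a70d15572a37174277104c410c0f93 ∷
    0x1866d69af5c2e0915162046331968172efe1a392f3e3e6d0c8c0f25155c07488a23892514170a154c2b8a072f38 ∷
    0x1302a05042a462b1768480a2a0c3f3443397a4e99162c13fc8204275c222c1b049238734115ba2b0c1b734f0bac ∷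
    0x1144b38804c060e2d4615680a06394e2e10a7863819154dbe3d37be536e4d480f6de3135c291d0a1b289b2d0c76 ∷
    0x11325cb0926354ba61c1c1a164d0a0b429036120d140c4a5a0b36db977c22303f86a0b4881609260e2c450f5406 ∷
    0x1353e1028296a5c3f530524963806 ∷
    []

  start₉ : Digits
  start₉ = d2 (d2 (d2 (d1 (d3 (d3 (d0 (d0 (d2 end))))))))

  hints₉ : List ℕ
  hints₉ =
    0x13f1602b51d1606f65a9b0b1c245f2d0a5bfbac1d293b14569b56350b255f16690c0e820722065b375fc7160c06 ∷
    0x16e2f0f373d0e0d070512045a18861b1287141e1583100d603c0c0d0dba0bc62872650e6a4704057d1418763b0f ∷
    0x1b42a150e0d1e3d5f150c29593d995c912648ab84161b3436075e0e1c5c50dbdb211d1b17bec912670985373972 ∷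
    0x1b4bb60121e37c3043e464644701c15362d557d2fca8810175c4c7406125a0644b6215e0516210c2c5522d7350d ∷
    0x1ae2d4606277857063c291b3605382e924a0b2b1b439b1c0d9b38271929280b31eb1d9924320e14341be72f2e40 ∷
    0x128d1d14d1268b343160baf4b471f36b189601726211b4e067e12dd2f50174b6606257881370e8c672d83602ebc ∷
    0x126301b040c72720d5e120a15291e142c14d03d612f8d28184f72542a2a70e5252f412e1b040f2e0b86d50e6444 ∷
    0x10704386423181c34130db7342a1d661791782f1a063ca7001d3c0d6828166b060d77357aac1c0b5bc51945b229 ∷
    0x175841c2a1d2e1714ac34271e190c149b41aa1921fc0d3e602a961224175b114e1f062284120265274706593d1b ∷
    0x19d05170a096916249b5a171421442258e839140d1d0c2edc240c2ae31b1b593534096e2b0e9c1408740b362124 ∷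
    0x1071e1f3b0f451e2b822c5470731f3b0e5fba2771cd359514b8189d0a86251f19b7600f3c44214644130f7d8507 ∷
    0x13d0d1202a70c1d4a432b221c1b823843738b855c342122d575764222052282b20e52220c2634319962063e2536 ∷
    0x1262d0d416d165f0c0c081a4de34e28381e8b205b123414340b170ba54b6799c2434586372a8c5a6e1b82ba4b3d ∷
    0x1246f1cef540a339c2c164e3e2ec104151d0fe92d73d6af16a2285c5b1715891a0c438305a55a3a3f123e34674e ∷
    0x139195715cd660921541e1c3b396628061025930ccd0656300a40681017068d0516223d263c4d0d0f22251c2d8c ∷
    0x14b21465d4c5050220b876fa98223719a160c3f022f39295d1c7c1737167e309a1d722a3af9394a4bb8290434bd ∷
    0x158ada6224276437d33163d380938360e15a327181c934d23163f9c8637240c622907bd17cf832f141809057535 ∷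
    0x11b35060c2a9a27460e698e43cc402556131c4c5e8f7c1473b60976456d2d1e293c26210d210c6e0b2543053504 ∷
    0x14c1b8c173b15751e7e33292b210c451a17720c0c0b0679192b200505835b061476986912193c060c5a4f4f4436 ∷
    0x12fcc2a550f084356700b3a0b86694a1dad100a7c433aab8b255d16490e6fc80b190d0ef03d34380d272b06195d ∷
    0x1000f96060d560c3516188d3814148c06820e5230523d2e5c28efa4331e6417072706071516169a1f3956041e83 ∷
    0x1293768386f16139c0e0267250e0e601c453cdb22894e404724267c23741e2a502540144713551a176f0f232f7d ∷
    0x10c1e2b37b49e561816060e4a5d0d4a4e136f1727122d792b5a3d420670068004107d7aa0300e3b0e2abb062230 ∷
    0x109533d4c4b8346ee736e1b0cefac17f5532756d7050e2838305f7170590620751d0e5620330d380a37403e0c0c ∷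
    0x1740e582f220b411250180f0e1d74579edb232d0b82662c4da416213c53b3a526140e763e0f464696251f615a4f ∷
    0x12b0b222c193d04390b0b0ee83e6515053e0e426c431627c3481c3d576153212b67166e1e4d5809ff0a27f6070a ∷
    0x15c4cba0e27145a16b422364764383a161a421a120a2a930dec5d380c534d363a73d52a0b3846361714a6061604 ∷
    0x1164f4204240a002a0d2720b21c1d0c162e271b0722064da539286f181656042d0aee359b5404ea22342b3c4a6f ∷
    0x1add2172c342f920c28340b9d672c9a71409e071d0a484d0d93136672173477131a95ae9f05750b17298b43368c ∷
    0x1134e7514980c3a4825720617dde876341e600c6c3444353a15500e0b2f04b81707267ab62c2b065b1c30bf1e27 ∷
    0x1b9e50b253d5527fd7f0576861c27072106b7511a68362d83394e6d6b1d1635b15c2314383c0e4189ad1b76381b ∷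
    0x18e5f0aa6980b1ccc0c5c35ac4a0b253a47619d0e433b220b0b3b6684678d962602054d51660e293d150a29cb19 ∷
    0x106df2718164636064e581322062b692f2e72475d4a3a3d2a0d7b173047b6771669141c2a361d6a821428302929 ∷
    0x1151d2883261bee7e1835e8193a133094154ed40746210a842a1b1d84584c8a3c3443152c5d990d3c6a3f080a68 ∷
    0x13f0b25501a1b2ed7433d0cbe0c23282ac12347c51d1712441d151f0d25060e26208633b23aad29684026380e16 ∷
    0x16e5404705616425518582d0717990c672b167634145e302f4bb202109b0aba0d6a061c302353ad378e0eda0621 ∷
    0x14d2e05062a1a0cd6275c094234601309923434cb46249b4757140e861b4d1b58152d0616322058143628381083 ∷
    0x1d68314223b6e3c2e603d234ca64714684a9e7e2f1e1434c1cd0771756d3b43db221e1d55f304fd347b0c061521 ∷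
    0x170573b6e671728350f9e0c705f17e43b2728490c6db527bd692237c6046a3a166f700a4346573d43cce90d80e7 ∷
    0x13f3a0a373605674729083c3e530e0c4513151b4a10c22806513fb01e3583be153956710c26431ca24d192a0e8c ∷
    0x154742f180eb858423c3875690b9b02531256292e05c71ec9159c14761a2a154c870d37883d596f29fe45450b08 ∷
    0x11d0e1d2d234e2b220b15959e0615462a054ca0b73e73140b06716c456b370f356a17202ce5357c5a1ab06506c6 ∷
    0x12f062614241c4fbc41275b040c3262040c1d6706536f8742074a73666b372c61a62e716605230c0d373c8d5806 ∷
    0x1460e5c0d5b0bb402700c0c0e14666a1d4a500c673115060f584f3718698a1b2d162a455668213d390a0a312a06 ∷
    0x10c342b3022536027161515509d560e4d2f3305542f580d2ef4130a361a264dd32a490834294c04434716367554 ∷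
    0x102680d13331577170e44170da8bf671807862a443b12b7281406124b27d39b4b5e1b8013a6101d3d1c06594aea ∷
    0x1534b870834ce893f74231b0613e4602740050e9816665a4466600d331dbf1c2f15083114162c2e162eb4766669 ∷
    0x1043d494d0a0b0217ad37171d56142e2e2e6f4b1d24302e0eca66281c ∷
    []

  abstract
    -- The bound 8 · 108 = 864 separates the fields treated with an individual y from those with y =
    -- (1 , c , ε , ε c).
    small : T (smallSweep 108)
    small = tt

    swept₀ : Sweeps 14990 108 start₀ 1 hints₀
    swept₀ = sweeps tt

    swept₁ : Sweeps 14990 15098 start₁ 1 hints₁
    swept₁ = sweeps tt

    swept₂ : Sweeps 14990 30088 start₂ 1 hints₂
    swept₂ = sweeps tt

    swept₃ : Sweeps 14990 45078 start₃ 1 hints₃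
    swept₃ = sweeps tt

    swept₄ : Sweeps 14990 60068 start₄ 1 hints₄
    swept₄ = sweeps tt

    swept₅ : Sweeps 14990 75058 start₅ 1 hints₅
    swept₅ = sweeps tt

    swept₆ : Sweeps 14990 90048 start₆ 1 hints₆
    swept₆ = sweeps tt

    swept₇ : Sweeps 14990 105038 start₇ 1 hints₇
    swept₇ = sweeps tt

    swept₈ : Sweeps 14990 120028 start₈ 1 hints₈
    swept₈ = sweeps tt

    swept₉ : Sweeps 14990 135018 start₉ 1 hints₉
    swept₉ = sweeps tt

  -- The ten sweeps cover 108 ≤ k < 108 + 10 · 14990 = 150008.
  certified : ∀ k → k < 150000 → Certified k
  certified k k< = below₀ (k ℕ.<? 108)
    where
    below₁₀ : 135018 ≤ k → Dec (k < 150008) → Certified k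
    below₁₀ ≤k (yes k<) = sweeps-sound 14990 135018 start₉ 1 hints₉ refl swept₉ k ≤k k<
    below₁₀ _ (no k≮) = ⊥-elim (k≮ (ℕ.<-≤-trans k< (ℕ.≤ᵇ⇒≤ 150000 150008 tt)))
    below₉ : 120028 ≤ k → Dec (k < 135018) → Certified k
    below₉ ≤k (yes k<) = sweeps-sound 14990 120028 start₈ 1 hints₈ refl swept₈ k ≤k k<
    below₉ _ (no k≮) = below₁₀ (ℕ.≮⇒≥ k≮) (k ℕ.<? 150008)
    below₈ : 105038 ≤ k → Dec (k < 120028) → Certified k
    below₈ ≤k (yes k<) = sweeps-sound 14990 105038 start₇ 1 hints₇ refl swept₇ k ≤k k<
    below₈ _ (no k≮) = below₉ (ℕ.≮⇒≥ k≮) (k ℕ.<? 135018)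
    below₇ : 90048 ≤ k → Dec (k < 105038) → Certified k
    below₇ ≤k (yes k<) = sweeps-sound 14990 90048 start₆ 1 hints₆ refl swept₆ k ≤k k<
    below₇ _ (no k≮) = below₈ (ℕ.≮⇒≥ k≮) (k ℕ.<? 120028)
    below₆ : 75058 ≤ k → Dec (k < 90048) → Certified k
    below₆ ≤k (yes k<) = sweeps-sound 14990 75058 start₅ 1 hints₅ refl swept₅ k ≤k k<
    below₆ _ (no k≮) = below₇ (ℕ.≮⇒≥ k≮) (k ℕ.<? 105038)
    below₅ : 60068 ≤ k → Dec (k < 75058) → Certified k
    below₅ ≤k (yes k<) = sweeps-sound 14990 60068 start₄ 1 hints₄ refl swept₄ k ≤k k<
    below₅ _ (no k≮) = below₆ (ℕ.≮⇒≥ k≮) (k ℕ.<? 90048)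
    below₄ : 45078 ≤ k → Dec (k < 60068) → Certified k
    below₄ ≤k (yes k<) = sweeps-sound 14990 45078 start₃ 1 hints₃ refl swept₃ k ≤k k<
    below₄ _ (no k≮) = below₅ (ℕ.≮⇒≥ k≮) (k ℕ.<? 75058)
    below₃ : 30088 ≤ k → Dec (k < 45078) → Certified k
    below₃ ≤k (yes k<) = sweeps-sound 14990 30088 start₂ 1 hints₂ refl swept₂ k ≤k k<
    below₃ _ (no k≮) = below₄ (ℕ.≮⇒≥ k≮) (k ℕ.<? 60068)
    below₂ : 15098 ≤ k → Dec (k < 30088) → Certified k
    below₂ ≤k (yes k<) = sweeps-sound 14990 15098 start₁ 1 hints₁ refl swept₁ k ≤k k<
    below₂ _ (no k≮) = below₃ (ℕ.≮⇒≥ k≮) (k ℕ.<? 45078)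
    below₁ : 108 ≤ k → Dec (k < 15098) → Certified k
    below₁ ≤k (yes k<) = sweeps-sound 14990 108 start₀ 1 hints₀ refl swept₀ k ≤k k<
    below₁ _ (no k≮) = below₂ (ℕ.≮⇒≥ k≮) (k ℕ.<? 30088)
    below₀ : Dec (k < 108) → Certified k
    below₀ (yes k<) = smallSweep-sound 108 small k k<
    below₀ (no k≮) = below₁ (ℕ.≮⇒≥ k≮) (k ℕ.<? 15098)

  good : ∀ k pq 0<4k → GoodAt k pq 0<4k
  good k pq 0<4k = go (k ℕ.<? 150000)
    where
    go : Dec (k < 150000) → GoodAt k pq 0<4k
    go (yes k<) = certified k k< pq 0<4k
    -- From k ≥ 150000 follows h = 4 k ≥ 600000, where the character sum estimates take over.
    go (no k≮)  = LargeField.good-field (IntegersModulo.primeField _ pq) k 0<4k (q-split k) (ℕ.*-monoʳ-≤ 4 (ℕ.≮⇒≥ k≮))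

  family : ∀ q k → q ≡ suc (8 ℕ.* k) → (pq : Prime q) → Σ (List (List (G q))) (IsRelativeDF _≟G_ (subG q pq) (InN pq) 17 2)
  family _ zero      refl pq = ⊥-elim (¬prime[1] pq)
  family _ k@(suc _) refl pq =
    let i , ii , y , isGood = good k pq (s≤s z≤n)
    in Construction.Family.family _ pq k (s≤s z≤n) (q-split k) i ii y isGood

  relative-difference-family : ∀ q (pq : Prime q) → q % 8 ≡ 1 → Σ (List (List (G q))) (IsRelativeDF _≟G_ (subG q pq) (InN pq) 17 2)
  relative-difference-family q pq q%8≡1 = family q (q / 8) (trans (m≡m%n+[m/n]*n q 8) (cong₂ ℕ._+_ q%8≡1 (ℕ.*-comm (q / 8) 8))) pq

theorem3p12 : (q : ℕ) (pq : Prime q) → q % 8 ≡ 1 →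
    Σ (List (List (G q))) (IsRelativeDF _≟G_ (subG q pq) (InN pq) 17 2)
theorem3p12 q pq q%8≡1 = Certificates.relative-difference-family q pq q%8≡1
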